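{- Let $n,a,b$ be positive integers, $c$ a nonnegative integer and $k$ an integer with $0\le k\le n$. Then $\Psi_n(k,a,b,c)$ equals each of the following. (i) The sum of the Kostant partition functions $K_{k_{n+2}^{a,b,c}}(0,a_1,\dots,a_n,-\sum_{j=1}^n a_j)$ over all integer vectors $(a_1,\dots,a_n)$ such that $a_i\le a-1+c(i-1)$ for every $i\in[n]$, with equality $a_i=a-1+c(i-1)$ for exactly $n-k$ values of $i$. (ii) The sum of normalized volumes $$\Psi_n(k,a,b,c)=\sum_{S\in\binom{[n]}{k}}\operatorname{vol}\mathcal F_{k^{a,b,c}_{n+2}(S)},$$ where $\binom{[n]}{k}$ denotes the set of $k$-element subsets of $[n]=\{1,\dots,n\}$.
   Context: For a finite loopless directed multigraph $G$ on vertex set $\{0,1,\dots,n+1\}$ whose edges $(i,j)$ are oriented $i\to j$ with $i<j$, and a vector $\mathbf a=(a_0,\dots,a_{n+1})$ with $\sum_i a_i=0$, the flow polytope $\mathcal F_G(\mathbf a)$ is the set of $f\in\mathbb R_{\ge 0}^{E(G)}$ such that for each vertex $v$ the net flow (total flow on outgoing edges minus total flow on incoming edges) equals $a_v$. Write $\mathcal F_G:=\mathcal F_G(1,0,\dots,0,-1)$. The Kostant partition function $K_G(\mathbf a)$ is the number of integer points of $\mathcal F_G(\mathbf a)$. $\operatorname{vol}$ denotes normalized volume: for a $d$-dimensional polytope, $d!$ times its $d$-dimensional volume measured with respect to the lattice of integer points in its affine span. $k_{n+2}^{a,b,c}$ is the multigraph on $\{0,\dots,n+1\}$ with edge $(0,i)$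 of multiplicity $a$ and edge $(i,n+1)$ of multiplicity $b$ for each $i\in[n]$, and edge $(i,j)$ of multiplicity $c$ for $1\le i<j\le n$. For $S\subseteq[n]$, $k^{a,b,c}_{n+2}(S)$ is obtained from $k^{a,b,c}_{n+2}$ by adding $n$ edges $(0,n+1)$ and, for each $i\in S$, deleting one of the $a$ copies of $(0,i)$ and adding one edge $(i,n+1)$. Define $$\Psi_n(k,a,b,c):=\operatorname{CT}_x[t^k]\prod_{i=1}^n(1-x_i)^{ -b}x_i^{ -a+1}\Big(1+t\frac{x_i}{1-x_i}\Big)\prod_{1\le i<j\le n}(x_j-x_i)^{ -c},$$ where $[t^k]$ extracts the coefficient of $t^k$, $\operatorname{CT}_x=\operatorname{CT}_{x_n}\cdots\operatorname{CT}_{x_1}$ is iterated constant-term extraction, $(1-x_i)^{ -b}$ and $x_i/(1-x_i)$ are expanded as power series in $x_i$, and for $i<j$, $(x_j-x_i)^{ -c}=x_j^{ -c}(1-x_i/x_j)^{ -c}$ is expanded as a power series in $x_i/x_j$.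
   Formalization: Volume is taken in the space of all flows with net flow (1,0,…,0,-1), not in the affine span of the polytope, so lower-dimensional polytopes get 0; this differs only for a=1, k≥1, where the literal claim fails (n=a=k=1: a point of volume 1, but Ψ=0). -}

module Defs where

open import Algebra.Bundles using (CommutativeRing)
open import Algebra.Bundles.Raw using (RawMonoid; RawRing)
import Algebra.Definitions.RawMonoid
import Algebra.Definitions.RawSemiring
import Algebra.Properties.CommutativeMonoid.Sum as CommutativeMonoidSum
import Algebra.Properties.Semiring.Sum as SemiringSum
open import Data.Bool.Base using (if_then_else_)
open import Data.Fin.Base as Fin using (Fin; zero; suc; toℕ; fromℕ; inject₁)
import Data.Fin.Properties as Fin
open import Data.Fin.Subset using (Subset)
open import Data.Fin.Subset.Properties using (_∈?_)
open import Data.Integer.Base as ℤ using (ℤ; +_; -[1+_]; 0ℤ; 1ℤ; -1ℤ)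
import Data.Integer.Properties as ℤ
open import Data.List.Base as List using (List; []; _∷_; _++_; length)
open import Data.List.Membership.Propositional using (_∈_)
import Data.List.Membership.Propositional.Properties as ∈
open import Data.List.Relation.Unary.All using (All)
open import Data.List.Relation.Unary.Any using (Any; here)
open import Data.List.Relation.Unary.AllPairs using (AllPairs; []; _∷_)
import Data.List.Relation.Unary.All as All
open import Data.List.Relation.Unary.Unique.Propositional using (Unique)
import Data.List.Relation.Unary.Unique.Propositional.Properties as Unique
open import Data.Nat.Base as ℕ using (ℕ; zero; suc; _∸_; _!; z<s; s<s)
import Data.Nat.Properties as ℕ
open import Data.Product using (Σ; ∃!; ∃-syntax; _×_; _,_; proj₁; proj₂)
open import Data.Rational.Base using (ℚ; 0ℚ; 1ℚ; _+_; _-_; _*_; -_; _≤_; _<_)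
import Data.Rational.Base as ℚ
open import Data.Rational.Literals using (fromℤ)
import Data.Rational.Properties as ℚ
import Data.Rational.Unnormalised.Base as ℚᵘ
import Data.Rational.Unnormalised.Properties as ℚᵘ
open import Data.Sum.Base using (_⊎_)
open import Data.Vec.Base as Vec using (Vec; []; _∷_; _∷ʳ_; lookup; allFin; replicate; tabulate)
import Data.Vec.Properties as Vec
open import Function.Base using (_∘_; _$_)
open import Function.Bundles using (_⇔_; mk⇔)
open import Level using (0ℓ)
open import Relation.Binary.PropositionalEquality
  using (_≡_; refl; sym; trans; cong; cong₂; subst; subst₂; module ≡-Reasoning)
open import Relation.Nullary.Decidable using (Dec; yes; no; does; _×-dec_)
open import Relation.Nullary.Negation using (¬_)
open import Relation.Unary using (Pred)

private
  variable
    m n d N : ℕ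
    A : Set

record Enumeration (P : Pred A 0ℓ) : Set where
  field
    list    : List A
    unique  : Unique list
    correct : ∀ {x} → x ∈ list ⇔ P x

card : {P : Pred A 0ℓ} → Enumeration P → ℕ
card = length ∘ Enumeration.list

-- s = Σ_{x ∈ P} f x, for f with finitely many nonzero values on P.
module _ (M : RawMonoid 0ℓ 0ℓ) where
  open RawMonoid M

  IsSumOver : Pred A 0ℓ → (A → Carrier) → Carrier → Set
  IsSumOver P f s = ∃[ xs ]
    Unique xs
    × All P xs
    × (∀ x → P x → ¬ (f x ≈ ε) → x ∈ xs)
    × List.foldr (λ x → f x ∙_) ε xs ≈ s

open Algebra.Definitions.RawMonoid ℚ.+-0-rawMonoid using () renaming (sum to ∑)
open Algebra.Definitions.RawMonoid ℚ.*-1-rawMonoid using () renaming (sum to ∏)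

record Edge (N : ℕ) : Set where
  constructor edge
  field
    src     : Fin N
    tgt     : Fin N
    src<tgt : src Fin.< tgt

open Edge public

-- The list of edges is indexed by Fin (length G), so parallel edges are
-- distinguished and f ∈ ℝ^{E(G)} has one coordinate for each copy.
Multigraph : ℕ → Set
Multigraph N = List (Edge N)

#E : Multigraph N → ℕ
#E = length

toℚⁿ : Vec ℤ m → Vec ℚ m
toℚⁿ = Vec.map fromℤ

module _ (G : Multigraph N) where

  outflow inflow netflow : Vec ℚ (#E G) → Fin N → ℚ
  outflow f v = ∑ λ e → if does (src (List.lookup G e) Fin.≟ v) then lookup f e else 0ℚ
  inflow  f v = ∑ λ e → if does (tgt (List.lookup G e) Fin.≟ v) then lookup f e else 0ℚ
  netflow f v = outflow f v - inflow f v

  FlowSpace : Vec ℤ N → Pred (Vec ℚ (#E G)) 0ℓ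
  FlowSpace a f = ∀ v → netflow f v ≡ fromℤ (lookup a v)

  -- The rational points of F_G(a). Since a is integral, F_G(a) is a rational
  -- polytope, i.e. the closure in ℝ^{E(G)} of this set.
  FlowPolytope : Vec ℤ N → Pred (Vec ℚ (#E G)) 0ℓ
  FlowPolytope a f = (∀ e → 0ℚ ≤ lookup f e) × FlowSpace a f

  LatticePoint : Vec ℤ N → Pred (Vec ℤ (#E G)) 0ℓ
  LatticePoint a z = FlowPolytope a (toℚⁿ z)

  latticePoint? : ∀ a z → Dec (LatticePoint a z)
  latticePoint? a z = Fin.all? (λ e → 0ℚ ℚ.≤? lookup (toℚⁿ z) e)
    ×-dec Fin.all? (λ v → netflow (toℚⁿ z) v ℚ.≟ fromℤ (lookup a v))

-- Finiteness of the set of integer points: as edges increase, a flow f ≥ 0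
-- with net flow a has  Σ_e f_e ≤ Σ_e (tgt e - src e) f_e = - Σ_v v a_v.

private
  fromℤ-+ : ∀ i j → fromℤ (i ℤ.+ j) ≡ fromℤ i + fromℤ j
  fromℤ-+ i j = ℚ.toℚᵘ-injective $ ℚᵘ.≃-trans
    (ℚᵘ.*≡* (cong (ℤ._* 1ℤ) (sym (cong₂ ℤ._+_ (ℤ.*-identityʳ i) (ℤ.*-identityʳ j)))))
    (ℚᵘ.≃-sym (ℚ.toℚᵘ-homo-+ (fromℤ i) (fromℤ j)))

  fromℤ-* : ∀ i j → fromℤ (i ℤ.* j) ≡ fromℤ i * fromℤ j
  fromℤ-* i j = ℚ.toℚᵘ-injective $ ℚᵘ.≃-trans
    (ℚᵘ.*≡* refl) (ℚᵘ.≃-sym (ℚ.toℚᵘ-homo-* (fromℤ i) (fromℤ j)))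

  fromℤ-mono-≤ : ∀ {i j} → i ℤ.≤ j → fromℤ i ≤ fromℤ j
  fromℤ-mono-≤ {i} {j} i≤j =
    ℚ.*≤* (subst₂ ℤ._≤_ (sym (ℤ.*-identityʳ i)) (sym (ℤ.*-identityʳ j)) i≤j)

  fromℤ-cancel-≤ : ∀ {i j} → fromℤ i ≤ fromℤ j → i ℤ.≤ j
  fromℤ-cancel-≤ {i} {j} (ℚ.*≤* p) =
    subst₂ ℤ._≤_ (ℤ.*-identityʳ i) (ℤ.*-identityʳ j) p

  open CommutativeMonoidSum (CommutativeRing.+-commutativeMonoid ℚ.+-*-commutativeRing)
    using (∑-comm; ∑-distrib-+; sum-cong-≗)
  open SemiringSum (CommutativeRing.semiring ℚ.+-*-commutativeRing)
    using (*-distribˡ-sum)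

  ∑-mono : {f g : Fin m → ℚ} → (∀ i → f i ≤ g i) → ∑ f ≤ ∑ g
  ∑-mono {zero}  f≤g = ℚ.≤-refl
  ∑-mono {suc m} f≤g = ℚ.+-mono-≤ (f≤g zero) (∑-mono (f≤g ∘ suc))

  ∑-zero : {f : Fin m → ℚ} → (∀ i → f i ≡ 0ℚ) → ∑ f ≡ 0ℚ
  ∑-zero {zero}  f≡0 = refl
  ∑-zero {suc m} f≡0 = cong₂ _+_ (f≡0 zero) (∑-zero (f≡0 ∘ suc))

  ∑-≥0 : {f : Fin m → ℚ} → (∀ i → 0ℚ ≤ f i) → 0ℚ ≤ ∑ f
  ∑-≥0 {m} {f} f≥0 = subst (_≤ ∑ f) (∑-zero {m} {λ _ → 0ℚ} (λ _ → refl)) (∑-mono f≥0)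

  ∑-term : {f : Fin m → ℚ} → (∀ i → 0ℚ ≤ f i) → ∀ i → f i ≤ ∑ f
  ∑-term {f = f} f≥0 zero    =
    subst (_≤ ∑ f) (ℚ.+-identityʳ _) (ℚ.+-monoʳ-≤ (f zero) (∑-≥0 (f≥0 ∘ suc)))
  ∑-term {f = f} f≥0 (suc i) =
    subst (_≤ ∑ f) (ℚ.+-identityˡ _) (ℚ.+-mono-≤ (f≥0 zero) (∑-term (f≥0 ∘ suc) i))

  ∑-δ : (h : Fin m → ℚ) (w : Fin m) (x : ℚ) →
        ∑ (λ v → h v * (if does (w Fin.≟ v) then x else 0ℚ)) ≡ h w * x
  ∑-δ h zero x = trans
    (cong (λ z → h zero * x + z) (∑-zero {f = λ v → h (suc v) * 0ℚ} λ v → ℚ.*-zeroʳ (h (suc v))))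
    (ℚ.+-identityʳ _)
  ∑-δ h (suc w) x =
    trans (cong₂ _+_ (ℚ.*-zeroʳ (h zero)) (∑-δ (h ∘ suc) w x)) (ℚ.+-identityˡ _)

  fromℤ-∑ : (f : Fin m → ℤ) →
            fromℤ (Vec.foldr (λ _ → ℤ) ℤ._+_ 0ℤ (tabulate f)) ≡ ∑ (fromℤ ∘ f)
  fromℤ-∑ {zero}  f = refl
  fromℤ-∑ {suc m} f =
    trans (fromℤ-+ (f zero) _) (cong (λ z → fromℤ (f zero) + z) (fromℤ-∑ (f ∘ suc)))

  height : Fin N → ℤ
  height v = + toℕ v

  h : Fin N → ℚ
  h = fromℤ ∘ height

  moment : Vec ℤ N → ℤ
  moment {N} a = Vec.foldr (λ _ → ℤ) ℤ._+_ 0ℤ (tabulate λ v → height v ℤ.* lookup a v)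

  weighted : (w : Fin m → Fin N) (f : Fin m → ℚ) →
             ∑ (λ v → h v * ∑ (λ e → if does (w e Fin.≟ v) then f e else 0ℚ))
             ≡ ∑ (λ e → h (w e) * f e)
  weighted w f = begin
    ∑ (λ v → h v * ∑ (λ e → δ e v))    ≡⟨ sum-cong-≗ (λ v → *-distribˡ-sum (h v) (λ e → δ e v)) ⟩
    ∑ (λ v → ∑ (λ e → h v * δ e v))    ≡⟨ ∑-comm (λ v e → h v * δ e v) ⟩
    ∑ (λ e → ∑ (λ v → h v * δ e v))    ≡⟨ sum-cong-≗ (λ e → ∑-δ h (w e) (f e)) ⟩
    ∑ (λ e → h (w e) * f e)            ∎
    where
    open ≡-Reasoning
    δ = λ e v → if does (w e Fin.≟ v) then f e else 0ℚ

  module Bound (G : Multigraph N) (a : Vec ℤ N) (f : Vec ℚ (#E G))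
               (f∈F : FlowPolytope G a f) where

    f≥0 : ∀ e → 0ℚ ≤ lookup f e
    f≥0 = proj₁ f∈F

    out inn : Fin (#E G) → ℚ
    out e = h (src (List.lookup G e)) * lookup f e
    inn e = h (tgt (List.lookup G e)) * lookup f e

    outflow≡ : ∀ v → outflow G f v ≡ fromℤ (lookup a v) + inflow G f v
    outflow≡ v = begin
      o            ≡⟨ ℚ.+-identityʳ o ⟨
      o + 0ℚ       ≡⟨ cong (λ z → o + z) (ℚ.+-inverseˡ i) ⟨
      o + (- i + i) ≡⟨ ℚ.+-assoc o (- i) i ⟨
      (o - i) + i  ≡⟨ cong (_+ i) (proj₂ f∈F v) ⟩
      fromℤ (lookup a v) + i ∎
      where
      open ≡-Reasoning
      o = outflow G f v
      i = inflow G f v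

    balance : ∑ out ≡ fromℤ (moment a) + ∑ inn
    balance = begin
      ∑ out
        ≡⟨ weighted (src ∘ List.lookup G) (lookup f) ⟨
      ∑ (λ v → h v * outflow G f v)
        ≡⟨ sum-cong-≗ (λ v → trans (cong (h v *_) (outflow≡ v)) (ℚ.*-distribˡ-+ (h v) (fromℤ (lookup a v)) (inflow G f v))) ⟩
      ∑ (λ v → h v * fromℤ (lookup a v) + h v * inflow G f v)
        ≡⟨ ∑-distrib-+ (λ v → h v * fromℤ (lookup a v)) (λ v → h v * inflow G f v) ⟩
      ∑ (λ v → h v * fromℤ (lookup a v)) + ∑ (λ v → h v * inflow G f v)
        ≡⟨ cong₂ _+_
             (trans (sum-cong-≗ (λ v → sym (fromℤ-* (height v) (lookup a v))))
                    (sym (fromℤ-∑ (λ v → height v ℤ.* lookup a v))))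
             (weighted (tgt ∘ List.lookup G) (lookup f)) ⟩
      fromℤ (moment a) + ∑ inn ∎
      where open ≡-Reasoning

    step : ∀ e → out e + lookup f e ≤ inn e
    step e = begin
      h s * x + x            ≡⟨ cong (λ z → h s * x + z) (ℚ.*-identityˡ x) ⟨
      h s * x + 1ℚ * x       ≡⟨ ℚ.*-distribʳ-+ x (h s) 1ℚ ⟨
      (h s + 1ℚ) * x         ≡⟨ cong (_* x) (fromℤ-+ (height s) 1ℤ) ⟨
      fromℤ (height s ℤ.+ 1ℤ) * x
        ≤⟨ ℚ.*-monoʳ-≤-nonNeg x ⦃ ℚ.nonNegative (f≥0 e) ⦄ (fromℤ-mono-≤ (ℤ.+≤+
             (subst (ℕ._≤ toℕ t) (ℕ.+-comm 1 (toℕ s)) (src<tgt (List.lookup G e))))) ⟩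
      h t * x                ∎
      where
      open ℚ.≤-Reasoning
      s = src (List.lookup G e)
      t = tgt (List.lookup G e)
      x = lookup f e

    total≤ : fromℤ (moment a) + ∑ (lookup f) ≤ 0ℚ
    total≤ = subst₂ _≤_ p (ℚ.+-inverseʳ (∑ inn)) (ℚ.+-monoˡ-≤ (- ∑ inn) q)
      where
      open ≡-Reasoning
      q : ∑ out + ∑ (lookup f) ≤ ∑ inn
      q = subst (_≤ ∑ inn) (∑-distrib-+ out (lookup f)) (∑-mono step)
      p : (∑ out + ∑ (lookup f)) - ∑ inn ≡ fromℤ (moment a) + ∑ (lookup f)
      p = begin
        (∑ out + F) - I    ≡⟨ cong (λ o → (o + F) - I) balance ⟩
        ((M + I) + F) - I  ≡⟨ cong (_- I) (ℚ.+-assoc M I F) ⟩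
        (M + (I + F)) - I  ≡⟨ cong (λ z → (M + z) - I) (ℚ.+-comm I F) ⟩
        (M + (F + I)) - I  ≡⟨ cong (_- I) (ℚ.+-assoc M F I) ⟨
        ((M + F) + I) - I  ≡⟨ ℚ.+-assoc (M + F) I (- I) ⟩
        (M + F) + (I - I)  ≡⟨ cong (λ z → (M + F) + z) (ℚ.+-inverseʳ I) ⟩
        (M + F) + 0ℚ       ≡⟨ ℚ.+-identityʳ (M + F) ⟩
        M + F              ∎
        where
        F = ∑ (lookup f)
        I = ∑ inn
        M = fromℤ (moment a)

    bound : ∀ e → fromℤ (moment a) + lookup f e ≤ 0ℚ
    bound e = ℚ.≤-trans (ℚ.+-monoʳ-≤ (fromℤ (moment a)) (∑-term f≥0 e)) total≤

  entry∈ : ∀ M z → fromℤ M + fromℤ z ≤ 0ℚ → 0ℚ ≤ fromℤ z →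
           z ∈ List.map +_ (List.upTo (suc ℤ.∣ M ∣))
  entry∈ M -[1+ k ] _ p with () ← fromℤ-cancel-≤ {0ℤ} { -[1+ k ] } p
  entry∈ M (+ k) p _ = ∈.∈-map⁺ +_ (∈.∈-upTo⁺ (ℕ.s≤s (ℤ.drop‿+≤+ k≤∣M∣)))
    where
    M+k≤0 : M ℤ.+ + k ℤ.≤ 0ℤ
    M+k≤0 = fromℤ-cancel-≤ (subst (_≤ 0ℚ) (sym (fromℤ-+ M (+ k))) p)
    k≤-M : + k ℤ.≤ ℤ.- M
    k≤-M = subst₂ ℤ._≤_
      (trans (sym (ℤ.+-assoc (ℤ.- M) M (+ k)))
        (trans (cong (ℤ._+ + k) (ℤ.+-inverseˡ M)) (ℤ.+-identityˡ (+ k))))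
      (ℤ.+-identityʳ (ℤ.- M))
      (ℤ.+-monoʳ-≤ (ℤ.- M) M+k≤0)
    -i≤∣i∣ : ∀ i → ℤ.- i ℤ.≤ + ℤ.∣ i ∣
    -i≤∣i∣ (+ zero)  = ℤ.≤-refl
    -i≤∣i∣ (+ suc _) = ℤ.-≤+
    -i≤∣i∣ -[1+ _ ]  = ℤ.≤-refl
    k≤∣M∣ : + k ℤ.≤ + ℤ.∣ M ∣
    k≤∣M∣ = ℤ.≤-trans k≤-M (-i≤∣i∣ M)

  box : List ℤ → ∀ m → List (Vec ℤ m)
  box zs zero    = [] ∷ []
  box zs (suc m) = List.cartesianProductWith _∷_ zs (box zs m)

  box-unique : ∀ {zs} → Unique zs → ∀ m → Unique (box zs m)
  box-unique u zero    = All.[] ∷ []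
  box-unique u (suc m) = Unique.cartesianProductWith⁺ _∷_ Vec.∷-injective u (box-unique u m)

  box-complete : ∀ {zs} (v : Vec ℤ m) → (∀ i → lookup v i ∈ zs) → v ∈ box zs m
  box-complete []      p = here refl
  box-complete (x ∷ v) p =
    ∈.∈-cartesianProductWith⁺ _∷_ (p zero) (box-complete v (p ∘ suc))

latticePoints : (G : Multigraph N) (a : Vec ℤ N) → Enumeration (LatticePoint G a)
latticePoints {N} G a = record
  { list    = List.filter P? candidates
  ; unique  = Unique.filter⁺ P? (box-unique (Unique.map⁺ ℤ.+-injective (Unique.upTo⁺ _)) _)
  ; correct = mk⇔ (λ z∈ → proj₂ (∈.∈-filter⁻ P? {xs = candidates} z∈)) (λ p → ∈.∈-filter⁺ P? (complete p) p)
  }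
  where
  P? = latticePoint? G a
  candidates = box (List.map +_ (List.upTo (suc ℤ.∣ moment a ∣))) (#E G)
  complete : ∀ {z} → LatticePoint G a z → z ∈ candidates
  complete {z} p = box-complete z λ e → entry∈ (moment a) (lookup z e)
    (subst (λ x → fromℤ (moment a) + x ≤ 0ℚ) (Vec.lookup-map e fromℤ z)
      (Bound.bound G a (toℚⁿ z) p e))
    (subst (0ℚ ≤_) (Vec.lookup-map e fromℤ z) (proj₁ p e))

kostant : (G : Multigraph N) → Vec ℤ N → ℕ
kostant G a = card (latticePoints G a)

record Box (d : ℕ) : Set where
  field
    lo hi : Vec ℚ d
    lo≤hi : ∀ i → lookup lo i ≤ lookup hi i

open Box public

_∈Box_ : Vec ℚ d → Box d → Set
y ∈Box B = ∀ i → lookup (lo B) i ≤ lookup y i × lookup y i ≤ lookup (hi B) i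

boxVolume : Box d → ℚ
boxVolume B = ∏ λ i → lookup (hi B) i - lookup (lo B) i

totalVolume : List (Box d) → ℚ
totalVolume = List.foldr (λ B v → boxVolume B + v) 0ℚ

NonOverlapping : Box d → Box d → Set
NonOverlapping B C = ∃[ i ]
  (lookup (hi B) i ≤ lookup (lo C) i ⊎ lookup (hi C) i ≤ lookup (lo B) i)

-- v is the d-dimensional (Jordan) volume: finite unions of closed boxes inside
-- P, and finite unions of closed boxes covering P, both approximate v. For P the
-- rational points of a rational polytope Q ⊆ ℝ^d, a finite union of closed
-- boxes with rational corners is contained in (covers) Q iff its rational points
-- are contained in (it covers) P, so v is the volume of Q.
IsVolume : Pred (Vec ℚ d) 0ℓ → ℚ → Set
IsVolume {d} P v = ∀ ε → 0ℚ < ε →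
  (∃[ Bs ] AllPairs NonOverlapping Bs
         × All (λ B → ∀ y → y ∈Box B → P y) Bs
         × v - ε < totalVolume {d} Bs)
  × (∃[ Bs ] (∀ y → P y → Any (y ∈Box_) Bs)
           × totalVolume {d} Bs < v + ε)

-- An affine parametrization  y ↦ origin + Σ_i y_i basis_i  which identifies ℤ^d
-- with the integer points of the affine subspace A.
record LatticeChart (A : Pred (Vec ℚ m) 0ℓ) (d : ℕ) : Set where
  field
    origin : Vec ℤ m
    basis  : Fin d → Vec ℤ m

  param : Vec ℚ d → Vec ℚ m
  param y = tabulate λ e →
    fromℤ (lookup origin e) + ∑ λ i → lookup y i * fromℤ (lookup (basis i) e)

  field
    into : ∀ (y : Vec ℤ d) → A (param (toℚⁿ y))
    onto : ∀ (z : Vec ℤ m) → A (toℚⁿ z) → ∃! _≡_ λ y → param (toℚⁿ y) ≡ toℚⁿ z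

-- d! times the volume of P measured in the d-dimensional affine space A with
-- respect to its lattice of integer points. Any two charts differ by an affine
-- unimodular map, so v does not depend on the choice of the chart.
IsNormalizedVolume : (A P : Pred (Vec ℚ m) 0ℓ) → ℚ → Set
IsNormalizedVolume A P v = ∃[ d ] Σ (LatticeChart A d) λ χ → ∃[ w ]
  IsVolume (P ∘ LatticeChart.param χ) w × v ≡ fromℤ (+ (d !)) * w

unitFlow : ∀ n → Vec ℤ (2 ℕ.+ n)
unitFlow n = 1ℤ ∷ (replicate n 0ℤ ∷ʳ -1ℤ)

-- vol F_G, with d the dimension #E - #V + 1 (for G connected) of the space of all
-- flows with net flow (1,0,…,0,-1). This space is the affine span of F_G when
-- every edge lies on a directed path from 0 to n+1; otherwise F_G lies in a
-- proper subspace and vol F_G = 0. The latter occurs for k^{1,b,c}(S): for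
-- n = a = 1 and S = {1}, F_G is a point while Ψ_1(1,1,b,c) = 0.
IsFlowVolume : Multigraph (2 ℕ.+ n) → ℚ → Set
IsFlowVolume {n} G = IsNormalizedVolume (FlowSpace G (unitFlow n)) (FlowPolytope G (unitFlow n))

-- i : Fin n stands for the element toℕ i + 1 of [n].
inner : Fin n → Fin (2 ℕ.+ n)
inner i = suc (inject₁ i)

sink : Fin (2 ℕ.+ n)
sink {n} = fromℕ (suc n)

0→inner : Fin n → Edge (2 ℕ.+ n)
0→inner i = edge zero (inner i) z<s

inner→sink : Fin n → Edge (2 ℕ.+ n)
inner→sink {n} i = edge (inner i) sink
  (s<s (subst₂ ℕ._<_ (sym (Fin.toℕ-inject₁ i)) (sym (Fin.toℕ-fromℕ n)) (Fin.toℕ<n i)))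

inner→inner : (i j : Fin n) → i Fin.< j → Edge (2 ℕ.+ n)
inner→inner i j i<j = edge (inner i) (inner j)
  (s<s (subst₂ ℕ._<_ (sym (Fin.toℕ-inject₁ i)) (sym (Fin.toℕ-inject₁ j)) i<j))

0→sink : ∀ n → Edge (2 ℕ.+ n)
0→sink n = edge zero sink z<s

parallel : ℕ → Fin n → Fin n → List (Edge (2 ℕ.+ n))
parallel c i j with i Fin.<? j
... | yes i<j = List.replicate c (inner→inner i j i<j)
... | no  _   = []

-- α i copies of (0,i), β i copies of (i,n+1), c copies of (i,j), r copies of (0,n+1).
graph : ∀ n → (α β : Fin n → ℕ) (c r : ℕ) → Multigraph (2 ℕ.+ n)
graph n α β c r =
  List.concatMap (λ i → List.replicate (α i) (0→inner i)) (List.allFin n)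
  ++ List.concatMap (λ i → List.replicate (β i) (inner→sink i)) (List.allFin n)
  ++ List.concatMap (λ i → List.concatMap (parallel c i) (List.allFin n)) (List.allFin n)
  ++ List.replicate r (0→sink n)

k[_] : ∀ n → (a b c : ℕ) → Multigraph (2 ℕ.+ n)
k[ n ] a b c = graph n (λ _ → a) (λ _ → b) c 0

kS[_] : ∀ n → (a b c : ℕ) → Subset n → Multigraph (2 ℕ.+ n)
kS[ n ] a b c S = graph n
  (λ i → if does (i ∈? S) then a ∸ 1 else a)
  (λ i → if does (i ∈? S) then suc b else b)
  c n

threshold : (a c : ℕ) → Fin n → ℤ
threshold a c i = + a ℤ.- 1ℤ ℤ.+ + c ℤ.* + toℕ i

Admissible : ∀ n (k a c : ℕ) → Pred (Vec ℤ n) 0ℓ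
Admissible n k a c as =
  (∀ i → lookup as i ℤ.≤ threshold a c i)
  × Vec.count (λ i → lookup as i ℤ.≟ threshold a c i) (allFin n) ≡ n ∸ k

netflowVector : Vec ℤ n → Vec ℤ (2 ℕ.+ n)
netflowVector as = 0ℤ ∷ (as ∷ʳ ℤ.- Vec.foldr (λ _ → ℤ) ℤ._+_ 0ℤ as)

module Series (R : RawRing 0ℓ 0ℓ) where
  private
    module R = RawRing R
  open Algebra.Definitions.RawSemiring R.rawSemiring using (sum)

  cauchy : (f g : ℕ → R.Carrier) → ℕ → R.Carrier
  cauchy f g l = sum {suc l} λ i → f (toℕ i) R.* g (l ∸ toℕ i)

  δ : ℕ → ℕ → R.Carrier
  δ zero    zero    = R.1#
  δ zero    (suc _) = R.0#
  δ (suc _) zero    = R.0#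
  δ (suc i) (suc j) = δ i j

  scalar : R.Carrier → ℕ → R.Carrier
  scalar r zero    = r
  scalar r (suc _) = R.0#

  powerSeries : RawRing 0ℓ 0ℓ
  powerSeries = record
    { Carrier = ℕ → R.Carrier
    ; _≈_     = λ f g → ∀ i → f i R.≈ g i
    ; _+_     = λ f g i → f i R.+ g i
    ; _*_     = cauchy
    ; -_      = λ f i → R.- f i
    ; 0#      = λ _ → R.0#
    ; 1#      = δ 0
    }

  -- Σ_i coeffs i · x^(i - pole)
  record Laurent : Set where
    constructor laurent
    field
      pole   : ℕ
      coeffs : ℕ → R.Carrier

    coeff : ℤ → R.Carrier
    coeff z with z ℤ.+ + pole
    ... | + i      = coeffs i
    ... | -[1+ _ ] = R.0#

  open Laurent public

  laurentSeries : RawRing 0ℓ 0ℓ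
  laurentSeries = record
    { Carrier = Laurent
    ; _≈_     = λ f g → ∀ z → coeff f z R.≈ coeff g z
    ; _+_     = λ f g → let p = pole f ℕ.⊔ pole g in
                laurent p λ i → coeff f (+ i ℤ.- + p) R.+ coeff g (+ i ℤ.- + p)
    ; _*_     = λ f g → laurent (pole f ℕ.+ pole g) (cauchy (coeffs f) (coeffs g))
    ; -_      = λ f → laurent (pole f) λ i → R.- coeffs f i
    ; 0#      = laurent 0 λ _ → R.0#
    ; 1#      = laurent 0 (δ 0)
    }

  constant : R.Carrier → Laurent
  constant r = laurent 0 (scalar r)

  monomial : ℤ → Laurent
  monomial (+ i)    = laurent 0 (δ i)
  monomial -[1+ i ] = laurent (suc i) (δ 0)

  open Algebra.Definitions.RawSemiring R.rawSemiring using (_^_)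

  -- 1/(1 - r x) = Σ_i r^i x^i
  geometric : R.Carrier → Laurent
  geometric r = laurent 0 (r ^_)

-- ℤ((x_n))⋯((x_2))((x_1)): Laurent series in x_1 (the variable zero : Fin n)
-- whose coefficients are Laurent series in x_2, and so on.
iterLaurent : ℕ → RawRing 0ℓ 0ℓ
iterLaurent zero    = ℤ.+-*-rawRing
iterLaurent (suc n) = Series.laurentSeries (iterLaurent n)

𝕃 : ℕ → Set
𝕃 n = RawRing.Carrier (iterLaurent n)

-- CT_{x_n} ⋯ CT_{x_1}
CT : ∀ n → 𝕃 n → ℤ
CT zero    z = z
CT (suc n) f = CT n (Series.coeff f 0ℤ)

x^ : Fin n → ℤ → 𝕃 n
x^ {suc n} zero    z = Series.monomial (iterLaurent n) z
x^ {suc n} (suc i) z = Series.constant (iterLaurent n) (x^ i z)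

1/1-x : Fin n → 𝕃 n
1/1-x {suc n} zero    = Series.geometric (iterLaurent n) (RawRing.1# (iterLaurent n))
1/1-x {suc n} (suc i) = Series.constant (iterLaurent n) (1/1-x i)

-- (1 - x_i/x_j)^{-1}; with a factor x_j^{-1} this is the expansion of (x_j - x_i)^{-1}.
1/1-x/x : (i j : Fin n) → i Fin.< j → 𝕃 n
1/1-x/x {suc n} zero    (suc j) _         = Series.geometric (iterLaurent n) (x^ j -1ℤ)
1/1-x/x {suc n} (suc i) (suc j) (s<s i<j) = Series.constant (iterLaurent n) (1/1-x/x i j i<j)

module Integrand (n a b c : ℕ) where
  private
    module L where
      open RawRing (iterLaurent n) public
      open Algebra.Definitions.RawSemiring rawSemiring public using (_^_)
  open Series (iterLaurent n) using (powerSeries; δ; scalar)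
  open RawRing powerSeries using (Carrier; 1#; rawSemiring)
    renaming (_+_ to infixl 6 _⊕_; _*_ to infixl 7 _⊛_)
  open Algebra.Definitions.RawSemiring rawSemiring using (product)

  t : Carrier
  t = δ 1

  vertexFactor : Fin n → Carrier
  vertexFactor i =
    scalar (1/1-x i L.^ b) ⊛ scalar (x^ i (ℤ.- + a ℤ.+ 1ℤ))
    ⊛ (1# ⊕ t ⊛ scalar (x^ i 1ℤ L.* 1/1-x i))

  pairFactor : Fin n → Fin n → Carrier
  pairFactor i j with i Fin.<? j
  ... | yes i<j = scalar (x^ j (ℤ.- + c) L.* 1/1-x/x i j i<j L.^ c)
  ... | no  _   = 1#

  integrand : Carrier
  integrand = product vertexFactor ⊛ product (λ i → product (pairFactor i))

-- [t^k] of a power series in t is its value at k.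
Ψ : (n k a b c : ℕ) → ℤ
Ψ n k a b c = CT n (Integrand.integrand n a b c k)

{-# OPTIONS --safe #-}

-- Edges are oriented upwards, so a flow is built vertex by vertex: the inflow
-- of a vertex is distributed over its outgoing edges. Counting flows this way
-- is the same as extracting the constant term one variable at a time, so Ψ is
-- the sum over the k-subsets S of the Kostant partition functions with net flow
-- (indegree - 1) in k(S), the factor x_i/(1 - x_i) trading an edge (0,i) for
-- an edge (i,n+1). Expanding it instead as Σ_{p≥1} x_i^p gives the sum over
-- admissible vectors.
--
-- For the volume, the flows along all edges but one edge to the sink per vertex
-- are lattice coordinates on the space of flows. The cells of side 1/N inside
-- F_G, and those meeting F_G, are counted by Kostant partition functions with
-- net flow N at the source and bounded net flow elsewhere. Eliminating a vertex
-- with p incoming slots (a discrete form of the Postnikov–Stanley subdivision,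
-- resting on Vandermonde's identity for compositions) turns these counts into
-- K_G(0, indegree - 1, …) times a binomial coefficient ~ N^d/d!.

module Submission where

-- The identity that eliminates a vertex is exact only for the weight `B (suc k) (l + R)`, where R
-- units are sent on and l is the outdegree without the edge set aside. This shift by l shapes the
-- volume argument. A cell stays inside the polytope if each capacity is lowered by the outdegree,
-- so the inner count carries exactly this shift; in the outer count it is absorbed by the
-- monotonicity of `B`. Both errors are of relative order 1/N. Monotonicity needs a slot, hence an
-- incoming edge at every vertex other than the source. This fails in k(S), for instance, when a = 1
-- and the first vertex lies in S. Then F_G lies in a coordinate hyperplane and has volume 0, and
-- the flow count is 0 as well, since indegree - 1 is negative. Setting aside an edge to the sink at
-- each vertex lets the sink absorb everything: conservation becomes an inequality whose slack is
-- the flow on that edge, and no condition at the sink remains. In k(S) this uses up one of the n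
-- edges (0,n+1). For the Kostant partition functions of k, which has none, such an edge is added
-- and carries no flow.

module AntidiagonalSums where

  -- Sums over pairs of indices with fixed total.

  open import Algebra.Bundles using (CommutativeMonoid)

  module Antidiagonal {c ℓ} (M : CommutativeMonoid c ℓ) where
    open import Data.Nat.Base using (ℕ; zero; suc)
    open import Function.Base using (flip)
    open CommutativeMonoid M
    open import Relation.Binary.Reasoning.Setoid setoid
    open import Algebra.Properties.CommutativeSemigroup commutativeSemigroup using (interchange)

    -- Σ_{i+j=n} f i j
    Δ : ℕ → (ℕ → ℕ → Carrier) → Carrier
    Δ zero    f = f 0 0
    Δ (suc n) f = f 0 (suc n) ∙ Δ n (λ i j → f (suc i) j)

    Δ-cong : ∀ n {f g} → (∀ i j → f i j ≈ g i j) → Δ n f ≈ Δ n g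
    Δ-cong zero    f≈g = f≈g 0 0
    Δ-cong (suc n) f≈g = ∙-cong (f≈g 0 (suc n)) (Δ-cong n (λ i j → f≈g (suc i) j))

    Δ-∙ : ∀ n f g → Δ n (λ i j → f i j ∙ g i j) ≈ Δ n f ∙ Δ n g
    Δ-∙ zero    f g = refl
    Δ-∙ (suc n) f g = trans (∙-congˡ (Δ-∙ n _ _)) (interchange _ _ _ _)

    Δ-ε : ∀ n → Δ n (λ _ _ → ε) ≈ ε
    Δ-ε zero    = refl
    Δ-ε (suc n) = trans (identityˡ _) (Δ-ε n)

    Δ-last : ∀ n f → Δ (suc n) f ≈ Δ n (λ i j → f i (suc j)) ∙ f (suc n) 0
    Δ-last zero    f = refl
    Δ-last (suc n) f = trans (∙-congˡ (Δ-last n (λ i j → f (suc i) j))) (sym (assoc _ _ _))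

    Δ-flip : ∀ n f → Δ n f ≈ Δ n (flip f)
    Δ-flip zero    f = refl
    Δ-flip (suc n) f = begin
      f 0 (suc n) ∙ Δ n (λ i j → f (suc i) j) ≈⟨ ∙-congˡ (Δ-flip n _) ⟩
      f 0 (suc n) ∙ Δ n (λ i j → f (suc j) i) ≈⟨ comm _ _ ⟩
      Δ n (λ i j → f (suc j) i) ∙ f 0 (suc n) ≈⟨ Δ-last n (flip f) ⟨
      Δ (suc n) (flip f)                      ∎

    -- Both sides run over i + j + k = n. The terms with i = 0 form `Δ (suc n) (f 0)`; its first
    -- term is the m = 0 term on the right, and the others join the inner sums with m > 0.
    Δ-assoc : ∀ n (f : ℕ → ℕ → ℕ → Carrier) →
              Δ n (λ i m → Δ m (λ j k → f i j k)) ≈ Δ n (λ m k → Δ m (λ i j → f i j k))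
    Δ-assoc zero    f = refl
    Δ-assoc (suc n) f = begin
      Δ (suc n) (f 0) ∙ Δ n (λ i m → Δ m (f (suc i)))
        ≈⟨ ∙-congˡ (Δ-assoc n (λ i → f (suc i))) ⟩
      Δ (suc n) (f 0) ∙ Δ n (λ m k → Δ m (λ i j → f (suc i) j k))
        ≈⟨ assoc _ _ _ ⟩
      f 0 0 (suc n) ∙ (Δ n (λ j k → f 0 (suc j) k) ∙ Δ n (λ m k → Δ m (λ i j → f (suc i) j k)))
        ≈⟨ ∙-congˡ (Δ-∙ n _ _) ⟨
      Δ (suc n) (λ m k → Δ m (λ i j → f i j k)) ∎

    Δ-comm : ∀ m n (f : ℕ → ℕ → ℕ → ℕ → Carrier) →
             Δ m (λ i j → Δ n (λ k l → f i j k l)) ≈ Δ n (λ k l → Δ m (λ i j → f i j k l))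
    Δ-comm zero    n f = refl
    Δ-comm (suc m) n f = trans (∙-congˡ (Δ-comm m n _)) (sym (Δ-∙ n _ _))

    Δ-exchange : ∀ n (f : ℕ → ℕ → ℕ → Carrier) →
                 Δ n (λ i m → Δ m (λ j k → f i j k)) ≈ Δ n (λ j m → Δ m (λ i k → f i j k))
    Δ-exchange n f = begin
      Δ n (λ i m → Δ m (λ j k → f i j k)) ≈⟨ Δ-assoc n f ⟩
      Δ n (λ m k → Δ m (λ i j → f i j k)) ≈⟨ Δ-cong n (λ m k → Δ-flip m _) ⟩
      Δ n (λ m k → Δ m (λ j i → f i j k)) ≈⟨ Δ-assoc n (λ j i k → f i j k) ⟨
      Δ n (λ j m → Δ m (λ i k → f i j k)) ∎

  module _ {c ℓ c′ ℓ′} (M : CommutativeMonoid c ℓ) (M′ : CommutativeMonoid c′ ℓ′) where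
    open import Data.Nat.Base using (ℕ; zero; suc)
    private
      module M  = CommutativeMonoid M
      module M′ = CommutativeMonoid M′
      module Δ  = Antidiagonal M
      module Δ′ = Antidiagonal M′

    -- Serves for multiplication by a fixed factor, for the embedding of ℕ into ℤ and for `CT`.
    -- Additivity suffices because a `Δ` is never an empty sum.
    Δ-homo : (φ : M.Carrier → M′.Carrier) → (∀ x y → φ (x M.∙ y) M′.≈ φ x M′.∙ φ y) →
             ∀ n f → φ (Δ.Δ n f) M′.≈ Δ′.Δ n (λ i j → φ (f i j))
    Δ-homo φ φ-∙ zero    f = M′.refl
    Δ-homo φ φ-∙ (suc n) f = M′.trans (φ-∙ _ _) (M′.∙-congˡ (Δ-homo φ φ-∙ n _))

-- Semiring laws for power series and iterated Laurent series.

module IteratedLaurentSeries where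

  open AntidiagonalSums
  open import Defs
  open import Algebra.Bundles using (CommutativeSemiring)
  open import Algebra.Bundles.Raw using (RawRing)
  open import Algebra.Structures using (IsCommutativeSemiring; IsCommutativeRing)
  open import Data.Integer.Base as ℤ using (ℤ; +_; -[1+_]; 1ℤ)
  import Data.Integer.Properties as ℤ
  open import Data.Integer.Tactic.RingSolver using () renaming (solve-∀ to ℤsolve-∀)
  open import Data.Nat.Base as ℕ using (ℕ; zero; suc)
  import Data.Nat.Properties as ℕ
  open import Data.Product.Base using (_,_)
  open import Function.Base using (_$_)
  open import Level using (0ℓ)
  open import Relation.Binary.PropositionalEquality as ≡ using (_≡_)

  IsSemiringRaw : RawRing 0ℓ 0ℓ → Set
  IsSemiringRaw R = IsCommutativeSemiring _≈_ _+_ _*_ 0# 1# where open RawRing R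

  -- Positive and negative parts put both cases of `monomial` into one form: x^z has the coefficient
  -- sequence `δ (pos z)` and the pole `neg z`.
  pos neg : ℤ → ℕ
  pos (+ n)    = n
  pos -[1+ n ] = 0
  neg (+ n)    = 0
  neg -[1+ n ] = suc n

  pos-neg : ∀ z → + pos z ℤ.- + neg z ≡ z
  pos-neg (+ n)    = ℤ.+-identityʳ (+ n)
  pos-neg -[1+ n ] = ≡.refl

  -- The product of two monomials has the pole `neg i` + `neg j`, which may exceed that of the
  -- monomial of i + j. This is the condition for the two representations to have the same exponent.
  cross : ∀ i j → pos (i ℤ.+ j) ℕ.+ (neg i ℕ.+ neg j) ≡ pos i ℕ.+ pos j ℕ.+ neg (i ℤ.+ j)
  cross i j = ℤ.+-injective $ begin
    + (pos s ℕ.+ (neg i ℕ.+ neg j))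
      ≡⟨ ≡.trans (ℤ.pos-+ (pos s) _) (≡.cong (λ w → + pos s ℤ.+ w) (ℤ.pos-+ (neg i) (neg j))) ⟩
    + pos s ℤ.+ (+ neg i ℤ.+ + neg j)
      ≡⟨ rearrange₁ (+ pos s) (+ neg s) (+ neg i) (+ neg j) ⟩
    (+ pos s ℤ.- + neg s) ℤ.+ (+ neg s ℤ.+ (+ neg i ℤ.+ + neg j))
      ≡⟨ ≡.cong (ℤ._+ (+ neg s ℤ.+ (+ neg i ℤ.+ + neg j)))
           (≡.trans (pos-neg s) (≡.sym (≡.cong₂ ℤ._+_ (pos-neg i) (pos-neg j)))) ⟩
    (+ pos i ℤ.- + neg i) ℤ.+ (+ pos j ℤ.- + neg j) ℤ.+ (+ neg s ℤ.+ (+ neg i ℤ.+ + neg j))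
      ≡⟨ rearrange₂ (+ neg s) (+ pos i) (+ neg i) (+ pos j) (+ neg j) ⟩
    + pos i ℤ.+ + pos j ℤ.+ + neg s
      ≡⟨ ≡.trans (ℤ.pos-+ (pos i ℕ.+ pos j) (neg s)) (≡.cong (ℤ._+ + neg s) (ℤ.pos-+ (pos i) (pos j))) ⟨
    + (pos i ℕ.+ pos j ℕ.+ neg s) ∎
    where
    open ≡.≡-Reasoning
    s = i ℤ.+ j
    rearrange₁ : ∀ a b d f → a ℤ.+ (d ℤ.+ f) ≡ (a ℤ.- b) ℤ.+ (b ℤ.+ (d ℤ.+ f))
    rearrange₁ = ℤsolve-∀
    rearrange₂ : ∀ b c d e f → (c ℤ.- d) ℤ.+ (e ℤ.- f) ℤ.+ (b ℤ.+ (d ℤ.+ f)) ≡ c ℤ.+ e ℤ.+ b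
    rearrange₂ = ℤsolve-∀

  module SeriesProperties (R : RawRing 0ℓ 0ℓ) (csr : IsSemiringRaw R) where
    private
      S : CommutativeSemiring 0ℓ 0ℓ
      S = record { isCommutativeSemiring = csr }
    open Series R
    open CommutativeSemiring S
    open import Relation.Binary.Reasoning.Setoid setoid
    open Antidiagonal +-commutativeMonoid public

    -- `cauchy` sums over `Fin` with a truncated difference as second index. `Δ` carries both
    -- indices, so commutativity and associativity become reindexings of pairs and triples.
    cauchy-Δ : ∀ f g l → cauchy f g l ≈ Δ l (λ i j → f i * g j)
    cauchy-Δ f g zero    = +-identityʳ _
    cauchy-Δ f g (suc l) = +-congˡ (cauchy-Δ (λ i → f (suc i)) g l)

    *-Δ : ∀ x n f → x * Δ n f ≈ Δ n (λ i j → x * f i j)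
    *-Δ x = Δ-homo +-commutativeMonoid +-commutativeMonoid (x *_) (distribˡ x)

    Δ-* : ∀ x n f → Δ n f * x ≈ Δ n (λ i j → f i j * x)
    Δ-* x = Δ-homo +-commutativeMonoid +-commutativeMonoid (_* x) (distribʳ x)

    cauchy-cong : ∀ {f f′ g g′} → (∀ i → f i ≈ f′ i) → (∀ i → g i ≈ g′ i) → ∀ l → cauchy f g l ≈ cauchy f′ g′ l
    cauchy-cong {f} {f′} {g} {g′} p q l = begin
      cauchy f g l               ≈⟨ cauchy-Δ f g l ⟩
      Δ l (λ i j → f i * g j)    ≈⟨ Δ-cong l (λ i j → *-cong (p i) (q j)) ⟩
      Δ l (λ i j → f′ i * g′ j)  ≈⟨ cauchy-Δ f′ g′ l ⟨
      cauchy f′ g′ l             ∎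

    cauchy-comm : ∀ f g l → cauchy f g l ≈ cauchy g f l
    cauchy-comm f g l = begin
      cauchy f g l             ≈⟨ cauchy-Δ f g l ⟩
      Δ l (λ i j → f i * g j)  ≈⟨ Δ-flip l _ ⟩
      Δ l (λ i j → f j * g i)  ≈⟨ Δ-cong l (λ i j → *-comm _ _) ⟩
      Δ l (λ i j → g i * f j)  ≈⟨ cauchy-Δ g f l ⟨
      cauchy g f l             ∎

    cauchy-assoc : ∀ f g h l → cauchy (cauchy f g) h l ≈ cauchy f (cauchy g h) l
    cauchy-assoc f g h l = begin
      cauchy (cauchy f g) h l
        ≈⟨ cauchy-Δ (cauchy f g) h l ⟩
      Δ l (λ m k → cauchy f g m * h k)
        ≈⟨ Δ-cong l (λ m k → trans (*-congʳ (cauchy-Δ f g m)) (Δ-* (h k) m _)) ⟩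
      Δ l (λ m k → Δ m (λ i j → f i * g j * h k))
        ≈⟨ Δ-assoc l _ ⟨
      Δ l (λ i m → Δ m (λ j k → f i * g j * h k))
        ≈⟨ Δ-cong l (λ i m → trans (Δ-cong m (λ j k → *-assoc _ _ _)) (trans (sym (*-Δ (f i) m _)) (*-congˡ (sym (cauchy-Δ g h m))))) ⟩
      Δ l (λ i m → f i * cauchy g h m)
        ≈⟨ cauchy-Δ f (cauchy g h) l ⟨
      cauchy f (cauchy g h) l ∎

    cauchy-distribʳ : ∀ f g h l → cauchy (λ i → g i + h i) f l ≈ cauchy g f l + cauchy h f l
    cauchy-distribʳ f g h l = begin
      cauchy (λ i → g i + h i) f l
        ≈⟨ trans (cauchy-Δ _ f l) (Δ-cong l (λ i j → distribʳ _ _ _)) ⟩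
      Δ l (λ i j → g i * f j + h i * f j)
        ≈⟨ Δ-∙ l _ _ ⟩
      Δ l (λ i j → g i * f j) + Δ l (λ i j → h i * f j)
        ≈⟨ +-cong (cauchy-Δ g f l) (cauchy-Δ h f l) ⟨
      cauchy g f l + cauchy h f l ∎

    cauchy-zeroˡ : ∀ f l → cauchy (λ _ → 0#) f l ≈ 0#
    cauchy-zeroˡ f l = trans (cauchy-Δ (λ _ → 0#) f l) (trans (Δ-cong l (λ i j → zeroˡ _)) (Δ-ε l))

    cauchy-scalarˡ : ∀ r f l → cauchy (scalar r) f l ≈ r * f l
    cauchy-scalarˡ r f zero    = +-identityʳ _
    cauchy-scalarˡ r f (suc l) = trans (+-congˡ (cauchy-zeroˡ f l)) (+-identityʳ _)

    δ-scalar : ∀ i → δ 0 i ≈ scalar 1# i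
    δ-scalar zero    = refl
    δ-scalar (suc i) = refl

    cauchy-identityˡ : ∀ f l → cauchy (δ 0) f l ≈ f l
    cauchy-identityˡ f l = begin
      cauchy (δ 0) f l        ≈⟨ cauchy-cong {g = f} δ-scalar (λ _ → refl) l ⟩
      cauchy (scalar 1#) f l  ≈⟨ cauchy-scalarˡ 1# f l ⟩
      1# * f l                ≈⟨ *-identityˡ _ ⟩
      f l                     ∎

    powerSeries-isSemiring : IsSemiringRaw powerSeries
    powerSeries-isSemiring = record
      { isSemiring = record
        { isSemiringWithoutAnnihilatingZero = record
          { +-isCommutativeMonoid = record
            { isMonoid = record
              { isSemigroup = record
                { isMagma = record
                  { isEquivalence = record
                    { refl  = λ _ → refl
                    ; sym   = λ p i → sym (p i)
                    ; trans = λ p q i → trans (p i) (q i)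
                    }
                  ; ∙-cong = λ p q i → +-cong (p i) (q i)
                  }
                ; assoc = λ f g h i → +-assoc _ _ _
                }
              ; identity = (λ f i → +-identityˡ _) , (λ f i → +-identityʳ _)
              }
            ; comm = λ f g i → +-comm _ _
            }
          ; *-cong = cauchy-cong
          ; *-assoc = cauchy-assoc
          ; *-identity = cauchy-identityˡ , λ f i → trans (cauchy-comm f (δ 0) i) (cauchy-identityˡ f i)
          ; distrib = (λ f g h i → trans (cauchy-comm f (λ i → g i + h i) i) (trans (cauchy-distribʳ f g h i)
                         (+-cong (cauchy-comm g f i) (cauchy-comm h f i))))
                    , cauchy-distribʳ
          }
        ; zero = cauchy-zeroˡ , λ f i → trans (cauchy-comm f (λ _ → 0#) i) (cauchy-zeroˡ f i)
        }
      ; *-comm = cauchy-comm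
      }

    infix 4 _≋_
    _≋_ : Laurent → Laurent → Set
    _≋_ = RawRing._≈_ laurentSeries

    private
      infixl 7 _⊛_
      infixl 6 _⊕_
      _⊛_ _⊕_ : Laurent → Laurent → Laurent
      _⊛_ = RawRing._*_ laurentSeries
      _⊕_ = RawRing._+_ laurentSeries

      ≋-refl : ∀ {f} → f ≋ f
      ≋-refl z = refl

      ≋-sym : ∀ {f g} → f ≋ g → g ≋ f
      ≋-sym p z = sym (p z)

      ≋-trans : ∀ {f g h} → f ≋ g → g ≋ h → f ≋ h
      ≋-trans p q z = trans (p z) (q z)

    i-p+p : ∀ i p → + i ℤ.- + p ℤ.+ + p ≡ + i
    i-p+p i p = ≡.trans (ℤ.+-assoc (+ i) (ℤ.- + p) (+ p))
      (≡.trans (≡.cong (λ w → + i ℤ.+ w) (ℤ.+-inverseˡ (+ p))) (ℤ.+-identityʳ (+ i)))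

    coeff-nonneg : ∀ f z {i} → z ℤ.+ + pole f ≡ + i → coeff f z ≡ coeffs f i
    coeff-nonneg f z eq with z ℤ.+ + pole f
    coeff-nonneg f z ≡.refl | .(+ _) = ≡.refl

    coeff-neg : ∀ f z {i} → z ℤ.+ + pole f ≡ -[1+ i ] → coeff f z ≡ 0#
    coeff-neg f z eq with z ℤ.+ + pole f
    coeff-neg f z ≡.refl | .(-[1+ _ ]) = ≡.refl

    coeff-at : ∀ f i → coeff f (+ i ℤ.- + pole f) ≡ coeffs f i
    coeff-at f i = coeff-nonneg f (+ i ℤ.- + pole f) (i-p+p i (pole f))

    same-pole : ∀ {f g} → pole f ≡ pole g → (∀ i → coeffs f i ≈ coeffs g i) → f ≋ g
    same-pole {f} {g} ≡.refl p z with z ℤ.+ + pole f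
    ... | + i      = p i
    ... | -[1+ _ ] = refl

    same-pole⁻¹ : ∀ {f g} → pole f ≡ pole g → f ≋ g → ∀ i → coeffs f i ≈ coeffs g i
    same-pole⁻¹ {f} {g} ≡.refl p i = begin
      coeffs f i                    ≡⟨ coeff-at f i ⟨
      coeff f (+ i ℤ.- + pole f)    ≈⟨ p (+ i ℤ.- + pole f) ⟩
      coeff g (+ i ℤ.- + pole f)    ≡⟨ coeff-at g i ⟩
      coeffs g i                    ∎

    infixr 5 0∷_
    0∷_ : (ℕ → Carrier) → ℕ → Carrier
    (0∷ f) zero    = 0#
    (0∷ f) (suc i) = f i

    -- The same series with its pole order raised by one. Equality compares coefficients by
    -- exponent, while products are computed on coefficient sequences; padding two representations
    -- to a common pole connects the two views.
    pad₁ : Laurent → Laurent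
    pad₁ f = laurent (suc (pole f)) (0∷ coeffs f)

    pad : ℕ → Laurent → Laurent
    pad zero    f = f
    pad (suc k) f = pad₁ (pad k f)

    pole-pad : ∀ k f → pole (pad k f) ≡ k ℕ.+ pole f
    pole-pad zero    f = ≡.refl
    pole-pad (suc k) f = ≡.cong suc (pole-pad k f)

    private
      +suc : ∀ z p → z ℤ.+ + suc p ≡ ℤ.suc (z ℤ.+ + p)
      +suc z p = ≡.trans (≡.cong (λ w → z ℤ.+ w) (ℤ.pos-+ 1 p)) (≡.trans (≡.sym (ℤ.+-assoc z 1ℤ (+ p)))
        (≡.trans (≡.cong (ℤ._+ + p) (ℤ.+-comm z 1ℤ)) (ℤ.+-assoc 1ℤ z (+ p))))

    pad₁-≋ : ∀ f → f ≋ pad₁ f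
    pad₁-≋ f z with z ℤ.+ + pole f in eq
    ... | + i          = sym (reflexive (coeff-nonneg (pad₁ f) z (≡.trans (+suc z (pole f)) (≡.cong ℤ.suc eq))))
    ... | -[1+ 0 ]     = sym (reflexive (coeff-nonneg (pad₁ f) z (≡.trans (+suc z (pole f)) (≡.cong ℤ.suc eq))))
    ... | -[1+ suc m ] = sym (reflexive (coeff-neg (pad₁ f) z (≡.trans (+suc z (pole f)) (≡.cong ℤ.suc eq))))

    pad-≋ : ∀ k f → f ≋ pad k f
    pad-≋ zero    f = ≋-refl {f}
    pad-≋ (suc k) f = ≋-trans {f} {pad k f} {pad (suc k) f} (pad-≋ k f) (pad₁-≋ (pad k f))

    common-pole : ∀ f g → pole (pad (pole g) f) ≡ pole (pad (pole f) g)
    common-pole f g = ≡.trans (pole-pad (pole g) f) (≡.trans (ℕ.+-comm (pole g) (pole f)) (≡.sym (pole-pad (pole f) g)))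

    private
      cauchy-0∷ : ∀ f g l → cauchy (0∷ f) g l ≈ (0∷ cauchy f g) l
      cauchy-0∷ f g zero    = trans (+-identityʳ _) (zeroˡ _)
      cauchy-0∷ f g (suc l) = trans (+-congʳ (zeroˡ _)) (+-identityˡ _)

      pad-⊛ : ∀ k f g → pad k f ⊛ g ≋ f ⊛ g
      pad-⊛ zero    f g = ≋-refl {f ⊛ g}
      pad-⊛ (suc k) f g = ≋-trans {pad (suc k) f ⊛ g} {pad₁ (pad k f ⊛ g)} {f ⊛ g}
        (same-pole {pad (suc k) f ⊛ g} {pad₁ (pad k f ⊛ g)} ≡.refl (cauchy-0∷ (coeffs (pad k f)) (coeffs g)))
        (≋-trans {pad₁ (pad k f ⊛ g)} {pad k f ⊛ g} {f ⊛ g} (≋-sym {pad k f ⊛ g} {pad₁ (pad k f ⊛ g)} (pad₁-≋ (pad k f ⊛ g))) (pad-⊛ k f g))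

      -- Padding does not change a product up to `≋`, and at a common pole `f ≋ f′` is equality of
      -- coefficient sequences.
      ⊛-congʳ : ∀ f f′ g → f ≋ f′ → f ⊛ g ≋ f′ ⊛ g
      ⊛-congʳ f f′ g p z = trans (sym (pad-⊛ (pole f′) f g z)) (trans (same-pole {F ⊛ g} {F′ ⊛ g}
          (≡.cong (ℕ._+ pole g) (common-pole f f′)) (cauchy-cong (same-pole⁻¹ {F} {F′} (common-pole f f′) F≋F′) (λ _ → refl)) z)
          (pad-⊛ (pole f) f′ g z))
        where
        F  = pad (pole f′) f
        F′ = pad (pole f) f′
        F≋F′ : F ≋ F′
        F≋F′ z = trans (sym (pad-≋ (pole f′) f z)) (trans (p z) (pad-≋ (pole f) f′ z))

      ⊛-comm : ∀ f g → f ⊛ g ≋ g ⊛ f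
      ⊛-comm f g = same-pole {f ⊛ g} {g ⊛ f} (ℕ.+-comm (pole f) (pole g)) (cauchy-comm (coeffs f) (coeffs g))

      ⊛-cong : ∀ {f f′ g g′} → f ≋ f′ → g ≋ g′ → f ⊛ g ≋ f′ ⊛ g′
      ⊛-cong {f} {f′} {g} {g′} p q z = trans (⊛-congʳ f f′ g p z) (trans (⊛-comm f′ g z)
        (trans (⊛-congʳ g g′ f′ q z) (⊛-comm g′ f′ z)))

      ⊛-assoc : ∀ f g h → (f ⊛ g) ⊛ h ≋ f ⊛ (g ⊛ h)
      ⊛-assoc f g h = same-pole {(f ⊛ g) ⊛ h} {f ⊛ (g ⊛ h)}
        (ℕ.+-assoc (pole f) (pole g) (pole h)) (cauchy-assoc (coeffs f) (coeffs g) (coeffs h))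

      ⊛-identityˡ : ∀ f → laurent 0 (δ 0) ⊛ f ≋ f
      ⊛-identityˡ f = same-pole {laurent 0 (δ 0) ⊛ f} {f} ≡.refl (cauchy-identityˡ (coeffs f))

      coeff-below : ∀ f {p} z {m} → pole f ℕ.≤ p → z ℤ.+ + p ≡ -[1+ m ] → coeff f z ≡ 0#
      coeff-below f {p} z f≤p eq with z ℤ.+ + pole f in eq′
      ... | -[1+ _ ] = ≡.refl
      ... | + i with () ← ≡.subst₂ ℤ._≤_ eq′ eq (ℤ.+-monoʳ-≤ z (ℤ.+≤+ f≤p))

      i-p : ∀ z p {i} → z ℤ.+ + p ≡ + i → + i ℤ.- + p ≡ z
      i-p z p eq = ≡.trans (≡.cong (ℤ._- + p) (≡.sym eq)) (≡.trans (ℤ.+-assoc z (+ p) (ℤ.- + p))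
        (≡.trans (≡.cong (λ w → z ℤ.+ w) (ℤ.+-inverseʳ (+ p))) (ℤ.+-identityʳ z)))

    coeff-+ : ∀ f g z → coeff (f ⊕ g) z ≈ coeff f z + coeff g z
    coeff-+ f g z with z ℤ.+ + (pole f ℕ.⊔ pole g) in eq
    ... | + i      = reflexive (≡.cong (λ w → coeff f w + coeff g w) (i-p z (pole f ℕ.⊔ pole g) eq))
    ... | -[1+ m ] = sym (trans (+-cong (reflexive (coeff-below f z (ℕ.m≤m⊔n (pole f) (pole g)) eq))
                                        (reflexive (coeff-below g z (ℕ.m≤n⊔m (pole f) (pole g)) eq))) (+-identityˡ 0#))

    coeff-0 : ∀ p z → coeff (laurent p (λ _ → 0#)) z ≈ 0#
    coeff-0 p z with z ℤ.+ + p
    ... | + i      = refl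
    ... | -[1+ _ ] = refl

    private
      ⊕-cong : ∀ {f f′ g g′} → f ≋ f′ → g ≋ g′ → f ⊕ g ≋ f′ ⊕ g′
      ⊕-cong {f} {f′} {g} {g′} p q z = trans (coeff-+ f g z) (trans (+-cong (p z) (q z)) (sym (coeff-+ f′ g′ z)))

      laurent-+ : ∀ p F G → laurent p F ⊕ laurent p G ≋ laurent p (λ i → F i + G i)
      laurent-+ p F G z = trans (coeff-+ (laurent p F) (laurent p G) z) (lemma z)
        where
        lemma : ∀ z → coeff (laurent p F) z + coeff (laurent p G) z ≈ coeff (laurent p (λ i → F i + G i)) z
        lemma z with z ℤ.+ + p
        ... | + i      = refl
        ... | -[1+ _ ] = +-identityˡ 0#

      laurent-cong : ∀ {f} p → pole f ≡ p → f ≋ laurent p (coeffs f)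
      laurent-cong {f} p eq = same-pole {f} {laurent p (coeffs f)} eq (λ _ → refl)

      -- Both summands are brought to a common pole, where distributivity is that of the Cauchy
      -- product of coefficient sequences.
      ⊛-distribʳ : ∀ h f g → (f ⊕ g) ⊛ h ≋ (f ⊛ h) ⊕ (g ⊛ h)
      ⊛-distribʳ h f g =
        ≋-trans {(f ⊕ g) ⊛ h} {(F ⊕ G) ⊛ h} {(f ⊛ h) ⊕ (g ⊛ h)}
          (⊛-congʳ (f ⊕ g) (F ⊕ G) h (⊕-cong {f} {F} {g} {G} f≋F g≋G))
        (≋-trans {(F ⊕ G) ⊛ h} {laurent P (λ i → coeffs F i + coeffs G i) ⊛ h} {(f ⊛ h) ⊕ (g ⊛ h)}
          (⊛-congʳ (F ⊕ G) _ h (laurent-+ P (coeffs F) (coeffs G)))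
        (≋-trans {laurent P (λ i → coeffs F i + coeffs G i) ⊛ h} {(F ⊛ h) ⊕ (G ⊛ h)} {(f ⊛ h) ⊕ (g ⊛ h)}
          (≋-trans {_} {laurent (P ℕ.+ pole h) (λ i → cauchy (coeffs F) (coeffs h) i + cauchy (coeffs G) (coeffs h) i)} {(F ⊛ h) ⊕ (G ⊛ h)}
            (same-pole {laurent P (λ i → coeffs F i + coeffs G i) ⊛ h}
                       {laurent (P ℕ.+ pole h) (λ i → cauchy (coeffs F) (coeffs h) i + cauchy (coeffs G) (coeffs h) i)}
                       ≡.refl (cauchy-distribʳ (coeffs h) (coeffs F) (coeffs G)))
            (≋-sym {(F ⊛ h) ⊕ (G ⊛ h)} (laurent-+ (P ℕ.+ pole h) (cauchy (coeffs F) (coeffs h)) (cauchy (coeffs G) (coeffs h)))))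
          (⊕-cong {F ⊛ h} {f ⊛ h} {G ⊛ h} {g ⊛ h}
            (⊛-congʳ F f h (≋-sym {f} {F} f≋F)) (⊛-congʳ G g h (≋-sym {g} {G} g≋G)))))
        where
        P = pole (pad (pole g) f)
        F G : Laurent
        F = laurent P (coeffs (pad (pole g) f))
        G = laurent P (coeffs (pad (pole f) g))
        f≋F : f ≋ F
        f≋F = pad-≋ (pole g) f
        g≋G : g ≋ G
        g≋G = ≋-trans {g} {pad (pole f) g} {G} (pad-≋ (pole f) g) (laurent-cong {pad (pole f) g} P (≡.sym (common-pole f g)))

      ⊛-zeroˡ : ∀ f → laurent 0 (λ _ → 0#) ⊛ f ≋ laurent 0 (λ _ → 0#)
      ⊛-zeroˡ f z = trans (same-pole {laurent 0 (λ _ → 0#) ⊛ f} {laurent (pole f) (λ _ → 0#)} ≡.refl (cauchy-zeroˡ (coeffs f)) z)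
        (trans (coeff-0 (pole f) z) (sym (coeff-0 0 z)))

    laurent-isSemiring : IsSemiringRaw laurentSeries
    laurent-isSemiring = record
      { isSemiring = record
        { isSemiringWithoutAnnihilatingZero = record
          { +-isCommutativeMonoid = record
            { isMonoid = record
              { isSemigroup = record
                { isMagma = record
                  { isEquivalence = record
                    { refl  = λ {f} → ≋-refl {f}
                    ; sym   = λ {f} {g} → ≋-sym {f} {g}
                    ; trans = λ {f} {g} {h} → ≋-trans {f} {g} {h}
                    }
                  ; ∙-cong = λ {f} {f′} {g} {g′} → ⊕-cong {f} {f′} {g} {g′}
                  }
                ; assoc = λ f g h z → trans (trans (coeff-+ (f ⊕ g) h z) (+-congʳ (coeff-+ f g z)))
                    (trans (+-assoc _ _ _) (sym (trans (coeff-+ f (g ⊕ h) z) (+-congˡ (coeff-+ g h z)))))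
                }
              ; identity = (λ f z → trans (coeff-+ (laurent 0 (λ _ → 0#)) f z) (trans (+-congʳ (coeff-0 0 z)) (+-identityˡ _)))
                         , (λ f z → trans (coeff-+ f (laurent 0 (λ _ → 0#)) z) (trans (+-congˡ (coeff-0 0 z)) (+-identityʳ _)))
              }
            ; comm = λ f g z → trans (coeff-+ f g z) (trans (+-comm _ _) (sym (coeff-+ g f z)))
            }
          ; *-cong = λ {f} {f′} {g} {g′} → ⊛-cong {f} {f′} {g} {g′}
          ; *-assoc = ⊛-assoc
          ; *-identity = ⊛-identityˡ , λ f z → trans (⊛-comm f (laurent 0 (δ 0)) z) (⊛-identityˡ f z)
          ; distrib = (λ h f g z → trans (⊛-comm h (f ⊕ g) z) (trans (⊛-distribʳ h f g z)
                         (⊕-cong {f ⊛ h} {h ⊛ f} {g ⊛ h} {h ⊛ g} (⊛-comm f h) (⊛-comm g h) z)))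
                    , ⊛-distribʳ
          }
        ; zero = ⊛-zeroˡ , λ f z → trans (⊛-comm f (laurent 0 (λ _ → 0#)) z) (⊛-zeroˡ f z)
        }
      ; *-comm = ⊛-comm
      }

    constant-cong : ∀ {x y} → x ≈ y → constant x ≋ constant y
    constant-cong {x} {y} p = same-pole {constant x} {constant y} ≡.refl λ where
      zero    → p
      (suc _) → refl

    constant-* : ∀ x y → constant (x * y) ≋ constant x ⊛ constant y
    constant-* x y = same-pole {constant (x * y)} {constant x ⊛ constant y} ≡.refl λ i →
      trans (lemma i) (sym (cauchy-scalarˡ x (scalar y) i))
      where
      lemma : ∀ i → scalar (x * y) i ≈ x * scalar y i
      lemma zero    = refl
      lemma (suc i) = sym (zeroʳ x)

    constant-1 : constant 1# ≋ laurent 0 (δ 0)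
    constant-1 = same-pole {constant 1#} {laurent 0 (δ 0)} ≡.refl (λ i → sym (δ-scalar i))

    private
      -- x^(k - p)
      mono : ℕ → ℕ → Laurent
      mono p k = laurent p (δ k)

      pad₁-mono : ∀ p k → pad₁ (mono p k) ≋ mono (suc p) (suc k)
      pad₁-mono p k = same-pole {pad₁ (mono p k)} {mono (suc p) (suc k)} ≡.refl λ where
        zero    → refl
        (suc i) → refl

      mono-pad : ∀ m p k → mono p k ≋ mono (m ℕ.+ p) (m ℕ.+ k)
      mono-pad zero    p k = ≋-refl {mono p k}
      mono-pad (suc m) p k z = trans (mono-pad m p k z) (trans (pad₁-≋ (mono (m ℕ.+ p) (m ℕ.+ k)) z) (pad₁-mono (m ℕ.+ p) (m ℕ.+ k) z))

      mono-≡ : ∀ {p k p′ k′} → k ℕ.+ p′ ≡ k′ ℕ.+ p → mono p k ≋ mono p′ k′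
      mono-≡ {p} {k} {p′} {k′} eq z = trans (mono-pad p′ p k z) (trans
        (reflexive (≡.cong₂ (λ a b → coeff (mono a b) z) (ℕ.+-comm p′ p)
          (≡.trans (ℕ.+-comm p′ k) (≡.trans eq (ℕ.+-comm k′ p)))))
        (sym (mono-pad p p′ k′ z)))

      δ-* : ∀ k l i → cauchy (δ k) (δ l) i ≈ δ (k ℕ.+ l) i
      δ-* zero    l i       = cauchy-identityˡ (δ l) i
      δ-* (suc k) l zero    = trans (+-identityʳ _) (zeroˡ _)
      δ-* (suc k) l (suc i) = trans (+-congʳ (zeroˡ _)) (trans (+-identityˡ _) (δ-* k l i))

      monomial-mono : ∀ z → monomial z ≡ mono (neg z) (pos z)
      monomial-mono (+ n)    = ≡.refl
      monomial-mono -[1+ n ] = ≡.refl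

    monomial-+ : ∀ i j → monomial (i ℤ.+ j) ≋ monomial i ⊛ monomial j
    monomial-+ i j z = trans (reflexive (≡.cong (λ f → coeff f z) (monomial-mono (i ℤ.+ j))))
      (trans (mono-≡ {neg (i ℤ.+ j)} {pos (i ℤ.+ j)} {neg i ℕ.+ neg j} {pos i ℕ.+ pos j} (cross i j) z)
      (trans (same-pole {mono (neg i ℕ.+ neg j) (pos i ℕ.+ pos j)} {mono (neg i) (pos i) ⊛ mono (neg j) (pos j)}
                ≡.refl (λ k → sym (δ-* (pos i) (pos j) k)) z)
      (reflexive (≡.cong₂ (λ f g → coeff (f ⊛ g) z) (≡.sym (monomial-mono i)) (≡.sym (monomial-mono j))))))

  iterLaurent-isSemiring : ∀ n → IsSemiringRaw (iterLaurent n)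
  iterLaurent-isSemiring zero    = IsCommutativeRing.isCommutativeSemiring ℤ.+-*-isCommutativeRing
  iterLaurent-isSemiring (suc n) = SeriesProperties.laurent-isSemiring (iterLaurent n) (iterLaurent-isSemiring n)

-- Flow counts on acyclic networks and the elimination of vertices.

module Networks where

  open AntidiagonalSums
  open import Data.Fin.Base using (Fin; zero; suc; fromℕ)
  open import Data.Integer.Base as ℤ using (ℤ; +_; -[1+_]; 1ℤ)
  import Data.Integer.Properties as ℤ
  open import Data.List.Base using (List; []; _∷_; length)
  open import Data.Nat.Base
  open import Data.Nat.Properties
  open import Data.Nat.Tactic.RingSolver using (solve-∀)
  open import Data.Vec.Base as Vec using (Vec; []; _∷_; lookup; map; zipWith; sum; updateAt)
  open import Function.Base using (_∘_)
  open import Relation.Binary.PropositionalEquality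

  private
    variable
      n : ℕ
    module Δℕ = Antidiagonal +-0-commutativeMonoid

  open Δℕ using (Δ; Δ-cong; Δ-∙; Δ-ε; Δ-assoc; Δ-exchange; Δ-comm; Δ-flip; Δ-last) public

  Δ-cong′ : ∀ n {f g} → (∀ i j → i + j ≡ n → f i j ≡ g i j) → Δ n f ≡ Δ n g
  Δ-cong′ zero    p = p 0 0 refl
  Δ-cong′ (suc n) p = cong₂ _+_ (p 0 (suc n) refl) (Δ-cong′ n (λ i j eq → p (suc i) j (cong suc eq)))

  Δ-mono : ∀ n {f g} → (∀ i j → i + j ≡ n → f i j ≤ g i j) → Δ n f ≤ Δ n g
  Δ-mono zero    p = p 0 0 refl
  Δ-mono (suc n) p = +-mono-≤ (p 0 (suc n) refl) (Δ-mono n (λ i j eq → p (suc i) j (cong suc eq)))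

  Δ-drop : ∀ m n f → Δ n (λ i j → f (m + i) j) ≤ Δ (m + n) f
  Δ-drop zero    n f = ≤-refl
  Δ-drop (suc m) n f = ≤-trans (Δ-drop m n (f ∘ suc)) (m≤n+m _ _)

  *-Δ : ∀ x n f → x * Δ n f ≡ Δ n (λ i j → x * f i j)
  *-Δ x = Δ-homo +-0-commutativeMonoid +-0-commutativeMonoid (_*_ x) (*-distribˡ-+ x)

  Δ-* : ∀ x n f → Δ n f * x ≡ Δ n (λ i j → f i j * x)
  Δ-* x = Δ-homo +-0-commutativeMonoid +-0-commutativeMonoid (_* x) (*-distribʳ-+ x)

  -- The number of compositions of k into m nonnegative parts.
  B : ℕ → ℕ → ℕ
  B m       zero    = 1
  B zero    (suc k) = 0
  B (suc m) (suc k) = B m (suc k) + B (suc m) k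

  B1 : ∀ k → B 1 k ≡ 1
  B1 zero    = refl
  B1 (suc k) = B1 k

  -- Both are the binomial coefficient C(m + k, k).
  B-sym : ∀ m k → B (suc m) k ≡ B (suc k) m
  B-sym zero    zero    = refl
  B-sym zero    (suc k) = B1 k
  B-sym (suc m) zero    = sym (B1 m)
  B-sym (suc m) (suc k) = trans (cong₂ _+_ (B-sym m (suc k)) (B-sym (suc m) k)) (+-comm (B (suc (suc k)) m) _)

  -- Vandermonde's identity for compositions: the first m parts have some sum i, and the last m′
  -- parts make up the remainder j. Pascal's rule gives the induction.
  B-split : ∀ m m′ k → B (m + m′) k ≡ Δ k (λ i j → B m i * B m′ j)
  B-split m       m′ zero    = refl
  B-split zero    m′ (suc k) = sym (trans
    (cong₂ _+_ (*-identityˡ (B m′ (suc k))) (Δ-ε k)) (+-identityʳ _))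
  B-split (suc m) m′ (suc k) = begin
    B (m + m′) (suc k) + B (suc m + m′) k
      ≡⟨ cong₂ _+_ (B-split m m′ (suc k)) (B-split (suc m) m′ k) ⟩
    1 * B m′ (suc k) + Δ k (λ i j → B m (suc i) * B m′ j) + Δ k (λ i j → B (suc m) i * B m′ j)
      ≡⟨ +-assoc (1 * B m′ (suc k)) _ _ ⟩
    1 * B m′ (suc k) + (Δ k (λ i j → B m (suc i) * B m′ j) + Δ k (λ i j → B (suc m) i * B m′ j))
      ≡⟨ cong (_+_ (1 * B m′ (suc k))) (Δ-∙ k _ _) ⟨
    1 * B m′ (suc k) + Δ k (λ i j → B m (suc i) * B m′ j + B (suc m) i * B m′ j)
      ≡⟨ cong (_+_ (1 * B m′ (suc k))) (Δ-cong k (λ i j → *-distribʳ-+ (B m′ j) (B m (suc i)) (B (suc m) i))) ⟨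
    Δ (suc k) (λ i j → B (suc m) i * B m′ j) ∎
    where open ≡-Reasoning

  B-mono : ∀ m k l → B (suc m) k ≤ B (suc m) (l + k)
  B-mono m k zero    = ≤-refl
  B-mono m k (suc l) = ≤-trans (B-mono m k l) (m≤n+m _ _)

  -- Absorption for binomial coefficients, where `B (suc i) j` is C(i + j, j). Pascal's rule leads
  -- back to (i, j) and, by symmetry, to (j, i).
  B-absorb : ∀ i j → suc j * B (suc i) (suc j) ≡ (i + suc j) * B (suc i) j
  B-absorb zero    j = refl
  B-absorb (suc i) j = begin
    suc j * (B (suc i) (suc j) + b)      ≡⟨ *-distribˡ-+ (suc j) (B (suc i) (suc j)) b ⟩
    suc j * B (suc i) (suc j) + suc j * b ≡⟨ cong (_+ suc j * b) (B-absorb i j) ⟩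
    (i + suc j) * B (suc i) j + suc j * b ≡⟨ cong (_+ suc j * b) (trans (cong₂ _*_ (trans (+-comm i (suc j)) (sym (+-suc j i))) (B-sym i j)) (sym (B-absorb j i))) ⟩
    suc i * B (suc j) (suc i) + suc j * b ≡⟨ cong (λ x → suc i * x + suc j * b) (B-sym j (suc i)) ⟩
    suc i * b + suc j * b                ≡⟨ *-distribʳ-+ b (suc i) (suc j) ⟨
    (suc i + suc j) * b                  ∎
    where
    open ≡-Reasoning
    b = B (suc (suc i)) j

  -- Hence `d ! * B (suc d) k` is the rising factorial (k + 1)⋯(k + d), each step multiplying by its
  -- last factor.
  !*B-suc : ∀ d k → suc d ! * B (suc (suc d)) k ≡ (suc d + k) * (d ! * B (suc d) k)
  !*B-suc d k = begin
    suc d * d ! * B (suc (suc d)) k        ≡⟨ cong (_*_ (suc d * d !)) (B-sym (suc d) k) ⟩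
    suc d * d ! * B (suc k) (suc d)        ≡⟨ rearrange (suc d) (d !) _ ⟩
    d ! * (suc d * B (suc k) (suc d))      ≡⟨ cong (d ! *_) (B-absorb k d) ⟩
    d ! * ((k + suc d) * B (suc k) d)      ≡⟨ cong₂ (λ x y → d ! * (x * y)) (+-comm k (suc d)) (B-sym k d) ⟩
    d ! * ((suc d + k) * B (suc d) k)      ≡⟨ rearrange′ (d !) (suc d + k) _ ⟩
    (suc d + k) * (d ! * B (suc d) k)      ∎
    where
    open ≡-Reasoning
    rearrange : ∀ a b c → a * b * c ≡ b * (a * c)
    rearrange = solve-∀
    rearrange′ : ∀ a b c → a * (b * c) ≡ b * (a * c)
    rearrange′ = solve-∀

  -- A product of d factors between k and k + d. Together with `!*B≤^` this makes `B (suc d) k`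
  -- asymptotic to k^d / d!.
  ^≤!*B : ∀ d k → k ^ d ≤ d ! * B (suc d) k
  ^≤!*B zero    k = ≤-reflexive (sym (trans (+-identityʳ _) (B1 k)))
  ^≤!*B (suc d) k = ≤-trans (*-mono-≤ (m≤n+m k (suc d)) (^≤!*B d k)) (≤-reflexive (sym (!*B-suc d k)))

  !*B≤^ : ∀ d k → d ! * B (suc d) k ≤ (k + d) ^ d
  !*B≤^ zero    k = ≤-reflexive (trans (+-identityʳ _) (B1 k))
  !*B≤^ (suc d) k = ≤-trans (≤-reflexive (!*B-suc d k)) (*-mono-≤
    (≤-reflexive (+-comm (suc d) k))
    (≤-trans (!*B≤^ d k) (^-monoˡ-≤ d (+-monoʳ-≤ k (n≤1+n d)))))

  -- An acyclic network on the vertices 0, …, n with sink n: the head lists the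
  -- targets of the edges leaving vertex 0, except for one further edge from
  -- vertex 0 to the sink, which is always present.
  data Net : ℕ → Set where
    []  : Net 0
    _∷_ : List (Fin (suc n)) → Net n → Net (suc n)

  bump : Fin n → ℕ → Vec ℤ n → Vec ℤ n
  bump j q s = updateAt s j (ℤ._+ + q)

  bumpℕ : Fin n → ℕ → Vec ℕ n → Vec ℕ n
  bumpℕ j q s = updateAt s j (_+_ q)

  ifPos : ℤ → (ℕ → ℕ) → ℕ
  ifPos (+ r)    f = f r
  ifPos -[1+ _ ] f = 0

  -- Sum of F over all ways of sending r units along the edges to os and the
  -- additional edge to the sink.
  spread : List (Fin (suc n)) → (Vec ℤ (suc n) → ℕ) → ℕ → Vec ℤ (suc n) → ℕ
  spread []       F r s = F (bump (fromℕ _) r s)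
  spread (o ∷ os) F r s = Δ r (λ q r′ → spread os F r′ (bump o q s))

  -- The Kostant partition function for net flow s at the vertices 0, …, n-1.
  flows : Net n → Vec ℤ (suc n) → ℕ
  flows []         _       = 1
  flows (os ∷ net) (z ∷ s) = ifPos z (λ r → spread os (flows net) r s)

  -- Sum of F y over y with y_1 + y_2 + ⋯ = N, each y weighted by ∏ B α_i y_i.
  E : Vec ℕ n → ℕ → (Vec ℕ n → ℕ) → ℕ
  E []      N F = B 0 N * F []
  E (a ∷ α) N F = Δ N (λ y N′ → B a y * E α N′ (λ ys → F (y ∷ ys)))

  E-cong : ∀ (α : Vec ℕ n) N {F G} → (∀ ys → F ys ≡ G ys) → E α N F ≡ E α N G
  E-cong []      N p = cong (B 0 N *_) (p [])
  E-cong (a ∷ α) N p = Δ-cong N (λ y N′ → cong (B a y *_) (E-cong α N′ (λ ys → p (y ∷ ys))))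

  E-+ : ∀ (α : Vec ℕ n) N F G → E α N (λ ys → F ys + G ys) ≡ E α N F + E α N G
  E-+ []      N F G = *-distribˡ-+ (B 0 N) _ _
  E-+ (a ∷ α) N F G = trans
    (Δ-cong N (λ y N′ → trans (cong (B a y *_) (E-+ α N′ _ _)) (*-distribˡ-+ (B a y) _ _)))
    (Δ-∙ N _ _)

  E-Δ : ∀ (α : Vec ℕ n) N r (F : ℕ → ℕ → Vec ℕ n → ℕ) → E α N (λ ys → Δ r (λ i j → F i j ys)) ≡ Δ r (λ i j → E α N (F i j))
  E-Δ α N zero    F = refl
  E-Δ α N (suc r) F = trans (E-+ α N _ _) (cong (_+_ (E α N (F 0 (suc r)))) (E-Δ α N r (λ i → F (suc i))))

  -- With m additional slots at j, q units enter j through the new slots and the others through the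
  -- old ones, by `B-split`.
  E-bump : ∀ (α : Vec ℕ n) j m N F →
           E (bumpℕ j m α) N F ≡ Δ N (λ q N′ → B m q * E α N′ (F ∘ bumpℕ j q))
  E-bump (a ∷ α) zero m N F = begin
    Δ N (λ y N′ → B (m + a) y * X y N′)
      ≡⟨ Δ-cong N (λ y N′ → trans (cong (_* X y N′) (B-split m a y)) (Δ-* (X y N′) y _)) ⟩
    Δ N (λ y N′ → Δ y (λ q x → B m q * B a x * X y N′))
      ≡⟨ Δ-cong N (λ y N′ → Δ-cong′ y (λ q x eq → cong (λ w → B m q * B a x * X w N′) (sym eq))) ⟩
    Δ N (λ y N′ → Δ y (λ q x → B m q * B a x * X (q + x) N′))
      ≡⟨ Δ-assoc N _ ⟨
    Δ N (λ q M → Δ M (λ x N′ → B m q * B a x * X (q + x) N′))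
      ≡⟨ Δ-cong N (λ q M → trans (Δ-cong M (λ x N′ → *-assoc (B m q) (B a x) _)) (sym (*-Δ (B m q) M _))) ⟩
    Δ N (λ q M → B m q * E (a ∷ α) M (F ∘ bumpℕ zero q)) ∎
    where
    open ≡-Reasoning
    X = λ y N′ → E α N′ (λ ys → F (y ∷ ys))
  E-bump (a ∷ α) (suc j) m N F = begin
    Δ N (λ y M → B a y * E (bumpℕ j m α) M (λ ys → F (y ∷ ys)))
      ≡⟨ Δ-cong N (λ y M → trans (cong (B a y *_) (E-bump α j m M _)) (*-Δ (B a y) M _)) ⟩
    Δ N (λ y M → Δ M (λ q N′ → B a y * (B m q * X y q N′)))
      ≡⟨ Δ-exchange N _ ⟩
    Δ N (λ q M → Δ M (λ y N′ → B a y * (B m q * X y q N′)))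
      ≡⟨ Δ-cong N (λ q M → trans (Δ-cong M (λ y N′ → rearrange (B a y) (B m q) _)) (sym (*-Δ (B m q) M _))) ⟩
    Δ N (λ q M → B m q * E (a ∷ α) M (F ∘ bumpℕ (suc j) q)) ∎
    where
    open ≡-Reasoning
    X = λ y q N′ → E α N′ (λ ys → F (y ∷ bumpℕ j q ys))
    rearrange : ∀ x y z → x * (y * z) ≡ y * (x * z)
    rearrange = solve-∀

  infixl 6 _⊕_
  _⊕_ : Vec ℤ n → Vec ℕ n → Vec ℤ n
  _⊕_ = zipWith (λ z y → z ℤ.+ + y)

  ⊕-bump : ∀ (s : Vec ℤ n) j q ys → bump j q (s ⊕ ys) ≡ s ⊕ bumpℕ j q ys
  ⊕-bump (z ∷ s) zero    q (y ∷ ys) = cong (_∷ s ⊕ ys)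
    (trans (ℤ.+-assoc z (+ y) (+ q)) (cong (λ w → z ℤ.+ + w) (+-comm y q)))
  ⊕-bump (z ∷ s) (suc j) q (y ∷ ys) = cong (_∷_ (z ℤ.+ + y)) (⊕-bump s j q ys)

  -- A vertex with k + 1 incoming slots and the outgoing edges os is eliminated by
  -- handing g_o + 1 slots to the target of each outgoing edge o, where Σ g_o = k.
  eliminate : List (Fin (suc n)) → ℕ → Vec ℕ (suc n) → ℕ → (Vec ℕ (suc n) → ℕ) → ℕ
  eliminate []       k α N F = E (bumpℕ (fromℕ _) (suc k) α) N F
  eliminate (o ∷ os) k α N F = Δ k (λ g k′ → eliminate os k′ (bumpℕ o (suc g) α) N F)

  -- By `B-sym` the weight is B (l + R + 1) k with l = `length os`. If R is split into amounts q on
  -- the edges and a rest, then l + R + 1 is the sum of all q + 1 and of rest + 1, so Vandermonde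
  -- splits k into parts g with factors B (q + 1) g = B (g + 1) q. Such a factor is what g + 1 new
  -- slots at the target contribute, by `E-bump`. The shift by l supplies the +1 for each edge.
  elimination : ∀ (os : List (Fin (suc n))) F s k α N →
    Δ N (λ R N′ → B (suc k) (length os + R) * E α N′ (λ ys → spread os F R (s ⊕ ys)))
    ≡ eliminate os k α N (λ ys → F (s ⊕ ys))
  elimination []       F s k α N = trans
    (Δ-cong N (λ R N′ → cong (B (suc k) R *_) (E-cong α N′ (λ ys → cong F (⊕-bump s (fromℕ _) R ys)))))
    (sym (E-bump α (fromℕ _) (suc k) N (λ ys → F (s ⊕ ys))))
  elimination (o ∷ os) F s k α N = begin
    Δ N (λ R N′ → B (suc k) (suc l + R) * E α N′ (λ ys → Δ R (λ q R′ → G R′ (bump o q (s ⊕ ys)))))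
      ≡⟨ Δ-cong N (λ R N′ → trans (cong (B (suc k) (suc l + R) *_) (trans
           (E-Δ α N′ R (λ q R′ ys → G R′ (bump o q (s ⊕ ys))))
           (Δ-cong R (λ q R′ → E-cong α N′ (λ ys → cong (G R′) (⊕-bump s o q ys))))))
           (*-Δ (B (suc k) (suc l + R)) R _)) ⟩
    Δ N (λ R N′ → Δ R (λ q R′ → B (suc k) (suc l + R) * X q R′ N′))
      ≡⟨ Δ-cong N (λ R N′ → Δ-cong′ R (λ q R′ eq → trans (cong (_* X q R′ N′) (split R q R′ eq)) (Δ-* (X q R′ N′) k _))) ⟩
    Δ N (λ R N′ → Δ R (λ q R′ → Δ k (λ g k′ → Y g k′ q R′ N′)))
      ≡⟨ trans (Δ-cong N (λ R N′ → Δ-comm R k _)) (Δ-comm N k _) ⟩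
    Δ k (λ g k′ → Δ N (λ R N′ → Δ R (λ q R′ → Y g k′ q R′ N′)))
      ≡⟨ Δ-cong k (λ g k′ → trans (sym (Δ-assoc N _)) (Δ-exchange N _)) ⟩
    Δ k (λ g k′ → Δ N (λ R′ M → Δ M (λ q N′ → Y g k′ q R′ N′)))
      ≡⟨ Δ-cong k (λ g k′ → Δ-cong N (λ R′ M → trans
           (Δ-cong M (λ q N′ → rearrange (B (suc g) q) (B (suc k′) (l + R′)) _))
           (sym (*-Δ (B (suc k′) (l + R′)) M _)))) ⟩
    Δ k (λ g k′ → Δ N (λ R′ M → B (suc k′) (l + R′) * Δ M (λ q N′ → B (suc g) q * X q R′ N′)))
      ≡⟨ Δ-cong k (λ g k′ → Δ-cong N (λ R′ M → cong (B (suc k′) (l + R′) *_) (E-bump α o (suc g) M _))) ⟨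
    Δ k (λ g k′ → Δ N (λ R′ M → B (suc k′) (l + R′) * E (bumpℕ o (suc g) α) M (λ ys → G R′ (s ⊕ ys))))
      ≡⟨ Δ-cong k (λ g k′ → elimination os F s k′ (bumpℕ o (suc g) α) N) ⟩
    eliminate (o ∷ os) k α N (λ ys → F (s ⊕ ys)) ∎
    where
    open ≡-Reasoning
    l = length os
    G = spread os F
    X = λ q R′ N′ → E α N′ (λ ys → G R′ (s ⊕ bumpℕ o q ys))
    Y = λ g k′ q R′ N′ → B (suc g) q * B (suc k′) (l + R′) * X q R′ N′
    rearrange : ∀ x y z → x * y * z ≡ y * (x * z)
    rearrange = solve-∀
    index : ∀ l q r → 2 + l + (q + r) ≡ suc q + suc (l + r)
    index = solve-∀
    split : ∀ R q R′ → q + R′ ≡ R →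
            B (suc k) (suc l + R) ≡ Δ k (λ g k′ → B (suc g) q * B (suc k′) (l + R′))
    split R q R′ refl = trans (B-sym k (suc l + (q + R′))) (trans
      (cong (λ w → B w k) (index l q R′))
      (trans (B-split (suc q) (suc (l + R′)) k)
        (Δ-cong k (λ g k′ → cong₂ _*_ (B-sym q g) (B-sym (l + R′) k′)))))

  incoming : List (Fin (suc n)) → Vec ℕ (suc n) → Vec ℕ (suc n)
  incoming []       v = bumpℕ (fromℕ _) 1 v
  incoming (o ∷ os) v = bumpℕ o 1 (incoming os v)

  -- The edge to the sink that every vertex has implicitly is counted in `indegrees` but not in
  -- `outdegrees`.
  indegrees outdegrees : Net n → Vec ℕ (suc n)
  indegrees []         = 0 ∷ []
  indegrees (os ∷ net) = 0 ∷ incoming os (indegrees net)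
  outdegrees []         = 0 ∷ []
  outdegrees (os ∷ net) = length os ∷ outdegrees net

  -- The flow on the implicit edges is determined by that on the listed ones, so the listed edges
  -- are coordinates and their number is the dimension of the space of flows.
  dim : Net n → ℕ
  dim []         = 0
  dim (os ∷ net) = length os + dim net

  -- The net flow (indegree - 1) of the volume formula, a slot counting as an incoming edge.
  _⊞_∸1 : Vec ℕ n → Vec ℕ n → Vec ℤ n
  v ⊞ α ∸1 = zipWith (λ i a → + (i + a) ℤ.- 1ℤ) v α

  -- Replacing an edge into j by g + 1 slots raises indegree - 1 at j by g, which is also the effect
  -- of sending g units along that edge. So `eliminate` distributes slots exactly as `spread`
  -- distributes flow.
  ⊞-bump : ∀ (v : Vec ℕ n) α j g → bump j g (bumpℕ j 1 v ⊞ α ∸1) ≡ v ⊞ bumpℕ j (suc g) α ∸1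
  ⊞-bump (i ∷ v) (a ∷ α) zero    g = cong (_∷ v ⊞ α ∸1) (trans
    (cong +_ (trans (+-assoc i a g) (cong (_+_ i) (+-comm a g))))
    (cong (λ w → + w ℤ.- 1ℤ) (sym (+-suc i (g + a)))))
  ⊞-bump (i ∷ v) (a ∷ α) (suc j) g = cong (_ ∷_) (⊞-bump v α j g)

  sum-bump : ∀ (α : Vec ℕ n) j m → sum (bumpℕ j m α) ≡ m + sum α
  sum-bump (a ∷ α) zero    m = +-assoc m a (sum α)
  sum-bump (a ∷ α) (suc j) m = trans (cong (_+_ a) (sum-bump α j m)) (rearrange a m (sum α))
    where
    rearrange : ∀ a m s → a + (m + s) ≡ m + (a + s)
    rearrange = solve-∀

  private
    -o+[o+r] : ∀ o r → ℤ.- (+ o) ℤ.+ + (o + r) ≡ + r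
    -o+[o+r] o r = trans (cong (λ w → ℤ.- (+ o) ℤ.+ w) (ℤ.pos-+ o r)) (trans
      (sym (ℤ.+-assoc (ℤ.- (+ o)) (+ o) (+ r)))
      (trans (cong (ℤ._+ + r) (ℤ.+-inverseˡ (+ o))) (ℤ.+-identityˡ (+ r))))

    eliminate-bound : ∀ g k′ S l t → suc g + S + (suc k′ + (l + t)) ≡ S + (suc (g + k′) + (suc l + t))
    eliminate-bound = solve-∀

  mutual
    -- With the net flow lowered by the outdegree l, an inflow y leaves R = y - l units to send, so
    -- its weight is the `B (suc k) (l + R)` for which `elimination` is exact; inflows below l are
    -- dropped. Each elimination spends l units of the total and creates l slots, so in the end M
    -- units enter `sum α + dim net` slots at the sink.
    flows-lower : ∀ (net : Net n) α M →
      flows net (indegrees net ⊞ α ∸1) * B (sum α + dim net) M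
      ≤ E α (M + dim net) (λ ys → flows net (Vec.map (λ o → ℤ.- (+ o)) (outdegrees net) ⊕ ys))
    flows-lower []         (a ∷ []) M = ≤-reflexive (begin
      1 * B (a + 0 + 0) M                          ≡⟨ *-identityˡ _ ⟩
      B (a + 0 + 0) M                              ≡⟨ cong₂ B (+-identityʳ _) (sym (+-identityʳ M)) ⟩
      B (a + 0) (M + 0)                            ≡⟨ B-split a 0 (M + 0) ⟩
      Δ (M + 0) (λ y N′ → B a y * B 0 N′)          ≡⟨ Δ-cong (M + 0) (λ y N′ → cong (B a y *_) (*-identityʳ (B 0 N′))) ⟨
      Δ (M + 0) (λ y N′ → B a y * (B 0 N′ * 1))    ∎)
      where open ≡-Reasoning
    -- Without a slot the first vertex, which no edge of the network enters, has net flow -1, so the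
    -- left side is 0.
    flows-lower (os ∷ net) (zero  ∷ α) M = z≤n
    flows-lower (os ∷ net) (suc k ∷ α) M = begin
      V * B (suc k + sum α + (l + dim net)) M
        ≡⟨ cong (λ w → V * B w M) (index′ (suc k) (sum α) (l + dim net)) ⟩
      V * B (sum α + (suc k + (l + dim net))) M
        ≤⟨ eliminate-lower os net k α M ⟩
      eliminate os k α (M + dim net) (λ ys → flows net (s ⊕ ys))
        ≡⟨ elimination os (flows net) s k α (M + dim net) ⟨
      Δ (M + dim net) (λ R N′ → f (l + R) N′ R)
        ≡⟨ Δ-cong (M + dim net) (λ R N′ → cong (λ z → B (suc k) (l + R) * E α N′ (λ ys → ifPos z (λ r → spread os (flows net) r (s ⊕ ys)))) (-o+[o+r] l R)) ⟨
      Δ (M + dim net) (λ R N′ → g (l + R) N′)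
        ≤⟨ Δ-drop l (M + dim net) g ⟩
      Δ (l + (M + dim net)) g
        ≡⟨ cong (λ w → Δ w g) (index l M (dim net)) ⟩
      Δ (M + (l + dim net)) g ∎
      where
      open ≤-Reasoning
      l = length os
      s = Vec.map (λ o → ℤ.- (+ o)) (outdegrees net)
      V = spread os (flows net) k (incoming os (indegrees net) ⊞ α ∸1)
      f = λ y N′ r → B (suc k) y * E α N′ (λ ys → spread os (flows net) r (s ⊕ ys))
      g = λ y N′ → B (suc k) y * E α N′ (λ ys → ifPos (ℤ.- (+ l) ℤ.+ + y) (λ r → spread os (flows net) r (s ⊕ ys)))
      index : ∀ a b c → a + (b + c) ≡ b + (a + c)
      index = solve-∀
      index′ : ∀ a b c → a + b + c ≡ b + (a + c)
      index′ = solve-∀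

    eliminate-lower : ∀ os (net : Net n) k α M →
      spread os (flows net) k (incoming os (indegrees net) ⊞ α ∸1) * B (sum α + (suc k + (length os + dim net))) M
      ≤ eliminate os k α (M + dim net) (λ ys → flows net (Vec.map (λ o → ℤ.- (+ o)) (outdegrees net) ⊕ ys))
    eliminate-lower [] net k α M = begin
      flows net (bump _ k (bumpℕ _ 1 (indegrees net) ⊞ α ∸1)) * B (sum α + (suc k + dim net)) M
        ≡⟨ cong₂ (λ s m → flows net s * B m M) (⊞-bump (indegrees net) α _ k)
             (trans (index (sum α) (suc k) (dim net)) (cong (_+ dim net) (sym (sum-bump α _ (suc k))))) ⟩
      flows net (indegrees net ⊞ α′ ∸1) * B (sum α′ + dim net) M
        ≤⟨ flows-lower net α′ M ⟩
      eliminate [] k α (M + dim net) _ ∎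
      where
      open ≤-Reasoning
      α′ = bumpℕ (fromℕ _) (suc k) α
      index : ∀ a b c → a + (b + c) ≡ (b + a) + c
      index = solve-∀
    eliminate-lower (o ∷ os) net k α M = ≤-trans
      (≤-reflexive (Δ-* (B (sum α + (suc k + (suc (length os) + dim net))) M) k _))
      (Δ-mono k (λ g k′ eq → ≤-trans (≤-reflexive (cong₂ (λ s m → spread os (flows net) k′ s * B m M)
          (⊞-bump (incoming os (indegrees net)) α o g)
          (sym (trans (cong (_+ (suc k′ + (length os + dim net))) (sum-bump α o (suc g)))
            (trans (eliminate-bound g k′ (sum α) (length os) (dim net)) (cong (λ k → sum α + (suc k + (suc (length os) + dim net))) eq))))))
        (eliminate-lower os net k′ (bumpℕ o (suc g) α) M)))

  Positive : Vec ℕ n → Set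
  Positive v = ∀ j → 1 ≤ lookup v j

  private
    _⊞_ : Vec ℕ n → Vec ℕ n → Vec ℕ n
    _⊞_ = zipWith _+_

    positive-bump : ∀ (v : Vec ℕ n) α o g → Positive (bumpℕ o 1 v ⊞ α) → Positive (v ⊞ bumpℕ o (suc g) α)
    positive-bump (i ∷ v) (a ∷ α) zero    g p zero    = ≤-trans (s≤s z≤n) (m≤n+m (suc (g + a)) i)
    positive-bump (i ∷ v) (a ∷ α) zero    g p (suc j) = p (suc j)
    positive-bump (i ∷ v) (a ∷ α) (suc o) g p zero    = p zero
    positive-bump (i ∷ v) (a ∷ α) (suc o) g p (suc j) = positive-bump v α o g (p ∘ suc) j

  mutual
    -- Here an inflow y leaves m + y units to send, and its weight must be enlarged to
    -- `B (suc k) (l + (m + y))` before `elimination` applies. This is monotonicity of `B` in its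
    -- second argument, which fails for zero slots; hence `Positive`, which persists because an
    -- eliminated edge turns into slots at its target. The enlargements μ are passed on into the
    -- total.
    flows-upper : ∀ (net : Net n) α μ N → Positive (zipWith _+_ (indegrees net) α) →
      E α N (λ ys → flows net (Vec.map +_ μ ⊕ ys))
      ≤ flows net (indegrees net ⊞ α ∸1) * B (sum α + dim net) (N + sum μ)
    flows-upper []         (zero  ∷ []) μ       N p with () ← p zero
    flows-upper []         (suc a ∷ []) (m ∷ []) N p = begin
      Δ N (λ y N′ → B (suc a) y * (B 0 N′ * 1))    ≡⟨ Δ-cong N (λ y N′ → cong (B (suc a) y *_) (*-identityʳ (B 0 N′))) ⟩
      Δ N (λ y N′ → B (suc a) y * B 0 N′)          ≡⟨ B-split (suc a) 0 N ⟨
      B (suc a + 0) N                              ≤⟨ B-mono (a + 0) N (m + 0) ⟩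
      B (suc a + 0) (m + 0 + N)                    ≡⟨ cong₂ B (sym (+-identityʳ (suc a + 0))) (+-comm (m + 0) N) ⟩
      B (suc a + 0 + 0) (N + (m + 0))              ≡⟨ *-identityˡ _ ⟨
      1 * B (suc a + 0 + 0) (N + (m + 0))          ∎
      where open ≤-Reasoning
    flows-upper (os ∷ net) (zero  ∷ α) μ       N p with () ← p zero
    flows-upper (os ∷ net) (suc k ∷ α) (m ∷ μ) N p = begin
      Δ N (λ y N′ → B (suc k) y * F (m + y) N′)
        ≤⟨ Δ-mono N (λ y N′ _ → *-monoˡ-≤ (F (m + y) N′) (≤-trans (B-mono k y m) (B-mono k (m + y) l))) ⟩
      Δ N (λ y N′ → B (suc k) (l + (m + y)) * F (m + y) N′)
        ≤⟨ Δ-drop m N (λ R N′ → B (suc k) (l + R) * F R N′) ⟩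
      Δ (m + N) (λ R N′ → B (suc k) (l + R) * F R N′)
        ≡⟨ elimination os (flows net) (Vec.map +_ μ) k α (m + N) ⟩
      eliminate os k α (m + N) (λ ys → flows net (Vec.map +_ μ ⊕ ys))
        ≤⟨ eliminate-upper os net k α μ (m + N) (p ∘ suc) ⟩
      V * B (sum α + (suc k + (l + dim net))) (m + N + sum μ)
        ≡⟨ cong₂ (λ i j → V * B i j) (index (sum α) (suc k) (l + dim net)) (index′ m N (sum μ)) ⟩
      V * B (suc k + sum α + (l + dim net)) (N + (m + sum μ)) ∎
      where
      open ≤-Reasoning
      l = length os
      V = spread os (flows net) k (incoming os (indegrees net) ⊞ α ∸1)
      F = λ r N′ → E α N′ (λ ys → spread os (flows net) r (Vec.map +_ μ ⊕ ys))
      index : ∀ a b c → a + (b + c) ≡ b + a + c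
      index = solve-∀
      index′ : ∀ a b c → a + b + c ≡ b + (a + c)
      index′ = solve-∀

    eliminate-upper : ∀ os (net : Net n) k α μ N → Positive (zipWith _+_ (incoming os (indegrees net)) α) →
      eliminate os k α N (λ ys → flows net (Vec.map +_ μ ⊕ ys))
      ≤ spread os (flows net) k (incoming os (indegrees net) ⊞ α ∸1) * B (sum α + (suc k + (length os + dim net))) (N + sum μ)
    eliminate-upper [] net k α μ N p = begin
      E α′ N (λ ys → flows net (Vec.map +_ μ ⊕ ys))
        ≤⟨ flows-upper net α′ μ N (positive-bump (indegrees net) α _ k p) ⟩
      flows net (indegrees net ⊞ α′ ∸1) * B (sum α′ + dim net) (N + sum μ)
        ≡⟨ cong₂ (λ s m → flows net s * B m (N + sum μ)) (⊞-bump (indegrees net) α _ k)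
             (trans (index (sum α) (suc k) (dim net)) (cong (_+ dim net) (sym (sum-bump α _ (suc k))))) ⟨
      flows net (bump _ k (bumpℕ _ 1 (indegrees net) ⊞ α ∸1)) * B (sum α + (suc k + dim net)) (N + sum μ) ∎
      where
      open ≤-Reasoning
      α′ = bumpℕ (fromℕ _) (suc k) α
      index : ∀ a b c → a + (b + c) ≡ (b + a) + c
      index = solve-∀
    eliminate-upper (o ∷ os) net k α μ N p = ≤-trans
      (Δ-mono k (λ g k′ eq → ≤-trans
        (eliminate-upper os net k′ (bumpℕ o (suc g) α) μ N (positive-bump (incoming os (indegrees net)) α o g p))
        (≤-reflexive (cong₂ (λ s m → spread os (flows net) k′ s * B m (N + sum μ))
          (sym (⊞-bump (incoming os (indegrees net)) α o g))
          (trans (cong (_+ (suc k′ + (length os + dim net))) (sum-bump α o (suc g)))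
            (trans (eliminate-bound g k′ (sum α) (length os) (dim net)) (cong (λ k → sum α + (suc k + (suc (length os) + dim net))) eq)))))))
      (≤-reflexive (sym (Δ-* (B (sum α + (suc k + (suc (length os) + dim net))) (N + sum μ)) k _)))

-- Constant terms of network monomials are flow counts.

module NetworkMonomials where

  open AntidiagonalSums
  open IteratedLaurentSeries
  open Networks hiding (Δ; Δ-cong; Δ-∙; Δ-ε; Δ-assoc; Δ-exchange; Δ-comm; Δ-flip; Δ-last; *-Δ; Δ-*)
  open import Defs
  open import Algebra.Bundles using (CommutativeSemiring; CommutativeMonoid)
  import Algebra.Definitions.RawSemiring
  import Algebra.Properties.CommutativeSemigroup
  open import Data.Fin.Base as Fin using (Fin; zero; suc; fromℕ; inject₁)
  import Data.Fin.Properties as Fin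
  open import Data.Integer.Base as ℤ using (ℤ; +_; -[1+_]; 0ℤ; 1ℤ; -1ℤ)
  import Data.Integer.Properties as ℤ
  open import Data.List.Base as List using (List; []; _∷_; _++_)
  open import Data.Nat.Base as ℕ using (ℕ; zero; suc)
  import Data.Nat.Properties as ℕ
  open import Data.Vec.Base as Vec using (Vec; []; _∷_)
  open import Function.Base using (_∘_)
  open import Level using (0ℓ)
  open import Relation.Binary.PropositionalEquality as ≡ using (_≡_)

  private
    variable
      n : ℕ

  𝕃-semiring : ℕ → CommutativeSemiring 0ℓ 0ℓ
  𝕃-semiring n = record { isCommutativeSemiring = iterLaurent-isSemiring n }

  module 𝕃ₙ (n : ℕ) where
    open CommutativeSemiring (𝕃-semiring n) public hiding (zero)
    open Algebra.Definitions.RawSemiring rawSemiring public using (_^_; product)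
    open SeriesProperties (iterLaurent n) (iterLaurent-isSemiring n) public
    open Series (iterLaurent n) public

  module CommutativeSemiringLemmas (S : CommutativeSemiring 0ℓ 0ℓ) where
    open CommutativeSemiring S hiding (zero)
    open Algebra.Definitions.RawSemiring rawSemiring using (_^_; product)
    open Algebra.Properties.CommutativeSemigroup *-commutativeSemigroup using (interchange)
    open import Algebra.Solver.CommutativeMonoid *-commutativeMonoid using (solve; _⊜_) renaming (_⊕_ to _:*_)
    open import Relation.Binary.Reasoning.Setoid setoid

    ^-cong : ∀ {x y} m → x ≈ y → x ^ m ≈ y ^ m
    ^-cong zero    p = refl
    ^-cong (suc m) p = *-cong p (^-cong m p)

    1^ : ∀ m → 1# ^ m ≈ 1#
    1^ zero    = refl
    1^ (suc m) = trans (*-identityˡ _) (1^ m)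

    product-cong : ∀ {n} {f g : Fin n → Carrier} → (∀ i → f i ≈ g i) → product f ≈ product g
    product-cong {zero}  p = refl
    product-cong {suc n} p = *-cong (p zero) (product-cong (p ∘ suc))

    product-* : ∀ {n} (f g : Fin n → Carrier) → product (λ i → f i * g i) ≈ product f * product g
    product-* {zero}  f g = sym (*-identityˡ 1#)
    product-* {suc n} f g = trans (*-congˡ (product-* (f ∘ suc) (g ∘ suc))) (interchange _ _ _ _)

    rearrange₁ : ∀ a m l y → a * (m * (l * y)) ≈ m * (l * (a * y))
    rearrange₁ = solve 4 (λ a m l y → (a :* (m :* (l :* y))) ⊜ (m :* (l :* (a :* y)))) refl

    rearrange₂ : ∀ g m p κ γ q → ((g * m) * p) * ((1# * (κ * γ)) * q) ≈ m * ((g * γ) * ((κ * p) * q))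
    rearrange₂ g m p κ γ q = trans (*-congˡ (*-congʳ (*-identityˡ _)))
      (solve 6 (λ g m p κ γ q → (((g :* m) :* p) :* ((κ :* γ) :* q)) ⊜ (m :* ((g :* γ) :* ((κ :* p) :* q)))) refl g m p κ γ q)

    rearrange₃ : ∀ a b c → a * (b * c) ≈ b * (a * c)
    rearrange₃ = solve 3 (λ a b c → (a :* (b :* c)) ⊜ (b :* (a :* c))) refl

    rearrange₄ : ∀ a b c d → (a * b) * (c * d) ≈ (d * a) * (b * c)
    rearrange₄ = solve 4 (λ a b c d → ((a :* b) :* (c :* d)) ⊜ ((d :* a) :* (b :* c))) refl

    listProduct : ∀ {A : Set} → (A → Carrier) → List A → Carrier
    listProduct G = List.foldr (λ o → G o *_) 1#

    module _ {A : Set} (G : A → Carrier) where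
      listProduct-++ : ∀ xs ys → listProduct G (xs ++ ys) ≈ listProduct G xs * listProduct G ys
      listProduct-++ []       ys = sym (*-identityˡ _)
      listProduct-++ (x ∷ xs) ys = trans (*-congˡ (listProduct-++ xs ys)) (sym (*-assoc _ _ _))

      listProduct-replicate : ∀ m x → listProduct G (List.replicate m x) ≈ G x ^ m
      listProduct-replicate zero    x = refl
      listProduct-replicate (suc m) x = *-congˡ (listProduct-replicate m x)

      listProduct-concatMap : ∀ {n} {I : Set} m (f : I → A) (g : Fin n → I) →
        listProduct G (List.concatMap (λ j → List.replicate m (f j)) (List.tabulate g)) ≈ product (λ j → G (f (g j)) ^ m)
      listProduct-concatMap {zero}  m f g = refl
      listProduct-concatMap {suc n} m f g = trans (listProduct-++ (List.replicate m (f (g zero))) _)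
        (*-cong (listProduct-replicate m (f (g zero))) (listProduct-concatMap m f (g ∘ suc)))

  module Homomorphism (R L : CommutativeSemiring 0ℓ 0ℓ) where
    private
      module R where
        open CommutativeSemiring R public hiding (zero)
        open Algebra.Definitions.RawSemiring rawSemiring public using (_^_; product)
      open CommutativeSemiring L hiding (zero)
      open Algebra.Definitions.RawSemiring rawSemiring using (_^_; product)

    module _ (φ : R.Carrier → Carrier) (φ-cong : ∀ {x y} → x R.≈ y → φ x ≈ φ y)
             (φ-* : ∀ x y → φ (x R.* y) ≈ φ x * φ y) (φ-1 : φ R.1# ≈ 1#) where

      φ-^ : ∀ x m → φ (x R.^ m) ≈ φ x ^ m
      φ-^ x zero    = φ-1
      φ-^ x (suc m) = trans (φ-* x _) (*-congˡ (φ-^ x m))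

      φ-product : ∀ {n} (f : Fin n → R.Carrier) → φ (R.product f) ≈ product (φ ∘ f)
      φ-product {zero}  f = φ-1
      φ-product {suc n} f = trans (φ-* _ _) (*-congˡ (φ-product (f ∘ suc)))

  -- x_j^z for the vertices j of a network, where the variable of the sink is 1.
  vx^ : Fin (suc n) → ℤ → 𝕃 n
  vx^ {zero}  zero    z = 1ℤ
  vx^ {suc n} zero    z = Series.monomial (iterLaurent n) z
  vx^ {suc n} (suc j) z = Series.constant (iterLaurent n) (vx^ j z)

  vx^-inject₁ : ∀ (i : Fin n) z → vx^ (inject₁ i) z ≡ x^ i z
  vx^-inject₁ {suc n} zero    z = ≡.refl
  vx^-inject₁ {suc n} (suc i) z = ≡.cong (Series.constant (iterLaurent n)) (vx^-inject₁ i z)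

  constant-1′ : ∀ n {x} → let open 𝕃ₙ n in x ≈ 1# → constant x ≋ 𝕃ₙ.1# (suc n)
  constant-1′ n {x} p = 𝕃ₙ.trans (suc n) {constant x} {constant 1#} {𝕃ₙ.1# (suc n)} (constant-cong p) constant-1
    where open 𝕃ₙ n

  vx^-sink : ∀ n z → let open 𝕃ₙ n in vx^ (fromℕ n) z ≈ 1#
  vx^-sink zero    z = ≡.refl
  vx^-sink (suc n) z = constant-1′ n (vx^-sink n z)

  vx^-+ : ∀ (j : Fin (suc n)) y z → let open 𝕃ₙ n in vx^ j (y ℤ.+ z) ≈ vx^ j y * vx^ j z
  vx^-+ {zero}  zero    y z = ≡.refl
  vx^-+ {suc n} zero    y z = 𝕃ₙ.monomial-+ n y z
  vx^-+ {suc n} (suc j) y z = 𝕃ₙ.trans (suc n) {constant (vx^ j (y ℤ.+ z))}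
    {constant (vx^ j y * vx^ j z)} {𝕃ₙ._*_ (suc n) (vx^ (suc j) y) (vx^ (suc j) z)}
    (constant-cong (vx^-+ j y z)) (constant-* _ _)
    where open 𝕃ₙ n

  vx^-0 : ∀ (j : Fin (suc n)) → let open 𝕃ₙ n in vx^ j 0ℤ ≈ 1#
  vx^-0 {zero}  zero    = ≡.refl
  vx^-0 {suc n} zero    = 𝕃ₙ.refl (suc n) {𝕃ₙ.1# (suc n)}
  vx^-0 {suc n} (suc j) = constant-1′ n (vx^-0 j)

  x^-+ : ∀ (i : Fin n) y z → let open 𝕃ₙ n in x^ i (y ℤ.+ z) ≈ x^ i y * x^ i z
  x^-+ {n} i y z = ≡.subst₂ _≈_ (vx^-inject₁ i (y ℤ.+ z))
    (≡.cong₂ _*_ (vx^-inject₁ i y) (vx^-inject₁ i z)) (vx^-+ (inject₁ i) y z)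
    where open 𝕃ₙ n

  module _ {n : ℕ} where
    open 𝕃ₙ n
    open CommutativeSemiringLemmas (𝕃-semiring n)

    vx^-^ : ∀ (j : Fin (suc n)) q → vx^ j -1ℤ ^ q ≈ vx^ j (ℤ.- (+ q))
    vx^-^ j zero    = sym (vx^-0 j)
    vx^-^ j (suc q) = trans (*-congˡ (vx^-^ j q)) (trans (sym (vx^-+ j -1ℤ (ℤ.- (+ q))))
      (reflexive (≡.cong (vx^ j) (≡.sym (ℤ.neg-distrib-+ 1ℤ (+ q))))))

    -- The coefficients of ∏_o (1 - x_0/x_o)^{-1} in x_0, including the edge to the sink.
    spreadSeries : List (Fin (suc n)) → ℕ → 𝕃 n
    spreadSeries []       r = vx^ (fromℕ n) -1ℤ ^ r
    spreadSeries (o ∷ os)   = cauchy (vx^ o -1ℤ ^_) (spreadSeries os)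

  -- The generating function of flows in expanded form: x^(-s) times the product of 1/(1 - x_u/x_v)
  -- over all edges u → v, with x_v = 1 at the sink. The factors of the edges leaving u are grouped
  -- at the layer of x_u.
  netMonomial : Net n → Vec ℤ (suc n) → 𝕃 n
  netMonomial []         _       = 1ℤ
  netMonomial {suc n} (os ∷ net) (z ∷ s) = monomial (ℤ.- z) L.* (laurent 0 (spreadSeries os) L.* constant (netMonomial net s))
    where
    open Series (iterLaurent n)
    module L = 𝕃ₙ (suc n)

  -- A factor x_o^(-q) merges with the power of x_o that precedes the edge factors of o. In terms of
  -- flows, q units sent to o join the net flow to be shipped from there.
  netMonomial-bump : ∀ (net : Net n) o q s → let open 𝕃ₙ n in
                     vx^ o -1ℤ ^ q * netMonomial net s ≈ netMonomial net (bump o q s)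
  netMonomial-bump []         zero    q s = ≡.trans (ℤ.*-identityʳ _) (CommutativeSemiringLemmas.1^ (𝕃-semiring 0) q)
  netMonomial-bump {suc n} (os ∷ net) zero    q (z ∷ s) = begin
    monomial -1ℤ L.^ q L.* (monomial (ℤ.- z) L.* Y)    ≈⟨ L.*-congʳ {x = monomial (ℤ.- z) L.* Y} {monomial -1ℤ L.^ q} {monomial (ℤ.- (+ q))} (vx^-^ {suc n} zero q) ⟩
    monomial (ℤ.- (+ q)) L.* (monomial (ℤ.- z) L.* Y)  ≈⟨ L.*-assoc (monomial (ℤ.- (+ q))) (monomial (ℤ.- z)) Y ⟨
    (monomial (ℤ.- (+ q)) L.* monomial (ℤ.- z)) L.* Y  ≈⟨ L.*-congʳ {x = Y} {monomial (ℤ.- (+ q) ℤ.+ ℤ.- z)} {monomial (ℤ.- (+ q)) L.* monomial (ℤ.- z)} (𝕃ₙ.monomial-+ n (ℤ.- (+ q)) (ℤ.- z)) ⟨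
    monomial (ℤ.- (+ q) ℤ.+ ℤ.- z) L.* Y               ≡⟨ ≡.cong (λ w → monomial w L.* Y) (≡.trans (ℤ.+-comm (ℤ.- (+ q)) (ℤ.- z)) (≡.sym (ℤ.neg-distrib-+ z (+ q)))) ⟩
    monomial (ℤ.- (z ℤ.+ + q)) L.* Y                   ∎
    where
    open Series (iterLaurent n)
    module L = 𝕃ₙ (suc n)
    open import Relation.Binary.Reasoning.Setoid L.setoid
    Y = laurent 0 (spreadSeries os) L.* constant (netMonomial net s)
  netMonomial-bump {suc n} (os ∷ net) (suc o) q (z ∷ s) = begin
    constant w L.^ q L.* (M L.* (H L.* constant W))
      ≈⟨ CommutativeSemiringLemmas.rearrange₁ (𝕃-semiring (suc n)) (constant w L.^ q) M H (constant W) ⟩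
    M L.* (H L.* (constant w L.^ q L.* constant W))
      ≈⟨ tail {constant (w ^ q) L.* constant W} {constant w L.^ q L.* constant W} (L.*-congʳ {x = constant W} {constant (w ^ q)} {constant w L.^ q}
           (Homomorphism.φ-^ (𝕃-semiring n) (𝕃-semiring (suc n)) constant constant-cong constant-* constant-1 w q)) ⟨
    M L.* (H L.* (constant (w ^ q) L.* constant W))
      ≈⟨ tail {constant (w ^ q * W)} {constant (w ^ q) L.* constant W} (constant-* (w ^ q) W) ⟨
    M L.* (H L.* constant (w ^ q * W))
      ≈⟨ tail {constant (w ^ q * W)} {constant (netMonomial net (bump o q s))} (constant-cong (netMonomial-bump net o q s)) ⟩
    M L.* (H L.* constant (netMonomial net (bump o q s))) ∎
    where
    open 𝕃ₙ n
    module L = 𝕃ₙ (suc n)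
    open import Relation.Binary.Reasoning.Setoid L.setoid
    w = vx^ o -1ℤ
    W = netMonomial net s
    M = monomial (ℤ.- z)
    H = laurent 0 (spreadSeries os)
    tail : ∀ {x y} → x L.≈ y → M L.* (H L.* x) L.≈ M L.* (H L.* y)
    tail {x} {y} p = L.*-congˡ {x = M} {H L.* x} {H L.* y} (L.*-congˡ {x = H} {x} {y} p)

  CT-cong : ∀ n {f g} → let open 𝕃ₙ n in f ≈ g → CT n f ≡ CT n g
  CT-cong zero    p = p
  CT-cong (suc n) p = CT-cong n (p 0ℤ)

  CT-+ : ∀ n f g → let open 𝕃ₙ n in CT n (f + g) ≡ CT n f ℤ.+ CT n g
  CT-+ zero    f g = ≡.refl
  CT-+ (suc n) f g = ≡.trans (CT-cong n (𝕃ₙ.coeff-+ n f g 0ℤ)) (CT-+ n _ _)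

  CT-0 : ∀ n → CT n (𝕃ₙ.0# n) ≡ 0ℤ
  CT-0 zero    = ≡.refl
  CT-0 (suc n) = CT-0 n

  module _ {n : ℕ} where
    open 𝕃ₙ n
    private
      module L = 𝕃ₙ (suc n)

    coeff₀-below : ∀ m G F → coeff (monomial (+ suc m) L.* (laurent 0 G L.* constant F)) 0ℤ ≈ 0#
    coeff₀-below m G F = trans (+-identityʳ _) (zeroˡ _)

    coeff₀-above : ∀ r G F → coeff (monomial (ℤ.- (+ r)) L.* (laurent 0 G L.* constant F)) 0ℤ ≈ G r * F
    coeff₀-above r G F = trans (reflexive (shift r)) (trans (cauchy-identityˡ (cauchy G (scalar F)) r)
      (trans (cauchy-comm G (scalar F) r) (trans (cauchy-scalarˡ F G r) (*-comm F (G r)))))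
      where
      f = laurent 0 G L.* constant F
      shift : ∀ r → coeff (monomial (ℤ.- (+ r)) L.* f) 0ℤ ≡ cauchy (δ 0) (coeffs f) r
      shift zero    = ≡.refl
      shift (suc r) = coeff-nonneg (monomial (ℤ.- (+ suc r)) L.* f) 0ℤ (≡.cong (λ m → + suc m) (ℕ.+-identityʳ r))

  mutual
    -- The constant term in x_0 selects the power x_0^r in the series of the edges leaving vertex 0.
    -- Its terms are the ways of distributing r units, each contributing powers x_o^(-q) that
    -- `netMonomial-bump` moves to the targets.
    CT-netMonomial : ∀ (net : Net n) s → CT n (netMonomial net s) ≡ + flows net s
    CT-netMonomial []         s       = ≡.refl
    CT-netMonomial {suc n} (os ∷ net) (+ r ∷ s) = ≡.trans
      (CT-cong n (coeff₀-above {n} r (spreadSeries os) (netMonomial net s))) (CT-spread os net r s)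
    CT-netMonomial {suc n} (os ∷ net) (-[1+ m ] ∷ s) = ≡.trans
      (CT-cong n (coeff₀-below {n} m (spreadSeries os) (netMonomial net s))) (CT-0 n)

    CT-spread : ∀ os (net : Net n) r s → let open 𝕃ₙ n in
                CT n (spreadSeries os r * netMonomial net s) ≡ + spread os (flows net) r s
    CT-spread {n} [] net r s = ≡.trans (CT-cong n (netMonomial-bump net (fromℕ n) r s)) (CT-netMonomial net (bump (fromℕ n) r s))
    CT-spread {n} (o ∷ os) net r s = begin
      CT n (cauchy (w ^_) (spreadSeries os) r * W)
        ≡⟨ CT-cong n (trans (*-congʳ (cauchy-Δ (w ^_) (spreadSeries os) r)) (Δ-* W r _)) ⟩
      CT n (Δ r (λ q r′ → (w ^ q * spreadSeries os r′) * W))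
        ≡⟨ CT-cong n (Δ-cong r (λ q r′ → trans (trans (*-congʳ (*-comm _ _)) (*-assoc _ _ _)) (*-congˡ (netMonomial-bump net o q s)))) ⟩
      CT n (Δ r (λ q r′ → spreadSeries os r′ * netMonomial net (bump o q s)))
        ≡⟨ Δ-homo +-commutativeMonoid ℤ.+-0-commutativeMonoid (CT n) (CT-+ n) r _ ⟩
      ℤΔ.Δ r (λ q r′ → CT n (spreadSeries os r′ * netMonomial net (bump o q s)))
        ≡⟨ ℤΔ.Δ-cong r (λ q r′ → CT-spread os net r′ (bump o q s)) ⟩
      ℤΔ.Δ r (λ q r′ → + spread os (flows net) r′ (bump o q s))
        ≡⟨ Δ-homo ℕ.+-0-commutativeMonoid ℤ.+-0-commutativeMonoid +_ ℤ.pos-+ r _ ⟨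
      + spread (o ∷ os) (flows net) r s ∎
      where
      open ≡.≡-Reasoning
      open 𝕃ₙ n
      module ℤΔ = Antidiagonal ℤ.+-0-commutativeMonoid
      w = vx^ o -1ℤ
      W = netMonomial net s

-- The product formula for the monomial of a complete network.

module ProductFormula where

  open AntidiagonalSums
  open IteratedLaurentSeries
  open Networks hiding (Δ; Δ-cong; Δ-∙; Δ-ε; Δ-assoc; Δ-exchange; Δ-comm; Δ-flip; Δ-last; *-Δ; Δ-*)
  open NetworkMonomials
  open import Defs
  open import Data.Fin.Base as Fin using (Fin; zero; suc; toℕ; fromℕ; inject₁)
  import Data.Fin.Properties as Fin
  open import Data.Fin.Subset using (Subset; inside; outside)
  open import Data.Integer.Base as ℤ using (ℤ; +_; 0ℤ; 1ℤ; -1ℤ)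
  import Data.Integer.Properties as ℤ
  open import Data.Integer.Tactic.RingSolver using (solve-∀)
  open import Data.List.Base as List using (List; []; _∷_; _++_)
  open import Data.Nat.Base as ℕ using (ℕ; zero; suc; s<s)
  import Data.Nat.Properties as ℕ
  open import Data.Vec.Base as Vec using (Vec; []; _∷_)
  open import Function.Base using (_∘_)
  open import Relation.Binary.PropositionalEquality as ≡ using (_≡_)
  open import Relation.Nullary.Decidable using (yes; no)
  open import Relation.Nullary.Negation using (contradiction)

  private
    variable
      n : ℕ

  -- β i + 1 edges from i to the sink and c edges from i to j for each i < j.
  completeRow : ∀ n (c β : ℕ) → List (Fin (suc n))
  completeRow n c β = List.replicate β (fromℕ n) ++ List.concatMap (λ j → List.replicate c (inject₁ j)) (List.allFin n)

  completeNet : ∀ n (c : ℕ) (β : Fin n → ℕ) → Net n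
  completeNet zero    c β = []
  completeNet (suc n) c β = completeRow n c (β zero) ∷ completeNet n c (β ∘ suc)

  atInner : (Fin n → ℤ) → Vec ℤ (suc n)
  atInner {zero}  e = 0ℤ ∷ []
  atInner {suc n} e = e zero ∷ atInner (e ∘ suc)

  atInner-cong : {e f : Fin n → ℤ} → (∀ i → e i ≡ f i) → atInner e ≡ atInner f
  atInner-cong {zero}  p = ≡.refl
  atInner-cong {suc n} p = ≡.cong₂ _∷_ (p zero) (atInner-cong (p ∘ suc))

  module _ {n : ℕ} where
    private
      open module L = 𝕃ₙ (suc n) using (_≈_; _*_; _^_; product; 1#)
      open 𝕃ₙ n using (geometric; laurent; same-pole)
      open CommutativeSemiringLemmas (𝕃-semiring (suc n))
      open import Relation.Binary.Reasoning.Setoid L.setoid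

      slot : Fin (suc n) → 𝕃 (suc n)
      slot o = geometric (vx^ o -1ℤ)

    spreadSeries-product : ∀ os → slot (fromℕ n) * listProduct slot os ≈ laurent 0 (spreadSeries os)
    spreadSeries-product []       = L.*-identityʳ (slot (fromℕ n))
    spreadSeries-product (o ∷ os) = begin
      slot (fromℕ n) * (slot o * listProduct slot os)
        ≈⟨ rearrange₃ (slot (fromℕ n)) (slot o) (listProduct slot os) ⟩
      slot o * (slot (fromℕ n) * listProduct slot os)
        ≈⟨ L.*-congˡ {slot o} {slot (fromℕ n) * listProduct slot os} {laurent 0 (spreadSeries os)} (spreadSeries-product os) ⟩
      slot o * laurent 0 (spreadSeries os) ∎

    slot-sink : slot (fromℕ n) ≈ 1/1-x {suc n} zero
    slot-sink = same-pole {slot (fromℕ n)} {1/1-x {suc n} zero} ≡.refl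
      (λ i → CommutativeSemiringLemmas.^-cong (𝕃-semiring n) i (vx^-sink n -1ℤ))

    -- The exponent is `suc β` because one of the edges to the sink is implicit in the row.
    completeRow-product : ∀ c β →
      1/1-x {suc n} zero ^ suc β * product (λ (j : Fin n) → geometric (x^ j -1ℤ) ^ c) ≈ laurent 0 (spreadSeries (completeRow n c β))
    completeRow-product c β = begin
      1/1-x {suc n} zero ^ suc β * Γ
        ≈⟨ L.*-congʳ {Γ} {slot (fromℕ n) ^ suc β} {1/1-x {suc n} zero ^ suc β} (^-cong {slot (fromℕ n)} {1/1-x {suc n} zero} (suc β) slot-sink) ⟨
      (slot (fromℕ n) * slot (fromℕ n) ^ β) * Γ
        ≈⟨ L.*-assoc (slot (fromℕ n)) (slot (fromℕ n) ^ β) Γ ⟩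
      slot (fromℕ n) * (slot (fromℕ n) ^ β * Γ)
        ≈⟨ L.*-congˡ {slot (fromℕ n)} {listProduct slot row} {slot (fromℕ n) ^ β * Γ} rowProduct ⟨
      slot (fromℕ n) * listProduct slot row
        ≈⟨ spreadSeries-product row ⟩
      laurent 0 (spreadSeries row) ∎
      where
      row = completeRow n c β
      Γ = product (λ (j : Fin n) → geometric (x^ j -1ℤ) ^ c)
      innerRow = List.concatMap (λ j → List.replicate c (inject₁ j)) (List.allFin n)
      rowProduct : listProduct slot row ≈ slot (fromℕ n) ^ β * Γ
      rowProduct = begin
        listProduct slot row
          ≈⟨ listProduct-++ slot (List.replicate β (fromℕ n)) innerRow ⟩
        listProduct slot (List.replicate β (fromℕ n)) * listProduct slot innerRow
          ≈⟨ L.*-cong {listProduct slot (List.replicate β (fromℕ n))} {slot (fromℕ n) ^ β} {listProduct slot innerRow} {Γ}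
               (listProduct-replicate slot β (fromℕ n))
               (L.trans {listProduct slot innerRow} {product (λ j → slot (inject₁ j) ^ c)} {Γ}
                 (listProduct-concatMap slot c inject₁ (λ j → j))
                 (product-cong {n} {λ j → slot (inject₁ j) ^ c} {λ (j : Fin n) → geometric (x^ j -1ℤ) ^ c}
                   (λ j → L.reflexive (≡.cong (λ w → geometric w ^ c) (vx^-inject₁ j -1ℤ))))) ⟩
        slot (fromℕ n) ^ β * Γ ∎

  pairTerm : ∀ n (c : ℕ) → Fin n → Fin n → 𝕃 n
  pairTerm n c i j with i Fin.<? j
  ... | yes i<j = x^ j (ℤ.- + c) * 1/1-x/x i j i<j ^ c where open 𝕃ₙ n using (_*_; _^_)
  ... | no  _   = 𝕃ₙ.1# n

  pairTerm-suc : ∀ c (i j : Fin n) → let open 𝕃ₙ n in 𝕃ₙ._≈_ (suc n) (pairTerm (suc n) c (suc i) (suc j)) (constant (pairTerm n c i j))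
  pairTerm-suc {n} c i j with suc i Fin.<? suc j | i Fin.<? j
  ... | yes (s<s p) | yes q with ≡.refl ← ℕ.<-irrelevant p q = L.trans
    {constant (x^ j (ℤ.- + c)) L.* constant (1/1-x/x i j p) L.^ c} {constant (x^ j (ℤ.- + c)) L.* constant (1/1-x/x i j p ^ c)} {constant (x^ j (ℤ.- + c) * 1/1-x/x i j p ^ c)}
    (L.*-congˡ {constant (x^ j (ℤ.- + c))} {constant (1/1-x/x i j p) L.^ c} {constant (1/1-x/x i j p ^ c)}
      (L.sym {constant (1/1-x/x i j p ^ c)} {constant (1/1-x/x i j p) L.^ c} (φ-^ constant constant-cong constant-* constant-1 (1/1-x/x i j p) c)))
    (L.sym {constant (x^ j (ℤ.- + c) * 1/1-x/x i j p ^ c)} {constant (x^ j (ℤ.- + c)) L.* constant (1/1-x/x i j p ^ c)} (constant-* (x^ j (ℤ.- + c)) (1/1-x/x i j p ^ c)))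
    where
    open 𝕃ₙ n
    module L = 𝕃ₙ (suc n)
    open Homomorphism (𝕃-semiring n) (𝕃-semiring (suc n))
  ... | yes (s<s p) | no ¬q = contradiction p ¬q
  ... | no ¬p | yes q = contradiction (s<s q) ¬p
  ... | no ¬p | no ¬q = L.sym {constant 1#} {L.1#} constant-1
    where
    open 𝕃ₙ n
    module L = 𝕃ₙ (suc n)

  vertexTerm : ∀ n → (β : Fin n → ℕ) (e : Fin n → ℤ) → Fin n → 𝕃 n
  vertexTerm n β e i = 1/1-x i ^ suc (β i) * x^ i (e i) where open 𝕃ₙ n using (_*_; _^_)

  -- The coefficient of ∏ t^{[i ∈ S]} in the integrand, for suitable β and e.
  term : ∀ n (c : ℕ) → (β : Fin n → ℕ) (e : Fin n → ℤ) → 𝕃 n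
  term n c β e = product (vertexTerm n β e) * product (λ i → product (pairTerm n c i))
    where open 𝕃ₙ n using (_*_; product)

  -- Each step takes out x_0. The powers x_j^(-c) coming from the pairs (0,j) do not involve x_0 and
  -- are merged into the exponents of the later variables. By the time a variable is taken out, it
  -- has received one such power from each earlier variable; this is the origin of the summand c (i
  -- - 1) in the thresholds.
  term-netMonomial : ∀ n c β e →
    𝕃ₙ._≈_ n (term n c β e) (netMonomial (completeNet n c β) (atInner (λ i → ℤ.- e i ℤ.+ + c ℤ.* + toℕ i)))
  term-netMonomial zero    c β e = ≡.refl
  term-netMonomial (suc n) c β e = begin
    ((g * m) * product (λ i → con (1/1-x i) ^ suc (β (suc i)) * con (x^ i (e (suc i)))))
      * ((1# * product (λ j → con (κ j) * γ j)) * product (λ i → 1# * product (λ j → pairTerm (suc n) c (suc i) (suc j))))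
      ≈⟨ *-cong {(g * m) * Π₀} {(g * m) * con P} {(1# * product (λ j → con (κ j) * γ j)) * Q₀} {(1# * (con K * Γ)) * con Q}
           (*-congˡ {g * m} {Π₀} {con P} Π₀≈P)
           (*-cong {1# * product (λ j → con (κ j) * γ j)} {1# * (con K * Γ)} {Q₀} {con Q}
             (*-congˡ {1#} {product (λ j → con (κ j) * γ j)} {con K * Γ} K*Γ) Q₀≈Q) ⟩
    ((g * m) * con P) * ((1# * (con K * Γ)) * con Q)
      ≈⟨ Lemmas.rearrange₂ g m (con P) (con K) Γ (con Q) ⟩
    m * ((g * Γ) * ((con K * con P) * con Q))
      ≈⟨ *-congˡ {m} {(g * Γ) * ((con K * con P) * con Q)} {S * con (netMonomial net s)} (*-cong {g * Γ} {S} {(con K * con P) * con Q} {con (netMonomial net s)}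
           (completeRow-product {n} c (β zero)) innerRow) ⟩
    m * (S * con (netMonomial net s))
      ≡⟨ ≡.cong (λ z → monomial z * (S * con (netMonomial net s))) (exponent₀ (e zero) (+ c)) ⟩
    netMonomial (completeNet (suc n) c β) (atInner (λ i → ℤ.- e i ℤ.+ + c ℤ.* + toℕ i)) ∎
    where
    module R = 𝕃ₙ n
    module RLemmas = CommutativeSemiringLemmas (𝕃-semiring n)
    open 𝕃ₙ n using (monomial; geometric; laurent; constant-cong; constant-*; constant-1) renaming (constant to con)
    open 𝕃ₙ (suc n) using (_≈_; _*_; _^_; product; 1#; *-cong; *-congˡ; *-congʳ; setoid; trans; sym; *-identityˡ)
    module Lemmas = CommutativeSemiringLemmas (𝕃-semiring (suc n))
    open Homomorphism (𝕃-semiring n) (𝕃-semiring (suc n))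
    open import Relation.Binary.Reasoning.Setoid setoid
    con-^ = φ-^ con constant-cong constant-* constant-1
    con-product : ∀ {m} (f : Fin m → 𝕃 n) → con (R.product f) ≈ product (con ∘ f)
    con-product = φ-product con constant-cong constant-* constant-1
    g = 1/1-x {suc n} zero ^ suc (β zero)
    m = monomial (e zero)
    κ : Fin n → 𝕃 n
    κ j = x^ j (ℤ.- + c)
    γ : Fin n → 𝕃 (suc n)
    γ j = geometric (x^ j -1ℤ) ^ c
    K = R.product κ
    Γ = product γ
    β′ = β ∘ suc
    e′ : Fin n → ℤ
    e′ i = ℤ.- + c ℤ.+ e (suc i)
    net = completeNet n c β′
    s = atInner (λ i → ℤ.- e (suc i) ℤ.+ + c ℤ.* + suc (toℕ i))
    S = laurent 0 (spreadSeries (completeRow n c (β zero)))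
    P = R.product (vertexTerm n β′ (e ∘ suc))
    Q = R.product (λ i → R.product (pairTerm n c i))
    Π₀ = product (λ i → con (1/1-x i) ^ suc (β′ i) * con (x^ i (e (suc i))))
    Q₀ = product (λ i → 1# * product (λ j → pairTerm (suc n) c (suc i) (suc j)))

    Π₀≈P : Π₀ ≈ con P
    Π₀≈P = begin
      Π₀ ≈⟨ Lemmas.product-cong {n} {λ i → con (vertexTerm n β′ (e ∘ suc) i)} {λ i → con (1/1-x i) ^ suc (β′ i) * con (x^ i (e (suc i)))} (λ i → trans
              {con (vertexTerm n β′ (e ∘ suc) i)} {con (1/1-x i R.^ suc (β′ i)) * con (x^ i (e (suc i)))} {con (1/1-x i) ^ suc (β′ i) * con (x^ i (e (suc i)))}
              (constant-* (1/1-x i R.^ suc (β′ i)) (x^ i (e (suc i))))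
              (*-congʳ {con (x^ i (e (suc i)))} {con (1/1-x i R.^ suc (β′ i))} {con (1/1-x i) ^ suc (β′ i)} (con-^ (1/1-x i) (suc (β′ i))))) ⟨
      product (λ i → con (vertexTerm n β′ (e ∘ suc) i)) ≈⟨ con-product (vertexTerm n β′ (e ∘ suc)) ⟨
      con P ∎

    K*Γ : product (λ j → con (κ j) * γ j) ≈ con K * Γ
    K*Γ = begin
      product (λ j → con (κ j) * γ j)  ≈⟨ Lemmas.product-* (con ∘ κ) γ ⟩
      product (con ∘ κ) * Γ            ≈⟨ *-congʳ {Γ} {con K} {product (con ∘ κ)} (con-product κ) ⟨
      con K * Γ                        ∎

    Q₀≈Q : Q₀ ≈ con Q
    Q₀≈Q = begin
      Q₀ ≈⟨ Lemmas.product-cong {n} {λ i → 1# * product (λ j → pairTerm (suc n) c (suc i) (suc j))} {λ i → con (R.product (pairTerm n c i))} (λ i → trans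
              {1# * product (λ j → pairTerm (suc n) c (suc i) (suc j))} {product (λ j → pairTerm (suc n) c (suc i) (suc j))} {con (R.product (pairTerm n c i))}
              (*-identityˡ (product (λ j → pairTerm (suc n) c (suc i) (suc j))))
              (trans {product (λ j → pairTerm (suc n) c (suc i) (suc j))} {product (λ j → con (pairTerm n c i j))} {con (R.product (pairTerm n c i))}
                (Lemmas.product-cong {n} {λ j → pairTerm (suc n) c (suc i) (suc j)} {λ j → con (pairTerm n c i j)} (pairTerm-suc c i))
                (sym {con (R.product (pairTerm n c i))} {product (λ j → con (pairTerm n c i j))} (con-product (pairTerm n c i))))) ⟩
      product (λ i → con (R.product (pairTerm n c i))) ≈⟨ con-product (λ i → R.product (pairTerm n c i)) ⟨
      con Q ∎

    exponent₀ : ∀ e c → e ≡ ℤ.- (ℤ.- e ℤ.+ c ℤ.* 0ℤ)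
    exponent₀ = solve-∀

    exponent : ∀ c e i → ℤ.- (ℤ.- c ℤ.+ e) ℤ.+ c ℤ.* i ≡ ℤ.- e ℤ.+ c ℤ.* (1ℤ ℤ.+ i)
    exponent = solve-∀

    K*P : K R.* P R.≈ R.product (vertexTerm n β′ e′)
    K*P = R.trans (R.sym (RLemmas.product-* κ (vertexTerm n β′ (e ∘ suc)))) (RLemmas.product-cong (λ i →
      R.trans (RLemmas.rearrange₃ (κ i) _ _) (R.*-congˡ (R.sym (x^-+ i (ℤ.- + c) (e (suc i)))))))

    innerRow : (con K * con P) * con Q ≈ con (netMonomial net s)
    innerRow = begin
      (con K * con P) * con Q    ≈⟨ *-congʳ {con Q} {con (K R.* P)} {con K * con P} (constant-* K P) ⟨
      con (K R.* P) * con Q      ≈⟨ constant-* (K R.* P) Q ⟨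
      con ((K R.* P) R.* Q)      ≈⟨ constant-cong (R.*-congʳ K*P) ⟩
      con (term n c β′ e′)       ≈⟨ constant-cong (term-netMonomial n c β′ e′) ⟩
      con (netMonomial net (atInner (λ i → ℤ.- e′ i ℤ.+ + c ℤ.* + toℕ i)))
        ≡⟨ ≡.cong (con ∘ netMonomial net) (atInner-cong (λ i → exponent (+ c) (e (suc i)) (+ toℕ i))) ⟩
      con (netMonomial net s) ∎

  subsets : ∀ n → ℕ → List (Subset n)
  subsets zero    zero    = [] ∷ []
  subsets zero    (suc k) = []
  subsets (suc n) zero    = List.map (outside ∷_) (subsets n zero)
  subsets (suc n) (suc k) = List.map (outside ∷_) (subsets n (suc k)) ++ List.map (inside ∷_) (subsets n k)

-- Expansion of the integrand over subsets.

module SubsetExpansion where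

  open AntidiagonalSums
  open IteratedLaurentSeries
  open Networks hiding (Δ; Δ-cong; Δ-∙; Δ-ε; Δ-assoc; Δ-exchange; Δ-comm; Δ-flip; Δ-last; *-Δ; Δ-*)
  open NetworkMonomials
  open ProductFormula
  open import Defs
  open import Algebra.Bundles using (CommutativeSemiring)
  open import Algebra.Bundles.Raw using (RawRing)
  import Algebra.Definitions.RawSemiring
  open import Data.Bool.Base using (Bool; true; false; if_then_else_)
  open import Data.Fin.Base as Fin using (Fin; zero; suc; toℕ)
  import Data.Fin.Properties as Fin
  open import Data.Fin.Subset using (Subset; inside; outside)
  open import Data.Integer.Base as ℤ using (ℤ; +_; 0ℤ; 1ℤ)
  import Data.Integer.Properties as ℤ
  open import Data.Integer.Tactic.RingSolver using (solve-∀)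
  open import Data.List.Base as List using (List; []; _∷_; _++_)
  open import Data.Nat.Base as ℕ using (ℕ; zero; suc)
  import Data.Nat.Properties as ℕ
  open import Data.Vec.Base as Vec using (Vec; []; _∷_; lookup)
  open import Function.Base using (_∘_)
  open import Level using (0ℓ)
  open import Relation.Binary.PropositionalEquality as ≡ using (_≡_)
  open import Relation.Nullary.Decidable using (yes; no)

  private
    variable
      n : ℕ

  module _ (R : RawRing 0ℓ 0ℓ) (csr : IsSemiringRaw R) where
    open Series R
    open SeriesProperties R csr
    private
      S P : CommutativeSemiring 0ℓ 0ℓ
      S = record { isCommutativeSemiring = csr }
      P = record { isCommutativeSemiring = powerSeries-isSemiring }
      module P where
        open CommutativeSemiring P public
        open Algebra.Definitions.RawSemiring rawSemiring public using (product)
      open CommutativeSemiring S hiding (zero)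
      open Algebra.Definitions.RawSemiring rawSemiring using (product)
      open CommutativeSemiringLemmas S
      open import Relation.Binary.Reasoning.Setoid setoid

    listSum : ∀ {A : Set} → (A → Carrier) → List A → Carrier
    listSum f = List.foldr (λ x → _+_ (f x)) 0#

    module _ {A : Set} where
      listSum-++ : ∀ (f : A → Carrier) xs ys → listSum f (xs ++ ys) ≈ listSum f xs + listSum f ys
      listSum-++ f []       ys = sym (+-identityˡ _)
      listSum-++ f (x ∷ xs) ys = trans (+-congˡ (listSum-++ f xs ys)) (sym (+-assoc _ _ _))

      listSum-map : ∀ {B : Set} (f : A → Carrier) (g : B → A) xs → listSum f (List.map g xs) ≡ listSum (f ∘ g) xs
      listSum-map f g []       = ≡.refl
      listSum-map f g (x ∷ xs) = ≡.cong (_+_ (f (g x))) (listSum-map f g xs)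

      listSum-cong : ∀ {f g : A → Carrier} → (∀ x → f x ≈ g x) → ∀ xs → listSum f xs ≈ listSum g xs
      listSum-cong p []       = refl
      listSum-cong p (x ∷ xs) = +-cong (p x) (listSum-cong p xs)

      *-listSum : ∀ c (f : A → Carrier) xs → c * listSum f xs ≈ listSum (λ x → c * f x) xs
      *-listSum c f []       = zeroʳ c
      *-listSum c f (x ∷ xs) = trans (distribˡ c _ _) (+-congˡ (*-listSum c f xs))

      listSum-* : ∀ c (f : A → Carrier) xs → listSum f xs * c ≈ listSum (λ x → f x * c) xs
      listSum-* c f xs = trans (*-comm _ c) (trans (*-listSum c f xs) (listSum-cong (λ x → *-comm c (f x)) xs))

    subsetProduct : (Fin n → Carrier) → Subset n → Carrier
    subsetProduct w s = product (λ i → if lookup s i then w i else 1#)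

    linear : Carrier → ℕ → Carrier
    linear w = P.1# P.+ δ 1 P.* scalar w

    private
      linear-zero : ∀ w → linear w 0 ≈ 1#
      linear-zero w = trans (+-congˡ (trans (+-congʳ (zeroˡ w)) (+-identityˡ 0#))) (+-identityʳ 1#)

      linear-suc : ∀ w i → linear w (suc i) ≈ scalar w i
      linear-suc w i = trans (+-identityˡ _) (trans (+-congʳ (zeroˡ _)) (trans (+-identityˡ _) (cauchy-identityˡ (scalar w) i)))

    linear-*-zero : ∀ w F → (linear w P.* F) 0 ≈ F 0
    linear-*-zero w F = trans (+-identityʳ _) (trans (*-congʳ (linear-zero w)) (*-identityˡ _))

    linear-*-suc : ∀ w F k → (linear w P.* F) (suc k) ≈ F (suc k) + w * F k
    linear-*-suc w F k = +-cong (trans (*-congʳ (linear-zero w)) (*-identityˡ _))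
      (trans (cauchy-cong {g = F} (linear-suc w) (λ _ → refl) k) (cauchy-scalarˡ w F k))

    -- The coefficient of t^k in the product of all 1 + t w_i is the elementary symmetric polynomial
    -- e_k: the first factor contributes either 1 or t w_0.
    elementary : ∀ (w : Fin n → Carrier) k → P.product (linear ∘ w) k ≈ listSum (subsetProduct w) (subsets n k)
    elementary {zero}  w zero    = sym (+-identityʳ 1#)
    elementary {zero}  w (suc k) = refl
    elementary {suc n} w zero    = begin
      (linear (w zero) P.* F) 0                            ≈⟨ linear-*-zero (w zero) F ⟩
      F 0                                                  ≈⟨ elementary (w ∘ suc) 0 ⟩
      listSum (subsetProduct (w ∘ suc)) (subsets n 0)      ≈⟨ listSum-cong (λ s → *-identityˡ _) (subsets n 0) ⟨
      listSum (subsetProduct w ∘ (outside ∷_)) (subsets n 0) ≡⟨ listSum-map (subsetProduct w) (outside ∷_) (subsets n 0) ⟨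
      listSum (subsetProduct w) (subsets (suc n) 0)        ∎
      where F = P.product (linear ∘ w ∘ suc)
    elementary {suc n} w (suc k) = begin
      (linear (w zero) P.* F) (suc k)
        ≈⟨ linear-*-suc (w zero) F k ⟩
      F (suc k) + w zero * F k
        ≈⟨ +-cong (elementary (w ∘ suc) (suc k)) (*-congˡ (elementary (w ∘ suc) k)) ⟩
      listSum G (subsets n (suc k)) + w zero * listSum G (subsets n k)
        ≈⟨ +-cong (listSum-cong (λ s → sym (*-identityˡ _)) (subsets n (suc k))) (*-listSum (w zero) G (subsets n k)) ⟩
      listSum (subsetProduct w ∘ (outside ∷_)) (subsets n (suc k)) + listSum (subsetProduct w ∘ (inside ∷_)) (subsets n k)
        ≡⟨ ≡.cong₂ _+_ (listSum-map (subsetProduct w) (outside ∷_) (subsets n (suc k))) (listSum-map (subsetProduct w) (inside ∷_) (subsets n k)) ⟨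
      listSum (subsetProduct w) (List.map (outside ∷_) (subsets n (suc k))) + listSum (subsetProduct w) (List.map (inside ∷_) (subsets n k))
        ≈⟨ listSum-++ (subsetProduct w) (List.map (outside ∷_) (subsets n (suc k))) _ ⟨
      listSum (subsetProduct w) (subsets (suc n) (suc k)) ∎
      where
      F = P.product (linear ∘ w ∘ suc)
      G = subsetProduct (w ∘ suc)

    scalar-cong : ∀ {x y} → x ≈ y → scalar x P.≈ scalar y
    scalar-cong p zero    = p
    scalar-cong p (suc i) = refl

    scalar-* : ∀ x y → scalar (x * y) P.≈ scalar x P.* scalar y
    scalar-* x y i = sym (trans (cauchy-scalarˡ x (scalar y) i) (lemma i))
      where
      lemma : ∀ i → x * scalar y i ≈ scalar (x * y) i
      lemma zero    = refl
      lemma (suc i) = zeroʳ x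

    scalar-1 : scalar 1# P.≈ P.1#
    scalar-1 i = sym (δ-scalar i)

    scalar-product : ∀ (f : Fin n → Carrier) → scalar (product f) P.≈ P.product (scalar ∘ f)
    scalar-product = Homomorphism.φ-product S P scalar scalar-cong scalar-* scalar-1

    expansion : ∀ (p w : Fin n → Carrier) (q : Carrier) k →
      (P.product (λ i → scalar (p i) P.* linear (w i)) P.* scalar q) k
      ≈ listSum (λ s → product (λ i → p i * (if lookup s i then w i else 1#)) * q) (subsets n k)
    expansion {n} p w q k = begin
      (P.product (λ i → scalar (p i) P.* linear (w i)) P.* scalar q) k
        ≈⟨ P.*-congʳ {scalar q} {P.product (λ i → scalar (p i) P.* linear (w i))} {scalar (product p) P.* F}
             (P.trans {P.product (λ i → scalar (p i) P.* linear (w i))} {P.product (scalar ∘ p) P.* F} {scalar (product p) P.* F}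
               (CommutativeSemiringLemmas.product-* P (scalar ∘ p) (linear ∘ w))
               (P.*-congʳ {F} {P.product (scalar ∘ p)} {scalar (product p)} (λ i → sym (scalar-product p i)))) k ⟩
      ((scalar (product p) P.* F) P.* scalar q) k
        ≈⟨ P.*-comm (scalar (product p) P.* F) (scalar q) k ⟩
      (scalar q P.* (scalar (product p) P.* F)) k
        ≈⟨ trans (cauchy-scalarˡ q (scalar (product p) P.* F) k) (*-congˡ (cauchy-scalarˡ (product p) F k)) ⟩
      q * (product p * F k)
        ≈⟨ *-comm q _ ⟩
      product p * F k * q
        ≈⟨ *-congʳ (trans (*-congˡ (elementary w k)) (*-listSum (product p) (subsetProduct w) (subsets n k))) ⟩
      listSum (λ s → product p * subsetProduct w s) (subsets n k) * q
        ≈⟨ listSum-* q (λ s → product p * subsetProduct w s) (subsets n k) ⟩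
      listSum (λ s → product p * subsetProduct w s * q) (subsets n k)
        ≈⟨ listSum-cong (λ s → *-congʳ (sym (product-* p (λ i → if lookup s i then w i else 1#)))) (subsets n k) ⟩
      listSum (λ s → product (λ i → p i * (if lookup s i then w i else 1#)) * q) (subsets n k) ∎
      where F = P.product (linear ∘ w)

  bit : Bool → ℕ
  bit true  = 1
  bit false = 0

  -- The argument b is one less than the multiplicity in k(S), one edge to the sink being implicit
  -- at each vertex.
  subsetNet : ∀ n (b c : ℕ) → Subset n → Net n
  subsetNet n b c S = completeNet n c (λ i → bit (lookup S i) ℕ.+ b)

  -- This is indegree - 1 in k(S): c edges come from each earlier inner vertex, and a from the
  -- source, or a - 1 for a member of S.
  subsetState : ∀ n (a c : ℕ) → Subset n → Vec ℤ (suc n)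
  subsetState n a c S = atInner (λ i → threshold a c i ℤ.- + bit (lookup S i))

  CT-listSum : ∀ {A : Set} n (f : A → 𝕃 n) xs →
               CT n (listSum (iterLaurent n) (iterLaurent-isSemiring n) f xs) ≡ List.foldr (λ x → ℤ._+_ (CT n (f x))) 0ℤ xs
  CT-listSum n f []       = CT-0 n
  CT-listSum n f (x ∷ xs) = ≡.trans (CT-+ n _ _) (≡.cong (λ w → CT n (f x) ℤ.+ w) (CT-listSum n f xs))

  module 𝕃[[t]] (n : ℕ) where
    bundle : CommutativeSemiring 0ℓ 0ℓ
    bundle = record { isCommutativeSemiring = 𝕃ₙ.powerSeries-isSemiring n }
    open CommutativeSemiring bundle public
    open Algebra.Definitions.RawSemiring rawSemiring public using (product)

  module _ (n a b c : ℕ) where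
    open 𝕃ₙ n
    private
      module P = 𝕃[[t]] n
      R = iterLaurent n
      csr = iterLaurent-isSemiring n
      open CommutativeSemiringLemmas (𝕃-semiring n)
      module PLemmas = CommutativeSemiringLemmas P.bundle
      open Integrand n a (suc b) c

      e : ℤ
      e = ℤ.- + a ℤ.+ 1ℤ

      p w : Fin n → 𝕃 n
      p i = 1/1-x i ^ suc b * x^ i e
      w i = x^ i 1ℤ * 1/1-x i

      pairFactor-scalar : ∀ i j → pairFactor i j P.≈ scalar (pairTerm n c i j)
      pairFactor-scalar i j with i Fin.<? j
      ... | yes i<j = λ _ → refl
      ... | no  _   = λ k → sym (scalar-1 R csr k)

      pairs : Carrier
      pairs = product (λ i → product (pairTerm n c i))

      pairs-scalar : P.product (λ i → P.product (pairFactor i)) P.≈ scalar pairs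
      pairs-scalar k = trans
        (PLemmas.product-cong {n} {λ i → P.product (pairFactor i)} {λ i → scalar (product (pairTerm n c i))} (λ i → P.trans
          {P.product (pairFactor i)} {P.product (λ j → scalar (pairTerm n c i j))} {scalar (product (pairTerm n c i))}
          (PLemmas.product-cong (pairFactor-scalar i)) (λ k → sym (scalar-product R csr (pairTerm n c i) k))) k)
        (sym (scalar-product R csr (λ i → product (pairTerm n c i)) k))

      vertexFactor-scalar : ∀ i → vertexFactor i P.≈ scalar (p i) P.* linear R csr (w i)
      vertexFactor-scalar i = P.*-congʳ {linear R csr (w i)} {scalar (1/1-x i ^ suc b) P.* scalar (x^ i e)} {scalar (p i)}
        (λ k → sym (scalar-* R csr (1/1-x i ^ suc b) (x^ i e) k))

      -- The factor x_i/(1 - x_i) is one more 1/(1 - x_i), an extra edge to the sink, times x_i, a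
      -- net flow lowered by one.
      factor : ∀ (S : Subset n) i → p i * (if lookup S i then w i else 1#)
               ≈ vertexTerm n (λ i → bit (lookup S i) ℕ.+ b) (λ i → e ℤ.+ + bit (lookup S i)) i
      factor S i with lookup S i
      ... | true  = trans (rearrange₄ (1/1-x i ^ suc b) (x^ i e) (x^ i 1ℤ) (1/1-x i)) (*-congˡ (sym (x^-+ i e 1ℤ)))
      ... | false = trans (*-identityʳ _) (reflexive (≡.cong (λ z → 1/1-x i ^ suc b * x^ i z) (≡.sym (ℤ.+-identityʳ e))))

      exponent : ∀ a σ ci → ℤ.- ((ℤ.- a ℤ.+ 1ℤ) ℤ.+ σ) ℤ.+ ci ≡ a ℤ.- 1ℤ ℤ.+ ci ℤ.- σ
      exponent = solve-∀

    Ψ-flows : ∀ k → Ψ n k a (suc b) c ≡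
      List.foldr (λ S → ℤ._+_ (+ flows (subsetNet n b c S) (subsetState n a c S))) 0ℤ (subsets n k)
    Ψ-flows k = ≡.trans (CT-cong n integrand≈) (≡.trans
      (CT-listSum n (λ S → netMonomial (subsetNet n b c S) (subsetState n a c S)) (subsets n k))
      (foldr-cong (subsets n k)))
      where
      foldr-cong : ∀ xs → List.foldr (λ S → ℤ._+_ (CT n (netMonomial (subsetNet n b c S) (subsetState n a c S)))) 0ℤ xs
                   ≡ List.foldr (λ S → ℤ._+_ (+ flows (subsetNet n b c S) (subsetState n a c S))) 0ℤ xs
      foldr-cong []       = ≡.refl
      foldr-cong (S ∷ xs) = ≡.cong₂ ℤ._+_ (CT-netMonomial (subsetNet n b c S) (subsetState n a c S)) (foldr-cong xs)
      integrand≈ : integrand k ≈ listSum R csr (λ S → netMonomial (subsetNet n b c S) (subsetState n a c S)) (subsets n k)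
      integrand≈ = trans
        (P.*-cong {P.product vertexFactor} {P.product (λ i → scalar (p i) P.* linear R csr (w i))} {P.product (λ i → P.product (pairFactor i))} {scalar pairs}
          (PLemmas.product-cong vertexFactor-scalar) pairs-scalar k)
        (trans (expansion R csr p w pairs k) (listSum-cong R csr (λ S → trans
          (*-congʳ (product-cong (factor S)))
          (trans (term-netMonomial n c (λ i → bit (lookup S i) ℕ.+ b) (λ i → e ℤ.+ + bit (lookup S i)))
            (reflexive (≡.cong (netMonomial (subsetNet n b c S)) (atInner-cong (λ i → exponent (+ a) (+ bit (lookup S i)) (+ c ℤ.* + toℕ i)))))))
          (subsets n k)))

-- From subsets with extra edges to deficit vectors.

module Deficits where

  open IteratedLaurentSeries using (pos)
  open Networks
  open ProductFormula
  open SubsetExpansion using (bit)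
  open import Defs
  open import Data.Bool.Base using (if_then_else_)
  import Data.Empty
  open import Data.Fin.Base using (zero; suc; fromℕ)
  open import Data.Fin.Subset using (Subset; inside; outside)
  open import Data.Integer.Base as ℤ using (ℤ; +_; -[1+_]; 1ℤ; _⊖_)
  import Data.Integer.Properties as ℤ
  open import Data.List.Base as List using (List; []; _∷_; _++_)
  open import Data.List.Membership.Propositional using (_∈_)
  import Data.List.Membership.Propositional.Properties as ∈
  open import Data.List.Relation.Unary.All using ([]; _∷_)
  open import Data.List.Relation.Unary.AllPairs using ([]; _∷_)
  open import Data.List.Relation.Unary.Any using (here)
  open import Data.List.Relation.Unary.Unique.Propositional using (Unique)
  import Data.List.Relation.Unary.Unique.Propositional.Properties as Unique
  open import Data.Nat.Base hiding (_⊔_)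
  open import Data.Nat.Properties
  open import Data.Product.Base using (_×_; _,_)
  open import Data.Sum.Base using (inj₁; inj₂)
  open import Data.Vec.Base as Vec using (Vec; []; _∷_; lookup)
  import Data.Vec.Properties as Vec
  open import Function.Base using (_∘_; id)
  open import Relation.Binary.PropositionalEquality

  private
    variable
      n : ℕ
      X Y : Set

  sumOver : (X → ℕ) → List X → ℕ
  sumOver f = List.foldr (λ x → _+_ (f x)) 0

  sumOver-cong : ∀ {f g : X → ℕ} → (∀ x → f x ≡ g x) → ∀ xs → sumOver f xs ≡ sumOver g xs
  sumOver-cong p []       = refl
  sumOver-cong p (x ∷ xs) = cong₂ _+_ (p x) (sumOver-cong p xs)

  sumOver-++ : ∀ (f : X → ℕ) xs ys → sumOver f (xs ++ ys) ≡ sumOver f xs + sumOver f ys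
  sumOver-++ f []       ys = refl
  sumOver-++ f (x ∷ xs) ys = trans (cong (_+_ (f x)) (sumOver-++ f xs ys)) (sym (+-assoc (f x) _ _))

  sumOver-map : ∀ (f : Y → ℕ) (g : X → Y) xs → sumOver f (List.map g xs) ≡ sumOver (f ∘ g) xs
  sumOver-map f g []       = refl
  sumOver-map f g (x ∷ xs) = cong (_+_ (f (g x))) (sumOver-map f g xs)

  sumOver-0 : ∀ (xs : List X) → sumOver (λ _ → 0) xs ≡ 0
  sumOver-0 []       = refl
  sumOver-0 (x ∷ xs) = sumOver-0 xs

  sumOver-+ : ∀ (f g : X → ℕ) xs → sumOver (λ x → f x + g x) xs ≡ sumOver f xs + sumOver g xs
  sumOver-+ f g []       = refl
  sumOver-+ f g (x ∷ xs) = trans (cong (_+_ (f x + g x)) (sumOver-+ f g xs)) (lemma (f x) (g x) _ _)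
    where
    open import Data.Nat.Tactic.RingSolver using (solve-∀)
    lemma : ∀ a b c d → a + b + (c + d) ≡ a + c + (b + d)
    lemma = solve-∀

  sumOver-Δ : ∀ (f : X → ℕ → ℕ → ℕ) r xs → sumOver (λ x → Δ r (f x)) xs ≡ Δ r (λ i j → sumOver (λ x → f x i j) xs)
  sumOver-Δ f zero    xs = refl
  sumOver-Δ f (suc r) xs = trans (sumOver-+ (λ x → f x 0 (suc r)) (λ x → Δ r (f x ∘ suc)) xs)
    (cong (_+_ (sumOver (λ x → f x 0 (suc r)) xs)) (sumOver-Δ (λ x → f x ∘ suc) r xs))

  sumOver-comm : ∀ (f : X → Y → ℕ) xs ys →
                 sumOver (λ x → sumOver (f x) ys) xs ≡ sumOver (λ y → sumOver (λ x → f x y) xs) ys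
  sumOver-comm f []       ys = sym (sumOver-0 ys)
  sumOver-comm f (x ∷ xs) ys = trans (cong (_+_ (sumOver (f x) ys)) (sumOver-comm f xs ys)) (sym (sumOver-+ (f x) _ ys))

  sumOver-product : ∀ {Z : Set} (f : Z → ℕ) (g : X → Y → Z) xs ys →
                    sumOver f (List.cartesianProductWith g xs ys) ≡ sumOver (λ x → sumOver (λ y → f (g x y)) ys) xs
  sumOver-product f g []       ys = refl
  sumOver-product f g (x ∷ xs) ys = trans (sumOver-++ f (List.map (g x) ys) _)
    (cong₂ _+_ (sumOver-map f (g x) ys) (sumOver-product f g xs ys))

  sumOver-ifPos : ∀ (z : ℤ) (f : X → ℕ → ℕ) xs → sumOver (λ x → ifPos z (f x)) xs ≡ ifPos z (λ r → sumOver (λ x → f x r) xs)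
  sumOver-ifPos (+ r)    f xs = refl
  sumOver-ifPos -[1+ _ ] f xs = sumOver-0 xs

  infixl 6 _⊝_
  _⊝_ : Vec ℤ (suc n) → Vec ℕ n → Vec ℤ (suc n)
  s       ⊝ []      = s
  (z ∷ s) ⊝ (p ∷ ps) = z ℤ.- + p ∷ (s ⊝ ps)

  private
    +-swapʳ : ∀ x y z → x ℤ.+ y ℤ.+ z ≡ x ℤ.+ z ℤ.+ y
    +-swapʳ x y z = trans (ℤ.+-assoc x y z) (trans (cong (λ w → x ℤ.+ w) (ℤ.+-comm y z)) (sym (ℤ.+-assoc x z y)))

  bump-⊝ : ∀ o q (s : Vec ℤ (suc n)) p → bump o q (s ⊝ p) ≡ bump o q s ⊝ p
  bump-⊝ o       q s       []       = refl
  bump-⊝ zero    q (z ∷ s) (p ∷ ps) = cong (_∷ _) (+-swapʳ z (ℤ.- + p) (+ q))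
  bump-⊝ (suc o) q (z ∷ s) (p ∷ ps) = cong (_ ∷_) (bump-⊝ o q s ps)

  bump-comm : ∀ o q o′ q′ (s : Vec ℤ n) → bump o q (bump o′ q′ s) ≡ bump o′ q′ (bump o q s)
  bump-comm zero    q zero     q′ (z ∷ s) = cong (_∷ s) (+-swapʳ z (+ q′) (+ q))
  bump-comm zero    q (suc o′) q′ (z ∷ s) = refl
  bump-comm (suc o) q zero     q′ (z ∷ s) = refl
  bump-comm (suc o) q (suc o′) q′ (z ∷ s) = cong (z ∷_) (bump-comm o q o′ q′ s)

  mutual
    flows-sink : ∀ (net : Net n) q s → flows net (bump (fromℕ n) q s) ≡ flows net s
    flows-sink []         q s = refl
    flows-sink (os ∷ net) q (+ r ∷ s)      = spread-sink os net r q s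
    flows-sink (os ∷ net) q (-[1+ _ ] ∷ s) = refl

    spread-sink : ∀ os (net : Net n) r q s → spread os (flows net) r (bump (fromℕ n) q s) ≡ spread os (flows net) r s
    spread-sink []       net r q s = trans (cong (flows net) (bump-comm _ r _ q s)) (flows-sink net q (bump _ r s))
    spread-sink (o ∷ os) net r q s = Δ-cong r (λ q′ r′ → trans
      (cong (spread os (flows net) r′) (bump-comm o q′ _ q s)) (spread-sink os net r′ q (bump o q′ s)))

  -- The units still to be sent plus this total do not increase while flow is passed on, so it
  -- bounds what any vertex ever has to ship. This makes the sum over deficits finite.
  total⁺ : Vec ℤ n → ℕ
  total⁺ []      = 0
  total⁺ (z ∷ s) = pos z + total⁺ s

  private
    pos-⊖ : ∀ m k → pos (m ⊖ k) ≤ m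
    pos-⊖ m       zero    = ≤-refl
    pos-⊖ zero    (suc k) = z≤n
    pos-⊖ (suc m) (suc k) = ≤-trans (≤-reflexive (cong pos (ℤ.[1+m]⊖[1+n]≡m⊖n m k))) (m≤n⇒m≤1+n (pos-⊖ m k))

    pos-+ : ∀ z q → pos (z ℤ.+ + q) ≤ q + pos z
    pos-+ (+ m)    q = ≤-reflexive (+-comm m q)
    pos-+ -[1+ m ] q = ≤-trans (pos-⊖ q (suc m)) (≤-reflexive (sym (+-identityʳ q)))

    pos-minus : ∀ z p → pos (z ℤ.- + p) ≤ pos z
    pos-minus (+ m)    p = ≤-trans (≤-reflexive (cong pos (ℤ.m-n≡m⊖n m p))) (pos-⊖ m p)
    pos-minus -[1+ m ] zero    = z≤n
    pos-minus -[1+ m ] (suc p) = z≤n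

  total⁺-bump : ∀ o q (s : Vec ℤ n) → total⁺ (bump o q s) ≤ q + total⁺ s
  total⁺-bump zero    q (z ∷ s) = ≤-trans (+-monoˡ-≤ (total⁺ s) (pos-+ z q)) (≤-reflexive (+-assoc q (pos z) _))
  total⁺-bump (suc o) q (z ∷ s) = ≤-trans (+-monoʳ-≤ (pos z) (total⁺-bump o q s))
    (≤-reflexive (trans (sym (+-assoc (pos z) q _)) (trans (cong (_+ total⁺ s) (+-comm (pos z) q)) (+-assoc q (pos z) _))))

  module _ (M : ℕ) where
    private
      Bounded : Vec ℤ n → Set
      Bounded s = total⁺ s ≤ M

    -- An identity between sums of flow counts at the later vertices survives the distribution of r
    -- units by an earlier one, since `spread` is additive in the counting function and commutes
    -- with subtracting deficits. Units sent move from r into `total⁺ s`, so the bound M is kept.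
    spread-sumOver : ∀ (xs : List X) (ys : List Y) (F : X → Vec ℤ (suc n) → ℕ) (d : X → Vec ℕ n)
      (G : Y → Vec ℤ (suc n) → ℕ) (e : Y → Vec ℕ n) →
      (∀ s → Bounded s → sumOver (λ x → F x (s ⊝ d x)) xs ≡ sumOver (λ y → G y (s ⊝ e y)) ys) →
      ∀ os r s → r + total⁺ s ≤ M →
      sumOver (λ x → spread os (F x) r (s ⊝ d x)) xs ≡ sumOver (λ y → spread os (G y) r (s ⊝ e y)) ys
    spread-sumOver xs ys F d G e p [] r s r+s≤M = begin
      sumOver (λ x → F x (bump _ r (s ⊝ d x))) xs  ≡⟨ sumOver-cong (λ x → cong (F x) (bump-⊝ _ r s (d x))) xs ⟩
      sumOver (λ x → F x (bump _ r s ⊝ d x)) xs    ≡⟨ p (bump _ r s) (≤-trans (total⁺-bump _ r s) r+s≤M) ⟩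
      sumOver (λ y → G y (bump _ r s ⊝ e y)) ys    ≡⟨ sumOver-cong (λ y → cong (G y) (bump-⊝ _ r s (e y))) ys ⟨
      sumOver (λ y → G y (bump _ r (s ⊝ e y))) ys  ∎
      where open ≡-Reasoning
    spread-sumOver xs ys F d G e p (o ∷ os) r s r+s≤M = begin
      sumOver (λ x → Δ r (λ q r′ → spread os (F x) r′ (bump o q (s ⊝ d x)))) xs
        ≡⟨ sumOver-Δ _ r xs ⟩
      Δ r (λ q r′ → sumOver (λ x → spread os (F x) r′ (bump o q (s ⊝ d x))) xs)
        ≡⟨ Δ-cong′ r (λ q r′ q+r′≡r → trans
             (sumOver-cong (λ x → cong (spread os (F x) r′) (bump-⊝ o q s (d x))) xs)
             (trans (spread-sumOver xs ys F d G e p os r′ (bump o q s) (bound q r′ q+r′≡r))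
               (sumOver-cong (λ y → cong (spread os (G y) r′) (sym (bump-⊝ o q s (e y)))) ys))) ⟩
      Δ r (λ q r′ → sumOver (λ y → spread os (G y) r′ (bump o q (s ⊝ e y))) ys)
        ≡⟨ sumOver-Δ _ r ys ⟨
      sumOver (λ y → Δ r (λ q r′ → spread os (G y) r′ (bump o q (s ⊝ e y)))) ys ∎
      where
      open ≡-Reasoning
      bound : ∀ q r′ → q + r′ ≡ r → r′ + total⁺ (bump o q s) ≤ M
      bound q r′ refl = ≤-trans (+-monoʳ-≤ r′ (total⁺-bump o q s))
        (≤-trans (≤-reflexive (trans (sym (+-assoc r′ q _)) (cong (_+ total⁺ s) (+-comm r′ q)))) r+s≤M)

    -- Candidates for the vector of differences threshold - a_i, with k of them nonzero. A
    -- difference above M leaves no flow, by `flows-support`.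
    deficits : ∀ n → ℕ → List (Vec ℕ n)
    deficits zero    zero    = [] ∷ []
    deficits zero    (suc k) = []
    deficits (suc n) zero    = List.map (0 ∷_) (deficits n 0)
    deficits (suc n) (suc k) = List.map (0 ∷_) (deficits n (suc k))
      ++ List.cartesianProductWith (λ q ps → suc q ∷ ps) (List.upTo M) (deficits n k)

  addSinks : Net n → Subset n → Net n
  addSinks []         []      = []
  addSinks (os ∷ net) (σ ∷ S) = (if σ then fromℕ _ ∷ os else os) ∷ addSinks net S

  bits : Subset n → Vec ℕ n
  bits = Vec.map bit

  private
    -- Sending q ≤ z - 1 units along an extra edge to the sink leaves z - 1 - q units.
    spread-extra : ∀ (f : ℕ → ℕ) z (g : ℕ → ℤ) M → (∀ q → g q ≡ z ℤ.- + suc q) → pos z ≤ M →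
      ifPos (z ℤ.- 1ℤ) (λ r → Δ r (λ q r′ → f r′)) ≡ sumOver (λ q → ifPos (g q) f) (List.applyUpTo id M)
    spread-extra f z g M p z≤M = trans (go f z M z≤M) (trans (sumOver-applyUpTo M) (sumOver-cong (λ q → cong (λ w → ifPos w f) (sym (p q))) (List.upTo M)))
      where
      sumUpTo : (ℕ → ℕ) → ℕ → ℕ
      sumUpTo h zero    = 0
      sumUpTo h (suc m) = h 0 + sumUpTo (h ∘ suc) m
      sumUpTo-applyUpTo : ∀ (h k : ℕ → ℕ) m → sumUpTo (h ∘ k) m ≡ sumOver h (List.applyUpTo k m)
      sumUpTo-applyUpTo h k zero    = refl
      sumUpTo-applyUpTo h k (suc m) = cong (_+_ (h (k 0))) (sumUpTo-applyUpTo h (k ∘ suc) m)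
      sumOver-applyUpTo : ∀ M → sumUpTo (λ q → ifPos (z ℤ.- + suc q) f) M ≡ sumOver (λ q → ifPos (z ℤ.- + suc q) f) (List.upTo M)
      sumOver-applyUpTo M = sumUpTo-applyUpTo (λ q → ifPos (z ℤ.- + suc q) f) id M
      sumUpTo-cong : ∀ {h k : ℕ → ℕ} → (∀ q → h q ≡ k q) → ∀ m → sumUpTo h m ≡ sumUpTo k m
      sumUpTo-cong p zero    = refl
      sumUpTo-cong p (suc m) = cong₂ _+_ (p 0) (sumUpTo-cong (p ∘ suc) m)
      sumUpTo-0 : ∀ {h : ℕ → ℕ} m → (∀ q → h q ≡ 0) → sumUpTo h m ≡ 0
      sumUpTo-0 zero    p = refl
      sumUpTo-0 (suc m) p = cong₂ _+_ (p 0) (sumUpTo-0 m (p ∘ suc))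
      go : ∀ (f : ℕ → ℕ) z M → pos z ≤ M → ifPos (z ℤ.- 1ℤ) (λ r → Δ r (λ q r′ → f r′)) ≡ sumUpTo (λ q → ifPos (z ℤ.- + suc q) f) M
      go f -[1+ m ]  M       _ = sym (sumUpTo-0 M (λ q → refl))
      go f (+ 0)     M       _ = sym (sumUpTo-0 M (λ q → refl))
      go f (+ suc r) (suc M) (s≤s r≤M) = begin
        Δ r (λ q r′ → f r′)                                        ≡⟨ peel r ⟩
        f r + ifPos (+ r ℤ.- 1ℤ) (λ r → Δ r (λ q r′ → f r′))       ≡⟨ cong (_+_ (f r)) (go f (+ r) M r≤M) ⟩
        f r + sumUpTo (λ q → ifPos (+ r ℤ.- + suc q) f) M          ≡⟨ cong (_+_ (f r)) (sumUpTo-cong (λ q → cong (λ w → ifPos w f)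
                                                                        (trans (ℤ.m-n≡m⊖n r (suc q)) (sym (ℤ.[1+m]⊖[1+n]≡m⊖n r (suc q))))) M) ⟩
        f r + sumUpTo (λ q → ifPos (+ suc r ℤ.- + suc (suc q)) f) M ∎
        where
        open ≡-Reasoning
        peel : ∀ r → Δ r (λ q r′ → f r′) ≡ f r + ifPos (+ r ℤ.- 1ℤ) (λ r → Δ r (λ q r′ → f r′))
        peel zero    = sym (+-identityʳ (f 0))
        peel (suc r) = refl

  nonzeros : Vec ℕ n → ℕ
  nonzeros []           = 0
  nonzeros (zero  ∷ ps) = nonzeros ps
  nonzeros (suc _ ∷ ps) = suc (nonzeros ps)

  module _ (M : ℕ) where

    -- A member of S has net flow one less and one more edge to the sink. If q units take that edge,
    -- z - 1 - q remain for the others, as for a vertex of deficit q + 1. Members of S thus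
    -- correspond to positive deficits and the other vertices to deficit 0.
    subsets-deficits : ∀ (net : Net n) k s → total⁺ s ≤ M →
      sumOver (λ S → flows (addSinks net S) (s ⊝ bits S)) (subsets n k)
      ≡ sumOver (λ p → flows net (s ⊝ p)) (deficits M n k)

    private
      spread-subsets : ∀ os (net : Net n) k z s p → pos z + total⁺ s ≤ M →
        sumOver (λ S → ifPos (z ℤ.- + p) (λ r → spread os (flows (addSinks net S)) r (s ⊝ bits S))) (subsets n k)
        ≡ sumOver (λ ps → flows (os ∷ net) ((z ∷ s) ⊝ (p ∷ ps))) (deficits M n k)
      spread-subsets {n} os net k z s p z+s≤M = begin
        sumOver (λ S → ifPos (z ℤ.- + p) (λ r → spread os (flows (addSinks net S)) r (s ⊝ bits S))) (subsets n k)
          ≡⟨ sumOver-ifPos (z ℤ.- + p) _ (subsets n k) ⟩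
        ifPos (z ℤ.- + p) (λ r → sumOver (λ S → spread os (flows (addSinks net S)) r (s ⊝ bits S)) (subsets n k))
          ≡⟨ inside-ifPos (z ℤ.- + p) (pos-minus z p) ⟩
        ifPos (z ℤ.- + p) (λ r → sumOver (λ ps → spread os (flows net) r (s ⊝ ps)) (deficits M n k))
          ≡⟨ sumOver-ifPos (z ℤ.- + p) _ (deficits M n k) ⟨
        sumOver (λ ps → flows (os ∷ net) ((z ∷ s) ⊝ (p ∷ ps))) (deficits M n k) ∎
        where
        open ≡-Reasoning
        inside-ifPos : ∀ w → pos w ≤ pos z →
          ifPos w (λ r → sumOver (λ S → spread os (flows (addSinks net S)) r (s ⊝ bits S)) (subsets n k))
          ≡ ifPos w (λ r → sumOver (λ ps → spread os (flows net) r (s ⊝ ps)) (deficits M n k))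
        inside-ifPos (+ r)    r≤z = spread-sumOver M (subsets n k) (deficits M n k) (flows ∘ addSinks net) bits (λ _ → flows net) id
          (subsets-deficits net k) os r s (≤-trans (+-monoˡ-≤ (total⁺ s) r≤z) z+s≤M)
        inside-ifPos -[1+ _ ] _   = refl

    subsets-deficits []         zero    s       _ = refl
    subsets-deficits []         (suc k) s       _ = refl
    subsets-deficits {suc n} (os ∷ net) zero    (z ∷ s) b = begin
      sumOver (λ S → flows (addSinks (os ∷ net) S) ((z ∷ s) ⊝ bits S)) (List.map (outside ∷_) (subsets n 0))
        ≡⟨ sumOver-map _ (outside ∷_) (subsets n 0) ⟩
      sumOver (λ S → ifPos (z ℤ.- + 0) (λ r → spread os (flows (addSinks net S)) r (s ⊝ bits S))) (subsets n 0)
        ≡⟨ spread-subsets os net 0 z s 0 b ⟩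
      sumOver (λ ps → flows (os ∷ net) ((z ∷ s) ⊝ (0 ∷ ps))) (deficits M n 0)
        ≡⟨ sumOver-map _ (0 ∷_) (deficits M n 0) ⟨
      sumOver (λ p → flows (os ∷ net) ((z ∷ s) ⊝ p)) (deficits M (suc n) 0) ∎
      where open ≡-Reasoning
    subsets-deficits {suc n} (os ∷ net) (suc k) (z ∷ s) b = begin
      sumOver T (List.map (outside ∷_) (subsets n (suc k)) ++ List.map (inside ∷_) (subsets n k))
        ≡⟨ trans (sumOver-++ T (List.map (outside ∷_) (subsets n (suc k))) _)
             (cong₂ _+_ (sumOver-map T (outside ∷_) (subsets n (suc k))) (sumOver-map T (inside ∷_) (subsets n k))) ⟩
      sumOver (T ∘ (outside ∷_)) (subsets n (suc k)) + sumOver (T ∘ (inside ∷_)) (subsets n k)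
        ≡⟨ cong₂ _+_ (spread-subsets os net (suc k) z s 0 b) insides ⟩
      sumOver (U ∘ (0 ∷_)) (deficits M n (suc k)) + sumOver (λ q → sumOver (λ ps → U (suc q ∷ ps)) (deficits M n k)) (List.upTo M)
        ≡⟨ trans (sumOver-++ U (List.map (0 ∷_) (deficits M n (suc k))) _)
             (cong₂ _+_ (sumOver-map U (0 ∷_) (deficits M n (suc k))) (sumOver-product U (λ q ps → suc q ∷ ps) (List.upTo M) (deficits M n k))) ⟨
      sumOver U (deficits M (suc n) (suc k)) ∎
      where
      open ≡-Reasoning
      T = λ S → flows (addSinks (os ∷ net) S) ((z ∷ s) ⊝ bits S)
      U = λ p → flows (os ∷ net) ((z ∷ s) ⊝ p)
      insides : sumOver (T ∘ (inside ∷_)) (subsets n k) ≡ sumOver (λ q → sumOver (λ ps → U (suc q ∷ ps)) (deficits M n k)) (List.upTo M)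
      insides = begin
        sumOver (λ S → ifPos (z ℤ.- 1ℤ) (λ r → Δ r (λ q r′ → spread os (flows (addSinks net S)) r′ (bump (fromℕ n) q (s ⊝ bits S))))) (subsets n k)
          -- The q units on the added edge go straight to the sink and do not affect the count at
          -- the other vertices, so each q contributes the count for the units left.
          ≡⟨ sumOver-cong (λ S → trans (ifPos-cong (z ℤ.- 1ℤ) (λ r → Δ-cong r (λ q r′ → spread-sink os (addSinks net S) r′ q (s ⊝ bits S))))
               (spread-extra (λ r′ → spread os (flows (addSinks net S)) r′ (s ⊝ bits S)) z (λ q → z ℤ.- + suc q) M (λ _ → refl) (≤-trans (m≤m+n (pos z) (total⁺ s)) b))) (subsets n k) ⟩
        sumOver (λ S → sumOver (λ q → ifPos (z ℤ.- + suc q) (λ r → spread os (flows (addSinks net S)) r (s ⊝ bits S))) (List.upTo M)) (subsets n k)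
          ≡⟨ sumOver-comm _ (subsets n k) (List.upTo M) ⟩
        sumOver (λ q → sumOver (λ S → ifPos (z ℤ.- + suc q) (λ r → spread os (flows (addSinks net S)) r (s ⊝ bits S))) (subsets n k)) (List.upTo M)
          ≡⟨ sumOver-cong (λ q → spread-subsets os net k z s (suc q) b) (List.upTo M) ⟩
        sumOver (λ q → sumOver (λ ps → U (suc q ∷ ps)) (deficits M n k)) (List.upTo M) ∎
        where
        ifPos-cong : ∀ z {f g : ℕ → ℕ} → (∀ r → f r ≡ g r) → ifPos z f ≡ ifPos z g
        ifPos-cong (+ r)    p = p r
        ifPos-cong -[1+ _ ] p = refl

    deficits-sound : ∀ n k {p} → p ∈ deficits M n k → nonzeros p ≡ k
    deficits-sound zero    zero    (here refl) = refl
    deficits-sound (suc n) zero    p∈ with _ , p∈′ , refl ← ∈.∈-map⁻ (0 ∷_) p∈ = deficits-sound n zero p∈′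
    deficits-sound (suc n) (suc k) p∈ with ∈.∈-++⁻ (List.map (0 ∷_) (deficits M n (suc k))) p∈
    ... | inj₁ p∈₁ with _ , p∈′ , refl ← ∈.∈-map⁻ (0 ∷_) p∈₁ = deficits-sound n (suc k) p∈′
    ... | inj₂ p∈₂ with _ , _ , _ , p∈′ , refl ← ∈.∈-cartesianProductWith⁻ (λ q ps → suc q ∷ ps) (List.upTo M) (deficits M n k) p∈₂
      = cong suc (deficits-sound n k p∈′)

    deficits-complete : ∀ {p : Vec ℕ n} → (∀ i → lookup p i ≤ M) → p ∈ deficits M n (nonzeros p)
    deficits-complete {p = []}         _ = here refl
    deficits-complete {p = zero ∷ ps}  b = zero∷ (nonzeros ps) (deficits-complete (b ∘ suc))
      where
      zero∷ : ∀ {n} k {ps : Vec ℕ n} → ps ∈ deficits M n k → (0 ∷ ps) ∈ deficits M (suc n) k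
      zero∷ zero    ps∈ = ∈.∈-map⁺ (0 ∷_) ps∈
      zero∷ (suc k) ps∈ = ∈.∈-++⁺ˡ (∈.∈-map⁺ (0 ∷_) ps∈)
    deficits-complete {suc n} {p = suc q ∷ ps} b = ∈.∈-++⁺ʳ (List.map (0 ∷_) (deficits M n (suc (nonzeros ps))))
      (∈.∈-cartesianProductWith⁺ (λ q ps → suc q ∷ ps) (∈.∈-upTo⁺ (b zero)) (deficits-complete (b ∘ suc)))

    deficits-unique : ∀ n k → Unique (deficits M n k)
    deficits-unique zero    zero    = [] ∷ []
    deficits-unique zero    (suc k) = []
    deficits-unique (suc n) zero    = Unique.map⁺ Vec.∷-injectiveʳ (deficits-unique n 0)
    deficits-unique (suc n) (suc k) = Unique.++⁺ (Unique.map⁺ Vec.∷-injectiveʳ (deficits-unique n (suc k)))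
      (Unique.cartesianProductWith⁺ (λ q ps → suc q ∷ ps)
        (λ eq → suc-injective (Vec.∷-injectiveˡ eq) , Vec.∷-injectiveʳ eq)
        (Unique.upTo⁺ M) (deficits-unique n k))
      disjoint
      where
      disjoint : ∀ {p} → p ∈ List.map (0 ∷_) (deficits M n (suc k)) × p ∈ List.cartesianProductWith (λ q ps → suc q ∷ ps) (List.upTo M) (deficits M n k) → Data.Empty.⊥
      disjoint (p∈₁ , p∈₂) with ∈.∈-map⁻ (0 ∷_) p∈₁ | ∈.∈-cartesianProductWith⁻ (λ q ps → suc q ∷ ps) (List.upTo M) (deficits M n k) p∈₂
      ... | _ , _ , refl | _ , _ , _ , _ , ()

    -- Vertex i can collect at most M units, so a deficit above M leaves its net flow negative
    -- however the earlier vertices send theirs.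
    flows-support : ∀ (net : Net n) s p i → M < lookup p i → total⁺ s ≤ M → flows net (s ⊝ p) ≡ 0
    flows-support (os ∷ net) (z ∷ s) (p ∷ ps) zero    M<p b = vanish z p (≤-<-trans (≤-trans (m≤m+n (pos z) _) b) M<p)
      where
      vanish : ∀ z p → pos z < p → ∀ {f} → ifPos (z ℤ.- + p) f ≡ 0
      vanish (+ m)    p       m<p {f} = cong (λ w → ifPos w f) (trans (ℤ.m-n≡m⊖n m p) (trans (ℤ.⊖-< m<p) (neg-suc m<p)))
        where
        neg-suc : ∀ {m p} → m < p → ℤ.- (+ (p ∸ m)) ≡ -[1+ (p ∸ suc m) ]
        neg-suc {zero}  (s≤s z≤n)   = refl
        neg-suc {suc m} (s≤s m<p)   = neg-suc {m} m<p
      vanish -[1+ m ] (suc p) _   = refl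
    flows-support (os ∷ net) (z ∷ s) (p ∷ ps) (suc i) M<p b = vanish (z ℤ.- + p) (pos-minus z p)
      where
      vanish : ∀ w → pos w ≤ pos z → ifPos w (λ r → spread os (flows net) r (s ⊝ ps)) ≡ 0
      vanish -[1+ _ ] _   = refl
      -- Vanishing is passed through `spread` as the equality of a sum with one term and an empty
      -- sum.
      vanish (+ r)    r≤z = trans (sym (+-identityʳ _)) (spread-sumOver M (ps ∷ []) []
        (λ _ → flows net) id (λ (_ : Vec ℕ _) → flows net) id
        (λ s s≤M → trans (+-identityʳ _) (flows-support net s ps i M<p s≤M))
        os r s (≤-trans (+-monoˡ-≤ (total⁺ s) r≤z) b))

-- The sum over admissible vectors.

module AdmissibleSums where

  open Networks
  open ProductFormula
  open SubsetExpansion using (bit; subsetNet; subsetState; Ψ-flows)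
  open Deficits
  open import Defs
  open import Data.Bool.Base using (true; false; if_then_else_)
  open import Data.Fin.Base as Fin using (Fin; zero; suc)
  open import Data.Fin.Subset using (Subset)
  open import Data.Integer.Base as ℤ using (ℤ; +_; 0ℤ)
  import Data.Integer.Properties as ℤ
  open import Data.Integer.Tactic.RingSolver using (solve-∀)
  open import Data.List.Base as List using (List; []; _∷_)
  open import Data.List.Membership.Propositional using (_∈_)
  import Data.List.Membership.Propositional.Properties as ∈
  open import Data.List.Relation.Unary.All as All using (All)
  import Data.List.Relation.Unary.Unique.Propositional.Properties as Unique
  open import Data.Nat.Base hiding (_⊔_)
  open import Data.Nat.Properties
  open import Data.Product.Base using (_,_; proj₁; ∃-syntax)
  open import Data.Vec.Base as Vec using (Vec; []; _∷_; _∷ʳ_; lookup; tabulate; allFin)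
  import Data.Vec.Properties as Vec
  open import Function.Base using (_∘_; id)
  open import Relation.Binary.PropositionalEquality
  open import Relation.Nullary.Decidable using (does; dec-true; dec-false)
  open import Relation.Nullary.Negation using (contradiction; ¬_)
  open import Relation.Unary using (Decidable)

  private
    variable
      n : ℕ
      X : Set

  subsetNet-addSinks : ∀ b c (S : Subset n) → subsetNet n b c S ≡ addSinks (completeNet n c (λ _ → b)) S
  subsetNet-addSinks b c []          = refl
  subsetNet-addSinks b c (true  ∷ S) = cong (_ ∷_) (subsetNet-addSinks b c S)
  subsetNet-addSinks b c (false ∷ S) = cong (_ ∷_) (subsetNet-addSinks b c S)

  atInner-⊝ : ∀ (t : Fin n → ℤ) S → atInner (λ i → t i ℤ.- + bit (lookup S i)) ≡ atInner t ⊝ bits S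
  atInner-⊝ {zero}  t []      = refl
  atInner-⊝ {suc n} t (σ ∷ S) = cong (_ ∷_) (atInner-⊝ (t ∘ suc) S)

  atInner-∷ʳ : ∀ (t : Fin n → ℤ) → atInner t ≡ tabulate t ∷ʳ 0ℤ
  atInner-∷ʳ {zero}  t = refl
  atInner-∷ʳ {suc n} t = cong (t zero ∷_) (atInner-∷ʳ (t ∘ suc))

  private
    cancelˡ : ∀ x {y z} → x ℤ.+ y ≡ x ℤ.+ z → y ≡ z
    cancelˡ x {y} {z} eq = trans (lemma x y) (trans (cong (λ w → ℤ.- x ℤ.+ w) eq) (sym (lemma x z)))
      where
      lemma : ∀ x y → y ≡ ℤ.- x ℤ.+ (x ℤ.+ y)
      lemma = solve-∀

  infixl 6 _⊖ᵥ_
  _⊖ᵥ_ : Vec ℤ n → Vec ℕ n → Vec ℤ n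
  _⊖ᵥ_ = Vec.zipWith (λ z p → z ℤ.- + p)

  ∷ʳ-⊝ : ∀ (s : Vec ℤ n) p → (s ∷ʳ 0ℤ) ⊝ p ≡ (s ⊖ᵥ p) ∷ʳ 0ℤ
  ∷ʳ-⊝ []      []      = refl
  ∷ʳ-⊝ (z ∷ s) (p ∷ ps) = cong (_ ∷_) (∷ʳ-⊝ s ps)

  ⊖ᵥ-injective : ∀ (s : Vec ℤ n) {p q} → s ⊖ᵥ p ≡ s ⊖ᵥ q → p ≡ q
  ⊖ᵥ-injective []      {[]}     {[]}     eq = refl
  ⊖ᵥ-injective (z ∷ s) {p ∷ ps} {q ∷ qs} eq = cong₂ _∷_
    (ℤ.+-injective (ℤ.neg-injective (cancelˡ z (Vec.∷-injectiveˡ eq)))) (⊖ᵥ-injective s (Vec.∷-injectiveʳ eq))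

  count-tabulate : ∀ {m} {P : Fin n → Set} (P? : Decidable P) (f : Fin m → Fin n) →
                   Vec.count P? (tabulate f) ≡ Vec.count (P? ∘ f) (allFin m)
  count-tabulate {m = m} P? f = go f id
    where
    go : ∀ {m l} (f : Fin m → Fin _) (g : Fin l → Fin m) → Vec.count P? (tabulate (f ∘ g)) ≡ Vec.count (P? ∘ f) (tabulate g)
    go {l = zero}  f g = refl
    go {l = suc l} f g = cong (if does (P? (f (g zero))) then suc else id) (go f (g ∘ suc))

  -- An entry meets its threshold exactly when its deficit is 0. The additive form avoids truncated
  -- subtraction.
  count-zeros : ∀ (t : Fin n → ℤ) p →
    Vec.count (λ i → lookup (tabulate t ⊖ᵥ p) i ℤ.≟ t i) (allFin n) + nonzeros p ≡ n
  count-zeros {zero}  t []       = refl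
  count-zeros {suc n} t (p ∷ ps) = step p
    where
    P? : ∀ p → Decidable (λ i → lookup (tabulate t ⊖ᵥ (p ∷ ps)) i ≡ t i)
    P? p i = lookup (tabulate t ⊖ᵥ (p ∷ ps)) i ℤ.≟ t i
    rest : ∀ p → Vec.count (P? p) (tabulate suc) + nonzeros ps ≡ n
    rest p = trans (cong (_+ nonzeros ps) (count-tabulate (P? p) suc)) (count-zeros (t ∘ suc) ps)
    step : ∀ p → Vec.count (P? p) (allFin (suc n)) + nonzeros (p ∷ ps) ≡ suc n
    step zero    = trans
      (cong (λ b → (if b then suc else id) (Vec.count (P? 0) (tabulate suc)) + nonzeros ps)
        (dec-true (t zero ℤ.- 0ℤ ℤ.≟ t zero) (ℤ.+-identityʳ (t zero))))
      (cong suc (rest 0))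
    step (suc p) = trans
      (cong (λ b → (if b then suc else id) (Vec.count (P? (suc p)) (tabulate suc)) + suc (nonzeros ps))
        (dec-false (t zero ℤ.- + suc p ℤ.≟ t zero) (λ eq → contradiction (cancelˡ (t zero) {ℤ.- + suc p} {0ℤ}
          (trans eq (sym (ℤ.+-identityʳ (t zero))))) λ ())))
      (trans (+-suc (Vec.count (P? (suc p)) (tabulate suc)) (nonzeros ps)) (cong suc (rest (suc p))))

  ⊖ᵥ-lookup : ∀ (t : Fin n → ℤ) p i → lookup (tabulate t ⊖ᵥ p) i ≡ t i ℤ.- + lookup p i
  ⊖ᵥ-lookup t p i = trans (Vec.lookup-zipWith _ i (tabulate t) p) (cong (ℤ._- + lookup p i) (Vec.lookup∘tabulate t i))

  +-sumOver : ∀ (f : X → ℕ) xs → + sumOver f xs ≡ List.foldr (λ x → ℤ._+_ (+ f x)) 0ℤ xs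
  +-sumOver f []       = refl
  +-sumOver f (x ∷ xs) = trans (ℤ.pos-+ (f x) _) (cong (λ w → + f x ℤ.+ w) (+-sumOver f xs))

  deficit : ∀ (t : Fin n → ℤ) as → (∀ i → lookup as i ℤ.≤ t i) → ∃[ p ] tabulate t ⊖ᵥ p ≡ as
  deficit t []       _ = [] , refl
  deficit t (x ∷ as) le with ps , refl ← deficit (t ∘ suc) as (le ∘ suc) =
    ℤ.∣ t zero ℤ.- x ∣ ∷ ps , cong (_∷ _) (trans
      (cong (λ w → t zero ℤ.- w) (ℤ.0≤i⇒+∣i∣≡i (ℤ.i≤j⇒0≤j-i (le zero)))) (lemma (t zero) x))
    where
    lemma : ∀ t x → t ℤ.- (t ℤ.- x) ≡ x
    lemma = solve-∀

  module _ (n k a b c : ℕ) (k≤n : k ≤ n) where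
    private
      t : Fin n → ℤ
      t = threshold a c
      thresholds : Vec ℤ n
      thresholds = tabulate t
      -- No vertex ever has more to ship than the sum of the positive thresholds, so larger deficits
      -- contribute 0.
      M = total⁺ (thresholds ∷ʳ 0ℤ)
      net = completeNet n c (λ _ → b)
      f : Vec ℤ n → ℤ
      f as = + flows net (as ∷ʳ 0ℤ)

      admissible-nonzeros : ∀ p → Admissible n k a c (thresholds ⊖ᵥ p) → nonzeros p ≡ k
      admissible-nonzeros p (_ , count≡) = +-cancelˡ-≡ (n ∸ k) _ _
        (trans (trans (cong (_+ nonzeros p) (sym count≡)) (count-zeros t p)) (sym (m∸n+n≡m k≤n)))

      nonzeros-admissible : ∀ p → nonzeros p ≡ k → Admissible n k a c (thresholds ⊖ᵥ p)
      nonzeros-admissible p refl = (λ i → ℤ.≤-trans (ℤ.≤-reflexive (⊖ᵥ-lookup t p i)) (ℤ.i≤j⇒i-k≤j (+ lookup p i) ℤ.≤-refl))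
        , trans (sym (m+n∸n≡m _ (nonzeros p))) (cong (_∸ nonzeros p) (count-zeros t p))

      M-bounded : ∀ p → (∃[ i ] M < lookup p i) → f (thresholds ⊖ᵥ p) ≡ 0ℤ
      M-bounded p (i , M<p) = cong +_ (trans (cong (flows net) (sym (∷ʳ-⊝ thresholds p)))
        (flows-support M net (thresholds ∷ʳ 0ℤ) p i M<p ≤-refl))

      xs = List.map (thresholds ⊖ᵥ_) (deficits M n k)

      sum≡ : List.foldr (λ as → ℤ._+_ (f as)) 0ℤ xs ≡ Ψ n k a (suc b) c
      sum≡ = begin
        List.foldr (λ as → ℤ._+_ (f as)) 0ℤ xs
          ≡⟨ +-sumOver (λ as → flows net (as ∷ʳ 0ℤ)) xs ⟨
        + sumOver (λ as → flows net (as ∷ʳ 0ℤ)) xs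
          ≡⟨ cong +_ (sumOver-map (λ as → flows net (as ∷ʳ 0ℤ)) (thresholds ⊖ᵥ_) (deficits M n k)) ⟩
        + sumOver (λ p → flows net ((thresholds ⊖ᵥ p) ∷ʳ 0ℤ)) (deficits M n k)
          ≡⟨ cong +_ (sumOver-cong (λ p → cong (flows net) (sym (∷ʳ-⊝ thresholds p))) (deficits M n k)) ⟩
        + sumOver (λ p → flows net ((thresholds ∷ʳ 0ℤ) ⊝ p)) (deficits M n k)
          ≡⟨ cong +_ (subsets-deficits M net k (thresholds ∷ʳ 0ℤ) ≤-refl) ⟨
        + sumOver (λ S → flows (addSinks net S) ((thresholds ∷ʳ 0ℤ) ⊝ bits S)) (subsets n k)
          ≡⟨ cong +_ (sumOver-cong (λ S → cong₂ flows (subsetNet-addSinks b c S)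
               (trans (atInner-⊝ t S) (cong (_⊝ bits S) (atInner-∷ʳ t)))) (subsets n k)) ⟨
        + sumOver (λ S → flows (subsetNet n b c S) (subsetState n a c S)) (subsets n k)
          ≡⟨ +-sumOver (λ S → flows (subsetNet n b c S) (subsetState n a c S)) (subsets n k) ⟩
        List.foldr (λ S → ℤ._+_ (+ flows (subsetNet n b c S) (subsetState n a c S))) 0ℤ (subsets n k)
          ≡⟨ Ψ-flows n a b c k ⟨
        Ψ n k a (suc b) c ∎
        where open ≡-Reasoning

    flows-sum : IsSumOver ℤ.+-0-rawMonoid (Admissible n k a c) f (Ψ n k a (suc b) c)
    flows-sum = xs
      , Unique.map⁺ (⊖ᵥ-injective thresholds) (deficits-unique M n k)
      , All.tabulate admissible
      , complete
      , sum≡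
      where
      admissible : ∀ {as} → as ∈ xs → Admissible n k a c as
      admissible as∈ with p , p∈ , refl ← ∈.∈-map⁻ (thresholds ⊖ᵥ_) as∈ = nonzeros-admissible p (deficits-sound M n k p∈)
      complete : ∀ as → Admissible n k a c as → ¬ (f as ≡ 0ℤ) → as ∈ xs
      complete as adm f≢0 with p , refl ← deficit t as (proj₁ adm) = ∈.∈-map⁺ (thresholds ⊖ᵥ_)
        (subst (λ k → p ∈ deficits M n k) (admissible-nonzeros p adm)
          -- An entry of p above M would make the flow count 0, contrary to `f≢0`.
          (deficits-complete M (λ i → ≮⇒≥ (λ M<p → f≢0 (M-bounded p (i , M<p))))))

-- Explicit lists of the flows on a network.

module Solutions where

  open Networks
  open Deficits using (flows-sink)
  open import Defs
  open import Data.Empty using (⊥)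
  open import Data.Fin.Base as Fin using (Fin; zero; suc; inject₁)
  open import Data.Integer.Base as ℤ using (ℤ; +_; -[1+_]; 0ℤ)
  import Data.Integer.Properties as ℤ
  open import Data.List.Base as List using (List; []; _∷_; _++_; length)
  import Data.List.Properties as List
  open import Data.List.Membership.Propositional using (_∈_)
  import Data.List.Membership.Propositional.Properties as ∈
  open import Data.List.Relation.Unary.AllPairs using ([]; _∷_)
  open import Data.List.Relation.Unary.All using ([]; _∷_)
  open import Data.List.Relation.Unary.Any using (here)
  open import Data.List.Relation.Unary.Unique.Propositional using (Unique)
  import Data.List.Relation.Unary.Unique.Propositional.Properties as Unique
  open import Data.Nat.Base hiding (_⊔_)
  open import Data.Nat.Properties
  open import Data.Product.Base using (_×_; _,_; ∃-syntax)
  open import Data.Sum.Base using (inj₁; inj₂)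
  open import Data.Vec.Base as Vec using (Vec; []; _∷_; lookup; updateAt)
  import Data.Vec.Properties as Vec
  open import Relation.Binary.PropositionalEquality
  open import Relation.Nullary.Decidable using (yes; no)
  open import Relation.Nullary.Negation using (contradiction; ¬_)

  private
    variable
      n N : ℕ
      A X : Set

  shift : Edge N → Edge (suc N)
  shift (edge u v u<v) = edge (suc u) (suc v) (s<s u<v)

  fromZero : Fin N → Edge (suc N)
  fromZero o = edge zero (suc o) z<s

  netEdges : Net n → List (Edge (suc n))
  netEdges []         = []
  netEdges (os ∷ net) = List.map fromZero os ++ List.map shift (netEdges net)

  -- The net flow that remains to be shipped at each vertex once z is shipped along R.
  residual : (R : List (Edge N)) → Vec ℤ N → Vec ℕ (length R) → Vec ℤ N
  residual []      s []      = s
  residual (e ∷ R) s (q ∷ z) = residual R (bump (tgt e) q (updateAt s (src e) (ℤ._- + q))) z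

  -- The last vertex is the sink, whose balance is not constrained.
  Feasible : (R : List (Edge (suc n))) → Vec ℤ (suc n) → Vec ℕ (length R) → Set
  Feasible R s z = ∀ u → 0ℤ ℤ.≤ lookup (residual R s z) (inject₁ u)

  remap : ∀ (f : X → A) xs {B : Set} → Vec B (length xs) → Vec B (length (List.map f xs))
  remap f []       []      = []
  remap f (x ∷ xs) (z ∷ zs) = z ∷ remap f xs zs

  remap-injective : ∀ (f : X → A) xs {B : Set} {y z : Vec B (length xs)} → remap f xs y ≡ remap f xs z → y ≡ z
  remap-injective f []       {y = []}    {[]}    _  = refl
  remap-injective f (x ∷ xs) {y = _ ∷ _} {_ ∷ _} eq = cong₂ _∷_ (Vec.∷-injectiveˡ eq) (remap-injective f xs (Vec.∷-injectiveʳ eq))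

  remap-surjective : ∀ (f : X → A) xs {B : Set} (z : Vec B (length (List.map f xs))) → ∃[ y ] remap f xs y ≡ z
  remap-surjective f []       []      = [] , refl
  remap-surjective f (x ∷ xs) (z ∷ zs) with y , refl ← remap-surjective f xs zs = z ∷ y , refl

  residual-shift : ∀ (R : List (Edge N)) x s z → residual (List.map shift R) (x ∷ s) (remap shift R z) ≡ x ∷ residual R s z
  residual-shift []      x s []      = refl
  residual-shift (e ∷ R) x s (q ∷ z) = residual-shift R x _ z

  concatΔ : ℕ → (ℕ → ℕ → List A) → List A
  concatΔ zero    f = f 0 0
  concatΔ (suc r) f = f 0 (suc r) ++ concatΔ r (λ i j → f (suc i) j)

  length-concatΔ : ∀ r (f : ℕ → ℕ → List A) → length (concatΔ r f) ≡ Δ r (λ i j → length (f i j))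
  length-concatΔ zero    f = refl
  length-concatΔ (suc r) f = trans (List.length-++ (f 0 (suc r))) (cong (_+_ (length (f 0 (suc r)))) (length-concatΔ r _))

  ∈-concatΔ⁺ : ∀ {x : A} f i j → x ∈ f i j → x ∈ concatΔ (i + j) f
  ∈-concatΔ⁺ f zero    zero    x∈ = x∈
  ∈-concatΔ⁺ f zero    (suc j) x∈ = ∈.∈-++⁺ˡ x∈
  ∈-concatΔ⁺ f (suc i) j       x∈ = ∈.∈-++⁺ʳ (f 0 (suc (i + j))) (∈-concatΔ⁺ (λ i → f (suc i)) i j x∈)

  ∈-concatΔ⁻ : ∀ {x : A} r f → x ∈ concatΔ r f → ∃[ i ] ∃[ j ] i + j ≡ r × x ∈ f i j
  ∈-concatΔ⁻ zero    f x∈ = 0 , 0 , refl , x∈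
  ∈-concatΔ⁻ (suc r) f x∈ with ∈.∈-++⁻ (f 0 (suc r)) x∈
  ... | inj₁ x∈₁ = 0 , suc r , refl , x∈₁
  ... | inj₂ x∈₂ with i , j , eq , x∈′ ← ∈-concatΔ⁻ r (λ i → f (suc i)) x∈₂ = suc i , j , cong suc eq , x∈′

  concatΔ-unique : ∀ r (f : ℕ → ℕ → List A) → (∀ i j → Unique (f i j)) →
                   (∀ {x} i j i′ j′ → x ∈ f i j → x ∈ f i′ j′ → i ≡ i′) → Unique (concatΔ r f)
  concatΔ-unique zero    f u d = u 0 0
  concatΔ-unique (suc r) f u d = Unique.++⁺ (u 0 (suc r))
    (concatΔ-unique r (λ i → f (suc i)) (λ i → u (suc i)) (λ i j i′ j′ x∈ x∈′ → suc-injective (d (suc i) j (suc i′) j′ x∈ x∈′)))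
    disjoint
    where
    disjoint : ∀ {x} → x ∈ f 0 (suc r) × x ∈ concatΔ r (λ i j → f (suc i) j) → ⊥
    disjoint (x∈₁ , x∈₂) with i , j , _ , x∈′ ← ∈-concatΔ⁻ r (λ i → f (suc i)) x∈₂ with () ← d 0 (suc r) (suc i) j x∈₁ x∈′

  ifPosList : ℤ → (ℕ → List A) → List A
  ifPosList (+ r)    f = f r
  ifPosList -[1+ _ ] f = []

  mutual
    -- The flows counted by `flows`, as vectors on the listed edges. The flow on an implicit edge is
    -- not stored: it is the residual at the vertex that the edge leaves.
    solutions : ∀ (net : Net n) → Vec ℤ (suc n) → List (Vec ℕ (length (netEdges net)))
    solutions []         s       = [] ∷ []
    solutions (os ∷ net) (z ∷ s) = ifPosList z (λ r → spreads os net r s)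

    spreads : ∀ os (net : Net n) → ℕ → Vec ℤ (suc n) → List (Vec ℕ (length (netEdges (os ∷ net))))
    spreads []       net r s = List.map (remap shift (netEdges net)) (solutions net s)
    spreads (o ∷ os) net r s = concatΔ r (λ q r′ → List.map (q ∷_) (spreads os net r′ (bump o q s)))

  mutual
    length-solutions : ∀ (net : Net n) s → length (solutions net s) ≡ flows net s
    length-solutions []         s              = refl
    length-solutions (os ∷ net) (+ r ∷ s)      = length-spreads os net r s
    length-solutions (os ∷ net) (-[1+ _ ] ∷ s) = refl

    length-spreads : ∀ os (net : Net n) r s → length (spreads os net r s) ≡ spread os (flows net) r s
    -- `spread` adds the remaining units to the state of the sink, while `spreads` keeps them as the
    -- residual of the vertex; `flows-sink` reconciles the two.
    length-spreads []       net r s = trans (List.length-map _ (solutions net s)) (trans (length-solutions net s) (sym (flows-sink net r s)))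
    length-spreads (o ∷ os) net r s = trans (length-concatΔ r _) (Δ-cong r (λ q r′ →
      trans (List.length-map (q ∷_) (spreads os net r′ (bump o q s))) (length-spreads os net r′ (bump o q s))))

  mutual
    solutions-unique : ∀ (net : Net n) s → Unique (solutions net s)
    solutions-unique []         s              = [] ∷ []
    solutions-unique (os ∷ net) (+ r ∷ s)      = spreads-unique os net r s
    solutions-unique (os ∷ net) (-[1+ _ ] ∷ s) = []

    spreads-unique : ∀ os (net : Net n) r s → Unique (spreads os net r s)
    spreads-unique []       net r s = Unique.map⁺ (remap-injective shift (netEdges net)) (solutions-unique net s)
    spreads-unique (o ∷ os) net r s = concatΔ-unique r _
      (λ q r′ → Unique.map⁺ Vec.∷-injectiveʳ (spreads-unique os net r′ (bump o q s)))
      (λ q r′ q′ r″ x∈ x∈′ → let _ , _ , eq = ∈.∈-map⁻ (q ∷_) x∈; _ , _ , eq′ = ∈.∈-map⁻ (q′ ∷_) x∈′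
                              in Vec.∷-injectiveˡ (trans (sym eq) eq′))

  private
    0≤-[1+] : ∀ {m} → ¬ 0ℤ ℤ.≤ -[1+ m ]
    0≤-[1+] ()

    q+r-q : ∀ q r → + (q + r) ℤ.- + q ≡ + r
    q+r-q q r = trans (cong (ℤ._- + q) (trans (ℤ.pos-+ q r) (ℤ.+-comm (+ q) (+ r)))) (trans (ℤ.+-assoc (+ r) (+ q) (ℤ.- + q))
      (trans (cong (λ w → + r ℤ.+ w) (ℤ.+-inverseʳ (+ q))) (ℤ.+-identityʳ (+ r))))

    -- No edge enters the first vertex, so shipping can only lower what it has.
    residual-zero : ∀ os (net : Net n) x s z → lookup (residual (netEdges (os ∷ net)) (x ∷ s) z) zero ℤ.≤ x
    residual-zero []       net x s z with y , refl ← remap-surjective shift (netEdges net) z =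
      ℤ.≤-reflexive (cong (λ s → lookup s zero) (residual-shift (netEdges net) x s y))
    residual-zero (o ∷ os) net x s (q ∷ z) = ℤ.≤-trans (residual-zero os net (x ℤ.- + q) (bump o q s) z) (ℤ.i≤j⇒i-k≤j (+ q) ℤ.≤-refl)

  mutual
    solutions-sound : ∀ (net : Net n) s {z} → z ∈ solutions net s → Feasible (netEdges net) s z
    solutions-sound (os ∷ net) (+ r ∷ s) z∈ = spreads-sound os net r s z∈

    spreads-sound : ∀ os (net : Net n) r s {z} → z ∈ spreads os net r s → Feasible (netEdges (os ∷ net)) (+ r ∷ s) z
    spreads-sound []       net r s z∈ u with y , y∈ , refl ← ∈.∈-map⁻ (remap shift (netEdges net)) z∈ =
      subst (λ v → 0ℤ ℤ.≤ lookup v (inject₁ u)) (sym (residual-shift (netEdges net) (+ r) s y)) (lemma u)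
      where
      lemma : ∀ u → 0ℤ ℤ.≤ lookup (+ r ∷ residual (netEdges net) s y) (inject₁ u)
      lemma zero    = ℤ.+≤+ z≤n
      lemma (suc u) = solutions-sound net s y∈ u
    spreads-sound (o ∷ os) net r s z∈
      with q , r′ , refl , z∈′ ← ∈-concatΔ⁻ r _ z∈
      with z , z∈″ , refl ← ∈.∈-map⁻ (q ∷_) z∈′ =
      subst (λ x → Feasible (netEdges (os ∷ net)) (x ∷ bump o q s) z) (sym (q+r-q q r′)) (spreads-sound os net r′ (bump o q s) z∈″)

  mutual
    solutions-complete : ∀ (net : Net n) s {z} → Feasible (netEdges net) s z → z ∈ solutions net s
    solutions-complete []         s              {[]} _ = here refl
    solutions-complete (os ∷ net) (+ r ∷ s)      f = spreads-complete os net r s f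
    solutions-complete (os ∷ net) (-[1+ m ] ∷ s) {z} f = contradiction (ℤ.≤-trans (f zero) (residual-zero os net -[1+ m ] s z)) 0≤-[1+]

    spreads-complete : ∀ os (net : Net n) r s {z} → Feasible (netEdges (os ∷ net)) (+ r ∷ s) z → z ∈ spreads os net r s
    spreads-complete []       net r s {z} f with y , refl ← remap-surjective shift (netEdges net) z =
      ∈.∈-map⁺ (remap shift (netEdges net)) (solutions-complete net s (λ u →
        subst (λ v → 0ℤ ℤ.≤ lookup v (inject₁ (suc u))) (residual-shift (netEdges net) (+ r) s y) (f (suc u))))
    spreads-complete (o ∷ os) net r s {q ∷ z} f with q ≤? r
    ... | no q≰r = contradiction (ℤ.≤-trans (f zero) (residual-zero os net (+ r ℤ.- + q) (bump o q s) z))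
      (subst (λ x → ¬ 0ℤ ℤ.≤ x) (sym (trans (ℤ.m-n≡m⊖n r q) (ℤ.⊖-< (≰⇒> q≰r)))) (neg r q (≰⇒> q≰r)))
      where
      neg : ∀ r q → r < q → ¬ 0ℤ ℤ.≤ ℤ.- + (q ∸ r)
      neg zero    (suc q) _         ()
      neg (suc r) (suc q) (s≤s r<q) = neg r q r<q
    ... | yes q≤r = subst (λ r → (q ∷ z) ∈ spreads (o ∷ os) net r s) (m+[n∸m]≡n q≤r)
      (∈-concatΔ⁺ (λ q r′ → List.map (q ∷_) (spreads os net r′ (bump o q s))) q (r ∸ q)
        (∈.∈-map⁺ (q ∷_) (spreads-complete os net (r ∸ q) (bump o q s)
          (subst (λ x → Feasible (netEdges (os ∷ net)) (x ∷ bump o q s) z)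
            (trans (cong (λ r → + r ℤ.- + q) (sym (m+[n∸m]≡n q≤r))) (q+r-q q (r ∸ q))) f))))

-- The edges of the graphs as those of a network and a spanning tree.

module EdgeLists where

  open Networks
  open ProductFormula using (completeNet)
  open Solutions using (shift; fromZero; netEdges)
  open import Defs
  open import Data.Fin.Base as Fin using (Fin; zero; suc; fromℕ; inject₁)
  import Data.Fin.Properties as Fin
  open import Data.List.Base as List using (List; []; _∷_; _++_; concatMap)
  import Data.List.Properties as List
  open import Data.List.Relation.Binary.Permutation.Propositional
  import Data.List.Relation.Binary.Permutation.Propositional.Properties as ↭
  open import Data.Nat.Base hiding (_⊔_)
  import Data.Nat.Properties as ℕ
  open import Function.Base using (_∘_; id)
  open import Relation.Binary.PropositionalEquality as ≡ using (_≡_; cong; cong₂)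
  open import Relation.Nullary.Decidable using (yes; no)
  open import Relation.Nullary.Negation using (contradiction)

  private
    variable
      n N : ℕ
      A X Y : Set

  edge-≡ : ∀ {e f : Edge N} → src e ≡ src f → tgt e ≡ tgt f → e ≡ f
  edge-≡ {e = edge u v p} {edge .u .v q} ≡.refl ≡.refl = cong (edge u v) (ℕ.<-irrelevant p q)

  concatMap-tabulate : ∀ (f : X → List Y) (g : Fin n → X) → concatMap f (List.tabulate g) ≡ concatMap (f ∘ g) (List.allFin n)
  concatMap-tabulate {n = zero}  f g = ≡.refl
  concatMap-tabulate {n = suc n} f g = cong (f (g zero) ++_)
    (≡.trans (concatMap-tabulate f (g ∘ suc)) (≡.sym (concatMap-tabulate (f ∘ g) suc)))

  toSink : Fin n → Edge (suc n)
  toSink {n} u = edge (inject₁ u) (fromℕ n) (≡.subst₂ _<_ (≡.sym (Fin.toℕ-inject₁ u)) (≡.sym (Fin.toℕ-fromℕ n)) (Fin.toℕ<n u))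

  private
    toInner : (i j : Fin n) → i Fin.< j → Edge (suc n)
    toInner i j i<j = edge (inject₁ i) (inject₁ j) (≡.subst₂ _<_ (≡.sym (Fin.toℕ-inject₁ i)) (≡.sym (Fin.toℕ-inject₁ j)) i<j)

    pairEdges : ℕ → Fin n → Fin n → List (Edge (suc n))
    pairEdges c i j with i Fin.<? j
    ... | yes i<j = List.replicate c (toInner i j i<j)
    ... | no  _   = []

    rowEdges : ∀ n → ℕ → ℕ → Fin n → List (Edge (suc n))
    rowEdges n c β i = List.replicate β (toSink i) ++ concatMap (pairEdges c i) (List.allFin n)

    shift-pairEdges : ∀ c (i j : Fin n) → List.map shift (pairEdges c i j) ≡ pairEdges c (suc i) (suc j)
    shift-pairEdges c i j with i Fin.<? j | suc i Fin.<? suc j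
    ... | yes p | yes (s<s q) = ≡.trans (List.map-replicate shift c (toInner i j p)) (cong (List.replicate c) (edge-≡ ≡.refl ≡.refl))
    ... | yes p | no ¬q = contradiction (s<s p) ¬q
    ... | no ¬p | yes (s<s q) = contradiction q ¬p
    ... | no _  | no _ = ≡.refl

    parallel-pairEdges : ∀ c (i j : Fin n) → parallel c i j ≡ pairEdges c (suc i) (suc j)
    parallel-pairEdges c i j with i Fin.<? j | suc i Fin.<? suc j
    ... | yes p | yes (s<s q) = cong (List.replicate c) (edge-≡ ≡.refl ≡.refl)
    ... | yes p | no ¬q = contradiction (s<s p) ¬q
    ... | no ¬p | yes (s<s q) = contradiction q ¬p
    ... | no _  | no _ = ≡.refl

    shift-rowEdges : ∀ c β (i : Fin n) → List.map shift (rowEdges n c β i) ≡ rowEdges (suc n) c β (suc i)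
    shift-rowEdges {n} c β i = ≡.trans (List.map-++ shift (List.replicate β (toSink i)) _) (cong₂ _++_
      (≡.trans (List.map-replicate shift β (toSink i)) (cong (List.replicate β) (edge-≡ ≡.refl ≡.refl)))
      (≡.trans (List.map-concatMap shift (pairEdges c i) (List.allFin n)) (≡.trans
        (List.concatMap-cong (shift-pairEdges c i) (List.allFin n))
        (≡.sym (concatMap-tabulate (pairEdges c (suc i)) suc)))))

    netEdges-complete : ∀ n c (β : Fin n → ℕ) → netEdges (completeNet n c β) ≡ concatMap (λ i → rowEdges n c (β i) i) (List.allFin n)
    netEdges-complete zero    c β = ≡.refl
    netEdges-complete (suc n) c β = cong₂ _++_
      (≡.trans (List.map-++ fromZero (List.replicate (β zero) (fromℕ n)) _) (cong₂ _++_
        (≡.trans (List.map-replicate fromZero (β zero) (fromℕ n)) (cong (List.replicate (β zero)) (edge-≡ ≡.refl ≡.refl)))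
        (≡.trans (List.map-concatMap fromZero (λ j → List.replicate c (inject₁ j)) (List.allFin n)) (≡.trans
          (List.concatMap-cong (λ j → ≡.trans (List.map-replicate fromZero c (inject₁ j)) (cong (List.replicate c) (edge-≡ ≡.refl ≡.refl))) (List.allFin n))
          (≡.sym (concatMap-tabulate (pairEdges c zero) suc))))))
      (≡.trans (cong (List.map shift) (netEdges-complete n c (β ∘ suc)))
        (≡.trans (List.map-concatMap shift (λ i → rowEdges n c (β (suc i)) i) (List.allFin n)) (≡.trans
          (List.concatMap-cong (λ i → shift-rowEdges c (β (suc i)) i) (List.allFin n))
          (≡.sym (concatMap-tabulate (λ i → rowEdges (suc n) c (β i) i) suc)))))

    concatMap-++ : ∀ (f g : X → List Y) xs → concatMap f xs ++ concatMap g xs ↭ concatMap (λ x → f x ++ g x) xs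
    concatMap-++ f g []       = refl
    concatMap-++ f g (x ∷ xs) = begin
      (f x ++ concatMap f xs) ++ g x ++ concatMap g xs  ↭⟨ ↭.++-assoc (f x) _ _ ⟩
      f x ++ concatMap f xs ++ g x ++ concatMap g xs    ↭⟨ ↭.++⁺ˡ (f x) (↭.shifts (concatMap f xs) (g x)) ⟩
      f x ++ g x ++ concatMap f xs ++ concatMap g xs    ↭⟨ ↭.++⁺ˡ (f x) (↭.++⁺ˡ (g x) (concatMap-++ f g xs)) ⟩
      f x ++ g x ++ concatMap (λ x → f x ++ g x) xs     ↭⟨ ↭.++-assoc (f x) _ _ ⟨
      (f x ++ g x) ++ concatMap (λ x → f x ++ g x) xs   ∎
      where open PermutationReasoning

    concatMap-singletons : ∀ (f : X → Y) (g : Fin n → X) → concatMap (λ x → f x ∷ []) (List.tabulate g) ≡ List.tabulate (f ∘ g)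
    concatMap-singletons {n = zero}  f g = ≡.refl
    concatMap-singletons {n = suc n} f g = cong (_ ∷_) (concatMap-singletons f (g ∘ suc))

  sourceRow : ∀ n → (Fin n → ℕ) → ℕ → List (Fin (suc n))
  sourceRow n α r = concatMap (λ i → List.replicate (α i) (inject₁ i)) (List.allFin n) ++ List.replicate r (fromℕ n)

  sourceNet : ∀ n → (α β : Fin n → ℕ) (c r : ℕ) → Net (suc n)
  sourceNet n α β c r = sourceRow n α r ∷ completeNet n c β

  -- One edge to the sink is set aside at each vertex: one of the `suc (β i)` copies at an inner
  -- vertex and one of the `suc r` copies at the source. These edges form a spanning tree, a star
  -- centred at the sink.
  graph-net : ∀ n (α β : Fin n → ℕ) c r →
    graph n α (suc ∘ β) c (suc r) ↭ List.tabulate (toSink {suc n}) ++ netEdges (sourceNet n α β c r)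
  graph-net n α β c r = begin
    A₁ ++ concatMap (λ i → List.replicate (suc (β i)) (inner→sink i)) (List.allFin n) ++ P₁ ++ 0→sink n ∷ List.replicate r (0→sink n)
      ↭⟨ ↭.++⁺ˡ A₁ (↭.++⁺ʳ _ (↭-sym (concatMap-++ (λ i → inner→sink i ∷ []) (λ i → List.replicate (β i) (inner→sink i)) (List.allFin n)))) ⟩
    A₁ ++ (T₁ ++ B₁) ++ P₁ ++ 0→sink n ∷ R₁
      ↭⟨ ↭.++⁺ˡ A₁ (↭.++⁺ˡ (T₁ ++ B₁) (↭.shift (0→sink n) P₁ R₁)) ⟩
    A₁ ++ (T₁ ++ B₁) ++ 0→sink n ∷ P₁ ++ R₁
      ↭⟨ ↭.++⁺ˡ A₁ (↭.shift (0→sink n) (T₁ ++ B₁) (P₁ ++ R₁)) ⟩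
    A₁ ++ 0→sink n ∷ (T₁ ++ B₁) ++ P₁ ++ R₁
      ↭⟨ ↭.shift (0→sink n) A₁ ((T₁ ++ B₁) ++ P₁ ++ R₁) ⟩
    0→sink n ∷ A₁ ++ (T₁ ++ B₁) ++ P₁ ++ R₁
      ↭⟨ prep (0→sink n) (↭.++⁺ˡ A₁ (↭.++-assoc T₁ B₁ (P₁ ++ R₁))) ⟩
    0→sink n ∷ A₁ ++ T₁ ++ B₁ ++ P₁ ++ R₁
      ↭⟨ prep (0→sink n) (↭.shifts A₁ T₁) ⟩
    0→sink n ∷ T₁ ++ A₁ ++ B₁ ++ P₁ ++ R₁
      ↭⟨ prep (0→sink n) (↭.++⁺ˡ T₁ (↭.++⁺ˡ A₁ (↭.++-assoc B₁ P₁ R₁))) ⟨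
    0→sink n ∷ T₁ ++ A₁ ++ (B₁ ++ P₁) ++ R₁
      ↭⟨ prep (0→sink n) (↭.++⁺ˡ T₁ (↭.++⁺ˡ A₁ (↭.++-comm (B₁ ++ P₁) R₁))) ⟩
    0→sink n ∷ T₁ ++ A₁ ++ R₁ ++ B₁ ++ P₁
      ↭⟨ prep (0→sink n) (↭.++⁺ˡ T₁ (↭.++⁺ˡ A₁ (↭.++⁺ˡ R₁ (concatMap-++ (λ i → List.replicate (β i) (inner→sink i)) (λ i → concatMap (parallel c i) (List.allFin n)) (List.allFin n))))) ⟩
    0→sink n ∷ T₁ ++ A₁ ++ R₁ ++ C₁
      ≡⟨ cong₂ _∷_ (edge-≡ ≡.refl ≡.refl) (cong₂ _++_ trees (≡.trans (≡.sym (List.++-assoc A₁ R₁ C₁)) (cong₂ _++_ sourceEdges rows))) ⟩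
    List.tabulate (toSink {suc n}) ++ netEdges (sourceNet n α β c r) ∎
    where
    open PermutationReasoning
    A₁ = concatMap (λ i → List.replicate (α i) (0→inner i)) (List.allFin n)
    T₁ = concatMap (λ i → inner→sink i ∷ []) (List.allFin n)
    B₁ = concatMap (λ i → List.replicate (β i) (inner→sink i)) (List.allFin n)
    P₁ = concatMap (λ i → concatMap (parallel c i) (List.allFin n)) (List.allFin n)
    R₁ = List.replicate r (0→sink n)
    C₁ = concatMap (λ i → List.replicate (β i) (inner→sink i) ++ concatMap (parallel c i) (List.allFin n)) (List.allFin n)
    trees : T₁ ≡ List.tabulate (toSink ∘ suc)
    trees = ≡.trans (concatMap-singletons inner→sink id) (List.tabulate-cong (λ i → edge-≡ ≡.refl ≡.refl))
    sourceEdges : A₁ ++ R₁ ≡ List.map fromZero (sourceRow n α r)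
    sourceEdges = ≡.sym (≡.trans (List.map-++ fromZero (concatMap (λ i → List.replicate (α i) (inject₁ i)) (List.allFin n)) _) (cong₂ _++_
      (≡.trans (List.map-concatMap fromZero (λ i → List.replicate (α i) (inject₁ i)) (List.allFin n))
        (List.concatMap-cong (λ i → ≡.trans (List.map-replicate fromZero (α i) (inject₁ i)) (cong (List.replicate (α i)) (edge-≡ ≡.refl ≡.refl))) (List.allFin n)))
      (≡.trans (List.map-replicate fromZero r (fromℕ n)) (cong (List.replicate r) (edge-≡ ≡.refl ≡.refl)))))
    rows : C₁ ≡ List.map shift (netEdges (completeNet n c β))
    rows = ≡.sym (≡.trans (cong (List.map shift) (netEdges-complete n c β))
      (≡.trans (List.map-concatMap shift (λ i → rowEdges n c (β i) i) (List.allFin n))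
        (List.concatMap-cong (λ i → ≡.trans (shift-rowEdges c (β i) i) (cong₂ _++_
          (cong (List.replicate (β i)) (edge-≡ ≡.refl ≡.refl))
          (≡.trans (concatMap-tabulate (pairEdges c (suc i)) suc)
            (List.concatMap-cong (λ j → ≡.sym (parallel-pairEdges c i j)) (List.allFin n))))) (List.allFin n))))

-- Flows determined by their values outside the spanning tree.

module Presentations where

  open Networks
  open Solutions
  open EdgeLists
  open import Defs
  open import Algebra.Bundles using (CommutativeRing)
  import Algebra.Definitions.RawMonoid
  import Algebra.Properties.CommutativeMonoid.Sum as CommutativeMonoidSum
  import Algebra.Properties.Semiring.Sum as SemiringSum
  open import Data.Bool.Base using (Bool; false; if_then_else_)
  open import Data.Fin.Base as Fin using (Fin; zero; suc; fromℕ; inject₁; splitAt; _↑ˡ_; _↑ʳ_)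
  import Data.Fin.Properties as Fin
  open import Data.Fin.Permutation as Perm using (Permutation; _⟨$⟩ʳ_; _⟨$⟩ˡ_)
  open import Data.Integer.Base as ℤ using (ℤ; +_; -[1+_]; 1ℤ)
  import Data.Integer.Properties as ℤ
  open import Data.List.Base as List using (List; _++_; length)
  open import Data.List.Relation.Binary.Permutation.Propositional using (_↭_; ↭⇒↭ₛ)
  import Data.List.Relation.Binary.Permutation.Homogeneous as ↭ₕ
  import Data.List.Relation.Binary.Permutation.Setoid.Properties as ↭ₛ
  open import Data.Nat.Base as ℕ using (ℕ; zero; suc)
  import Data.Nat.Properties as ℕ
  open import Data.Product.Base using (_,_)
  open import Data.Rational.Base as ℚ using (ℚ; 0ℚ; _+_; _-_; _*_; -_; _≤_)
  open import Data.Rational.Literals using (fromℤ)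
  import Data.Rational.Properties as ℚ
  import Data.Rational.Unnormalised.Base as ℚᵘ
  import Data.Rational.Unnormalised.Properties as ℚᵘ
  open import Data.Sum.Base using (_⊎_; inj₁; inj₂; [_,_]′)
  open import Data.Vec.Base as Vec using (Vec; lookup; tabulate)
  import Data.Vec.Properties as Vec
  open import Function.Base using (_∘_; _$_; id)
  open import Relation.Binary.PropositionalEquality
  open import Relation.Nullary.Decidable using (does)
  open import Data.Rational.Solver using (module +-*-Solver)

  open +-*-Solver using (solve; _:=_; _:+_; _:-_)

  private
    variable
      m n d N : ℕ
      A X : Set

  open Algebra.Definitions.RawMonoid ℚ.+-0-rawMonoid using () renaming (sum to ∑)
  open CommutativeMonoidSum (CommutativeRing.+-commutativeMonoid ℚ.+-*-commutativeRing)
    using (∑-comm; ∑-distrib-+; sum-cong-≗; sum-permute; sum-init-last)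
  open SemiringSum (CommutativeRing.semiring ℚ.+-*-commutativeRing) using (*-distribˡ-sum)

  fromℤ-+ : ∀ i j → fromℤ (i ℤ.+ j) ≡ fromℤ i + fromℤ j
  fromℤ-+ i j = ℚ.toℚᵘ-injective $ ℚᵘ.≃-trans
    (ℚᵘ.*≡* (cong (ℤ._* 1ℤ) (sym (cong₂ ℤ._+_ (ℤ.*-identityʳ i) (ℤ.*-identityʳ j)))))
    (ℚᵘ.≃-sym (ℚ.toℚᵘ-homo-+ (fromℤ i) (fromℤ j)))

  fromℤ-* : ∀ i j → fromℤ (i ℤ.* j) ≡ fromℤ i * fromℤ j
  fromℤ-* i j = ℚ.toℚᵘ-injective $ ℚᵘ.≃-trans
    (ℚᵘ.*≡* refl) (ℚᵘ.≃-sym (ℚ.toℚᵘ-homo-* (fromℤ i) (fromℤ j)))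

  fromℤ-neg : ∀ i → fromℤ (ℤ.- i) ≡ - fromℤ i
  fromℤ-neg (+ zero)  = refl
  fromℤ-neg (+ suc n) = refl
  fromℤ-neg -[1+ n ]  = refl

  fromℤ-minus : ∀ i j → fromℤ (i ℤ.- j) ≡ fromℤ i - fromℤ j
  fromℤ-minus i j = trans (fromℤ-+ i (ℤ.- j)) (cong (λ w → fromℤ i + w) (fromℤ-neg j))

  fromℤ-mono-≤ : ∀ {i j} → i ℤ.≤ j → fromℤ i ≤ fromℤ j
  fromℤ-mono-≤ {i} {j} i≤j = ℚ.*≤* (subst₂ ℤ._≤_ (sym (ℤ.*-identityʳ i)) (sym (ℤ.*-identityʳ j)) i≤j)

  fromℤ-cancel-≤ : ∀ {i j} → fromℤ i ≤ fromℤ j → i ℤ.≤ j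
  fromℤ-cancel-≤ {i} {j} (ℚ.*≤* p) = subst₂ ℤ._≤_ (ℤ.*-identityʳ i) (ℤ.*-identityʳ j) p

  fromℤ-injective : ∀ {i j} → fromℤ i ≡ fromℤ j → i ≡ j
  fromℤ-injective refl = refl

  ∑-0 : ∀ n → ∑ {n} (λ _ → 0ℚ) ≡ 0ℚ
  ∑-0 zero    = refl
  ∑-0 (suc n) = trans (ℚ.+-identityˡ _) (∑-0 n)

  ∑-neg : (f : Fin n → ℚ) → ∑ (λ i → - f i) ≡ - ∑ f
  ∑-neg {zero}  f = refl
  ∑-neg {suc n} f = trans (cong (λ w → - f zero + w) (∑-neg (f ∘ suc))) (sym (ℚ.neg-distrib-+ (f zero) _))

  ∑-minus : (f g : Fin n → ℚ) → ∑ (λ i → f i - g i) ≡ ∑ f - ∑ g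
  ∑-minus f g = trans (∑-distrib-+ f (λ i → - g i)) (cong (λ w → ∑ f + w) (∑-neg g))

  ∑-split : ∀ m (h : Fin (m ℕ.+ n) → ℚ) → ∑ h ≡ ∑ (λ u → h (u ↑ˡ n)) + ∑ (λ i → h (m ↑ʳ i))
  ∑-split zero    h = sym (ℚ.+-identityˡ _)
  ∑-split {n} (suc m) h = trans (cong (λ w → h zero + w) (∑-split m (h ∘ suc))) (sym (ℚ.+-assoc (h zero) (∑ (λ u → h (suc u ↑ˡ n))) (∑ (λ i → h (suc m ↑ʳ i)))))

  ∑-single : ∀ (w : Fin n) (h : Fin n → ℚ) → ∑ (λ v → if does (w Fin.≟ v) then h v else 0ℚ) ≡ h w
  ∑-single {suc n} zero    h = trans (cong (λ z → h zero + z) (∑-0 n)) (ℚ.+-identityʳ _)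
  ∑-single {suc n} (suc w) h = trans (ℚ.+-identityˡ _) (∑-single w (h ∘ suc))

  if-cong : ∀ {b b′ : Bool} {x y : A} → b ≡ b′ → (if b then x else y) ≡ (if b′ then x else y)
  if-cong refl = refl

  ≟-sym : ∀ (i j : Fin n) → does (i Fin.≟ j) ≡ does (j Fin.≟ i)
  ≟-sym zero    zero    = refl
  ≟-sym zero    (suc j) = refl
  ≟-sym (suc i) zero    = refl
  ≟-sym (suc i) (suc j) = ≟-sym i j

  ∑-inject₁ : ∀ (x : Fin n → ℚ) u → ∑ (λ v → if does (inject₁ v Fin.≟ inject₁ u) then x v else 0ℚ) ≡ x u
  ∑-inject₁ x u = trans (sum-cong-≗ (λ v → if-cong (trans (inject₁-≟ v u) (≟-sym v u)))) (∑-single u x)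
    where
    inject₁-≟ : ∀ (v u : Fin n) → does (inject₁ v Fin.≟ inject₁ u) ≡ does (v Fin.≟ u)
    inject₁-≟ zero    zero    = refl
    inject₁-≟ zero    (suc u) = refl
    inject₁-≟ (suc v) zero    = refl
    inject₁-≟ (suc v) (suc u) = inject₁-≟ v u

  fromℕ-≟ : ∀ (u : Fin n) → does (fromℕ n Fin.≟ inject₁ u) ≡ false
  fromℕ-≟ zero    = refl
  fromℕ-≟ (suc u) = fromℕ-≟ u

  -- Every edge contributes its flow once with each sign. This serves to deduce conservation at the
  -- sink from conservation elsewhere.
  netflow-total : ∀ (G : Multigraph N) f → ∑ (netflow G f) ≡ 0ℚ
  netflow-total {N} G f = begin
    ∑ (λ v → outflow G f v - inflow G f v)  ≡⟨ ∑-minus (outflow G f) (inflow G f) ⟩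
    ∑ (outflow G f) - ∑ (inflow G f)        ≡⟨ cong₂ _-_ (total (src ∘ List.lookup G)) (total (tgt ∘ List.lookup G)) ⟩
    ∑ (lookup f) - ∑ (lookup f)             ≡⟨ ℚ.+-inverseʳ (∑ (lookup f)) ⟩
    0ℚ                                      ∎
    where
    open ≡-Reasoning
    total : ∀ (w : Fin (#E G) → Fin N) → ∑ (λ v → ∑ (λ e → if does (w e Fin.≟ v) then lookup f e else 0ℚ)) ≡ ∑ (lookup f)
    total w = trans (∑-comm (λ v e → if does (w e Fin.≟ v) then lookup f e else 0ℚ)) (sum-cong-≗ (λ e → ∑-single (w e) (λ _ → lookup f e)))

  -- A bijection of the edges of G with the edges to the sink, one for each other vertex, and those of R.
  record Presentation (G : Multigraph (suc m)) (R : Multigraph (suc m)) : Set where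
    field
      position : Permutation (#E G) (m ℕ.+ #E R)
      edges    : ∀ e → List.lookup G e ≡ [ toSink , List.lookup R ]′ (splitAt m (position ⟨$⟩ʳ e))

  presentation : ∀ {G : Multigraph (suc m)} {R} → G ↭ List.tabulate (toSink {m}) ++ R → Presentation G R
  presentation {m} {G} {R} p = record
    { position = ↭ₕ.onIndices (↭⇒↭ₛ p) Perm.∘ₚ split (toSink {m})
    ; edges    = λ e → trans (↭ₛ.onIndices-lookup (setoid _) (↭⇒↭ₛ p) e)
                             (split-lookup toSink (↭ₕ.onIndices (↭⇒↭ₛ p) ⟨$⟩ʳ e))
    }
    where
    split : ∀ {k} (f : Fin k → Edge (suc m)) → Permutation (length (List.tabulate f ++ R)) (k ℕ.+ length R)
    split {zero}  f = Perm.id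
    split {suc k} f = Perm.lift₀ (split (f ∘ suc))
    split-lookup : ∀ {k} (f : Fin k → Edge (suc m)) i →
      List.lookup (List.tabulate f ++ R) i ≡ [ f , List.lookup R ]′ (splitAt k (split f ⟨$⟩ʳ i))
    split-lookup {zero}  f i       = refl
    split-lookup {suc k} f zero    = refl
    split-lookup {suc k} f (suc i) with splitAt k (split (f ∘ suc) ⟨$⟩ʳ i) | split-lookup (f ∘ suc) i
    ... | inj₁ _ | eq = eq
    ... | inj₂ _ | eq = eq

  module Assembly {G R : Multigraph (suc m)} (P : Presentation G R) where
    open Presentation P

    private
      pos : Fin (#E G) → Fin m ⊎ Fin (#E R)
      pos e = splitAt m (position ⟨$⟩ʳ e)

    at₁ : Fin m → Fin (#E G)
    at₁ u = position ⟨$⟩ˡ (u ↑ˡ #E R)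

    at₂ : Fin (#E R) → Fin (#E G)
    at₂ i = position ⟨$⟩ˡ (m ↑ʳ i)

    private
      pos-at₁ : ∀ u → pos (at₁ u) ≡ inj₁ u
      pos-at₁ u = trans (cong (splitAt m) (Perm.inverseʳ position)) (Fin.splitAt-↑ˡ m u (#E R))

      pos-at₂ : ∀ i → pos (at₂ i) ≡ inj₂ i
      pos-at₂ i = trans (cong (splitAt m) (Perm.inverseʳ position)) (Fin.splitAt-↑ʳ m (#E R) i)

      at-pos : ∀ e → [ at₁ , at₂ ]′ (pos e) ≡ e
      at-pos e with splitAt m (position ⟨$⟩ʳ e) in eq
      ... | inj₁ u = trans (cong (position ⟨$⟩ˡ_) (Fin.splitAt⁻¹-↑ˡ eq)) (Perm.inverseˡ position)
      ... | inj₂ i = trans (cong (position ⟨$⟩ˡ_) (Fin.splitAt⁻¹-↑ʳ eq)) (Perm.inverseˡ position)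

    assemble : (Fin m → A) → Vec A (#E R) → Vec A (#E G)
    assemble x y = tabulate (λ e → [ x , lookup y ]′ (pos e))

    treePart : Vec A (#E G) → Fin m → A
    treePart f u = lookup f (at₁ u)

    restPart : Vec A (#E G) → Vec A (#E R)
    restPart f = tabulate (λ i → lookup f (at₂ i))

    assemble-parts : ∀ (f : Vec A (#E G)) → assemble (treePart f) (restPart f) ≡ f
    assemble-parts f = trans (Vec.tabulate-cong lemma) (Vec.tabulate∘lookup f)
      where
      lemma : ∀ e → [ treePart f , lookup (restPart f) ]′ (pos e) ≡ lookup f e
      lemma e with pos e | at-pos e
      ... | inj₁ u | eq = cong (lookup f) eq
      ... | inj₂ i | eq = trans (Vec.lookup∘tabulate _ i) (cong (lookup f) eq)

    lookup-assemble : ∀ (x : Fin m → A) y e → lookup (assemble x y) e ≡ [ x , lookup y ]′ (pos e)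
    lookup-assemble x y e = Vec.lookup∘tabulate _ e

    treePart-assemble : ∀ (x : Fin m → A) y u → treePart (assemble x y) u ≡ x u
    treePart-assemble x y u = trans (lookup-assemble x y (at₁ u)) (cong [ x , lookup y ]′ (pos-at₁ u))

    lookup-assemble-at₂ : ∀ (x : Fin m → A) y i → lookup (assemble x y) (at₂ i) ≡ lookup y i
    lookup-assemble-at₂ x y i = trans (lookup-assemble x y (at₂ i)) (cong [ x , lookup y ]′ (pos-at₂ i))

    restPart-assemble : ∀ (x : Fin m → A) y → restPart (assemble x y) ≡ y
    restPart-assemble x y = trans
      (Vec.tabulate-cong (lookup-assemble-at₂ x y))
      (Vec.tabulate∘lookup y)

    assemble-cong : ∀ {x x′ : Fin m → A} {y y′} → (∀ u → x u ≡ x′ u) → y ≡ y′ → assemble x y ≡ assemble x′ y′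
    assemble-cong {x = x} {x′} {y} p refl = Vec.tabulate-cong lemma
      where
      lemma : ∀ e → [ x , lookup y ]′ (pos e) ≡ [ x′ , lookup y ]′ (pos e)
      lemma e with pos e
      ... | inj₁ u = p u
      ... | inj₂ i = refl

    map-assemble : ∀ (g : A → X) x y → Vec.map g (assemble x y) ≡ assemble (g ∘ x) (Vec.map g y)
    map-assemble g x y = trans (sym (Vec.tabulate-∘ g _)) (Vec.tabulate-cong lemma)
      where
      lemma : ∀ e → g ([ x , lookup y ]′ (pos e)) ≡ [ g ∘ x , lookup (Vec.map g y) ]′ (pos e)
      lemma e with pos e
      ... | inj₁ u = refl
      ... | inj₂ i = sym (Vec.lookup-map i g y)

    assemble-All : ∀ (Q : A → Set) x y → (∀ u → Q (x u)) → (∀ i → Q (lookup y i)) → ∀ e → Q (lookup (assemble x y) e)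
    assemble-All Q x y p q e = subst Q (sym (lookup-assemble x y e)) (lemma e)
      where
      lemma : ∀ e → Q ([ x , lookup y ]′ (pos e))
      lemma e with pos e
      ... | inj₁ u = p u
      ... | inj₂ i = q i

    private
      ∑-assemble : ∀ (w : Edge (suc m) → Fin (suc m)) x y v →
        ∑ (λ e → if does (w (List.lookup G e) Fin.≟ v) then lookup (assemble x y) e else 0ℚ)
        ≡ ∑ (λ u → if does (w (toSink u) Fin.≟ v) then x u else 0ℚ)
          + ∑ (λ i → if does (w (List.lookup R i) Fin.≟ v) then lookup y i else 0ℚ)
      ∑-assemble w x y v = begin
        ∑ (λ e → if does (w (List.lookup G e) Fin.≟ v) then lookup (assemble x y) e else 0ℚ)
          ≡⟨ sum-cong-≗ (λ e → cong₂ (λ g z → if does (w g Fin.≟ v) then z else 0ℚ) (edges e) (lookup-assemble x y e)) ⟩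
        ∑ (λ e → h (position ⟨$⟩ʳ e))
          ≡⟨ sum-permute h position ⟨
        ∑ h
          ≡⟨ ∑-split m h ⟩
        ∑ (λ u → h (u ↑ˡ #E R)) + ∑ (λ i → h (m ↑ʳ i))
          ≡⟨ cong₂ _+_ (sum-cong-≗ (λ u → cong k (Fin.splitAt-↑ˡ m u (#E R)))) (sum-cong-≗ (λ i → cong k (Fin.splitAt-↑ʳ m (#E R) i))) ⟩
        ∑ (k ∘ inj₁) + ∑ (k ∘ inj₂) ∎
        where
        open ≡-Reasoning
        k : Fin m ⊎ Fin (#E R) → ℚ
        k s = if does (w ([ toSink , List.lookup R ]′ s) Fin.≟ v) then [ x , lookup y ]′ s else 0ℚ
        h : Fin (m ℕ.+ #E R) → ℚ
        h j = k (splitAt m j)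

    -- Tree edges end at the sink, so at any other vertex u the tree contributes only the edge
    -- leaving u.
    netflow-assemble : ∀ x y u → netflow G (assemble x y) (inject₁ u) ≡ x u + netflow R y (inject₁ u)
    netflow-assemble x y u = begin
      outflow G (assemble x y) (inject₁ u) - inflow G (assemble x y) (inject₁ u)
        ≡⟨ cong₂ _-_ (trans (∑-assemble src x y (inject₁ u)) (cong (_+ o) (∑-inject₁ x u)))
                     (trans (∑-assemble tgt x y (inject₁ u)) (trans (cong (_+ i) (trans (sum-cong-≗ {m} (λ v → if-cong {x = x v} {0ℚ} (fromℕ-≟ u))) (∑-0 m))) (ℚ.+-identityˡ i))) ⟩
      (x u + o) - i    ≡⟨ ℚ.+-assoc (x u) o (- i) ⟩
      x u + (o - i)    ∎
      where
      open ≡-Reasoning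
      o = outflow R y (inject₁ u)
      i = inflow R y (inject₁ u)

    module _ (a : Vec ℤ (suc m)) (a-balanced : ∑ (λ v → fromℤ (lookup a v)) ≡ 0ℚ) where

      -- The flow that conservation at u forces on the tree edge leaving u.
      slack : Vec ℚ (#E R) → Fin m → ℚ
      slack y u = fromℤ (lookup a (inject₁ u)) - netflow R y (inject₁ u)

      slack-unique : ∀ x y → FlowSpace G a (assemble x y) → ∀ u → x u ≡ slack y u
      slack-unique x y p u = trans (lemma (x u) (netflow R y (inject₁ u)))
        (cong (_- netflow R y (inject₁ u)) (trans (sym (netflow-assemble x y u)) (p (inject₁ u))))
        where
        lemma : ∀ x y → x ≡ (x + y) - y
        lemma = solve 2 (λ x y → x := (x :+ y) :- y) refl

      -- Away from the sink, conservation is the definition of `slack`. At the sink it follows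
      -- because the net flows and the entries of a both have sum 0.
      slack-flow : ∀ y → FlowSpace G a (assemble (slack y) y)
      slack-flow y v = Fin-last v
        where
        f = assemble (slack y) y
        lemma : ∀ a b → (a - b) + b ≡ a
        lemma = solve 2 (λ a b → (a :- b) :+ b := a) refl
        lemma′ : ∀ a b → b ≡ (a + b) - a
        lemma′ = solve 2 (λ a b → b := (a :+ b) :- a) refl
        inner≡ : ∀ u → netflow G f (inject₁ u) ≡ fromℤ (lookup a (inject₁ u))
        inner≡ u = trans (netflow-assemble (slack y) y u) (lemma (fromℤ (lookup a (inject₁ u))) (netflow R y (inject₁ u)))
        total : (g : Fin (suc m) → ℚ) → ∑ g ≡ ∑ (g ∘ inject₁) + g (fromℕ m)
        total g = sum-init-last g
        sink≡ : netflow G f (fromℕ m) ≡ fromℤ (lookup a (fromℕ m))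
        sink≡ = trans (lemma′ (∑ (netflow G f ∘ inject₁)) (netflow G f (fromℕ m))) (trans
          (cong₂ _-_ (trans (sym (total (netflow G f))) (trans (netflow-total G f) (trans (sym a-balanced) (total (λ v → fromℤ (lookup a v))))))
                     (sum-cong-≗ inner≡))
          (sym (lemma′ (∑ (λ u → fromℤ (lookup a (inject₁ u)))) (fromℤ (lookup a (fromℕ m))))))
        open import Data.Fin.Relation.Unary.Top using (view; ‵fromℕ; ‵inject₁)
        Fin-last : ∀ v → netflow G f v ≡ fromℤ (lookup a v)
        Fin-last v with view v
        ... | ‵fromℕ     = sink≡
        ... | ‵inject₁ u = inner≡ u

-- Lattice points and lattice charts of flow polytopes.

module FlowPolytopes where

  open Networks
  open Solutions
  open EdgeLists
  open Presentations
  open import Defs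
  open import Algebra.Bundles using (CommutativeRing)
  import Algebra.Definitions.RawMonoid
  import Algebra.Properties.CommutativeMonoid.Sum as CommutativeMonoidSum
  import Algebra.Properties.Semiring.Sum as SemiringSum
  open import Data.Bool.Base using (Bool; true; false; if_then_else_)
  open import Data.Fin.Base as Fin using (Fin; zero; suc; inject₁)
  import Data.Fin.Properties as Fin
  open import Data.Integer.Base as ℤ using (ℤ; +_; 0ℤ; 1ℤ)
  import Data.Integer.Properties as ℤ
  open import Data.List.Base as List using (List; []; _∷_; length)
  import Data.List.Properties as List
  open import Data.List.Membership.Propositional using (_∈_)
  import Data.List.Membership.Propositional.Properties as ∈
  open import Data.List.Membership.Propositional.Properties.WithK using (unique∧set⇒bag)
  open import Data.List.Relation.Binary.BagAndSetEquality using (∼bag⇒↭)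
  import Data.List.Relation.Binary.Permutation.Propositional.Properties as ↭
  open import Data.List.Relation.Unary.Unique.Propositional using (Unique)
  import Data.List.Relation.Unary.Unique.Propositional.Properties as Unique
  open import Data.Nat.Base as ℕ using (ℕ; zero; suc; z≤n)
  import Data.Nat.Properties as ℕ
  open import Data.Product.Base using (_×_; _,_; ∃-syntax)
  open import Data.Rational.Base as ℚ using (ℚ; 0ℚ; 1ℚ; _+_; _-_; _*_; -_; _≤_)
  open import Data.Rational.Literals using (fromℤ)
  import Data.Rational.Properties as ℚ
  open import Data.Vec.Base as Vec using (Vec; []; _∷_; lookup; tabulate; updateAt; replicate)
  import Data.Vec.Properties as Vec
  open import Function.Base using (_∘_)
  open import Function.Bundles using (_⇔_; mk⇔; Equivalence)
  open import Relation.Binary.PropositionalEquality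
  open import Relation.Nullary.Decidable using (does)
  open import Data.Rational.Solver using (module +-*-Solver)

  open +-*-Solver using (solve; _:=_; _:+_; _:*_; _:-_; con)

  private
    variable
      m n d N : ℕ
      A X : Set

  open Algebra.Definitions.RawMonoid ℚ.+-0-rawMonoid using () renaming (sum to ∑)
  open CommutativeMonoidSum (CommutativeRing.+-commutativeMonoid ℚ.+-*-commutativeRing)
    using (∑-distrib-+; sum-cong-≗)
  open SemiringSum (CommutativeRing.semiring ℚ.+-*-commutativeRing) using (*-distribˡ-sum)

  lookup-updateAt : ∀ (s : Vec A N) i f v → lookup (updateAt s i f) v ≡ (if does (i Fin.≟ v) then f (lookup s v) else lookup s v)
  lookup-updateAt (x ∷ s) zero    f zero    = refl
  lookup-updateAt (x ∷ s) zero    f (suc v) = refl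
  lookup-updateAt (x ∷ s) (suc i) f zero    = refl
  lookup-updateAt (x ∷ s) (suc i) f (suc v) = lookup-updateAt s i f v

  -- Connects the integral bookkeeping of `residual` with the rational `netflow`: what a vertex has
  -- shipped on balance is its initial amount minus what remains.
  residual-netflow : ∀ (R : Multigraph N) s z v →
    netflow R (toℚⁿ (Vec.map +_ z)) v ≡ fromℤ (lookup s v) - fromℤ (lookup (residual R s z) v)
  residual-netflow []      s []      v = sym (ℚ.+-inverseʳ (fromℤ (lookup s v)))
  residual-netflow (e ∷ R) s (q ∷ z) v = begin
    (out + o) - (inn + i)                   ≡⟨ rearrange₁ out o inn i ⟩
    (out - inn) + (o - i)                   ≡⟨ cong (λ w → (out - inn) + w) (residual-netflow R s′ z v) ⟩
    (out - inn) + (fromℤ (lookup s′ v) - r) ≡⟨ cong (λ w → (out - inn) + (w - r)) moved ⟩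
    (out - inn) + (((σ - out) + inn) - r)   ≡⟨ rearrange₂ out inn σ r ⟩
    σ - r                                   ∎
    where
    open ≡-Reasoning
    s′ = bump (tgt e) q (updateAt s (src e) (ℤ._- + q))
    out = if does (src e Fin.≟ v) then fromℤ (+ q) else 0ℚ
    inn = if does (tgt e Fin.≟ v) then fromℤ (+ q) else 0ℚ
    o = outflow R (toℚⁿ (Vec.map +_ z)) v
    i = inflow R (toℚⁿ (Vec.map +_ z)) v
    σ = fromℤ (lookup s v)
    r = fromℤ (lookup (residual R s′ z) v)
    rearrange₁ : ∀ a o b i → (a + o) - (b + i) ≡ (a - b) + (o - i)
    rearrange₁ = solve 4 (λ a o b i → (a :+ o) :- (b :+ i) := (a :- b) :+ (o :- i)) refl
    rearrange₂ : ∀ a b s r → (a - b) + (((s - a) + b) - r) ≡ s - r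
    rearrange₂ = solve 4 (λ a b s r → (a :- b) :+ (((s :- a) :+ b) :- r) := s :- r) refl
    moved : fromℤ (lookup s′ v) ≡ (σ - out) + inn
    moved = begin
      fromℤ (lookup s′ v)
        ≡⟨ cong fromℤ (trans (lookup-updateAt (updateAt s (src e) (ℤ._- + q)) (tgt e) (ℤ._+ + q) v)
             (cong (λ w → if does (tgt e Fin.≟ v) then w ℤ.+ + q else w) (lookup-updateAt s (src e) (ℤ._- + q) v))) ⟩
      fromℤ (let w = if does (src e Fin.≟ v) then lookup s v ℤ.- + q else lookup s v in if does (tgt e Fin.≟ v) then w ℤ.+ + q else w)
        ≡⟨ cases (does (src e Fin.≟ v)) (does (tgt e Fin.≟ v)) (lookup s v) ⟩
      (σ - out) + inn ∎
      where
      minus-0 : ∀ x → x ≡ x - 0ℚ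
      minus-0 = solve 1 (λ x → x := x :- con 0ℚ) refl
      cases : ∀ b b′ x → fromℤ (let w = if b then x ℤ.- + q else x in if b′ then w ℤ.+ + q else w)
              ≡ (fromℤ x - (if b then fromℤ (+ q) else 0ℚ)) + (if b′ then fromℤ (+ q) else 0ℚ)
      cases true  true  x = trans (fromℤ-+ (x ℤ.- + q) (+ q)) (cong (_+ fromℤ (+ q)) (fromℤ-minus x (+ q)))
      cases true  false x = trans (fromℤ-minus x (+ q)) (sym (ℚ.+-identityʳ _))
      cases false true  x = trans (fromℤ-+ x (+ q)) (cong (_+ fromℤ (+ q)) (minus-0 (fromℤ x)))
      cases false false x = trans (minus-0 (fromℤ x)) (sym (ℚ.+-identityʳ _))

  same-length : ∀ {xs ys : List A} → Unique xs → Unique ys → (∀ {x} → x ∈ xs ⇔ x ∈ ys) → length xs ≡ length ys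
  same-length u v p = ↭.↭-length (∼bag⇒↭ (unique∧set⇒bag u v p))

  toℚⁿ-injective : ∀ {y z : Vec ℤ n} → toℚⁿ y ≡ toℚⁿ z → y ≡ z
  toℚⁿ-injective {y = []}    {[]}    _  = refl
  toℚⁿ-injective {y = x ∷ y} {w ∷ z} eq = cong₂ _∷_ (fromℤ-injective (Vec.∷-injectiveˡ eq)) (toℚⁿ-injective (Vec.∷-injectiveʳ eq))

  map-∣∣ : ∀ (w : Vec ℤ n) → (∀ i → 0ℤ ℤ.≤ lookup w i) → Vec.map +_ (Vec.map ℤ.∣_∣ w) ≡ w
  map-∣∣ []      p = refl
  map-∣∣ (x ∷ w) p = cong₂ _∷_ (ℤ.0≤i⇒+∣i∣≡i (p zero)) (map-∣∣ w (p ∘ suc))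

  map-+-injective : ∀ {y z : Vec ℕ n} → Vec.map +_ y ≡ Vec.map +_ z → y ≡ z
  map-+-injective {y = []}    {[]}    _  = refl
  map-+-injective {y = x ∷ y} {w ∷ z} eq = cong₂ _∷_ (ℤ.+-injective (Vec.∷-injectiveˡ eq)) (map-+-injective (Vec.∷-injectiveʳ eq))

  Balanced : Vec ℤ N → Set
  Balanced a = ∑ (λ v → fromℤ (lookup a v)) ≡ 0ℚ

  module LatticePoints {G R : Multigraph (suc m)} (P : Presentation G R) (a : Vec ℤ (suc m)) (a-balanced : Balanced a) where
    open Assembly P

    -- The tree edge at u carries what remains there, so `Feasible` says exactly that the tree flow
    -- is nonnegative.
    point : Vec ℕ (#E R) → Vec ℤ (#E G)
    point y = assemble (λ u → lookup (residual R a y) (inject₁ u)) (Vec.map +_ y)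

    point-injective : ∀ {y z} → point y ≡ point z → y ≡ z
    point-injective eq = map-+-injective (trans (sym (restPart-assemble _ _)) (trans (cong restPart eq) (restPart-assemble _ _)))

    residual-slack : ∀ y u → fromℤ (lookup (residual R a y) (inject₁ u)) ≡ slack a a-balanced (toℚⁿ (Vec.map +_ y)) u
    residual-slack y u = trans (lemma (fromℤ (lookup a (inject₁ u))) _)
      (cong (λ w → fromℤ (lookup a (inject₁ u)) - w) (sym (residual-netflow R a y (inject₁ u))))
      where
      lemma : ∀ a r → r ≡ a - (a - r)
      lemma = solve 2 (λ a r → r := a :- (a :- r)) refl

    toℚⁿ-point : ∀ y → toℚⁿ (point y) ≡ assemble (slack a a-balanced (toℚⁿ (Vec.map +_ y))) (toℚⁿ (Vec.map +_ y))
    toℚⁿ-point y = trans (map-assemble fromℤ _ (Vec.map +_ y)) (assemble-cong {y = toℚⁿ (Vec.map +_ y)} (residual-slack y) refl)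

    point-lattice : ∀ y → Feasible R a y → LatticePoint G a (point y)
    point-lattice y f = (λ e → subst (0ℚ ≤_) (sym (Vec.lookup-map e fromℤ (point y)))
        (fromℤ-mono-≤ (assemble-All (0ℤ ℤ.≤_) _ (Vec.map +_ y) f (λ i → subst (0ℤ ℤ.≤_) (sym (Vec.lookup-map i +_ y)) (ℤ.+≤+ z≤n)) e)))
      , subst (FlowSpace G a) (sym (toℚⁿ-point y)) (slack-flow a a-balanced (toℚⁿ (Vec.map +_ y)))

    lattice-point : ∀ z → LatticePoint G a z → ∃[ y ] Feasible R a y × z ≡ point y
    lattice-point z (z≥0 , flow) = y , feasible , z≡
      where
      open ≡-Reasoning
      0≤z : ∀ e → 0ℤ ℤ.≤ lookup z e
      0≤z e = fromℤ-cancel-≤ (subst (0ℚ ≤_) (Vec.lookup-map e fromℤ z) (z≥0 e))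
      w = restPart z
      y = Vec.map ℤ.∣_∣ w
      +y≡w : Vec.map +_ y ≡ w
      +y≡w = map-∣∣ w (λ i → subst (0ℤ ℤ.≤_) (sym (Vec.lookup∘tabulate _ i)) (0≤z _))
      toℚⁿ-z : toℚⁿ z ≡ assemble (fromℤ ∘ treePart z) (toℚⁿ w)
      toℚⁿ-z = trans (cong toℚⁿ (sym (assemble-parts z))) (map-assemble fromℤ (treePart z) (restPart z))
      tree≡ : ∀ u → treePart z u ≡ lookup (residual R a y) (inject₁ u)
      tree≡ u = fromℤ-injective (begin
        fromℤ (treePart z u)                                     ≡⟨ slack-unique a a-balanced (fromℤ ∘ treePart z) (toℚⁿ w) (subst (FlowSpace G a) toℚⁿ-z flow) u ⟩
        slack a a-balanced (toℚⁿ w) u                            ≡⟨ cong (λ w → slack a a-balanced (toℚⁿ w) u) +y≡w ⟨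
        slack a a-balanced (toℚⁿ (Vec.map +_ y)) u               ≡⟨ residual-slack y u ⟨
        fromℤ (lookup (residual R a y) (inject₁ u))              ∎)
      feasible : Feasible R a y
      feasible u = subst (0ℤ ℤ.≤_) (tree≡ u) (0≤z _)
      z≡ : z ≡ point y
      z≡ = trans (sym (assemble-parts z)) (assemble-cong tree≡ (sym +y≡w))

  kostant-flows : ∀ (net : Net m) {G : Multigraph (suc m)} → Presentation G (netEdges net) →
                  ∀ a → Balanced a → kostant G a ≡ flows net a
  kostant-flows net {G} P a a-balanced = trans
    (same-length (Enumeration.unique (latticePoints G a))
      (Unique.map⁺ point-injective (solutions-unique net a))
      (λ {z} → mk⇔
        (λ z∈ → let y , f , z≡ = lattice-point z (Equivalence.to (Enumeration.correct (latticePoints G a)) z∈)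
                in subst (_∈ List.map point (solutions net a)) (sym z≡) (∈.∈-map⁺ point (solutions-complete net a f)))
        (λ z∈ → let y , y∈ , z≡ = ∈.∈-map⁻ point z∈
                in Equivalence.from (Enumeration.correct (latticePoints G a)) (subst (LatticePoint G a) (sym z≡) (point-lattice y (solutions-sound net a y∈))))))
    (trans (List.length-map point (solutions net a)) (length-solutions net a))
    where open LatticePoints P a a-balanced

  -- The flow polytope in the coordinates given by the edges outside the tree: nonnegativity of the
  -- tree flow turns conservation at u into an upper bound for the net flow there.
  Region : (R : Multigraph (suc m)) → Vec ℤ (suc m) → Vec ℚ (#E R) → Set
  Region R a y = (∀ i → 0ℚ ≤ lookup y i) × (∀ u → netflow R y (inject₁ u) ≤ fromℤ (lookup a (inject₁ u)))

  indicator : Bool → ℤ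
  indicator true  = 1ℤ
  indicator false = 0ℤ

  module _ (R : Multigraph N) where
    incidence : Fin (#E R) → Fin N → ℤ
    incidence i v = indicator (does (src (List.lookup R i) Fin.≟ v)) ℤ.- indicator (does (tgt (List.lookup R i) Fin.≟ v))

    netflow-incidence : ∀ y v → netflow R y v ≡ ∑ (λ i → lookup y i * fromℤ (incidence i v))
    netflow-incidence y v = trans (sym (∑-minus (λ i → if does (src (List.lookup R i) Fin.≟ v) then lookup y i else 0ℚ) (λ i → if does (tgt (List.lookup R i) Fin.≟ v) then lookup y i else 0ℚ))) (sum-cong-≗ (λ i →
      trans (cases (does (src (List.lookup R i) Fin.≟ v)) (does (tgt (List.lookup R i) Fin.≟ v)) (lookup y i))
        (cong (lookup y i *_) (sym (fromℤ-minus (indicator (does (src (List.lookup R i) Fin.≟ v))) (indicator (does (tgt (List.lookup R i) Fin.≟ v))))))))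
      where
      identity₁ : ∀ y → y - y ≡ y * (1ℚ - 1ℚ)
      identity₁ = solve 1 (λ y → y :- y := y :* (con 1ℚ :- con 1ℚ)) refl
      identity₂ : ∀ y → y - 0ℚ ≡ y * (1ℚ - 0ℚ)
      identity₂ = solve 1 (λ y → y :- con 0ℚ := y :* (con 1ℚ :- con 0ℚ)) refl
      identity₃ : ∀ y → 0ℚ - y ≡ y * (0ℚ - 1ℚ)
      identity₃ = solve 1 (λ y → con 0ℚ :- y := y :* (con 0ℚ :- con 1ℚ)) refl
      identity₄ : ∀ y → 0ℚ - 0ℚ ≡ y * (0ℚ - 0ℚ)
      identity₄ = solve 1 (λ y → con 0ℚ :- con 0ℚ := y :* (con 0ℚ :- con 0ℚ)) refl
      cases : ∀ b b′ y → (if b then y else 0ℚ) - (if b′ then y else 0ℚ) ≡ y * (fromℤ (indicator b) - fromℤ (indicator b′))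
      cases true  true  = identity₁
      cases true  false = identity₂
      cases false true  = identity₃
      cases false false = identity₄

  module Chart {G R : Multigraph (suc m)} (P : Presentation G R) (a : Vec ℤ (suc m)) (a-balanced : Balanced a) where
    open Assembly P
    private
      σ = slack a a-balanced

      origin : Vec ℤ (#E G)
      origin = assemble (λ u → lookup a (inject₁ u)) (replicate (#E R) 0ℤ)

      -- One unit along edge i, balanced by tree edges: the signed fundamental cycle of i.
      basis : Fin (#E R) → Vec ℤ (#E G)
      basis i = assemble (λ u → ℤ.- incidence R i (inject₁ u)) (tabulate (λ j → indicator (does (i Fin.≟ j))))

      param : Vec ℚ (#E R) → Vec ℚ (#E G)
      param y = tabulate λ e → fromℤ (lookup origin e) + ∑ λ i → lookup y i * fromℤ (lookup (basis i) e)

      param-assemble : ∀ y → param y ≡ assemble (σ y) y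
      param-assemble y = trans (sym (assemble-parts (param y))) (assemble-cong tree rest)
        where
        open ≡-Reasoning
        tree : ∀ u → treePart (param y) u ≡ σ y u
        tree u = begin
          treePart (param y) u
            ≡⟨ Vec.lookup∘tabulate _ (at₁ u) ⟩
          fromℤ (treePart origin u) + ∑ (λ i → lookup y i * fromℤ (treePart (basis i) u))
            ≡⟨ cong₂ (λ p q → fromℤ p + q) (treePart-assemble _ (replicate (#E R) 0ℤ) u) (sum-cong-≗ (λ i → trans
                 (cong (λ w → lookup y i * fromℤ w) (treePart-assemble _ (tabulate (λ j → indicator (does (i Fin.≟ j)))) u))
                 (trans (cong (lookup y i *_) (fromℤ-neg (incidence R i (inject₁ u)))) (sym (ℚ.neg-distribʳ-* (lookup y i) _))))) ⟩
          fromℤ (lookup a (inject₁ u)) + ∑ (λ i → - (lookup y i * fromℤ (incidence R i (inject₁ u))))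
            ≡⟨ cong (λ w → fromℤ (lookup a (inject₁ u)) + w) (∑-neg (λ i → lookup y i * fromℤ (incidence R i (inject₁ u)))) ⟩
          fromℤ (lookup a (inject₁ u)) - ∑ (λ i → lookup y i * fromℤ (incidence R i (inject₁ u)))
            ≡⟨ cong (λ w → fromℤ (lookup a (inject₁ u)) - w) (netflow-incidence R y (inject₁ u)) ⟨
          σ y u ∎
        rest : restPart (param y) ≡ y
        rest = trans (Vec.tabulate-cong entry) (Vec.tabulate∘lookup y)
          where
          scale : ∀ b (x : ℚ) → x * fromℤ (indicator b) ≡ (if b then x else 0ℚ)
          scale true  x = ℚ.*-identityʳ x
          scale false x = ℚ.*-zeroʳ x
          entry : ∀ j → lookup (param y) (at₂ j) ≡ lookup y j
          entry j = begin
            lookup (param y) (at₂ j)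
              ≡⟨ Vec.lookup∘tabulate _ (at₂ j) ⟩
            fromℤ (lookup origin (at₂ j)) + ∑ (λ i → lookup y i * fromℤ (lookup (basis i) (at₂ j)))
              ≡⟨ cong₂ (λ p q → fromℤ p + q)
                   (trans (lookup-assemble-at₂ _ (replicate (#E R) 0ℤ) j) (Vec.lookup-replicate j 0ℤ))
                   (sum-cong-≗ (λ i → trans (cong (λ w → lookup y i * fromℤ w)
                       (trans (lookup-assemble-at₂ _ (tabulate (λ j → indicator (does (i Fin.≟ j)))) j) (Vec.lookup∘tabulate _ j)))
                     (trans (scale (does (i Fin.≟ j)) (lookup y i)) (if-cong (≟-sym i j))))) ⟩
            0ℚ + ∑ (λ i → if does (j Fin.≟ i) then lookup y i else 0ℚ)
              ≡⟨ trans (ℚ.+-identityˡ _) (∑-single j (lookup y)) ⟩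
            lookup y j ∎

    -- The tree flow is an affine function of the other coordinates with integral coefficients, so
    -- integer points correspond to integer points in both directions.
    chart : LatticeChart (FlowSpace G a) (#E R)
    chart = record
      { origin = origin
      ; basis  = basis
      ; into   = λ y → subst (FlowSpace G a) (sym (param-assemble (toℚⁿ y))) (slack-flow a a-balanced (toℚⁿ y))
      ; onto   = λ z flow → restPart z
          , trans (param-assemble (toℚⁿ (restPart z)))
              (sym (trans (decompose z) (assemble-cong {y = toℚⁿ (restPart z)} (slack-unique a a-balanced (fromℤ ∘ treePart z) (toℚⁿ (restPart z)) (subst (FlowSpace G a) (decompose z) flow)) refl)))
          , λ {y} eq → toℚⁿ-injective (trans (sym (restPart-assemble (fromℤ ∘ treePart z) (toℚⁿ (restPart z))))
              (trans (cong restPart (trans (sym (decompose z)) (trans (sym eq) (param-assemble (toℚⁿ y))))) (restPart-assemble (σ (toℚⁿ y)) (toℚⁿ y))))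
      }
      where
      decompose : ∀ z → toℚⁿ z ≡ assemble (fromℤ ∘ treePart z) (toℚⁿ (restPart z))
      decompose z = trans (cong toℚⁿ (sym (assemble-parts z))) (map-assemble fromℤ (treePart z) (restPart z))

    chart-polytope : ∀ y → FlowPolytope G a (LatticeChart.param chart y) ⇔ Region R a y
    chart-polytope y = mk⇔
      (λ (f≥0 , _) → let g≥0 = subst (λ f → ∀ e → 0ℚ ≤ lookup f e) (param-assemble y) f≥0 in
          (λ i → subst (0ℚ ≤_) (trans (sym (Vec.lookup∘tabulate _ i)) (cong (λ v → lookup v i) (restPart-assemble (σ y) y))) (g≥0 _))
        , (λ u → ℚ.≤-trans (ℚ.≤-reflexive (lemma₁ (netflow R y (inject₁ u)) (fromℤ (lookup a (inject₁ u)))))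
            (ℚ.≤-trans (ℚ.+-monoʳ-≤ (netflow R y (inject₁ u)) (subst (0ℚ ≤_) (treePart-assemble (σ y) y u) (g≥0 _)))
              (ℚ.≤-reflexive (lemma₂ (netflow R y (inject₁ u)) (fromℤ (lookup a (inject₁ u))))))))
      (λ (y≥0 , cap) →
          subst (λ f → ∀ e → 0ℚ ≤ lookup f e) (sym (param-assemble y)) (assemble-All (0ℚ ≤_) (σ y) y
            (λ u → subst (_≤ σ y u) (ℚ.+-inverseʳ (netflow R y (inject₁ u))) (ℚ.+-monoˡ-≤ (- netflow R y (inject₁ u)) (cap u))) y≥0)
        , subst (FlowSpace G a) (sym (param-assemble y)) (slack-flow a a-balanced y))
      where
      lemma₁ : ∀ n a → n ≡ n + 0ℚ
      lemma₁ = solve 2 (λ n a → n := n :+ con 0ℚ) refl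
      lemma₂ : ∀ n a → n + (a - n) ≡ a
      lemma₂ = solve 2 (λ n a → n :+ (a :- n) := a) refl

  IsVolume-⇔ : ∀ {P Q : Vec ℚ d → Set} {v} → (∀ y → P y ⇔ Q y) → IsVolume Q v → IsVolume P v
  IsVolume-⇔ {P = P} {Q} P⇔Q vol ε 0<ε with vol ε 0<ε
  ... | (inner-boxes , disjoint , ⊆Q , lower) , (outer-boxes , Q⊆ , upper) =
      (inner-boxes , disjoint , All.map (λ B⊆Q y y∈B → Equivalence.from (P⇔Q y) (B⊆Q y y∈B)) ⊆Q , lower)
    , (outer-boxes , (λ y Py → Q⊆ y (Equivalence.to (P⇔Q y) Py)) , upper)
    where import Data.List.Relation.Unary.All as All

  normalizedVolume : ∀ {G R : Multigraph (suc m)} → Presentation G R → ∀ a → Balanced a → ∀ w →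
    IsVolume (Region R a) w → IsNormalizedVolume (FlowSpace G a) (FlowPolytope G a) (fromℤ (+ ((#E R) ℕ.!)) * w)
  normalizedVolume {R = R} P a a-balanced w vol = #E R , chart , w , IsVolume-⇔ {v = w} chart-polytope vol , refl
    where open Chart P a a-balanced

-- Bounds for the inner and outer flow counts.

module Asymptotics where

  open Networks
  open Solutions
  open Presentations
  open FlowPolytopes
  open import Defs
  open import Data.Fin.Base using (zero; suc)
  open import Data.Integer.Base as ℤ using (ℤ; +_; -[1+_]; 1ℤ)
  import Data.Integer.Properties as ℤ
  open import Data.List.Base as List using (List; []; _∷_)
  import Data.List.Properties as List
  open import Data.Nat.Base as ℕ using (ℕ; zero; suc; z≤n; s≤s; _^_; _!)
  import Data.Nat.DivMod as ℕ
  import Data.Nat.Properties as ℕ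
  open import Data.Nat.Tactic.RingSolver using (solve-∀)
  open import Data.Product.Base using (_×_; _,_; ∃-syntax)
  open import Data.Rational.Base as ℚ using (ℚ; mkℚ; 0ℚ; _+_; _-_; _*_; -_; _≤_; _<_)
  open import Data.Rational.Literals using (fromℤ)
  import Data.Rational.Properties as ℚ
  import Data.Rational.Unnormalised.Base as ℚᵘ
  import Data.Rational.Unnormalised.Properties as ℚᵘ
  open import Data.Vec.Base as Vec using (Vec; []; _∷_; replicate)
  import Data.Vec.Properties as Vec
  open import Relation.Binary.PropositionalEquality

  private
    variable
      m n : ℕ

  #E-netEdges : ∀ (net : Net n) → #E (netEdges net) ≡ dim net
  #E-netEdges []         = refl
  #E-netEdges (os ∷ net) = trans (List.length-++ (List.map fromZero os))
    (cong₂ ℕ._+_ (List.length-map fromZero os) (trans (List.length-map shift (netEdges net)) (#E-netEdges net)))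

  unitSource : ∀ n → Vec ℕ (suc n)
  unitSource n = 1 ∷ replicate n 0

  private
    E-replicate-0 : ∀ n k F → E (replicate n 0) k F ≡ B 0 k ℕ.* F (replicate n 0)
    E-replicate-0 zero    k F = refl
    E-replicate-0 (suc n) k F = trans
      (Δ-cong k (λ y k′ → cong (B 0 y ℕ.*_) (E-replicate-0 n k′ (λ ys → F (y ∷ ys)))))
      (pick k)
      where
      pick : ∀ k → Δ k (λ y k′ → B 0 y ℕ.* (B 0 k′ ℕ.* F (y ∷ replicate n 0))) ≡ B 0 k ℕ.* F (0 ∷ replicate n 0)
      pick zero    = ℕ.+-identityʳ _
      pick (suc k) = Δ-ε k

    -- Only the source has a slot: `B 1` is constantly 1 and `B 0` vanishes on positive inflow, so
    -- all k units enter at the source.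
    E-unitSource : ∀ n k F → E (unitSource n) k F ≡ F (k ∷ replicate n 0)
    E-unitSource n k F = trans
      (Δ-cong k (λ y k′ → trans (cong₂ ℕ._*_ (B1 y) (E-replicate-0 n k′ (λ ys → F (y ∷ ys)))) (ℕ.+-identityʳ _)))
      (pick k F)
      where
      pick : ∀ k (F : Vec ℕ (suc n) → ℕ) → Δ k (λ y k′ → B 0 k′ ℕ.* F (y ∷ replicate n 0)) ≡ F (k ∷ replicate n 0)
      pick zero    F = ℕ.+-identityʳ _
      pick (suc k) F = pick k (λ where (y ∷ ys) → F (suc y ∷ ys))

    sum-replicate-0 : ∀ n → Vec.sum (replicate n 0) ≡ 0
    sum-replicate-0 zero    = refl
    sum-replicate-0 (suc n) = sum-replicate-0 n

  -- The normalized volume: the flows with net flow 0 at the source and (indegree - 1) elsewhere.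
  volume : Net m → ℕ
  volume {m} net = flows net (indegrees net ⊞ unitSource m ∸1)

  -- States for cells of side 1/k, scaled by k. Within a cell the net flow exceeds its value at the
  -- lower corner by at most the outdegree times the side, which the inner state subtracts. Rounding
  -- a point down to a corner raises the net flow by at most the indegree; the outer state allows
  -- for the number of all listed edges instead.
  innerState outerState : Net m → ℕ → Vec ℤ (suc m)
  innerState {m} net k = Vec.map (λ o → ℤ.- (+ o)) (outdegrees net) ⊕ (k ∷ replicate m 0)
  outerState {m} net k = Vec.map +_ (replicate (suc m) (dim net)) ⊕ (k ∷ replicate m 0)

  inner-count : ∀ (net : Net m) M → volume net ℕ.* B (suc (dim net)) M ℕ.≤ flows net (innerState net (M ℕ.+ dim net))
  inner-count {m} net M = subst₂ ℕ._≤_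
    (cong (λ k → volume net ℕ.* B k M) (cong (λ s → suc (s ℕ.+ dim net)) (sum-replicate-0 m)))
    (E-unitSource m (M ℕ.+ dim net) (λ ys → flows net (Vec.map (λ o → ℤ.- (+ o)) (outdegrees net) ⊕ ys))) (flows-lower net (unitSource m) M)

  outer-count : ∀ (net : Net m) → Positive (Vec.zipWith ℕ._+_ (indegrees net) (unitSource m)) → ∀ k →
    flows net (outerState net k) ℕ.≤ volume net ℕ.* B (suc (dim net)) (k ℕ.+ Vec.sum (replicate (suc m) (dim net)))
  outer-count {m} net p k = subst₂ ℕ._≤_
    (E-unitSource m k (λ ys → flows net (Vec.map +_ (replicate (suc m) (dim net)) ⊕ ys)))
    (cong (λ j → volume net ℕ.* B j (k ℕ.+ Vec.sum (replicate (suc m) (dim net)))) (cong (λ s → suc (s ℕ.+ dim net)) (sum-replicate-0 m)))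
    (flows-upper net (unitSource m) (replicate (suc m) (dim net)) k p)

  -- Bernoulli's inequality (M/N)^d ≥ 1 - d k/N for N = M + k, with denominators cleared.
  power-shift : ∀ M k d → (M ℕ.+ k) ℕ.* (M ℕ.+ k) ^ d ℕ.≤ (M ℕ.+ k) ℕ.* M ^ d ℕ.+ d ℕ.* k ℕ.* (M ℕ.+ k) ^ d
  power-shift M k zero    = ℕ.m≤m+n _ _
  power-shift M k (suc d) = begin
    N ℕ.* (N ℕ.* N ^ d)                                      ≤⟨ ℕ.*-monoʳ-≤ N (power-shift M k d) ⟩
    N ℕ.* (N ℕ.* M ^ d ℕ.+ d ℕ.* k ℕ.* N ^ d)                ≡⟨ lemma₁ M k (M ^ d) d (N ^ d) ⟩
    N ℕ.* (M ℕ.* M ^ d) ℕ.+ (k ℕ.* (N ℕ.* M ^ d) ℕ.+ d ℕ.* k ℕ.* (N ℕ.* N ^ d))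
      ≤⟨ ℕ.+-monoʳ-≤ (N ℕ.* (M ℕ.* M ^ d)) (ℕ.+-monoˡ-≤ (d ℕ.* k ℕ.* (N ℕ.* N ^ d)) (ℕ.*-monoʳ-≤ k (ℕ.*-monoʳ-≤ N (ℕ.^-monoˡ-≤ d (ℕ.m≤m+n M k))))) ⟩
    N ℕ.* (M ℕ.* M ^ d) ℕ.+ (k ℕ.* (N ℕ.* N ^ d) ℕ.+ d ℕ.* k ℕ.* (N ℕ.* N ^ d))
      ≡⟨ lemma₂ (N ℕ.* (M ℕ.* M ^ d)) k (N ℕ.* N ^ d) d ⟩
    N ℕ.* (M ℕ.* M ^ d) ℕ.+ suc d ℕ.* k ℕ.* (N ℕ.* N ^ d)    ∎
    where
    open ℕ.≤-Reasoning
    N = M ℕ.+ k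
    lemma₁ : ∀ M k p d q → (M ℕ.+ k) ℕ.* ((M ℕ.+ k) ℕ.* p ℕ.+ d ℕ.* k ℕ.* q)
             ≡ (M ℕ.+ k) ℕ.* (M ℕ.* p) ℕ.+ (k ℕ.* ((M ℕ.+ k) ℕ.* p) ℕ.+ d ℕ.* k ℕ.* ((M ℕ.+ k) ℕ.* q))
    lemma₁ = solve-∀
    lemma₂ : ∀ a k b d → a ℕ.+ (k ℕ.* b ℕ.+ d ℕ.* k ℕ.* b) ≡ a ℕ.+ (k ℕ.+ d ℕ.* k) ℕ.* b
    lemma₂ = solve-∀

  -- With x = k/N ≤ 1 this is (1 + x)^d ≤ 1 + 3^d x. The base 3 suffices since (1 + t x)(1 + x) = 1
  -- + (t + 1) x + t x^2 ≤ 1 + 3 t x for t ≥ 1.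
  power-growth : ∀ k N d → k ℕ.≤ N → N ℕ.* (N ℕ.+ k) ^ d ℕ.≤ (N ℕ.+ 3 ^ d ℕ.* k) ℕ.* N ^ d
  power-growth k N zero    k≤N = ℕ.≤-trans (ℕ.m≤m+n (N ℕ.* 1) ((k ℕ.+ 0) ℕ.* 1)) (ℕ.≤-reflexive (sym (ℕ.*-distribʳ-+ 1 N (k ℕ.+ 0))))
  power-growth k N (suc d) k≤N = begin
    N ℕ.* ((N ℕ.+ k) ℕ.* (N ℕ.+ k) ^ d)
      ≡⟨ lemma₀ N (N ℕ.+ k) _ ⟩
    N ℕ.* (N ℕ.+ k) ^ d ℕ.* (N ℕ.+ k)
      ≤⟨ ℕ.*-monoˡ-≤ (N ℕ.+ k) (power-growth k N d k≤N) ⟩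
    (N ℕ.+ t ℕ.* k) ℕ.* N ^ d ℕ.* (N ℕ.+ k)
      ≡⟨ lemma₁ N t k (N ^ d) ⟩
    (N ℕ.* N ℕ.+ (N ℕ.* k ℕ.+ t ℕ.* (N ℕ.* k)) ℕ.+ t ℕ.* (k ℕ.* k)) ℕ.* N ^ d
      ≤⟨ ℕ.*-monoˡ-≤ (N ^ d) (ℕ.+-mono-≤ (ℕ.+-monoʳ-≤ (N ℕ.* N) (ℕ.+-monoˡ-≤ (t ℕ.* (N ℕ.* k)) Nk≤)) (ℕ.*-monoʳ-≤ t (ℕ.*-monoˡ-≤ k k≤N))) ⟩
    (N ℕ.* N ℕ.+ (t ℕ.* (N ℕ.* k) ℕ.+ t ℕ.* (N ℕ.* k)) ℕ.+ t ℕ.* (N ℕ.* k)) ℕ.* N ^ d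
      ≡⟨ lemma₂ N t k (N ^ d) ⟩
    (N ℕ.+ 3 ℕ.* t ℕ.* k) ℕ.* (N ℕ.* N ^ d) ∎
    where
    open ℕ.≤-Reasoning
    t = 3 ^ d
    Nk≤ : N ℕ.* k ℕ.≤ t ℕ.* (N ℕ.* k)
    Nk≤ = ℕ.≤-trans (ℕ.≤-reflexive (sym (ℕ.*-identityˡ (N ℕ.* k)))) (ℕ.*-monoˡ-≤ (N ℕ.* k) (ℕ.m^n>0 3 d))
    lemma₀ : ∀ N a b → N ℕ.* (a ℕ.* b) ≡ N ℕ.* b ℕ.* a
    lemma₀ = solve-∀
    lemma₁ : ∀ N t k p → (N ℕ.+ t ℕ.* k) ℕ.* p ℕ.* (N ℕ.+ k) ≡ (N ℕ.* N ℕ.+ (N ℕ.* k ℕ.+ t ℕ.* (N ℕ.* k)) ℕ.+ t ℕ.* (k ℕ.* k)) ℕ.* p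
    lemma₁ = solve-∀
    lemma₂ : ∀ N t k p → (N ℕ.* N ℕ.+ (t ℕ.* (N ℕ.* k) ℕ.+ t ℕ.* (N ℕ.* k)) ℕ.+ t ℕ.* (N ℕ.* k)) ℕ.* p ≡ (N ℕ.+ 3 ℕ.* t ℕ.* k) ℕ.* (N ℕ.* p)
    lemma₂ = solve-∀

  -- Divided by N^(d+1) this reads V ≤ d! · count / N^d + V d^2 / N. The total left in the inner
  -- binomial coefficient is M = N - d, and `power-shift` replaces M^d by N^d at the cost of the
  -- last term.
  inner-bound : ∀ (net : Net m) M → let d = dim net; N = M ℕ.+ d in
    volume net ℕ.* (N ℕ.* N ^ d) ℕ.≤ N ℕ.* (d ! ℕ.* flows net (innerState net N)) ℕ.+ volume net ℕ.* (d ℕ.* d) ℕ.* N ^ d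
  inner-bound net M = begin
    V ℕ.* (N ℕ.* N ^ d)                               ≤⟨ ℕ.*-monoʳ-≤ V (power-shift M d d) ⟩
    V ℕ.* (N ℕ.* M ^ d ℕ.+ d ℕ.* d ℕ.* N ^ d)         ≤⟨ ℕ.*-monoʳ-≤ V (ℕ.+-monoˡ-≤ (d ℕ.* d ℕ.* N ^ d) (ℕ.*-monoʳ-≤ N (^≤!*B d M))) ⟩
    V ℕ.* (N ℕ.* (d ! ℕ.* B (suc d) M) ℕ.+ d ℕ.* d ℕ.* N ^ d) ≡⟨ lemma V N (d !) (B (suc d) M) (d ℕ.* d) (N ^ d) ⟩
    N ℕ.* (d ! ℕ.* (V ℕ.* B (suc d) M)) ℕ.+ V ℕ.* (d ℕ.* d) ℕ.* N ^ d
      ≤⟨ ℕ.+-monoˡ-≤ (V ℕ.* (d ℕ.* d) ℕ.* N ^ d) (ℕ.*-monoʳ-≤ N (ℕ.*-monoʳ-≤ (d !) (inner-count net M))) ⟩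
    N ℕ.* (d ! ℕ.* flows net (innerState net N)) ℕ.+ V ℕ.* (d ℕ.* d) ℕ.* N ^ d ∎
    where
    open ℕ.≤-Reasoning
    d = dim net
    N = M ℕ.+ d
    V = volume net
    lemma : ∀ V N f b e p → V ℕ.* (N ℕ.* (f ℕ.* b) ℕ.+ e ℕ.* p) ≡ N ℕ.* (f ℕ.* (V ℕ.* b)) ℕ.+ V ℕ.* e ℕ.* p
    lemma = solve-∀

  -- The enlarged capacities add `dim net` units for each of the m + 1 entries of the state, and the
  -- bound `!*B≤^` on the rising factorial adds another `dim net`.
  outer-excess : Net m → ℕ
  outer-excess {m} net = Vec.sum (replicate (suc m) (dim net)) ℕ.+ dim net

  outer-bound : ∀ (net : Net m) → Positive (Vec.zipWith ℕ._+_ (indegrees net) (unitSource m)) →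
    let d = dim net; K = outer-excess net in ∀ N → K ℕ.≤ N →
    N ℕ.* (d ! ℕ.* flows net (outerState net N)) ℕ.≤ volume net ℕ.* (N ℕ.* N ^ d) ℕ.+ volume net ℕ.* (3 ^ d ℕ.* K) ℕ.* N ^ d
  outer-bound {m} net p N K≤N = begin
    N ℕ.* (d ! ℕ.* flows net (outerState net N))      ≤⟨ ℕ.*-monoʳ-≤ N (ℕ.*-monoʳ-≤ (d !) (outer-count net p N)) ⟩
    N ℕ.* (d ! ℕ.* (V ℕ.* B (suc d) (N ℕ.+ μ)))        ≡⟨ lemma₁ N (d !) V _ ⟩
    V ℕ.* (N ℕ.* (d ! ℕ.* B (suc d) (N ℕ.+ μ)))        ≤⟨ ℕ.*-monoʳ-≤ V (ℕ.*-monoʳ-≤ N (!*B≤^ d (N ℕ.+ μ))) ⟩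
    V ℕ.* (N ℕ.* (N ℕ.+ μ ℕ.+ d) ^ d)                 ≡⟨ cong (λ k → V ℕ.* (N ℕ.* k ^ d)) (ℕ.+-assoc N μ d) ⟩
    V ℕ.* (N ℕ.* (N ℕ.+ K) ^ d)                       ≤⟨ ℕ.*-monoʳ-≤ V (power-growth K N d K≤N) ⟩
    V ℕ.* ((N ℕ.+ 3 ^ d ℕ.* K) ℕ.* N ^ d)             ≡⟨ lemma₂ V N (3 ^ d ℕ.* K) (N ^ d) ⟩
    V ℕ.* (N ℕ.* N ^ d) ℕ.+ V ℕ.* (3 ^ d ℕ.* K) ℕ.* N ^ d ∎
    where
    open ℕ.≤-Reasoning
    d = dim net
    V = volume net
    μ = Vec.sum (replicate (suc m) (dim net))
    K = outer-excess net
    lemma₁ : ∀ N f V b → N ℕ.* (f ℕ.* (V ℕ.* b)) ≡ V ℕ.* (N ℕ.* (f ℕ.* b))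
    lemma₁ = solve-∀
    lemma₂ : ∀ V N k p → V ℕ.* ((N ℕ.+ k) ℕ.* p) ≡ V ℕ.* (N ℕ.* p) ℕ.+ V ℕ.* k ℕ.* p
    lemma₂ = solve-∀

  floorℕ : ∀ x → 0ℚ ≤ x → ∃[ z ] fromℤ (+ z) ≤ x × x ≤ fromℤ (+ suc z)
  floorℕ (mkℚ -[1+ _ ] _ _) (ℚ.*≤* ())
  floorℕ x@(mkℚ (+ k) q-1 _) _ = z , ℚ.*≤* lower , ℚ.*≤* upper
    where
    q = suc q-1
    z = k ℕ./ q
    division : k ≡ k ℕ.% q ℕ.+ z ℕ.* q
    division = ℕ.m≡m%n+[m/n]*n k q
    lower : + z ℤ.* + q ℤ.≤ + k ℤ.* 1ℤ
    lower = subst₂ ℤ._≤_ (ℤ.pos-* z q) (sym (ℤ.*-identityʳ (+ k)))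
      (ℤ.+≤+ (ℕ.≤-trans (ℕ.m≤n+m (z ℕ.* q) (k ℕ.% q)) (ℕ.≤-reflexive (sym division))))
    upper : + k ℤ.* 1ℤ ℤ.≤ + suc z ℤ.* + q
    upper = subst₂ ℤ._≤_ (sym (ℤ.*-identityʳ (+ k))) (ℤ.pos-* (suc z) q)
      (ℤ.+≤+ (ℕ.≤-trans (ℕ.≤-reflexive division) (ℕ.+-monoˡ-≤ (z ℕ.* q) (ℕ.<⇒≤ (ℕ.m%n<n k q)))))

  archimedean : ∀ ε → 0ℚ < ε → ∀ X → ∃[ N₀ ] ∀ N → N₀ ℕ.≤ N → fromℤ (+ X) < ε * fromℤ (+ N)
  archimedean (mkℚ -[1+ _ ] _ _)     (ℚ.*<* ()) X
  archimedean (mkℚ (+ 0) _ _)        (ℚ.*<* (ℤ.+<+ ())) X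
  -- For ε = (p + 1)/q the claim is X q < (p + 1) N, which N ≥ (X + 1) q implies.
  archimedean ε@(mkℚ (+ suc p) q-1 _) _ X = suc X ℕ.* q , λ N N₀≤N →
    ℚ.toℚᵘ-cancel-< (ℚᵘ.<-respʳ-≃ (ℚᵘ.≃-sym (ℚ.toℚᵘ-homo-* ε (fromℤ (+ N)))) (ℚᵘ.*<* (subst₂ ℤ._<_
      (ℤ.pos-* X (q ℕ.* 1)) (trans (cong +_ (sym (ℕ.*-identityʳ (suc p ℕ.* N)))) (trans (ℤ.pos-* (suc p ℕ.* N) 1) (cong (ℤ._* 1ℤ) (ℤ.pos-* (suc p) N))))
      (ℤ.+<+ (begin-strict
        X ℕ.* (q ℕ.* 1)   ≡⟨ cong (X ℕ.*_) (ℕ.*-identityʳ q) ⟩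
        X ℕ.* q           <⟨ ℕ.m<n+m (X ℕ.* q) (s≤s z≤n) ⟩
        suc X ℕ.* q       ≤⟨ N₀≤N ⟩
        N                 ≤⟨ ℕ.m≤m+n N (p ℕ.* N) ⟩
        suc p ℕ.* N       ∎)))))
    where
    open ℕ.≤-Reasoning
    q = suc q-1

-- Grid cells inside and around the region.

module CellDecomposition where

  open Networks
  open Solutions
  open Presentations
  open FlowPolytopes
  open Asymptotics
  open import Defs
  open import Algebra.Bundles using (CommutativeRing)
  import Algebra.Definitions.RawMonoid
  import Algebra.Properties.CommutativeMonoid.Sum as CommutativeMonoidSum
  import Algebra.Properties.Semiring.Sum as SemiringSum
  open import Data.Bool.Base using (true; false; if_then_else_)
  open import Data.Fin.Base as Fin using (Fin; zero; suc; fromℕ; inject₁)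
  import Data.Fin.Properties as Fin
  open import Data.Integer.Base as ℤ using (ℤ; +_; 1ℤ)
  import Data.Integer.Properties as ℤ
  open import Data.List.Base as List using (List; []; _∷_; length)
  open import Data.List.Relation.Unary.All using ([]; _∷_)
  open import Data.List.Relation.Unary.AllPairs using ([]; _∷_)
  open import Data.Nat.Base as ℕ using (ℕ; zero; suc; z≤n; s≤s; _^_)
  import Data.Nat.Properties as ℕ
  open import Data.Product.Base using (_×_; _,_; proj₁; proj₂; ∃-syntax)
  open import Data.Rational.Base as ℚ using (ℚ; 0ℚ; 1ℚ; _+_; _-_; _*_; -_; _≤_)
  open import Data.Rational.Literals using (fromℤ)
  import Data.Rational.Properties as ℚ
  open import Data.Sum.Base using (inj₁; inj₂)
  open import Data.Vec.Base as Vec using (Vec; []; _∷_; lookup; replicate)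
  import Data.Vec.Properties as Vec
  open import Function.Base using (_∘_)
  open import Relation.Binary.PropositionalEquality
  open import Relation.Binary.Definitions using (tri<; tri≈; tri>)
  open import Relation.Nullary.Decidable using (yes; no; does)
  open import Relation.Nullary.Negation using (contradiction; ¬_)
  open import Data.Rational.Solver using (module +-*-Solver)

  open +-*-Solver using (solve; _:=_; _:+_; _:*_; _:-_; :-_; con)

  private
    variable
      m n d N : ℕ

  open Algebra.Definitions.RawMonoid ℚ.+-0-rawMonoid using () renaming (sum to ∑)
  open Algebra.Definitions.RawMonoid ℚ.*-1-rawMonoid using () renaming (sum to ∏)
  open CommutativeMonoidSum (CommutativeRing.+-commutativeMonoid ℚ.+-*-commutativeRing)
    using (∑-distrib-+; sum-cong-≗)
  open SemiringSum (CommutativeRing.semiring ℚ.+-*-commutativeRing) using (*-distribʳ-sum)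

  ∑-mono : {f g : Fin n → ℚ} → (∀ i → f i ≤ g i) → ∑ f ≤ ∑ g
  ∑-mono {zero}  f≤g = ℚ.≤-refl
  ∑-mono {suc n} f≤g = ℚ.+-mono-≤ (f≤g zero) (∑-mono (f≤g ∘ suc))

  ∏-cong : {f g : Fin n → ℚ} → (∀ i → f i ≡ g i) → ∏ f ≡ ∏ g
  ∏-cong {zero}  p = refl
  ∏-cong {suc n} p = cong₂ _*_ (p zero) (∏-cong (p ∘ suc))

  ∏-zero : (f : Fin n → ℚ) → ∀ i → f i ≡ 0ℚ → ∏ f ≡ 0ℚ
  ∏-zero f zero    p = trans (cong (_* ∏ (f ∘ suc)) p) (ℚ.*-zeroˡ (∏ (f ∘ suc)))
  ∏-zero f (suc i) p = trans (cong (f zero *_) (∏-zero (f ∘ suc) i p)) (ℚ.*-zeroʳ (f zero))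

  -- `outflow` and `inflow` in one, for a flow given as a function: the corners of a cell then need
  -- not be packed into vectors.
  flowAt : (Fin d → Fin N) → (Fin d → ℚ) → Fin N → ℚ
  flowAt w g v = ∑ λ e → if does (w e Fin.≟ v) then g e else 0ℚ

  module _ (w : Fin d → Fin N) (v : Fin N) where
    private
      at : (Fin d → ℚ) → Fin d → ℚ
      at g e = if does (w e Fin.≟ v) then g e else 0ℚ

    flowAt-mono : ∀ {g h} → (∀ e → g e ≤ h e) → flowAt w g v ≤ flowAt w h v
    flowAt-mono {g} {h} g≤h = ∑-mono lemma
      where
      lemma : ∀ e → (if does (w e Fin.≟ v) then g e else 0ℚ) ≤ (if does (w e Fin.≟ v) then h e else 0ℚ)
      lemma e with does (w e Fin.≟ v)
      ... | true  = g≤h e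
      ... | false = ℚ.≤-refl

    flowAt-cong : ∀ {g h} → (∀ e → g e ≡ h e) → flowAt w g v ≡ flowAt w h v
    flowAt-cong p = sum-cong-≗ (λ e → cong (λ x → if does (w e Fin.≟ v) then x else 0ℚ) (p e))

    flowAt-+ : ∀ g h → flowAt w (λ e → g e + h e) v ≡ flowAt w g v + flowAt w h v
    flowAt-+ g h = trans (sum-cong-≗ lemma) (∑-distrib-+ (at g) (at h))
      where
      lemma : ∀ e → (if does (w e Fin.≟ v) then g e + h e else 0ℚ)
              ≡ (if does (w e Fin.≟ v) then g e else 0ℚ) + (if does (w e Fin.≟ v) then h e else 0ℚ)
      lemma e with does (w e Fin.≟ v)
      ... | true  = refl
      ... | false = refl

    flowAt-* : ∀ g c → flowAt w (λ e → g e * c) v ≡ flowAt w g v * c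
    flowAt-* g c = trans (sum-cong-≗ lemma) (sym (*-distribʳ-sum c (at g)))
      where
      lemma : ∀ e → (if does (w e Fin.≟ v) then g e * c else 0ℚ) ≡ (if does (w e Fin.≟ v) then g e else 0ℚ) * c
      lemma e with does (w e Fin.≟ v)
      ... | true  = refl
      ... | false = sym (ℚ.*-zeroˡ c)

    flowAt-≥0 : ∀ {g} → (∀ e → 0ℚ ≤ g e) → 0ℚ ≤ flowAt w g v
    flowAt-≥0 {g} g≥0 = subst (_≤ flowAt w g v) (trans (sum-cong-≗ lemma) (∑-0 d)) (flowAt-mono g≥0)
      where
      lemma : ∀ e → (if does (w e Fin.≟ v) then 0ℚ else 0ℚ) ≡ 0ℚ
      lemma e with does (w e Fin.≟ v)
      ... | true  = refl
      ... | false = refl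

    flowAt-term : ∀ {g} → (∀ e → 0ℚ ≤ g e) → ∀ e → w e ≡ v → g e ≤ flowAt w g v
    flowAt-term {g} g≥0 e we≡v = subst₂ _≤_ (∑-single e g) refl (∑-mono lemma)
      where
      lemma : ∀ e′ → (if does (e Fin.≟ e′) then g e′ else 0ℚ) ≤ (if does (w e′ Fin.≟ v) then g e′ else 0ℚ)
      lemma e′ with e Fin.≟ e′ | w e′ Fin.≟ v
      ... | yes _    | yes _ = ℚ.≤-refl
      ... | yes refl | no ¬p = contradiction we≡v ¬p
      ... | no _     | yes _ = g≥0 e′
      ... | no _     | no _  = ℚ.≤-refl

    flowAt-none : ∀ g → (∀ e → ¬ w e ≡ v) → flowAt w g v ≡ 0ℚ
    flowAt-none g none = trans (sum-cong-≗ lemma) (∑-0 d)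
      where
      lemma : ∀ e → (if does (w e Fin.≟ v) then g e else 0ℚ) ≡ 0ℚ
      lemma e with w e Fin.≟ v
      ... | yes p = contradiction p (none e)
      ... | no _  = refl

    flowAt-one≤ : flowAt w (λ _ → 1ℚ) v ≤ fromℤ (+ d)
    flowAt-one≤ = ℚ.≤-trans (∑-mono lemma) (ℚ.≤-reflexive (ones d))
      where
      lemma : ∀ e → (if does (w e Fin.≟ v) then 1ℚ else 0ℚ) ≤ 1ℚ
      lemma e with does (w e Fin.≟ v)
      ... | true  = ℚ.≤-refl
      ... | false = ℚ.*≤* (ℤ.+≤+ z≤n)
      ones : ∀ d → ∑ {d} (λ _ → 1ℚ) ≡ fromℤ (+ d)
      ones zero    = refl
      ones (suc d) = trans (cong (λ w → 1ℚ + w) (ones d)) (sym (trans (cong fromℤ (ℤ.pos-+ 1 d)) (fromℤ-+ 1ℤ (+ d))))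

  degree : (Edge N → Fin N) → Multigraph N → Fin N → ℕ
  degree w []      v = 0
  degree w (e ∷ R) v = (if does (w e Fin.≟ v) then 1 else 0) ℕ.+ degree w R v

  flowAt-degree : ∀ (w : Edge N → Fin N) R v → flowAt (w ∘ List.lookup R) (λ _ → 1ℚ) v ≡ fromℤ (+ degree w R v)
  flowAt-degree w []      v = refl
  flowAt-degree w (e ∷ R) v = trans (cong₂ _+_ (lemma (does (w e Fin.≟ v))) (flowAt-degree w R v))
    (sym (trans (cong fromℤ (ℤ.pos-+ (if does (w e Fin.≟ v) then 1 else 0) (degree w R v)))
      (fromℤ-+ (+ (if does (w e Fin.≟ v) then 1 else 0)) (+ degree w R v))))
    where
    lemma : ∀ b → (if b then 1ℚ else 0ℚ) ≡ fromℤ (+ (if b then 1 else 0))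
    lemma true  = refl
    lemma false = refl

  private
    degree-src-shift : ∀ (R : Multigraph N) v → degree src (List.map shift R) (suc v) ≡ degree src R v
    degree-src-shift []      v = refl
    degree-src-shift (e ∷ R) v = cong (_ ℕ.+_) (degree-src-shift R v)

    degree-src-shift-zero : ∀ (R : Multigraph N) → degree src (List.map shift R) zero ≡ 0
    degree-src-shift-zero []      = refl
    degree-src-shift-zero (e ∷ R) = degree-src-shift-zero R

    degree-tgt-shift : ∀ (R : Multigraph N) v → degree tgt (List.map shift R) (suc v) ≡ degree tgt R v
    degree-tgt-shift []      v = refl
    degree-tgt-shift (e ∷ R) v = cong (_ ℕ.+_) (degree-tgt-shift R v)

    degree-tgt-shift-zero : ∀ (R : Multigraph N) → degree tgt (List.map shift R) zero ≡ 0
    degree-tgt-shift-zero []      = refl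
    degree-tgt-shift-zero (e ∷ R) = degree-tgt-shift-zero R

  outdegrees-degree : ∀ (net : Net n) v → degree src (netEdges net) v ≡ lookup (outdegrees net) v
  outdegrees-degree []         zero = refl
  outdegrees-degree (os ∷ net) = go os
    where
    go : ∀ os v → degree src (netEdges (os ∷ net)) v ≡ lookup (length os ∷ outdegrees net) v
    go []       zero    = degree-src-shift-zero (netEdges net)
    go []       (suc v) = trans (degree-src-shift (netEdges net) v) (outdegrees-degree net v)
    go (o ∷ os) zero    = cong suc (go os zero)
    go (o ∷ os) (suc v) = go os (suc v)

  -- Restricted to vertices other than the sink because `indegrees` also counts the implicit edges,
  -- all of which end there.
  indegrees-degree : ∀ (net : Net n) u → degree tgt (netEdges net) (inject₁ u) ≡ lookup (indegrees net) (inject₁ u)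
  indegrees-degree (os ∷ net) = go os
    where
    go : ∀ os u → degree tgt (netEdges (os ∷ net)) (inject₁ u) ≡ lookup (0 ∷ incoming os (indegrees net)) (inject₁ u)
    go []       zero    = degree-tgt-shift-zero (netEdges net)
    go []       (suc u) = trans (degree-tgt-shift (netEdges net) (inject₁ u)) (trans (indegrees-degree net u)
      (sym (trans (lookup-updateAt (indegrees net) (fromℕ _) (1 ℕ.+_) (inject₁ u)) (if-cong (fromℕ-≟ u)))))
    go (o ∷ os) zero    = go os zero
    go (o ∷ os) (suc u) = trans (cong ((if does (o Fin.≟ inject₁ u) then 1 else 0) ℕ.+_) (go os (suc u)))
      (sym (trans (lookup-updateAt (incoming os (indegrees net)) o (1 ℕ.+_) (inject₁ u)) (lemma (does (o Fin.≟ inject₁ u)) _)))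
      where
      lemma : ∀ b x → (if b then suc x else x) ≡ (if b then 1 else 0) ℕ.+ x
      lemma true  x = refl
      lemma false x = refl

  indegrees-sink : ∀ (net : Net (suc n)) → 1 ℕ.≤ lookup (indegrees net) (fromℕ (suc n))
  indegrees-sink (os ∷ net) = go os
    where
    go : ∀ os → 1 ℕ.≤ lookup (incoming os (indegrees net)) (fromℕ _)
    go []       = subst (1 ℕ.≤_) (sym (trans (Vec.lookup∘updateAt (fromℕ _) (indegrees net)) refl)) (s≤s z≤n)
    go (o ∷ os) = subst (1 ℕ.≤_) (sym (lookup-updateAt (incoming os (indegrees net)) o (1 ℕ.+_) (fromℕ _)))
      (lemma (does (o Fin.≟ fromℕ _)) (go os))
      where
      lemma : ∀ b {x} → 1 ℕ.≤ x → 1 ℕ.≤ (if b then suc x else x)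
      lemma true  _ = s≤s z≤n
      lemma false p = p

  fromℤ-suc : ∀ k → fromℤ (+ suc k) ≡ fromℤ (+ k) + 1ℚ
  fromℤ-suc k = trans (cong (fromℤ ∘ +_) (ℕ.+-comm 1 k)) (trans (cong fromℤ (ℤ.pos-+ k 1)) (fromℤ-+ (+ k) 1ℤ))

  fromℕ-* : ∀ i j → fromℤ (+ (i ℕ.* j)) ≡ fromℤ (+ i) * fromℤ (+ j)
  fromℕ-* i j = trans (cong fromℤ (ℤ.pos-* i j)) (fromℤ-* (+ i) (+ j))

  fromℕ-+ : ∀ i j → fromℤ (+ (i ℕ.+ j)) ≡ fromℤ (+ i) + fromℤ (+ j)
  fromℕ-+ i j = trans (cong fromℤ (ℤ.pos-+ i j)) (fromℤ-+ (+ i) (+ j))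

  fromℕ-mono : ∀ {i j} → i ℕ.≤ j → fromℤ (+ i) ≤ fromℤ (+ j)
  fromℕ-mono i≤j = fromℤ-mono-≤ (ℤ.+≤+ i≤j)

  fromℕ≥0 : ∀ i → 0ℚ ≤ fromℤ (+ i)
  fromℕ≥0 i = fromℕ-mono {0} {i} z≤n

  *-monoʳ : ∀ {x y} c → 0ℚ ≤ c → x ≤ y → x * c ≤ y * c
  *-monoʳ c 0≤c = ℚ.*-monoʳ-≤-nonNeg c ⦃ ℚ.nonNegative 0≤c ⦄

  record Mesh (k : ℕ) : Set where
    field
      width   : ℚ
      width≥0 : 0ℚ ≤ width
      inverse : fromℤ (+ k) * width ≡ 1ℚ

  open Mesh

  mesh : ∀ k → Mesh (suc k)
  mesh k = record
    { width   = ℚ.1/ K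
    ; width≥0 = ℚ.*≤* (ℤ.+≤+ z≤n)
    ; inverse = ℚ.*-inverseʳ K
    }
    where
    K = fromℤ (+ suc k)

  powℚ : ℚ → ℕ → ℚ
  powℚ c d = ∏ {d} (λ _ → c)

  powℚ-≥0 : ∀ c d → 0ℚ ≤ c → 0ℚ ≤ powℚ c d
  powℚ-≥0 c zero    0≤c = ℚ.*≤* (ℤ.+≤+ z≤n)
  powℚ-≥0 c (suc d) 0≤c = subst (_≤ c * powℚ c d) (ℚ.*-zeroˡ (powℚ c d)) (*-monoʳ (powℚ c d) (powℚ-≥0 c d 0≤c) 0≤c)

  powℚ-inverse : ∀ k c d → fromℤ (+ k) * c ≡ 1ℚ → fromℤ (+ (k ^ d)) * powℚ c d ≡ 1ℚ
  powℚ-inverse k c zero    p = refl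
  powℚ-inverse k c (suc d) p = trans (cong (_* powℚ c (suc d)) (fromℕ-* k (k ^ d)))
    (trans (lemma (fromℤ (+ k)) (fromℤ (+ (k ^ d))) c (powℚ c d)) (trans (cong₂ _*_ p (powℚ-inverse k c d p)) refl))
    where
    lemma : ∀ a b c d → (a * b) * (c * d) ≡ (a * c) * (b * d)
    lemma = solve 4 (λ a b c d → (a :* b) :* (c :* d) := (a :* c) :* (b :* d)) refl

  module Cells {k : ℕ} (M : Mesh k) where
    private
      c = width M

    corner : ℕ → ℚ
    corner j = fromℤ (+ j) * c

    corner-mono : ∀ {i j} → i ℕ.≤ j → corner i ≤ corner j
    corner-mono i≤j = *-monoʳ c (width≥0 M) (fromℕ-mono i≤j)

    cell : Vec ℕ d → Box d
    cell z = record
      { lo = Vec.map corner z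
      ; hi = Vec.map (corner ∘ suc) z
      ; lo≤hi = λ i → subst₂ _≤_ (sym (Vec.lookup-map i corner z)) (sym (Vec.lookup-map i (corner ∘ suc) z)) (corner-mono (ℕ.n≤1+n _))
      }

    cell-volume : ∀ (z : Vec ℕ d) → boxVolume (cell z) ≡ powℚ c d
    cell-volume z = ∏-cong (λ i → trans (cong₂ _-_ (Vec.lookup-map i (corner ∘ suc) z) (Vec.lookup-map i corner z))
      (trans (cong (λ x → x * c - corner (lookup z i)) (fromℤ-suc (lookup z i))) (lemma (fromℤ (+ lookup z i)) c)))
      where
      lemma : ∀ x c → (x + 1ℚ) * c - x * c ≡ c
      lemma = solve 2 (λ x c → (x :+ con 1ℚ) :* c :- x :* c := c) refl

    cells-volume : ∀ (zs : List (Vec ℕ d)) → totalVolume (List.map cell zs) ≡ fromℤ (+ length zs) * powℚ c d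
    cells-volume {d} []       = sym (ℚ.*-zeroˡ (powℚ c d))
    cells-volume {d} (z ∷ zs) = trans (cong₂ _+_ (cell-volume z) (cells-volume zs))
      (trans (lemma (fromℤ (+ length zs)) (powℚ c d)) (cong (_* powℚ c d) (sym (fromℤ-suc (length zs)))))
      where
      lemma : ∀ l p → p + l * p ≡ (l + 1ℚ) * p
      lemma = solve 2 (λ l p → p :+ l :* p := (l :+ con 1ℚ) :* p) refl

    -- Distinct corners differ in some coordinate, where a grid hyperplane separates the two cells.
    cells-disjoint : ∀ {y z : Vec ℕ d} → ¬ y ≡ z → NonOverlapping (cell y) (cell z)
    cells-disjoint {y = []}    {[]}    y≢z = contradiction refl y≢z
    cells-disjoint {y = i ∷ y} {j ∷ z} y≢z with ℕ.<-cmp i j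
    ... | tri< i<j _ _ = zero , inj₁ (corner-mono i<j)
    ... | tri> _ _ j<i = zero , inj₂ (corner-mono j<i)
    ... | tri≈ _ refl _ with e , p ← cells-disjoint {y = y} {z} (y≢z ∘ cong (i ∷_)) = suc e , p

    ∈cell : ∀ {y : Vec ℚ d} {z} → (∀ e → fromℤ (+ lookup z e) ≤ fromℤ (+ k) * lookup y e) →
            (∀ e → fromℤ (+ k) * lookup y e ≤ fromℤ (+ suc (lookup z e))) → y ∈Box cell z
    ∈cell {y = y} {z} lower upper e =
        subst₂ _≤_ (sym (Vec.lookup-map e corner z)) (rescale (lookup y e)) (*-monoʳ c (width≥0 M) (lower e))
      , subst₂ _≤_ (rescale (lookup y e)) (sym (Vec.lookup-map e (corner ∘ suc) z)) (*-monoʳ c (width≥0 M) (upper e))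
      where
      lemma : ∀ k y c → (k * y) * c ≡ y * (k * c)
      lemma = solve 3 (λ k y c → (k :* y) :* c := y :* (k :* c)) refl
      rescale : ∀ y → (fromℤ (+ k) * y) * c ≡ y
      rescale y = trans (lemma (fromℤ (+ k)) y c) (trans (cong (y *_) (inverse M)) (ℚ.*-identityʳ y))

  netflow-flowAt : ∀ (R : Multigraph N) (z : Vec ℕ (#E R)) v →
    netflow R (toℚⁿ (Vec.map +_ z)) v
    ≡ flowAt (src ∘ List.lookup R) (λ e → fromℤ (+ lookup z e)) v - flowAt (tgt ∘ List.lookup R) (λ e → fromℤ (+ lookup z e)) v
  netflow-flowAt R z v = cong₂ _-_ (flowAt-cong (src ∘ List.lookup R) v entry) (flowAt-cong (tgt ∘ List.lookup R) v entry)
    where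
    entry : ∀ e → lookup (toℚⁿ (Vec.map +_ z)) e ≡ fromℤ (+ lookup z e)
    entry e = trans (Vec.lookup-map e fromℤ (Vec.map +_ z)) (cong fromℤ (Vec.lookup-map e +_ z))

  module RegionCells (net : Net m) (a : Vec ℤ (suc m))
                     (a-source : ∀ u → lookup a (inject₁ u) ≡ + lookup (unitSource m) (inject₁ u)) where
    private
      R = netEdges net
      source = src ∘ List.lookup R
      target = tgt ∘ List.lookup R
      one : Fin (#E R) → ℚ
      one _ = 1ℚ

      supply : ∀ k (u : Fin m) → fromℤ (+ lookup (k ∷ replicate m 0) (inject₁ u)) ≡ fromℤ (+ k) * fromℤ (lookup a (inject₁ u))
      supply k u = trans (lemma (inject₁ u)) (cong (λ x → fromℤ (+ k) * fromℤ x) (sym (a-source u)))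
        where
        lemma : ∀ (v : Fin (suc m)) → fromℤ (+ lookup (k ∷ replicate m 0) v) ≡ fromℤ (+ k) * fromℤ (+ lookup (unitSource m) v)
        lemma zero    = sym (ℚ.*-identityʳ (fromℤ (+ k)))
        lemma (suc v) = trans (cong (λ x → fromℤ (+ x)) (Vec.lookup-replicate v 0))
          (trans (sym (ℚ.*-zeroʳ (fromℤ (+ k)))) (cong (λ x → fromℤ (+ k) * fromℤ (+ x)) (sym (Vec.lookup-replicate v 0))))

      ⊕-lookup : ∀ (s : Vec ℤ (suc m)) k u → fromℤ (lookup (s ⊕ (k ∷ replicate m 0)) (inject₁ u))
                 ≡ fromℤ (lookup s (inject₁ u)) + fromℤ (+ k) * fromℤ (lookup a (inject₁ u))
      ⊕-lookup s k u = trans (cong fromℤ (Vec.lookup-zipWith _ (inject₁ u) s (k ∷ replicate m 0)))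
        (trans (fromℤ-+ (lookup s (inject₁ u)) (+ lookup (k ∷ replicate m 0) (inject₁ u))) (cong (λ x → fromℤ (lookup s (inject₁ u)) + x) (supply k u)))

      out-one : ∀ v → flowAt source one v ≡ fromℤ (+ lookup (outdegrees net) v)
      out-one v = trans (flowAt-degree src R v) (cong (fromℤ ∘ +_) (outdegrees-degree net v))

    module _ {k : ℕ} (M : Mesh k) where
      open Cells M
      private
        c = width M

      -- At a point of the cell the outflow is at most that of the upper corner and the inflow at
      -- least that of the lower corner. The resulting excess, the outdegree times the width, is
      -- what `innerState` reserves.
      inner-cell : ∀ {z} → Feasible R (innerState net k) z → ∀ y → y ∈Box cell z → Region R a y
      inner-cell {z} feasible y y∈ = y≥0 , λ u → begin
        flowAt source (lookup y) (inject₁ u) - flowAt target (lookup y) (inject₁ u)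
          ≤⟨ ℚ.+-mono-≤ (flowAt-mono source (inject₁ u) upper) (ℚ.neg-antimono-≤ (flowAt-mono target (inject₁ u) lower)) ⟩
        flowAt source (λ e → (ζ e + 1ℚ) * c) (inject₁ u) - flowAt target (λ e → ζ e * c) (inject₁ u)
          ≡⟨ cong₂ _-_ (trans (flowAt-* source (inject₁ u) (λ e → ζ e + 1ℚ) c) (cong (_* c) (flowAt-+ source (inject₁ u) ζ one)))
                       (flowAt-* target (inject₁ u) ζ c) ⟩
        (O u + out u) * c - I u * c
          ≡⟨ lemma₁ (O u) (out u) (I u) c ⟩
        ((O u - I u) + out u) * c
          ≤⟨ *-monoʳ c (width≥0 M) (ℚ.+-monoˡ-≤ (out u) (capacity u)) ⟩
        ((- out u + fromℤ (+ k) * A u) + out u) * c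
          ≡⟨ lemma₂ (out u) (fromℤ (+ k)) (A u) c ⟩
        A u * (fromℤ (+ k) * c)
          ≡⟨ trans (cong (A u *_) (inverse M)) (ℚ.*-identityʳ (A u)) ⟩
        A u ∎
        where
        open ℚ.≤-Reasoning
        ζ : Fin (#E R) → ℚ
        ζ e = fromℤ (+ lookup z e)
        O I out A : Fin m → ℚ
        O u = flowAt source ζ (inject₁ u)
        I u = flowAt target ζ (inject₁ u)
        out u = flowAt source one (inject₁ u)
        A u = fromℤ (lookup a (inject₁ u))
        lower : ∀ e → ζ e * c ≤ lookup y e
        lower e = subst (_≤ lookup y e) (Vec.lookup-map e corner z) (proj₁ (y∈ e))
        upper : ∀ e → lookup y e ≤ (ζ e + 1ℚ) * c
        upper e = subst (lookup y e ≤_) (trans (Vec.lookup-map e (corner ∘ suc) z) (cong (_* c) (fromℤ-suc (lookup z e)))) (proj₂ (y∈ e))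
        y≥0 : ∀ e → 0ℚ ≤ lookup y e
        y≥0 e = ℚ.≤-trans (subst (_≤ ζ e * c) (ℚ.*-zeroˡ c) (*-monoʳ c (width≥0 M) (fromℕ≥0 (lookup z e)))) (lower e)
        lemma₁ : ∀ o d i c → (o + d) * c - i * c ≡ ((o - i) + d) * c
        lemma₁ = solve 4 (λ o d i c → (o :+ d) :* c :- i :* c := ((o :- i) :+ d) :* c) refl
        lemma₂ : ∀ d k a c → ((- d + k * a) + d) * c ≡ a * (k * c)
        lemma₂ = solve 4 (λ d k a c → ((:- d :+ k :* a) :+ d) :* c := a :* (k :* c)) refl
        lemma₃ : ∀ s → s - 0ℚ ≡ s
        lemma₃ = solve 1 (λ s → s :- con 0ℚ := s) refl
        capacity : ∀ u → O u - I u ≤ - out u + fromℤ (+ k) * A u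
        capacity u = begin
          O u - I u
            ≡⟨ trans (sym (netflow-flowAt R z (inject₁ u))) (residual-netflow R (innerState net k) z (inject₁ u)) ⟩
          fromℤ (lookup (innerState net k) (inject₁ u)) - fromℤ (lookup (residual R (innerState net k) z) (inject₁ u))
            ≤⟨ ℚ.+-monoʳ-≤ (fromℤ (lookup (innerState net k) (inject₁ u))) (ℚ.neg-antimono-≤ (fromℤ-mono-≤ (feasible u))) ⟩
          fromℤ (lookup (innerState net k) (inject₁ u)) - 0ℚ
            ≡⟨ lemma₃ _ ⟩
          fromℤ (lookup (innerState net k) (inject₁ u))
            ≡⟨ ⊕-lookup (Vec.map (λ o → ℤ.- (+ o)) (outdegrees net)) k u ⟩
          fromℤ (lookup (Vec.map (λ o → ℤ.- (+ o)) (outdegrees net)) (inject₁ u)) + fromℤ (+ k) * A u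
            ≡⟨ cong (_+ fromℤ (+ k) * A u) (trans (cong fromℤ (Vec.lookup-map (inject₁ u) (λ o → ℤ.- (+ o)) (outdegrees net)))
                 (trans (fromℤ-neg (+ lookup (outdegrees net) (inject₁ u))) (cong -_ (sym (out-one (inject₁ u)))))) ⟩
          - out u + fromℤ (+ k) * A u ∎

      -- The corner arises by rounding k y down. This does not increase the outflow and lowers the
      -- inflow by at most the indegree, which `outerState` makes up for with `dim net`.
      outer-cell : ∀ y → Region R a y → ∃[ z ] Feasible R (outerState net k) z × y ∈Box cell z
      outer-cell y (y≥0 , cap) = z , feasible
        , ∈cell {y = y} {z} (λ e → subst (λ j → fromℤ (+ j) ≤ fromℤ (+ k) * lookup y e) (sym (Vec.lookup∘tabulate (proj₁ ∘ floor) e)) (proj₁ (proj₂ (floor e))))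
                (λ e → subst (λ j → fromℤ (+ k) * lookup y e ≤ fromℤ (+ suc j)) (sym (Vec.lookup∘tabulate (proj₁ ∘ floor) e)) (proj₂ (proj₂ (floor e))))
        where
        open ℚ.≤-Reasoning
        K = fromℤ (+ k)
        floor : ∀ e → ∃[ z ] fromℤ (+ z) ≤ K * lookup y e × K * lookup y e ≤ fromℤ (+ suc z)
        floor e = floorℕ (K * lookup y e) (subst (_≤ K * lookup y e) (ℚ.*-zeroˡ (lookup y e)) (*-monoʳ (lookup y e) (y≥0 e) (fromℕ≥0 k)))
        z = Vec.tabulate (proj₁ ∘ floor)
        ζ : Fin (#E R) → ℚ
        ζ e = fromℤ (+ lookup z e)
        below : ∀ e → ζ e ≤ lookup y e * K
        below e = subst₂ _≤_ (cong (fromℤ ∘ +_) (sym (Vec.lookup∘tabulate (proj₁ ∘ floor) e))) (ℚ.*-comm K (lookup y e)) (proj₁ (proj₂ (floor e)))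
        above : ∀ e → lookup y e * K ≤ ζ e + 1ℚ
        above e = subst₂ _≤_ (ℚ.*-comm K (lookup y e))
          (trans (fromℤ-suc (proj₁ (floor e))) (cong (λ j → fromℤ (+ j) + 1ℚ) (sym (Vec.lookup∘tabulate (proj₁ ∘ floor) e)))) (proj₂ (proj₂ (floor e)))
        O I inn A : Fin m → ℚ
        O u = flowAt source ζ (inject₁ u)
        I u = flowAt target ζ (inject₁ u)
        inn u = flowAt target one (inject₁ u)
        A u = fromℤ (lookup a (inject₁ u))
        D = fromℤ (+ dim net)
        I≥ : ∀ u → flowAt target (lookup y) (inject₁ u) * K - inn u ≤ I u
        I≥ u = begin
          flowAt target (lookup y) (inject₁ u) * K - inn u
            ≡⟨ cong (_- inn u) (sym (flowAt-* target (inject₁ u) (lookup y) K)) ⟩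
          flowAt target (λ e → lookup y e * K) (inject₁ u) - inn u
            ≤⟨ ℚ.+-monoˡ-≤ (- inn u) (flowAt-mono target (inject₁ u) above) ⟩
          flowAt target (λ e → ζ e + 1ℚ) (inject₁ u) - inn u
            ≡⟨ trans (cong (_- inn u) (flowAt-+ target (inject₁ u) ζ one)) (lemma (I u) (inn u)) ⟩
          I u ∎
          where
          lemma : ∀ i n → (i + n) - n ≡ i
          lemma = solve 2 (λ i n → (i :+ n) :- n := i) refl
        bound : ∀ u → O u - I u ≤ D + K * A u
        bound u = begin
          O u - I u
            ≤⟨ ℚ.+-mono-≤ (flowAt-mono source (inject₁ u) below) (ℚ.neg-antimono-≤ (I≥ u)) ⟩
          flowAt source (λ e → lookup y e * K) (inject₁ u) - (flowAt target (lookup y) (inject₁ u) * K - inn u)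
            ≡⟨ cong (_- (flowAt target (lookup y) (inject₁ u) * K - inn u)) (flowAt-* source (inject₁ u) (lookup y) K) ⟩
          outflow R y (inject₁ u) * K - (inflow R y (inject₁ u) * K - inn u)
            ≡⟨ lemma (outflow R y (inject₁ u)) K (inflow R y (inject₁ u)) (inn u) ⟩
          inn u + netflow R y (inject₁ u) * K
            ≤⟨ ℚ.+-mono-≤ (ℚ.≤-trans (flowAt-one≤ target (inject₁ u)) (ℚ.≤-reflexive (cong (fromℤ ∘ +_) (#E-netEdges net))))
                          (*-monoʳ K (fromℕ≥0 k) (cap u)) ⟩
          D + A u * K
            ≡⟨ cong (λ x → D + x) (ℚ.*-comm (A u) K) ⟩
          D + K * A u ∎
          where
          lemma : ∀ o k i n → o * k - (i * k - n) ≡ n + (o - i) * k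
          lemma = solve 4 (λ o k i n → o :* k :- (i :* k :- n) := n :+ (o :- i) :* k) refl
        feasible : Feasible R (outerState net k) z
        feasible u = fromℤ-cancel-≤ (begin
          0ℚ                               ≡⟨ ℚ.+-inverseʳ (O u - I u) ⟨
          (O u - I u) - (O u - I u)        ≤⟨ ℚ.+-monoˡ-≤ (- (O u - I u)) (bound u) ⟩
          (D + K * A u) - (O u - I u)
            ≡⟨ cong₂ _-_ (trans (cong (λ x → fromℤ x + K * A u) (sym (trans (Vec.lookup-map (inject₁ u) +_ (replicate (suc m) (dim net))) (cong +_ (Vec.lookup-replicate (inject₁ u) (dim net))))))
                                (sym (⊕-lookup (Vec.map +_ (replicate (suc m) (dim net))) k u)))
                         (trans (sym (netflow-flowAt R z (inject₁ u))) (residual-netflow R (outerState net k) z (inject₁ u))) ⟩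
          s - (s - r)                      ≡⟨ lemma s r ⟩
          r                                ∎)
          where
          s = fromℤ (lookup (outerState net k) (inject₁ u))
          r = fromℤ (lookup (residual R (outerState net k) z) (inject₁ u))
          lemma : ∀ s r → s - (s - r) ≡ r
          lemma = solve 2 (λ s r → s :- (s :- r) := r) refl

-- The volume of the region from cell counts.

module RegionVolumes where

  open Networks
  open Solutions
  open Presentations
  open FlowPolytopes
  open Asymptotics
  open CellDecomposition
  open import Defs
  import Algebra.Definitions.RawMonoid
  open import Data.Bool.Base using (true; false; if_then_else_)
  open import Data.Fin.Base as Fin using (Fin; suc; fromℕ; inject₁)
  import Data.Fin.Properties as Fin
  open import Data.Fin.Relation.Unary.Top using (view; ‵fromℕ; ‵inject₁)
  open import Data.Integer.Base as ℤ using (ℤ; +_; 0ℤ; 1ℤ; -1ℤ)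
  import Data.Integer.Properties as ℤ
  open import Data.List.Base as List using (List; []; _∷_; length)
  open import Data.List.Membership.Propositional using (_∈_; lose)
  import Data.List.Membership.Propositional.Properties as ∈
  open import Data.List.Relation.Unary.All as All using (All; []; _∷_)
  import Data.List.Relation.Unary.All.Properties as All
  open import Data.List.Relation.Unary.AllPairs as AllPairs using (AllPairs; []; _∷_)
  import Data.List.Relation.Unary.AllPairs.Properties as AllPairs
  open import Data.List.Relation.Unary.Any as Any using (Any; here)
  import Data.List.Relation.Unary.Any.Properties as Any
  open import Data.Nat.Base as ℕ using (ℕ; suc; z≤n; s≤s; _^_; _!)
  import Data.Nat.Properties as ℕ
  open import Data.Product.Base using (_×_; _,_; proj₁; proj₂; ∃-syntax)
  open import Data.Rational.Base as ℚ using (ℚ; 0ℚ; 1ℚ; _+_; _-_; _*_; -_; _≤_; _<_)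
  open import Data.Rational.Literals using (fromℤ)
  import Data.Rational.Properties as ℚ
  open import Data.Vec.Base as Vec using (Vec; []; _∷_; lookup; updateAt)
  import Data.Vec.Properties as Vec
  open import Function.Base using (_∘_; const)
  open import Relation.Binary.PropositionalEquality
  open import Relation.Nullary.Decidable using (yes; no; does)
  open import Relation.Nullary.Negation using (contradiction; ¬_)
  open import Data.Rational.Solver using (module +-*-Solver)

  open +-*-Solver using (solve; _:=_; _:+_; _:*_; _:-_; con)

  private
    variable
      m n d N : ℕ

  open Algebra.Definitions.RawMonoid ℚ.*-1-rawMonoid using () renaming (sum to ∏)

  private
    -- The bounds on counts are divided by k^(d+1): c stands for 1/k and P for k^(-d).
    shrink : ∀ k c d P → fromℤ (+ k) * c ≡ 1ℚ → fromℤ (+ (k ^ d)) * P ≡ 1ℚ → ∀ V →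
             fromℤ (+ (V ℕ.* (k ℕ.* k ^ d))) * (c * P) ≡ fromℤ (+ V)
    shrink k c d P kc≡1 kP≡1 V = begin
      fromℤ (+ (V ℕ.* (k ℕ.* k ^ d))) * (c * P)     ≡⟨ cong (_* (c * P)) (trans (fromℕ-* V (k ℕ.* k ^ d)) (cong (fromℤ (+ V) *_) (fromℕ-* k (k ^ d)))) ⟩
      (v * (K * Kd)) * (c * P)                      ≡⟨ lemma v K Kd c P ⟩
      v * ((K * c) * (Kd * P))                      ≡⟨ cong (v *_) (cong₂ _*_ kc≡1 kP≡1) ⟩
      v * 1ℚ                                        ≡⟨ ℚ.*-identityʳ v ⟩
      v                                             ∎
      where
      open ≡-Reasoning
      v = fromℤ (+ V)
      K = fromℤ (+ k)
      Kd = fromℤ (+ (k ^ d))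
      lemma : ∀ v k p c q → (v * (k * p)) * (c * q) ≡ v * ((k * c) * (p * q))
      lemma = solve 5 (λ v k p c q → (v :* (k :* p)) :* (c :* q) := v :* ((k :* c) :* (p :* q))) refl

    shrink-error : ∀ k c d P → fromℤ (+ (k ^ d)) * P ≡ 1ℚ → ∀ A → fromℤ (+ (A ℕ.* k ^ d)) * (c * P) ≡ fromℤ (+ A) * c
    shrink-error k c d P kP≡1 A = trans (cong (_* (c * P)) (fromℕ-* A (k ^ d)))
      (trans (lemma (fromℤ (+ A)) (fromℤ (+ (k ^ d))) c P) (trans (cong (λ x → (fromℤ (+ A) * c) * x) kP≡1) (ℚ.*-identityʳ _)))
      where
      lemma : ∀ a p c q → (a * p) * (c * q) ≡ (a * c) * (p * q)
      lemma = solve 4 (λ a p c q → (a :* p) :* (c :* q) := (a :* c) :* (p :* q)) refl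

    shrink-count : ∀ k c P → fromℤ (+ k) * c ≡ 1ℚ → ∀ f L → fromℤ (+ (k ℕ.* (f ℕ.* L))) * (c * P) ≡ fromℤ (+ f) * (fromℤ (+ L) * P)
    shrink-count k c P kc≡1 f L = trans (cong (_* (c * P)) (trans (fromℕ-* k (f ℕ.* L)) (cong (fromℤ (+ k) *_) (fromℕ-* f L))))
      (trans (lemma (fromℤ (+ k)) (fromℤ (+ f)) (fromℤ (+ L)) c P) (trans (cong (_* (fromℤ (+ f) * (fromℤ (+ L) * P))) kc≡1) (ℚ.*-identityˡ _)))
      where
      lemma : ∀ k f l c p → (k * (f * l)) * (c * p) ≡ (k * c) * (f * (l * p))
      lemma = solve 5 (λ k f l c p → (k :* (f :* l)) :* (c :* p) := (k :* c) :* (f :* (l :* p))) refl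

  record Reciprocal (k : ℕ) : Set where
    field
      value   : ℚ
      value≥0 : 0ℚ ≤ value
      value≤1 : value ≤ 1ℚ
      inverse : fromℤ (+ k) * value ≡ 1ℚ

  reciprocal : ∀ k → 1 ℕ.≤ k → Reciprocal k
  reciprocal (suc k) _ = record
    { value   = Mesh.width M
    ; value≥0 = Mesh.width≥0 M
    ; value≤1 = ℚ.≤-trans (ℚ.≤-reflexive (sym (ℚ.*-identityˡ (Mesh.width M))))
        (subst (1ℚ * Mesh.width M ≤_) (Mesh.inverse M) (*-monoʳ (Mesh.width M) (Mesh.width≥0 M) (fromℕ-mono {1} {suc k} (s≤s z≤n))))
    ; inverse = Mesh.inverse M
    }
    where M = mesh k

  module RegionVolume (net : Net m) (a : Vec ℤ (suc m))
                      (a-source : ∀ u → lookup a (inject₁ u) ≡ + lookup (unitSource m) (inject₁ u)) where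
    open RegionCells net a a-source
    private
      R = netEdges net
      D = dim net
      F = D !
      V = volume net
      recip = reciprocal F (ℕ.1≤n! D)
      r = Reciprocal.value recip

    region-volume : ℚ
    region-volume = fromℤ (+ V) * r

    private
      error : ∀ {x y} → x ≤ fromℤ (+ F) * y → x * r ≤ y
      error {x} {y} x≤Fy = ℚ.≤-trans (*-monoʳ r (Reciprocal.value≥0 recip) x≤Fy)
        (ℚ.≤-reflexive (trans (lemma (fromℤ (+ F)) y r) (trans (cong (y *_) (Reciprocal.inverse recip)) (ℚ.*-identityʳ y))))
        where
        lemma : ∀ f y r → (f * y) * r ≡ y * (f * r)
        lemma = solve 3 (λ f y r → (f :* y) :* r := y :* (f :* r)) refl

      scale-≤1 : ∀ x → 0ℚ ≤ x → x * r ≤ x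
      scale-≤1 x x≥0 = subst₂ _≤_ (ℚ.*-comm r x) (ℚ.*-identityˡ x) (*-monoʳ x x≥0 (Reciprocal.value≤1 recip))

    generic : Positive (Vec.zipWith ℕ._+_ (indegrees net) (unitSource m)) → IsVolume (Region R a) region-volume
    generic positive ε 0<ε = insideBoxes , coveringBoxes
      where
      A₁ = V ℕ.* (D ℕ.* D)
      K = outer-excess net
      A₂ = V ℕ.* (3 ^ D ℕ.* K)
      -- A₁ / k and A₂ / k bound the errors of the inner and the outer volume, so one mesh serves
      -- for both.
      arch = archimedean ε 0<ε (A₁ ℕ.+ A₂)
      -- k = M + D has to be positive, at least the archimedean bound and at least `outer-excess`; M
      -- itself is the total in the inner binomial coefficient.
      M = suc (proj₁ arch ℕ.+ K)
      k = M ℕ.+ D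
      N₀≤k : proj₁ arch ℕ.≤ k
      N₀≤k = ℕ.≤-trans (ℕ.m≤m+n (proj₁ arch) K) (ℕ.≤-trans (ℕ.n≤1+n _) (ℕ.m≤m+n M D))
      K≤k : K ℕ.≤ k
      K≤k = ℕ.≤-trans (ℕ.m≤n+m K (proj₁ arch)) (ℕ.≤-trans (ℕ.n≤1+n _) (ℕ.m≤m+n M D))
      msh : Mesh k
      msh = mesh (proj₁ arch ℕ.+ K ℕ.+ D)
      open Cells msh
      c = Mesh.width msh
      P = powℚ c D
      P≥0 = powℚ-≥0 c D (Mesh.width≥0 msh)
      kc≡1 = Mesh.inverse msh
      kP≡1 = powℚ-inverse k c D kc≡1
      cP≥0 : 0ℚ ≤ c * P
      cP≥0 = subst (_≤ c * P) (ℚ.*-zeroˡ P) (*-monoʳ P P≥0 (Mesh.width≥0 msh))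

      small : ∀ {B} → B ℕ.≤ A₁ ℕ.+ A₂ → fromℤ (+ B) * c < ε
      small {B} B≤A = ℚ.≤-<-trans (*-monoʳ c (Mesh.width≥0 msh) (fromℕ-mono B≤A))
        (subst (fromℤ (+ (A₁ ℕ.+ A₂)) * c <_) (trans (lemma ε (fromℤ (+ k)) c) (trans (cong (ε *_) kc≡1) (ℚ.*-identityʳ ε)))
          (ℚ.*-monoˡ-<-pos c ⦃ c>0 ⦄ (proj₂ arch k N₀≤k)))
        where
        c>0 : ℚ.Positive c
        c>0 = _
        lemma : ∀ e k c → (e * k) * c ≡ e * (k * c)
        lemma = solve 3 (λ e k c → (e :* k) :* c := e :* (k :* c)) refl

      count-volume : ∀ zs → totalVolume (List.map cell zs) ≡ fromℤ (+ length zs) * P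
      count-volume zs = trans (cells-volume zs) (cong (λ d → fromℤ (+ length zs) * powℚ c d) (#E-netEdges net))

      insideBoxes : ∃[ Bs ] AllPairs NonOverlapping Bs × All (λ B → ∀ y → y ∈Box B → Region R a y) Bs × region-volume - ε < totalVolume Bs
      insideBoxes = List.map cell zs
        , AllPairs.map⁺ (AllPairs.map cells-disjoint (solutions-unique net (innerState net k)))
        , All.map⁺ (All.tabulate (λ z∈ → inner-cell msh (solutions-sound net (innerState net k) z∈)))
        , (begin-strict
            fromℤ (+ V) * r - ε
              ≤⟨ ℚ.+-monoˡ-≤ (- ε) (ℚ.≤-trans (*-monoʳ r (Reciprocal.value≥0 recip) V≤) (ℚ.≤-reflexive (ℚ.*-distribʳ-+ r (fromℤ (+ F) * X) (fromℤ (+ A₁) * c)))) ⟩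
            ((fromℤ (+ F) * X) * r + (fromℤ (+ A₁) * c) * r) - ε
              ≤⟨ ℚ.+-monoˡ-≤ (- ε) (ℚ.+-mono-≤ (error {fromℤ (+ F) * X} {X} ℚ.≤-refl) (scale-≤1 (fromℤ (+ A₁) * c) A₁c≥0)) ⟩
            (X + fromℤ (+ A₁) * c) - ε
              <⟨ ℚ.+-monoˡ-< (- ε) (ℚ.+-monoʳ-< X (small (ℕ.m≤m+n A₁ A₂))) ⟩
            (X + ε) - ε
              ≡⟨ lemma X ε ⟩
            X
              ≡⟨ trans (count-volume zs) (cong (λ l → fromℤ (+ l) * P) (length-solutions net (innerState net k))) ⟨
            totalVolume (List.map cell zs) ∎)
        where
        open ℚ.≤-Reasoning
        zs = solutions net (innerState net k)
        L = flows net (innerState net k)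
        X = fromℤ (+ L) * P
        A₁c≥0 : 0ℚ ≤ fromℤ (+ A₁) * c
        A₁c≥0 = subst (_≤ fromℤ (+ A₁) * c) (ℚ.*-zeroˡ c) (*-monoʳ c (Mesh.width≥0 msh) (fromℕ≥0 A₁))
        V≤ : fromℤ (+ V) ≤ fromℤ (+ F) * X + fromℤ (+ A₁) * c
        V≤ = subst₂ _≤_ (shrink k c D P kc≡1 kP≡1 V)
          (trans (cong (_* (c * P)) (fromℕ-+ (k ℕ.* (F ℕ.* L)) (A₁ ℕ.* k ^ D)))
            (trans (ℚ.*-distribʳ-+ (c * P) (fromℤ (+ (k ℕ.* (F ℕ.* L)))) (fromℤ (+ (A₁ ℕ.* k ^ D))))
              (cong₂ _+_ (shrink-count k c P kc≡1 F L) (shrink-error k c D P kP≡1 A₁))))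
          (*-monoʳ (c * P) cP≥0 (fromℕ-mono (inner-bound net M)))
        lemma : ∀ x e → (x + e) - e ≡ x
        lemma = solve 2 (λ x e → (x :+ e) :- e := x) refl

      coveringBoxes : ∃[ Bs ] (∀ y → Region R a y → Any (y ∈Box_) Bs) × totalVolume Bs < region-volume + ε
      coveringBoxes = List.map cell zs
        , (λ y y∈ → let z , feasible , y∈cell = outer-cell msh y y∈ in
            Any.map⁺ (lose (solutions-complete net (outerState net k) feasible) y∈cell))
        , (begin-strict
            totalVolume (List.map cell zs)
              ≡⟨ trans (count-volume zs) (cong (λ l → fromℤ (+ l) * P) (length-solutions net (outerState net k))) ⟩
            X
              ≡⟨ trans (sym (ℚ.*-identityʳ X)) (trans (cong (X *_) (sym (Reciprocal.inverse recip))) (lemma X (fromℤ (+ F)) r)) ⟩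
            (fromℤ (+ F) * X) * r
              ≤⟨ *-monoʳ r (Reciprocal.value≥0 recip) ≤V ⟩
            (fromℤ (+ V) + fromℤ (+ A₂) * c) * r
              ≡⟨ ℚ.*-distribʳ-+ r (fromℤ (+ V)) (fromℤ (+ A₂) * c) ⟩
            fromℤ (+ V) * r + (fromℤ (+ A₂) * c) * r
              ≤⟨ ℚ.+-monoʳ-≤ (fromℤ (+ V) * r) (scale-≤1 (fromℤ (+ A₂) * c) A₂c≥0) ⟩
            fromℤ (+ V) * r + fromℤ (+ A₂) * c
              <⟨ ℚ.+-monoʳ-< (fromℤ (+ V) * r) (small (ℕ.m≤n+m A₂ A₁)) ⟩
            fromℤ (+ V) * r + ε ∎)
        where
        open ℚ.≤-Reasoning
        zs = solutions net (outerState net k)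
        L = flows net (outerState net k)
        X = fromℤ (+ L) * P
        A₂c≥0 : 0ℚ ≤ fromℤ (+ A₂) * c
        A₂c≥0 = subst (_≤ fromℤ (+ A₂) * c) (ℚ.*-zeroˡ c) (*-monoʳ c (Mesh.width≥0 msh) (fromℕ≥0 A₂))
        ≤V : fromℤ (+ F) * X ≤ fromℤ (+ V) + fromℤ (+ A₂) * c
        ≤V = subst₂ _≤_ (shrink-count k c P kc≡1 F L)
          (trans (cong (_* (c * P)) (fromℕ-+ (V ℕ.* (k ℕ.* k ^ D)) (A₂ ℕ.* k ^ D)))
            (trans (ℚ.*-distribʳ-+ (c * P) (fromℤ (+ (V ℕ.* (k ℕ.* k ^ D)))) (fromℤ (+ (A₂ ℕ.* k ^ D))))
              (cong₂ _+_ (shrink k c D P kc≡1 kP≡1 V) (shrink-error k c D P kP≡1 A₂))))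
          (*-monoʳ (c * P) cP≥0 (fromℕ-mono (outer-bound net positive k K≤k)))
        lemma : ∀ x f r → x * (f * r) ≡ (f * x) * r
        lemma = solve 3 (λ x f r → x :* (f :* r) := (f :* x) :* r) refl

    -- If a vertex other than the source has no incoming edge, then no flow leaves
    -- it, so one coordinate vanishes on the region and the cells can be flattened.
    module Degenerate (j : Fin m) (isolated : lookup (Vec.zipWith ℕ._+_ (indegrees net) (unitSource m)) (inject₁ j) ≡ 0)
                      (active : 1 ℕ.≤ lookup (outdegrees net) (inject₁ j)) where
      private
        v = inject₁ j
        source = src ∘ List.lookup R
        target = tgt ∘ List.lookup R

        sum-zero : lookup (indegrees net) v ℕ.+ lookup (unitSource m) v ≡ 0
        sum-zero = trans (sym (Vec.lookup-zipWith ℕ._+_ v (indegrees net) (unitSource m))) isolated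

        demand≡0 : lookup a v ≡ 0ℤ
        demand≡0 = trans (a-source j) (cong +_ (ℕ.m+n≡0⇒n≡0 (lookup (indegrees net) v) sum-zero))

        no-target : ∀ e → ¬ target e ≡ v
        no-target e te≡v = contradiction
          (fromℤ-cancel-≤ (subst (1ℚ ≤_) (trans (flowAt-degree tgt R v) (cong (fromℤ ∘ +_)
            (trans (indegrees-degree net j) (ℕ.m+n≡0⇒m≡0 (lookup (indegrees net) v) sum-zero))))
            (flowAt-term target v {λ _ → 1ℚ} (λ _ → fromℕ≥0 1) e te≡v)))
          λ where (ℤ.+≤+ ())

        outgoing : ∃[ e ] source e ≡ v
        outgoing with Fin.any? (λ e → source e Fin.≟ v)
        ... | yes p = p
        ... | no ¬p = contradiction
          (fromℤ-injective (trans (sym (trans (flowAt-degree src R v) (cong (fromℤ ∘ +_) (outdegrees-degree net v))))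
            (flowAt-none source v (λ _ → 1ℚ) (λ e p → ¬p (e , p)))))
          (λ eq → ℕ.m<n⇒n≢0 active (ℤ.+-injective eq))

        e₀ = proj₁ outgoing

        vanishes : ∀ y → Region R a y → lookup y e₀ ≡ 0ℚ
        vanishes y (y≥0 , cap) = ℚ.≤-antisym (begin
          lookup y e₀                   ≤⟨ flowAt-term source v y≥0 e₀ (proj₂ outgoing) ⟩
          outflow R y v                 ≡⟨ trans (sym (lemma (outflow R y v))) (cong (λ x → outflow R y v - x) (sym (flowAt-none target v (lookup y) no-target))) ⟩
          netflow R y v                 ≤⟨ cap j ⟩
          fromℤ (lookup a v)            ≡⟨ cong fromℤ demand≡0 ⟩
          0ℚ                            ∎) (y≥0 e₀)
          where
          open ℚ.≤-Reasoning
          lemma : ∀ x → x - 0ℚ ≡ x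
          lemma = solve 1 (λ x → x :- con 0ℚ := x) refl

        -- The volume formula prescribes the net flow indegree - 1 = -1 at v, which no flow attains
        -- since nothing enters v.
        negative : volume net ≡ 0
        negative = trans (sym (length-solutions net s)) (empty (solutions net s) (λ {z} z∈ → infeasible z (solutions-sound net s z∈)))
          where
          s = indegrees net ⊞ unitSource m ∸1
          empty : ∀ {A : Set} (xs : List A) → (∀ {x} → x ∈ xs → 0 ≡ 1) → length xs ≡ 0
          empty []      _ = refl
          empty (x ∷ _) p with () ← p (here refl)
          s-v : lookup s v ≡ -1ℤ
          s-v = trans (Vec.lookup-zipWith _ v (indegrees net) (unitSource m)) (cong (λ x → + x ℤ.- 1ℤ) sum-zero)
          infeasible : ∀ z → Feasible R s z → 0 ≡ 1
          infeasible z feasible = contradiction (fromℤ-cancel-≤ {0ℤ} { -1ℤ} (begin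
            0ℚ                                           ≤⟨ fromℤ-mono-≤ (feasible j) ⟩
            fromℤ (lookup (residual R s z) v)            ≡⟨ lemma (fromℤ (lookup s v)) (fromℤ (lookup (residual R s z) v)) ⟩
            fromℤ (lookup s v) - (fromℤ (lookup s v) - fromℤ (lookup (residual R s z) v))
              ≡⟨ cong₂ _-_ (cong fromℤ s-v) (trans (sym (residual-netflow R s z v)) (netflow-flowAt R z v)) ⟩
            fromℤ -1ℤ - (O - flowAt target ζ v)          ≡⟨ cong (λ x → fromℤ -1ℤ - (O - x)) (flowAt-none target v ζ no-target) ⟩
            fromℤ -1ℤ - (O - 0ℚ)                         ≤⟨ ℚ.+-monoʳ-≤ (fromℤ -1ℤ) (ℚ.neg-antimono-≤ (ℚ.+-monoˡ-≤ (- 0ℚ) (flowAt-≥0 source v (λ e → fromℕ≥0 (lookup z e))))) ⟩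
            fromℤ -1ℤ - (0ℚ - 0ℚ)                        ≡⟨⟩
            fromℤ -1ℤ                                    ∎)) λ ()
            where
            open ℚ.≤-Reasoning
            ζ : Fin (#E R) → ℚ
            ζ e = fromℤ (+ lookup z e)
            O = flowAt source ζ v
            lemma : ∀ s r → r ≡ s - (s - r)
            lemma = solve 2 (λ s r → r := s :- (s :- r)) refl

      degenerate : IsVolume (Region R a) region-volume
      degenerate = subst (IsVolume (Region R a)) (sym (trans (cong (λ V → fromℤ (+ V) * r) negative) (ℚ.*-zeroˡ r))) λ ε 0<ε →
          ([] , [] , [] , subst (0ℚ - ε <_) refl (subst (_< 0ℚ) (sym (ℚ.+-identityˡ (- ε))) (ℚ.neg-antimono-< 0<ε)))
        , (List.map flat zs , covers , subst₂ _<_ (sym (flat-volume zs)) (sym (ℚ.+-identityˡ ε)) 0<ε)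
        where
        -- Any mesh will do: flattened boxes have volume 0 whatever their size.
        msh : Mesh 1
        msh = mesh 0
        open Cells msh
        zs = solutions net (outerState net 1)
        flatten : Vec ℚ (#E R) → Vec ℚ (#E R)
        flatten x = updateAt x e₀ (const 0ℚ)
        flat : Vec ℕ (#E R) → Box (#E R)
        flat z = record { lo = flatten (lo (cell z)) ; hi = flatten (hi (cell z)) ; lo≤hi = ordered }
          where
          ordered : ∀ i → lookup (flatten (lo (cell z))) i ≤ lookup (flatten (hi (cell z))) i
          ordered i = subst₂ _≤_ (sym (lookup-updateAt (lo (cell z)) e₀ (const 0ℚ) i)) (sym (lookup-updateAt (hi (cell z)) e₀ (const 0ℚ) i))
            (lemma (does (e₀ Fin.≟ i)) (lo≤hi (cell z) i))
            where
            lemma : ∀ b {x y : ℚ} → x ≤ y → (if b then 0ℚ else x) ≤ (if b then 0ℚ else y)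
            lemma true  _ = ℚ.≤-refl
            lemma false p = p
        flat-box : ∀ z → boxVolume (flat z) ≡ 0ℚ
        flat-box z = ∏-zero _ e₀ (cong₂ _-_ (Vec.lookup∘updateAt e₀ (hi (cell z))) (Vec.lookup∘updateAt e₀ (lo (cell z))))
        flat-volume : ∀ zs → totalVolume (List.map flat zs) ≡ 0ℚ
        flat-volume []       = refl
        flat-volume (z ∷ zs) = cong₂ _+_ (flat-box z) (flat-volume zs)
        covers : ∀ y → Region R a y → Any (y ∈Box_) (List.map flat zs)
        covers y y∈ = let z , feasible , y∈cell = outer-cell msh y y∈ in
          Any.map⁺ (lose (solutions-complete net (outerState net 1) feasible) (λ i →
              subst (_≤ lookup y i) (sym (lookup-updateAt (lo (cell z)) e₀ (const 0ℚ) i)) (low i (proj₁ (y∈cell i)))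
            , subst (lookup y i ≤_) (sym (lookup-updateAt (hi (cell z)) e₀ (const 0ℚ) i)) (high i (proj₂ (y∈cell i)))))
          where
          low : ∀ i {x} → x ≤ lookup y i → (if does (e₀ Fin.≟ i) then 0ℚ else x) ≤ lookup y i
          low i p with e₀ Fin.≟ i
          ... | yes refl = ℚ.≤-reflexive (sym (vanishes y y∈))
          ... | no _     = p
          high : ∀ i {x} → lookup y i ≤ x → lookup y i ≤ (if does (e₀ Fin.≟ i) then 0ℚ else x)
          high i p with e₀ Fin.≟ i
          ... | yes refl = ℚ.≤-reflexive (vanishes y y∈)
          ... | no _     = p

    -- At a vertex other than the source that no edge enters, the second hypothesis provides an
    -- outgoing listed edge, whose coordinate vanishes on the region. If there is no such vertex,
    -- the positivity demanded by `flows-upper` holds, the sink being covered by the first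
    -- hypothesis.
    region-isVolume : 1 ℕ.≤ lookup (indegrees net) (fromℕ m) →
      (∀ j → lookup (Vec.zipWith ℕ._+_ (indegrees net) (unitSource m)) (inject₁ j) ≡ 0 → 1 ℕ.≤ lookup (outdegrees net) (inject₁ j)) →
      IsVolume (Region R a) region-volume
    region-isVolume sink active with Fin.any? (λ j → lookup (Vec.zipWith ℕ._+_ (indegrees net) (unitSource m)) (inject₁ j) ℕ.≟ 0)
    ... | yes (j , isolated) = Degenerate.degenerate j isolated (active j isolated)
    ... | no ¬isolated = generic positive
      where
      positive : Positive (Vec.zipWith ℕ._+_ (indegrees net) (unitSource m))
      positive v with view v
      ... | ‵fromℕ     = subst (1 ℕ.≤_) (sym (Vec.lookup-zipWith ℕ._+_ (fromℕ m) (indegrees net) (unitSource m))) (ℕ.≤-trans sink (ℕ.m≤m+n _ _))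
      ... | ‵inject₁ j = ℕ.n≢0⇒n>0 (λ p → ¬isolated (j , p))

    !*region-volume : fromℤ (+ ((#E R) !)) * region-volume ≡ fromℤ (+ V)
    !*region-volume = trans (cong (λ d → fromℤ (+ (d !)) * region-volume) (#E-netEdges net))
      (trans (lemma (fromℤ (+ F)) (fromℤ (+ V)) r) (trans (cong (fromℤ (+ V) *_) (Reciprocal.inverse recip)) (ℚ.*-identityʳ _)))
      where
      lemma : ∀ f v r → f * (v * r) ≡ v * (f * r)
      lemma = solve 3 (λ f v r → f :* (v :* r) := v :* (f :* r)) refl

-- Identification of both sums with the flow counts.

module FlowVolumes where

  open IteratedLaurentSeries using (pos; neg; pos-neg)
  open Networks
  open ProductFormula using (completeRow; completeNet; subsets; atInner)
  open SubsetExpansion using (bit; subsetNet; subsetState; Ψ-flows)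
  open Deficits using (flows-sink)
  open AdmissibleSums using (flows-sum; atInner-∷ʳ)
  open Solutions
  open EdgeLists
  open Presentations
  open FlowPolytopes
  open Asymptotics
  open CellDecomposition
  open RegionVolumes
  open import Defs
  open import Algebra.Bundles.Raw using (RawMonoid)
  import Algebra.Definitions.RawMonoid
  open import Data.Bool.Base using (true; false; if_then_else_)
  open import Data.Fin.Base as Fin using (Fin; zero; suc; toℕ; fromℕ; inject₁)
  import Data.Fin.Properties as Fin
  open import Data.Fin.Subset using (Subset; inside; outside; ∣_∣)
  open import Data.Fin.Subset.Properties using (_∈?_)
  open import Data.Integer.Base as ℤ using (ℤ; +_; 0ℤ; 1ℤ; -1ℤ)
  import Data.Integer.Properties as ℤ
  open import Data.Integer.Tactic.RingSolver using () renaming (solve-∀ to ℤsolve-∀)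
  open import Data.List.Base as List using (List; []; _∷_; _++_; concatMap)
  import Data.List.Properties as List
  open import Data.List.Membership.Propositional using (_∈_)
  import Data.List.Membership.Propositional.Properties as ∈
  open import Data.List.Relation.Binary.Permutation.Propositional using (_↭_; ↭-sym; ↭-trans; ↭-reflexive)
  import Data.List.Relation.Binary.Permutation.Propositional.Properties as ↭
  open import Data.List.Relation.Unary.All as All using (All; []; _∷_)
  open import Data.List.Relation.Unary.AllPairs using ([]; _∷_)
  open import Data.List.Relation.Unary.Any using (here)
  open import Data.List.Relation.Unary.Unique.Propositional using (Unique)
  import Data.List.Relation.Unary.Unique.Propositional.Properties as Unique
  open import Data.Nat.Base as ℕ using (ℕ; zero; suc; z≤n; s≤s)
  import Data.Nat.Properties as ℕ
  open import Data.Product.Base using (_×_; _,_; ∃-syntax)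
  open import Data.Rational.Base as ℚ using (ℚ; 0ℚ; 1ℚ; _+_; _-_; _*_; -_; _≤_)
  open import Data.Rational.Literals using (fromℤ)
  import Data.Rational.Properties as ℚ
  open import Data.Sum.Base using (inj₁; inj₂)
  open import Data.Vec.Base as Vec using (Vec; []; _∷_; _∷ʳ_; lookup; replicate)
  import Data.Vec.Properties as Vec
  open import Function.Base using (_∘_)
  open import Function.Bundles using (mk⇔; Equivalence)
  open import Relation.Binary.PropositionalEquality
  open import Relation.Nullary.Decidable using (does)
  open import Relation.Nullary.Negation using (contradiction; ¬_)
  open import Data.Rational.Solver using (module +-*-Solver)

  open +-*-Solver using (solve; _:=_; _:-_; con)

  private
    variable
      n N : ℕ
      A X : Set

  open Algebra.Definitions.RawMonoid ℚ.+-0-rawMonoid using () renaming (sum to ∑)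

  subsets-sound : ∀ n k {S} → S ∈ subsets n k → ∣ S ∣ ≡ k
  subsets-sound zero    zero    (here refl) = refl
  subsets-sound (suc n) zero    S∈ with _ , S∈′ , refl ← ∈.∈-map⁻ (outside ∷_) S∈ = subsets-sound n zero S∈′
  subsets-sound (suc n) (suc k) S∈ with ∈.∈-++⁻ (List.map (outside ∷_) (subsets n (suc k))) S∈
  ... | inj₁ S∈₁ with _ , S∈′ , refl ← ∈.∈-map⁻ (outside ∷_) S∈₁ = subsets-sound n (suc k) S∈′
  ... | inj₂ S∈₂ with _ , S∈′ , refl ← ∈.∈-map⁻ (inside ∷_) S∈₂ = cong suc (subsets-sound n k S∈′)

  subsets-complete : ∀ (S : Subset n) → S ∈ subsets n ∣ S ∣
  subsets-complete []            = here refl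
  subsets-complete (outside ∷ S) = add ∣ S ∣ (subsets-complete S)
    where
    add : ∀ {n} k {S : Subset n} → S ∈ subsets n k → (outside ∷ S) ∈ subsets (suc n) k
    add zero    S∈ = ∈.∈-map⁺ (outside ∷_) S∈
    add (suc k) S∈ = ∈.∈-++⁺ˡ (∈.∈-map⁺ (outside ∷_) S∈)
  subsets-complete {suc n} (inside ∷ S) = ∈.∈-++⁺ʳ (List.map (outside ∷_) (subsets n (suc ∣ S ∣))) (∈.∈-map⁺ (inside ∷_) (subsets-complete S))

  subsets-unique : ∀ n k → Unique (subsets n k)
  subsets-unique zero    zero    = [] ∷ []
  subsets-unique zero    (suc k) = []
  subsets-unique (suc n) zero    = Unique.map⁺ Vec.∷-injectiveʳ (subsets-unique n zero)
  subsets-unique (suc n) (suc k) = Unique.++⁺ (Unique.map⁺ Vec.∷-injectiveʳ (subsets-unique n (suc k)))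
    (Unique.map⁺ Vec.∷-injectiveʳ (subsets-unique n k))
    λ (S∈₁ , S∈₂) → let _ , _ , eq₁ = ∈.∈-map⁻ (outside ∷_) S∈₁ ; _ , _ , eq₂ = ∈.∈-map⁻ (inside ∷_) S∈₂
                    in contradiction (Vec.∷-injectiveˡ (trans (sym eq₁) eq₂)) λ ()

  private
    -- `bump` adds natural numbers only, so the sink entries x and y are both raised, to the common
    -- value `pos x` + `pos y`.
    sink-align : ∀ (s t : Vec ℤ (suc n)) → (∀ u → lookup s (inject₁ u) ≡ lookup t (inject₁ u)) →
                 ∃[ q ] ∃[ q′ ] bump (fromℕ n) q s ≡ bump (fromℕ n) q′ t
    sink-align {zero} (x ∷ []) (y ∷ []) p = pos y ℕ.+ neg x , pos x ℕ.+ neg y , cong (_∷ []) (trans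
      (cong₂ (λ w z → w ℤ.+ z) (sym (pos-neg x)) (ℤ.pos-+ (pos y) (neg x)))
      (trans (swap (+ pos x) (+ neg x) (+ pos y) (+ neg y)) (sym (cong₂ (λ w z → w ℤ.+ z) (sym (pos-neg y)) (ℤ.pos-+ (pos x) (neg y))))))
      where
      swap : ∀ a b c d → (a ℤ.- b) ℤ.+ (c ℤ.+ b) ≡ (c ℤ.- d) ℤ.+ (a ℤ.+ d)
      swap = ℤsolve-∀
    sink-align {suc n} (x ∷ s) (y ∷ t) p with q , q′ , eq ← sink-align s t (p ∘ suc) = q , q′ , cong₂ _∷_ (p zero) eq

  flows-inner : ∀ (net : Net n) s t → (∀ u → lookup s (inject₁ u) ≡ lookup t (inject₁ u)) → flows net s ≡ flows net t
  flows-inner net s t p with q , q′ , eq ← sink-align s t p = trans (sym (flows-sink net q s)) (trans (cong (flows net) eq) (flows-sink net q′ t))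

  spread-0 : ∀ os (F : Vec ℤ (suc n) → ℕ) s → spread os F 0 s ≡ F s
  spread-0 os F s = go os
    where
    bump-0 : ∀ {n} (o : Fin n) s → bump o 0 s ≡ s
    bump-0 zero    (x ∷ s) = cong (_∷ s) (ℤ.+-identityʳ x)
    bump-0 (suc o) (x ∷ s) = cong (x ∷_) (bump-0 o s)
    go : ∀ os → spread os F 0 s ≡ F s
    go []       = cong F (bump-0 (fromℕ _) s)
    go (o ∷ os) = trans (cong (spread os F 0) (bump-0 o s)) (go os)

  occurrences : List (Fin N) → Fin N → ℕ
  occurrences []       j = 0
  occurrences (o ∷ os) j = (if does (o Fin.≟ j) then 1 else 0) ℕ.+ occurrences os j

  private
    occurrences-++ : ∀ (os os′ : List (Fin N)) j → occurrences (os ++ os′) j ≡ occurrences os j ℕ.+ occurrences os′ j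
    occurrences-++ []       os′ j = refl
    occurrences-++ (o ∷ os) os′ j = trans (cong (d ℕ.+_) (occurrences-++ os os′ j)) (sym (ℕ.+-assoc d (occurrences os j) (occurrences os′ j)))
      where d = if does (o Fin.≟ j) then 1 else 0

    occurrences-replicate : ∀ k (o : Fin N) j → occurrences (List.replicate k o) j ≡ (if does (o Fin.≟ j) then k else 0)
    occurrences-replicate k o j = go (does (o Fin.≟ j)) refl k
      where
      go : ∀ b → does (o Fin.≟ j) ≡ b → ∀ k → occurrences (List.replicate k o) j ≡ (if b then k else 0)
      go true  p zero    = refl
      go false p zero    = refl
      go true  p (suc k) = cong₂ ℕ._+_ (if-cong p) (go true p k)
      go false p (suc k) = cong₂ ℕ._+_ (if-cong p) (go false p k)

    occurrences-map-suc : ∀ (os : List (Fin N)) j → occurrences (List.map suc os) (suc j) ≡ occurrences os j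
    occurrences-map-suc []       j = refl
    occurrences-map-suc (o ∷ os) j = cong ((if does (o Fin.≟ j) then 1 else 0) ℕ.+_) (occurrences-map-suc os j)

    occurrences-map-suc-zero : ∀ (os : List (Fin N)) → occurrences (List.map suc os) zero ≡ 0
    occurrences-map-suc-zero []       = refl
    occurrences-map-suc-zero (o ∷ os) = occurrences-map-suc-zero os

    occurrences-inner : ∀ (α : Fin n → ℕ) i → occurrences (concatMap (λ i → List.replicate (α i) (inject₁ i)) (List.allFin n)) (inject₁ i) ≡ α i
    occurrences-inner {suc n} α i = trans (cong (λ os → occurrences (List.replicate (α zero) zero ++ os) (inject₁ i)) later)
      (trans (occurrences-++ (List.replicate (α zero) zero) (List.map suc rest) (inject₁ i)) (go i))
      where
      rest = concatMap (λ i → List.replicate (α (suc i)) (inject₁ i)) (List.allFin n)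
      later : concatMap (λ i → List.replicate (α i) (inject₁ i)) (List.tabulate suc) ≡ List.map suc rest
      later = trans (concatMap-tabulate (λ i → List.replicate (α i) (inject₁ i)) suc)
        (sym (trans (List.map-concatMap suc (λ i → List.replicate (α (suc i)) (inject₁ i)) (List.allFin n))
          (List.concatMap-cong (λ i → List.map-replicate suc (α (suc i)) (inject₁ i)) (List.allFin n))))
      go : ∀ i → occurrences (List.replicate (α zero) zero) (inject₁ i) ℕ.+ occurrences (List.map suc rest) (inject₁ i) ≡ α i
      go zero    = trans (cong₂ ℕ._+_ (occurrences-replicate (α zero) zero zero) (occurrences-map-suc-zero rest)) (ℕ.+-identityʳ (α zero))
      go (suc i) = trans (cong₂ ℕ._+_ (occurrences-replicate (α zero) zero (suc (inject₁ i))) (occurrences-map-suc rest (inject₁ i)))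
        (occurrences-inner (α ∘ suc) i)

    occurrences-sink : ∀ k (i : Fin n) → occurrences (List.replicate k (fromℕ n)) (inject₁ i) ≡ 0
    occurrences-sink {n} k i = trans (occurrences-replicate k (fromℕ n) (inject₁ i)) (if-cong (fromℕ-≟ i))

    incoming-occurrences : ∀ os (v : Vec ℕ (suc n)) i → lookup (incoming os v) (inject₁ i) ≡ occurrences os (inject₁ i) ℕ.+ lookup v (inject₁ i)
    incoming-occurrences []       v i = trans (lookup-updateAt v (fromℕ _) (1 ℕ.+_) (inject₁ i)) (if-cong (fromℕ-≟ i))
    incoming-occurrences (o ∷ os) v i = trans (lookup-updateAt (incoming os v) o (1 ℕ.+_) (inject₁ i))
      (trans (lemma (does (o Fin.≟ inject₁ i))) (trans (cong (d ℕ.+_) (incoming-occurrences os v i)) (sym (ℕ.+-assoc d _ _))))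
      where
      d = if does (o Fin.≟ inject₁ i) then 1 else 0
      lemma : ∀ b {x} → (if b then suc x else x) ≡ (if b then 1 else 0) ℕ.+ x
      lemma true  = refl
      lemma false = refl

  indegrees-complete : ∀ n c β i → lookup (indegrees (completeNet n c β)) (inject₁ i) ≡ c ℕ.* toℕ i
  indegrees-complete (suc n) c β zero    = sym (ℕ.*-zeroʳ c)
  indegrees-complete (suc n) c β (suc i) = begin
    lookup (incoming (completeRow n c (β zero)) (indegrees (completeNet n c (β ∘ suc)))) (inject₁ i)
      ≡⟨ incoming-occurrences (completeRow n c (β zero)) (indegrees (completeNet n c (β ∘ suc))) i ⟩
    occurrences (completeRow n c (β zero)) (inject₁ i) ℕ.+ lookup (indegrees (completeNet n c (β ∘ suc))) (inject₁ i)
      ≡⟨ cong₂ ℕ._+_ (trans (occurrences-++ (List.replicate (β zero) (fromℕ n)) _ (inject₁ i))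
           (cong₂ ℕ._+_ (occurrences-sink (β zero) i) (occurrences-inner (λ _ → c) i))) (indegrees-complete n c (β ∘ suc) i) ⟩
    c ℕ.+ c ℕ.* toℕ i
      ≡⟨ ℕ.*-suc c (toℕ i) ⟨
    c ℕ.* suc (toℕ i) ∎
    where open ≡-Reasoning

  indegrees-source : ∀ n α β c r i → lookup (indegrees (sourceNet n α β c r)) (inject₁ (suc i)) ≡ α i ℕ.+ c ℕ.* toℕ i
  indegrees-source n α β c r i = trans (incoming-occurrences (sourceRow n α r) (indegrees (completeNet n c β)) i)
    (cong₂ ℕ._+_ (trans (occurrences-++ (concatMap (λ i → List.replicate (α i) (inject₁ i)) (List.allFin n)) _ (inject₁ i))
        (trans (cong₂ ℕ._+_ (occurrences-inner α i) (occurrences-sink r i)) (ℕ.+-identityʳ (α i))))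
      (indegrees-complete n c β i))

  outdegrees-complete : ∀ n c β i → β i ℕ.≤ lookup (outdegrees (completeNet n c β)) (inject₁ i)
  outdegrees-complete (suc n) c β zero    = ℕ.≤-trans (ℕ.m≤m+n (β zero) _) (ℕ.≤-reflexive (sym (trans
    (List.length-++ (List.replicate (β zero) (fromℕ n))) (cong (ℕ._+ _) (List.length-replicate (β zero))))))
  outdegrees-complete (suc n) c β (suc i) = outdegrees-complete n c (β ∘ suc) i

  does-∈? : ∀ i (S : Subset n) → does (i ∈? S) ≡ lookup S i
  does-∈? zero    (true  ∷ S) = refl
  does-∈? zero    (false ∷ S) = refl
  does-∈? (suc i) (σ ∷ S)     = does-∈? i S

  graph-cong : ∀ n {α α′ β β′ : Fin n → ℕ} c r → (∀ i → α i ≡ α′ i) → (∀ i → β i ≡ β′ i) → graph n α β c r ≡ graph n α′ β′ c r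
  graph-cong n c r p q = cong₂ _++_ (List.concatMap-cong (λ i → cong (λ k → List.replicate k (0→inner i)) (p i)) (List.allFin n))
    (cong (_++ _) (List.concatMap-cong (λ i → cong (λ k → List.replicate k (inner→sink i)) (q i)) (List.allFin n)))

  lookup-inject₁-∷ʳ : ∀ (xs : Vec A n) x i → lookup (xs ∷ʳ x) (inject₁ i) ≡ lookup xs i
  lookup-inject₁-∷ʳ (y ∷ xs) x zero    = refl
  lookup-inject₁-∷ʳ (y ∷ xs) x (suc i) = lookup-inject₁-∷ʳ xs x i

  ∑-∷ʳ : ∀ (xs : Vec ℤ n) x → ∑ (λ v → fromℤ (lookup (xs ∷ʳ x) v)) ≡ fromℤ (Vec.foldr (λ _ → ℤ) ℤ._+_ 0ℤ xs) + fromℤ x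
  ∑-∷ʳ []       x = trans (ℚ.+-identityʳ (fromℤ x)) (sym (ℚ.+-identityˡ (fromℤ x)))
  ∑-∷ʳ (y ∷ xs) x = trans (cong (λ w → fromℤ y + w) (∑-∷ʳ xs x)) (trans (sym (ℚ.+-assoc (fromℤ y) (fromℤ Σxs) (fromℤ x)))
    (cong (_+ fromℤ x) (sym (fromℤ-+ y Σxs))))
    where Σxs = Vec.foldr (λ _ → ℤ) ℤ._+_ 0ℤ xs

  unitFlow-balanced : ∀ n → Balanced (unitFlow n)
  unitFlow-balanced n = trans (cong (λ w → 1ℚ + w) (trans (∑-∷ʳ (replicate n 0ℤ) -1ℤ) (cong (λ z → fromℤ z + fromℤ -1ℤ) (zeros n)))) refl
    where
    zeros : ∀ n → Vec.foldr (λ _ → ℤ) ℤ._+_ 0ℤ (replicate n 0ℤ) ≡ 0ℤ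
    zeros zero    = refl
    zeros (suc n) = trans (ℤ.+-identityˡ _) (zeros n)

  unitFlow-source : ∀ n u → lookup (unitFlow n) (inject₁ u) ≡ + lookup (unitSource (suc n)) (inject₁ u)
  unitFlow-source n zero    = refl
  unitFlow-source n (suc i) = trans (lookup-inject₁-∷ʳ (replicate n 0ℤ) -1ℤ i)
    (trans (Vec.lookup-replicate i 0ℤ) (cong +_ (sym (Vec.lookup-replicate (inject₁ i) 0))))

  netflowVector-balanced : ∀ (as : Vec ℤ n) → Balanced (netflowVector as)
  netflowVector-balanced as = trans (ℚ.+-identityˡ _) (trans (∑-∷ʳ as _) (trans
    (cong (λ w → fromℤ (Vec.foldr (λ _ → ℤ) ℤ._+_ 0ℤ as) + w) (fromℤ-neg (Vec.foldr (λ _ → ℤ) ℤ._+_ 0ℤ as)))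
    (ℚ.+-inverseʳ (fromℤ (Vec.foldr (λ _ → ℤ) ℤ._+_ 0ℤ as)))))

  -- An edge leaving the source carries nothing when the net flow at the source is 0.
  module SourceEdge (G : Multigraph (suc N)) (e : Edge (suc N)) (e-src : src e ≡ zero)
                    (a : Vec ℤ (suc N)) (a-zero : lookup a zero ≡ 0ℤ) where
    private
      extend : ∀ z v → netflow (e ∷ G) (toℚⁿ (0ℤ ∷ z)) v ≡ netflow G (toℚⁿ z) v
      extend z v = cong₂ _-_ (drop (does (src e Fin.≟ v)) (outflow G (toℚⁿ z) v)) (drop (does (tgt e Fin.≟ v)) (inflow G (toℚⁿ z) v))
        where
        drop : ∀ b x → (if b then 0ℚ else 0ℚ) + x ≡ x
        drop true  = ℚ.+-identityˡ
        drop false = ℚ.+-identityˡ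

      lattice-extend : ∀ z → LatticePoint G a z → LatticePoint (e ∷ G) a (0ℤ ∷ z)
      lattice-extend z (z≥0 , flow) = (λ where zero → ℚ.≤-refl ; (suc i) → z≥0 i) , λ v → trans (extend z v) (flow v)

      lattice-restrict : ∀ z → LatticePoint (e ∷ G) a (0ℤ ∷ z) → LatticePoint G a z
      lattice-restrict z (z≥0 , flow) = (λ i → z≥0 (suc i)) , λ v → trans (sym (extend z v)) (flow v)

      lattice-zero : ∀ x z → LatticePoint (e ∷ G) a (x ∷ z) → x ≡ 0ℤ
      lattice-zero x z (z≥0 , flow) = fromℤ-injective {x} {0ℤ} (ℚ.≤-antisym (begin
        fromℤ x               ≤⟨ flowAt-term (src ∘ List.lookup (e ∷ G)) zero z≥0 zero e-src ⟩
        out                   ≡⟨ lemma out ⟨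
        out - 0ℚ              ≡⟨ cong (λ i → out - i) (flowAt-none (tgt ∘ List.lookup (e ∷ G)) zero (lookup (toℚⁿ (x ∷ z))) (λ i → no-target (List.lookup (e ∷ G) i))) ⟨
        netflow (e ∷ G) (toℚⁿ (x ∷ z)) zero ≡⟨ trans (flow zero) (cong fromℤ a-zero) ⟩
        0ℚ                    ∎) (z≥0 zero))
        where
        open ℚ.≤-Reasoning
        out = outflow (e ∷ G) (toℚⁿ (x ∷ z)) zero
        lemma : ∀ x → x - 0ℚ ≡ x
        lemma = solve 1 (λ x → x :- con 0ℚ := x) refl
        no-target : ∀ {N} (e : Edge (suc N)) → ¬ tgt e ≡ zero
        no-target (edge _ zero ()) refl

    kostant-extend : kostant (e ∷ G) a ≡ kostant G a
    kostant-extend = trans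
      (same-length (Enumeration.unique E₁) (Unique.map⁺ Vec.∷-injectiveʳ (Enumeration.unique E₂)) (λ {z} → mk⇔ (to z) (from z)))
      (List.length-map (0ℤ ∷_) (Enumeration.list E₂))
      where
      E₁ = latticePoints (e ∷ G) a
      E₂ = latticePoints G a
      to : ∀ z → z ∈ Enumeration.list E₁ → z ∈ List.map (0ℤ ∷_) (Enumeration.list E₂)
      to (x ∷ z) z∈ with p ← Equivalence.to (Enumeration.correct E₁) z∈ with refl ← lattice-zero x z p =
        ∈.∈-map⁺ (0ℤ ∷_) (Equivalence.from (Enumeration.correct E₂) (lattice-restrict z p))
      from : ∀ z → z ∈ List.map (0ℤ ∷_) (Enumeration.list E₂) → z ∈ Enumeration.list E₁
      from z z∈ with y , y∈ , refl ← ∈.∈-map⁻ (0ℤ ∷_) z∈ =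
        Equivalence.from (Enumeration.correct E₁) (lattice-extend y (Equivalence.to (Enumeration.correct E₂) y∈))

  graph-sourceEdge : ∀ n (α β : Fin n → ℕ) c → 0→sink n ∷ graph n α β c 0 ↭ graph n α β c 1
  graph-sourceEdge n α β c = ↭-sym (↭-trans
    (↭.++⁺ˡ A₁ (↭-trans (↭.++⁺ˡ B₁ (↭.shift (0→sink n) P₁ [])) (↭.shift (0→sink n) B₁ (P₁ ++ []))))
    (↭.shift (0→sink n) A₁ (B₁ ++ P₁ ++ [])))
    where
    A₁ = concatMap (λ i → List.replicate (α i) (0→inner i)) (List.allFin n)
    B₁ = concatMap (λ i → List.replicate (β i) (inner→sink i)) (List.allFin n)
    P₁ = concatMap (λ i → concatMap (parallel c i) (List.allFin n)) (List.allFin n)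

  -- A network needs an edge from the source to the sink, which k lacks. Adding one does not change
  -- the count, as nothing leaves a source of net flow 0; for the same reason the distribution at
  -- the source is trivial.
  kostant-complete : ∀ n a b c (as : Vec ℤ n) →
    kostant (k[ n ] a (suc b) c) (netflowVector as) ≡ flows (completeNet n c (λ _ → b)) (as ∷ʳ 0ℤ)
  kostant-complete n a b c as = begin
    kostant (k[ n ] a (suc b) c) (netflowVector as)
      ≡⟨ SourceEdge.kostant-extend (k[ n ] a (suc b) c) (0→sink n) refl (netflowVector as) refl ⟨
    kostant (0→sink n ∷ k[ n ] a (suc b) c) (netflowVector as)
      ≡⟨ kostant-flows net₀ (presentation (↭-trans (graph-sourceEdge n _ _ c) (graph-net n _ (λ _ → b) c 0))) (netflowVector as) (netflowVector-balanced as) ⟩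
    spread (sourceRow n (λ _ → a) 0) (flows net) 0 (as ∷ʳ total)
      ≡⟨ spread-0 (sourceRow n (λ _ → a) 0) (flows net) (as ∷ʳ total) ⟩
    flows net (as ∷ʳ total)
      ≡⟨ flows-inner net (as ∷ʳ total) (as ∷ʳ 0ℤ) (λ u → trans (lookup-inject₁-∷ʳ as total u) (sym (lookup-inject₁-∷ʳ as 0ℤ u))) ⟩
    flows net (as ∷ʳ 0ℤ) ∎
    where
    open ≡-Reasoning
    net = completeNet n c (λ _ → b)
    net₀ = sourceNet n (λ _ → a) (λ _ → b) c 0
    total = ℤ.- Vec.foldr (λ _ → ℤ) ℤ._+_ 0ℤ as

  module SubsetVolume (n a b c : ℕ) (S : Subset (suc n)) where
    private
      α β : Fin (suc n) → ℕ
      α i = if lookup S i then a else suc a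
      β i = bit (lookup S i) ℕ.+ b

      net : Net (suc (suc n))
      net = sourceNet (suc n) α β c n

      G : Multigraph (suc (suc (suc n)))
      G = kS[ suc n ] (suc a) (suc b) c S

      G-net : G ↭ List.tabulate (toSink {suc (suc n)}) ++ netEdges net
      G-net = ↭-trans (↭-reflexive (graph-cong (suc n) c (suc n)
        (λ i → cong (λ σ → if σ then a else suc a) (does-∈? i S))
        (λ i → trans (cong (λ σ → if σ then suc (suc b) else suc b) (does-∈? i S)) (β-cases (lookup S i)))))
        (graph-net (suc n) α β c n)
        where
        β-cases : ∀ σ → (if σ then suc (suc b) else suc b) ≡ suc (bit σ ℕ.+ b)
        β-cases true  = refl
        β-cases false = refl

      open RegionVolume net (unitFlow (suc n)) (unitFlow-source (suc n))

      state : Vec ℤ (suc (suc n))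
      state = incoming (sourceRow (suc n) α n) (indegrees (completeNet (suc n) c β)) ⊞ replicate (suc (suc n)) 0 ∸1

      -- The source has indegree 0 and one slot, hence net flow 0 and nothing to distribute. At the
      -- inner vertices `state` and `subsetState` agree; at the sink they may differ, which
      -- `flows-inner` permits.
      volume-subset : volume net ≡ flows (subsetNet (suc n) b c S) (subsetState (suc n) (suc a) c S)
      volume-subset = trans (spread-0 (sourceRow (suc n) α n) (flows (completeNet (suc n) c β)) state)
        (flows-inner (completeNet (suc n) c β) state (subsetState (suc n) (suc a) c S) states)
        where
        value : ∀ σ x → + ((if σ then a else suc a) ℕ.+ x ℕ.+ 0) ℤ.- 1ℤ ≡ (+ suc a ℤ.- 1ℤ ℤ.+ + x) ℤ.- + bit σ
        value σ x = trans (cong (λ y → + y ℤ.- 1ℤ) (ℕ.+-identityʳ ((if σ then a else suc a) ℕ.+ x))) (trans (cong (ℤ._- 1ℤ) (ℤ.pos-+ (if σ then a else suc a) x)) (cases σ))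
          where
          lemma : ∀ a x → a ℤ.+ x ℤ.- 1ℤ ≡ (1ℤ ℤ.+ a ℤ.- 1ℤ ℤ.+ x) ℤ.- 1ℤ
          lemma = ℤsolve-∀
          lemma′ : ∀ a x → 1ℤ ℤ.+ a ℤ.+ x ℤ.- 1ℤ ≡ (1ℤ ℤ.+ a ℤ.- 1ℤ ℤ.+ x) ℤ.- 0ℤ
          lemma′ = ℤsolve-∀
          cases : ∀ σ → + (if σ then a else suc a) ℤ.+ + x ℤ.- 1ℤ ≡ (+ suc a ℤ.- 1ℤ ℤ.+ + x) ℤ.- + bit σ
          cases true  = lemma (+ a) (+ x)
          cases false = lemma′ (+ a) (+ x)
        atInner-lookup : ∀ {n} (t : Fin n → ℤ) i → lookup (atInner t) (inject₁ i) ≡ t i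
        atInner-lookup t i = trans (cong (λ s → lookup s (inject₁ i)) (atInner-∷ʳ t)) (trans (lookup-inject₁-∷ʳ (Vec.tabulate t) 0ℤ i) (Vec.lookup∘tabulate t i))
        states : ∀ i → lookup state (inject₁ i) ≡ lookup (subsetState (suc n) (suc a) c S) (inject₁ i)
        states i = begin
          lookup state (inject₁ i)
            ≡⟨ Vec.lookup-zipWith _ (inject₁ i) (incoming (sourceRow (suc n) α n) (indegrees (completeNet (suc n) c β))) (replicate (suc (suc n)) 0) ⟩
          + (lookup (indegrees net) (inject₁ (suc i)) ℕ.+ lookup (replicate (suc (suc n)) 0) (inject₁ i)) ℤ.- 1ℤ
            ≡⟨ cong₂ (λ x y → + (x ℕ.+ y) ℤ.- 1ℤ) (indegrees-source (suc n) α β c n i) (Vec.lookup-replicate (inject₁ i) 0) ⟩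
          + (α i ℕ.+ c ℕ.* toℕ i ℕ.+ 0) ℤ.- 1ℤ
            ≡⟨ value (lookup S i) (c ℕ.* toℕ i) ⟩
          (+ suc a ℤ.- 1ℤ ℤ.+ + (c ℕ.* toℕ i)) ℤ.- + bit (lookup S i)
            ≡⟨ cong (λ x → (+ suc a ℤ.- 1ℤ ℤ.+ x) ℤ.- + bit (lookup S i)) (ℤ.pos-* c (toℕ i)) ⟩
          threshold (suc a) c i ℤ.- + bit (lookup S i)
            ≡⟨ atInner-lookup (λ i → threshold (suc a) c i ℤ.- + bit (lookup S i)) i ⟨
          lookup (subsetState (suc n) (suc a) c S) (inject₁ i) ∎
          where open ≡-Reasoning

      -- An inner vertex without incoming edges has lost its only edge from the source, so it
      -- belongs to S and has gained an edge to the sink. One of its edges to the sink thus lies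
      -- outside the tree.
      active : ∀ j → lookup (Vec.zipWith ℕ._+_ (indegrees net) (unitSource (suc (suc n)))) (inject₁ j) ≡ 0 → 1 ℕ.≤ lookup (outdegrees net) (inject₁ j)
      active (suc i) isolated = ℕ.≤-trans (positive (lookup S i) (ℕ.m+n≡0⇒m≡0 (α i) (trans (sym (indegrees-source (suc n) α β c n i))
          (ℕ.m+n≡0⇒m≡0 (lookup (indegrees net) (inject₁ (suc i))) (trans (sym (Vec.lookup-zipWith ℕ._+_ (inject₁ (suc i)) (indegrees net) (unitSource (suc (suc n))))) isolated)))))
        (outdegrees-complete (suc n) c β i)
        where
        positive : ∀ σ → (if σ then a else suc a) ≡ 0 → 1 ℕ.≤ bit σ ℕ.+ b
        positive true _ = s≤s z≤n

    isFlowVolume : IsFlowVolume G (fromℤ (+ flows (subsetNet (suc n) b c S) (subsetState (suc n) (suc a) c S)))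
    isFlowVolume = subst (IsFlowVolume G) (trans !*region-volume (cong (λ V → fromℤ (+ V)) volume-subset))
      (normalizedVolume (presentation G-net) (unitFlow (suc n)) (unitFlow-balanced (suc n)) region-volume
        (region-isVolume (indegrees-sink net) active))

  IsSumOver-cong : ∀ {P : A → Set} {f g : A → ℤ} {s} → (∀ x → f x ≡ g x) → IsSumOver ℤ.+-0-rawMonoid P f s → IsSumOver ℤ.+-0-rawMonoid P g s
  IsSumOver-cong {f = f} {g} p (xs , unique , sound , complete , sum≡) =
    xs , unique , sound , (λ x Px g≢0 → complete x Px (λ f≡0 → g≢0 (trans (sym (p x)) f≡0))) , trans (sym (foldr-cong xs)) sum≡
    where
    foldr-cong : ∀ xs → List.foldr (λ x → ℤ._+_ (f x)) 0ℤ xs ≡ List.foldr (λ x → ℤ._+_ (g x)) 0ℤ xs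
    foldr-cong []       = refl
    foldr-cong (x ∷ xs) = cong₂ ℤ._+_ (p x) (foldr-cong xs)

  fromℤ-foldr : ∀ (f : A → ℤ) xs → List.foldr (λ x → _+_ (fromℤ (f x))) 0ℚ xs ≡ fromℤ (List.foldr (λ x → ℤ._+_ (f x)) 0ℤ xs)
  fromℤ-foldr f []       = refl
  fromℤ-foldr f (x ∷ xs) = trans (cong (λ w → fromℤ (f x) + w) (fromℤ-foldr f xs)) (sym (fromℤ-+ (f x) _))

  kostant-sum : ∀ n k a b c → k ℕ.≤ suc n →
    IsSumOver ℤ.+-0-rawMonoid (Admissible (suc n) k (suc a) c)
      (λ as → + kostant (k[ suc n ] (suc a) (suc b) c) (netflowVector as)) (Ψ (suc n) k (suc a) (suc b) c)
  kostant-sum n k a b c k≤n =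
    IsSumOver-cong (λ as → cong +_ (sym (kostant-complete (suc n) (suc a) b c as))) (flows-sum (suc n) k (suc a) b c k≤n)

  flowVolume-sum : ∀ n k a b c →
    ∃[ vol ] (∀ (S : Subset (suc n)) → ∣ S ∣ ≡ k → IsFlowVolume (kS[ suc n ] (suc a) (suc b) c S) (vol S))
           × IsSumOver ℚ.+-0-rawMonoid (λ (S : Subset (suc n)) → ∣ S ∣ ≡ k) vol (fromℤ (Ψ (suc n) k (suc a) (suc b) c))
  flowVolume-sum n k a b c =
      (λ S → fromℤ (V S))
    , (λ S _ → SubsetVolume.isFlowVolume n a b c S)
    , subsets (suc n) k
    , subsets-unique (suc n) k
    , All.tabulate (subsets-sound (suc n) k)
    , (λ S ∣S∣≡k _ → subst (λ k → S ∈ subsets (suc n) k) ∣S∣≡k (subsets-complete S))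
    , trans (fromℤ-foldr V (subsets (suc n) k)) (cong fromℤ (sym (Ψ-flows (suc n) (suc a) b c k)))
    where
    V : Subset (suc n) → ℤ
    V S = + flows (subsetNet (suc n) b c S) (subsetState (suc n) (suc a) c S)

open import Data.Fin.Subset using (Subset; ∣_∣)
open import Data.Integer.Base as ℤ using (+_)
open import Data.Nat.Base using (ℕ; suc; _≤_)
open import Data.Product.Base using (_×_; _,_; ∃-syntax)
open import Data.Rational.Base as ℚ using (ℚ)
open import Data.Rational.Literals using (fromℤ)
open import Relation.Binary.PropositionalEquality using (_≡_)
open import Defs

theorem1p6 : ∀ (n k a b c : ℕ) → 1 ≤ n → 1 ≤ a → 1 ≤ b → k ≤ n →
    IsSumOver ℤ.+-0-rawMonoid (Admissible n k a c) (λ as → + kostant (k[ n ] a b c) (netflowVector as)) (Ψ n k a b c)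
    × (∃[ vol ] (∀ (S : Subset n) → ∣ S ∣ ≡ k → IsFlowVolume (kS[ n ] a b c S) (vol S))
    × IsSumOver ℚ.+-0-rawMonoid (λ (S : Subset n) → ∣ S ∣ ≡ k) vol (fromℤ (Ψ n k a b c)))
-- Positivity of b provides a tree edge at each inner vertex, and positivity of n provides one at
-- the source of k(S), among its n edges to the sink.
theorem1p6 (suc n) k (suc a) (suc b) c _ _ _ k≤n =
  FlowVolumes.kostant-sum n k a b c k≤n , FlowVolumes.flowVolume-sum n k a b c
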